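{- Let $d_0$ be a sufficiently large constant, let $d_0\leq d=d(n)=o(n)$ (with $dn$ even), let $\mathbf{G}_n\sim\mathcal{G}_{n,d}$, and let $k\in\mathbb{N}$ be an arbitrary constant. Then with high probability the following holds: for every non-trivial partition $[n]=V_1\sqcup V_2$ of the vertex set of $\mathbf{G}_n$, after at most $\operatorname{diam}(\mathbf{G}_n)+2$ rounds of colour refinement (started from the colouring given by this partition) there exists a partition $[n]=W_1\sqcup\dots\sqcup W_k$ such that for every $i\in[k]$, $n/(3k)\le|W_i|\le 3n/k$ and $W_i$ is a union of some colour classes.
   Context: $\mathcal{G}_{n,d}$ is the uniform distribution over $d$-regular graphs on $[n]=\{1,\dots,n\}$; "with high probability" means with probability tending to $1$ as $n\to\infty$. Colour refinement: from a colouring $C_{t-1}$, $C_t(v)=(C_{t-1}(v),\{\!\{C_{t-1}(w):w\in N(v)\}\!\})$ (multiset of neighbours' colours); the initial colouring gives colour $i$ to vertices of $V_i$. A two-part partition is non-trivial if both parts are non-empty. $\operatorname{diam}(G)$ is the diameter of $G$. -}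

module Defs where

open import Data.Nat using (ℕ; zero; suc; _+_; _*_; _≤_; _≡ᵇ_)
open import Data.Nat.Properties using ()
open import Data.Bool using (T; T?; Bool; true; false; _∧_; not; if_then_else_)
open import Data.Fin using (Fin)
import Data.Fin as Fin
open import Relation.Nullary.Decidable using (⌊_⌋)
open import Data.Vec using (Vec; []; _∷_; lookup)
open import Data.List using (List; []; _∷_; map; concatMap; length; allFin)
open import Data.Nat.ListAction using (sum)
open import Data.Bool.ListAction using (all)
import Data.List as L
open import Data.Product using (Σ; ∃; _×_)
open import Data.Sum using (_⊎_)
open import Relation.Binary.PropositionalEquality using (_≡_)

_==_ : Bool → Bool → Bool
true  == b = b
false == b = not b

Matrix : ℕ → Set
Matrix n = Vec (Vec Bool n) n

adj : {n : ℕ} → Matrix n → Fin n → Fin n → Bool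
adj M i j = lookup (lookup M i) j

countB : {n : ℕ} → (Fin n → Bool) → ℕ
countB {n} f = sum (map (λ x → if f x then 1 else 0) (allFin n))

allB : {n : ℕ} → (Fin n → Bool) → Bool
allB {n} f = all f (allFin n)

isRegular : {n : ℕ} → ℕ → Matrix n → Bool
isRegular {n} d M =
  allB (λ i → not (adj M i i) ∧ (countB (adj M i) ≡ᵇ d)
               ∧ allB (λ j → adj M i j == adj M j i))

allVec : {A : Set} → (m : ℕ) → List A → List (Vec A m)
allVec zero    xs = [] ∷ []
allVec (suc m) xs = concatMap (λ x → map (x ∷_) (allVec m xs)) xs

allMatrices : (n : ℕ) → List (Matrix n)
allMatrices n = allVec n (allVec n (true ∷ false ∷ []))

numRegular : ℕ → ℕ → ℕ
numRegular n d = length (L.filter (λ M → T? (isRegular d M)) (allMatrices n))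

-- Colour refinement started from the colouring given by p : Fin n → Bool
-- (V₁ = p⁻¹(true), V₂ = p⁻¹(false)).  sameColour M p t u v = true iff
-- C_t(u) = C_t(v).  C_{t+1}(u) = C_{t+1}(v) iff C_t(u) = C_t(v) and the
-- multisets of neighbours' C_t-colours agree, i.e. for every C_t-colour class
-- (represented by a vertex w) u and v have equally many neighbours in it.
sameColour : {n : ℕ} → Matrix n → (Fin n → Bool) → ℕ → Fin n → Fin n → Bool
sameColour M p zero    u v = p u == p v
sameColour M p (suc t) u v =
  sameColour M p t u v
  ∧ allB (λ w → countB (λ x → adj M u x ∧ sameColour M p t x w)
                ≡ᵇ countB (λ x → adj M v x ∧ sameColour M p t x w))

Reach : {n : ℕ} → Matrix n → ℕ → Fin n → Fin n → Set
Reach M zero    u v = u ≡ v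
Reach M (suc D) u v = u ≡ v ⊎ Σ _ (λ x → adj M u x ≡ true × Reach M D x v)

-- diam(G) ≤ D   (diam = ∞ for disconnected graphs: then no D qualifies)
DiamLe : {n : ℕ} → Matrix n → ℕ → Set
DiamLe M D = ∀ u v → Reach M D u v

partSize : {n k : ℕ} → (Fin n → Fin k) → Fin k → ℕ
partSize f i = countB (λ x → ⌊ f x Fin.≟ i ⌋)

Good : {n : ℕ} → (k : ℕ) → Matrix n → Set
Good {n} k M =
  (p : Fin n → Bool) → (∃ λ u → p u ≡ true) → (∃ λ v → p v ≡ false) →
  ∃ λ t → ((D : ℕ) → DiamLe M D → t ≤ D + 2)
        × ∃ λ (f : Fin n → Fin k) →
            ((i : Fin k) → n ≤ 3 * k * partSize f i × k * partSize f i ≤ 3 * n)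
          × ((u v : Fin n) → sameColour M p t u v ≡ true → f u ≡ f v)

-- All probabilistic input comes from switchings: deleting edges ab, zw and inserting az, bw connects the d-regular graphs,
-- and double counting switchings bounds ratios of numbers of graphs, hence tails, for every d = o(n) at once.
--
-- Starting from the smaller side S₀ of the partition, colours see the neighbourhoods of S₀.  Typical graphs expand, so
-- after s ≤ diam rounds a neighbourhood reaches n/(4d) vertices, and after one more round some union A of colour classes
-- and its complement both have linear size, because typically no small set has the same number of neighbours at almost
-- all vertices.  Vertices of one class at the next round have equally many neighbours in A.  Trading neighbours of two
-- vertices inside and outside A shows that this coincidence costs each pair of vertices a large constant factor, more
-- than the number of choices of A and of a pairing can make up for.  So for large d no class exceeds n/(6k) after
-- s + 2 rounds, and consecutive classes can be grouped into W₁, …, W_k.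
--
-- For bounded d ≥ d₀ the same argument, with targets split off one class for each neighbour of a vertex, gives classes of
-- size O(n/d); boundedly many further rounds shrink them below n/(6k), since vertices within distance j of a large class
-- would have all their edges in a set of pairs that is too sparse.  These rounds fit below the diameter: a ball of
-- radius s around a vertex of S₀ misses half of the vertices, and typically boundedly many further steps cannot
-- exhaust a linear remainder when d is bounded.
module Submission where

open import Defs
open import Data.Nat using (ℕ; _+_; _*_; _≤_; _%_)
open import Data.List using (List; length)
open import Data.List.Relation.Unary.All using (All)
open import Data.List.Relation.Unary.Unique.Propositional using (Unique)
open import Data.Product using (∃; _×_)
open import Data.Bool using (true)
open import Relation.Nullary using (¬_)
open import Relation.Binary.PropositionalEquality using (_≡_)

open import Data.Nat using (zero; suc; pred; _∸_; _^_; _<_; _≡ᵇ_; _≤ᵇ_; _/_; z≤n; s≤s; NonZero; >-nonZero; _≤?_; _<?_)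
open import Data.Nat.Properties
open import Data.Nat.DivMod using (m/n*n≤m; m≡m%n+[m/n]*n; m%n<n)
open import Data.Nat.Tactic.RingSolver using (solve-∀)
open import Data.Bool using (Bool; false; _∧_; _∨_; not; if_then_else_; T; T?; _xor_)
import Data.Bool.Properties as Boolₚ
open import Data.Bool.ListAction using (all; any)
open import Data.Nat.ListAction using (sum)
open import Data.Fin using (Fin; toℕ; fromℕ<)
import Data.Fin as Fin
import Data.Fin.Properties as Finₚ
open import Data.Vec using (Vec; []; _∷_; lookup; tabulate)
open import Data.Vec.Properties using (lookup∘tabulate; tabulate∘lookup; tabulate-cong)
open import Data.List using ([]; _∷_; map; concatMap; allFin; _++_; filter)
import Data.List as List
open import Data.List.Properties using (map-tabulate; length-map; length-++)
open import Data.List.Relation.Unary.All using ([]; _∷_)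
import Data.List.Relation.Unary.All as All
import Data.List.Relation.Unary.All.Properties as Allₚ
open import Data.List.Relation.Unary.AllPairs using (AllPairs; []; _∷_)
import Data.List.Relation.Unary.AllPairs as AllPairs
import Data.List.Relation.Unary.AllPairs.Properties as AllPairsₚ
import Data.List.Relation.Unary.Unique.Propositional.Properties as Uniqueₚ
open import Data.List.Membership.Propositional using (_∈_)
open import Data.List.Membership.Propositional.Properties using (∈-filter⁺; ∈-allFin)
open import Data.List.Relation.Unary.Any using (index)
open import Data.List.Relation.Unary.Any.Properties using (lookup-index)
open import Data.Product using (Σ; _,_; proj₁; proj₂)
open import Data.Sum using (_⊎_; inj₁; inj₂)
open import Data.Empty using (⊥; ⊥-elim)
open import Function using (_∘_; id; case_of_)
open import Relation.Nullary using (yes; no)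
open import Relation.Nullary.Decidable using (⌊_⌋)
open import Relation.Binary.PropositionalEquality using (_≢_; refl; sym; trans; cong; cong₂; subst; subst₂)

-- The threshold `d₀` is fixed before k. Rounds s + 1 and s + 2 push classes below n/(6k) only if d
-- exceeds a bound that depends on k; below this bound the degree cannot pay for k, and further
-- rounds must. Their parameters have to be free of k again: at stage m the walks grow with m and
-- labels become dearer, but the set of pairs becomes sparser along with it, so that the number of
-- edge-count steps per vertex, of order (log d)², serves all stages. The other obstacle is the
-- price of labels. A coincidence of A-degrees gains a factor q only if the two vertices have of
-- order q² private neighbours in the targets, so q stays below the square root of d, whereas naming
-- one of d labels at each vertex costs a factor d. Splitting the targets into g groups yields g
-- coincidences per pair and pays for the labels with a bounded g. Probabilities are never formed:
-- an event is a Boolean test on graphs, and `Rare d b` compares b times its count with the number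
-- of all d-regular graphs.

private variable
  n d b : ℕ
  𝔸 𝔹 𝕀 : Set

-- The slack s makes the side condition a semiring identity, which the solver decides.
lin : ∀ {L R l r} s → L ≤ R → l + R + s ≡ L + r → l ≤ r
lin {L} {R} {l} {r} s h e = +-cancelʳ-≤ R l r
  (≤-trans (≤-trans (m≤m+n (l + R) s) (≤-reflexive e)) (≤-trans (+-monoˡ-≤ r h) (≤-reflexive (+-comm R r))))

-- Booleans, indicators and comparisons of numbers.

⟦_⟧ : Bool → ℕ
⟦ b ⟧ = if b then 1 else 0

∧-l : ∀ {a b} → a ∧ b ≡ true → a ≡ true
∧-l {true} _ = refl

∧-r : ∀ {a b} → a ∧ b ≡ true → b ≡ true
∧-r {true} e = e

∧-i : ∀ {a b} → a ≡ true → b ≡ true → a ∧ b ≡ true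
∧-i refl refl = refl

not-t : ∀ {a} → not a ≡ true → a ≡ false
not-t {false} _ = refl

not-f : ∀ {a} → a ≡ false → not a ≡ true
not-f refl = refl

t≢f : ∀ {a} → a ≡ true → a ≡ false → ⊥
t≢f refl ()

¬t→f : ∀ {a} → ¬ (a ≡ true) → a ≡ false
¬t→f {true} h = ⊥-elim (h refl)
¬t→f {false} _ = refl

∨-e : ∀ {a b} → a ∨ b ≡ true → (a ≡ true) ⊎ (b ≡ true)
∨-e {true} _ = inj₁ refl
∨-e {false} e = inj₂ e

∨-i₁ : ∀ {a b} → a ≡ true → a ∨ b ≡ true
∨-i₁ refl = refl

∨-i₂ : ∀ {a b} → b ≡ true → a ∨ b ≡ true
∨-i₂ {true} _ = refl
∨-i₂ {false} e = e

∨-f₁ : ∀ {a b} → a ∨ b ≡ false → a ≡ false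
∨-f₁ {false} _ = refl

∨-f₂ : ∀ {a b} → a ∨ b ≡ false → b ≡ false
∨-f₂ {false} e = e

bool-ext : ∀ {a b} → (a ≡ true → b ≡ true) → (b ≡ true → a ≡ true) → a ≡ b
bool-ext {true} f g = sym (f refl)
bool-ext {false} {true} f g = g refl
bool-ext {false} {false} f g = refl

⟦∧⟧ : ∀ a b → ⟦ a ∧ b ⟧ ≡ ⟦ a ⟧ * ⟦ b ⟧
⟦∧⟧ true b = sym (+-identityʳ _)
⟦∧⟧ false b = refl

⟦⟧≤1 : ∀ a → ⟦ a ⟧ ≤ 1
⟦⟧≤1 true = ≤-refl
⟦⟧≤1 false = z≤n

⟦⟧-mono : ∀ {a b} → (a ≡ true → b ≡ true) → ⟦ a ⟧ ≤ ⟦ b ⟧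
⟦⟧-mono {true} h rewrite h refl = ≤-refl
⟦⟧-mono {false} h = z≤n

⟦⟧-split : ∀ a b → ⟦ a ⟧ ≡ ⟦ a ∧ b ⟧ + ⟦ a ∧ not b ⟧
⟦⟧-split true true = refl
⟦⟧-split true false = refl
⟦⟧-split false b = refl

⟦∨⟧≤ : ∀ a b → ⟦ a ∨ b ⟧ ≤ ⟦ a ⟧ + ⟦ b ⟧
⟦∨⟧≤ true b = m≤m+n 1 _
⟦∨⟧≤ false b = ≤-refl

≤ᵇ-t : ∀ {m k} → (m ≤ᵇ k) ≡ true → m ≤ k
≤ᵇ-t {m} {k} e = ≤ᵇ⇒≤ m k (subst T (sym e) _)

≤ᵇ-i : ∀ {m k} → m ≤ k → (m ≤ᵇ k) ≡ true
≤ᵇ-i {m} {k} h with m ≤ᵇ k | ≤⇒≤ᵇ h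
... | true | _ = refl

≤ᵇ-f : ∀ {m k} → (m ≤ᵇ k) ≡ false → k < m
≤ᵇ-f {m} {k} e = ≰⇒> λ h → t≢f (≤ᵇ-i h) e

≡ᵇ-t : ∀ {m k} → (m ≡ᵇ k) ≡ true → m ≡ k
≡ᵇ-t {m} {k} e = ≡ᵇ⇒≡ m k (subst T (sym e) _)

≡ᵇ-i : ∀ {m k} → m ≡ k → (m ≡ᵇ k) ≡ true
≡ᵇ-i {m} {k} h with m ≡ᵇ k | ≡⇒≡ᵇ m k h
... | true | _ = refl

infix 4 _≤b_ _=b_

opaque
  -- Opaque copies of the comparisons: events are built from tests against large symbolic bounds,
  -- which have to stay unevaluated.
  _≤b_ _=b_ : ℕ → ℕ → Bool
  m ≤b k = m ≤ᵇ k
  m =b k = m ≡ᵇ k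

  ≤b-t : ∀ {m k} → (m ≤b k) ≡ true → m ≤ k
  ≤b-t = ≤ᵇ-t

  ≤b-i : ∀ {m k} → m ≤ k → (m ≤b k) ≡ true
  ≤b-i = ≤ᵇ-i

  ≤b-f : ∀ {m k} → (m ≤b k) ≡ false → k < m
  ≤b-f = ≤ᵇ-f

  =b-t : ∀ {m k} → (m =b k) ≡ true → m ≡ k
  =b-t = ≡ᵇ-t

  =b-i : ∀ {m k} → m ≡ k → (m =b k) ≡ true
  =b-i = ≡ᵇ-i

eqF : Fin n → Fin n → Bool
eqF x y = ⌊ x Fin.≟ y ⌋

eqF-t : {x y : Fin n} → eqF x y ≡ true → x ≡ y
eqF-t {x = x} {y} e with x Fin.≟ y
... | yes p = p

eqF-r : (x : Fin n) → eqF x x ≡ true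
eqF-r x with x Fin.≟ x
... | yes p = refl
... | no ¬p = ⊥-elim (¬p refl)

eqF-i : {x y : Fin n} → x ≡ y → eqF x y ≡ true
eqF-i refl = eqF-r _

eqF-n : {x y : Fin n} → ¬ (x ≡ y) → eqF x y ≡ false
eqF-n h = ¬t→f (h ∘ eqF-t)

eqF-f : {x y : Fin n} → eqF x y ≡ false → ¬ (x ≡ y)
eqF-f e refl = t≢f (eqF-r _) e

-- Finite sums and enumerated types.

opaque
  S : List 𝔸 → (𝔸 → ℕ) → ℕ
  S xs f = sum (map f xs)

  S-cong : (xs : List 𝔸) {f g : 𝔸 → ℕ} → (∀ x → f x ≡ g x) → S xs f ≡ S xs g
  S-cong [] h = refl
  S-cong (x ∷ xs) h = cong₂ _+_ (h x) (S-cong xs h)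

  S-mono : (xs : List 𝔸) {f g : 𝔸 → ℕ} → (∀ x → f x ≤ g x) → S xs f ≤ S xs g
  S-mono [] h = z≤n
  S-mono (x ∷ xs) h = +-mono-≤ (h x) (S-mono xs h)

  S-+ : (xs : List 𝔸) (f g : 𝔸 → ℕ) → S xs (λ x → f x + g x) ≡ S xs f + S xs g
  S-+ [] f g = refl
  S-+ (x ∷ xs) f g rewrite S-+ xs f g = lem (f x) (g x) (S xs f) (S xs g) where
    lem : ∀ a b c e → a + b + (c + e) ≡ a + c + (b + e)
    lem = solve-∀

  S-* : (xs : List 𝔸) (c : ℕ) (f : 𝔸 → ℕ) → S xs (λ x → c * f x) ≡ c * S xs f
  S-* [] c f = sym (*-zeroʳ c)
  S-* (x ∷ xs) c f rewrite S-* xs c f = sym (*-distribˡ-+ c (f x) (S xs f))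

  S-*ʳ : (xs : List 𝔸) (c : ℕ) (f : 𝔸 → ℕ) → S xs (λ x → f x * c) ≡ S xs f * c
  S-*ʳ xs c f = trans (S-cong xs (λ x → *-comm (f x) c)) (trans (S-* xs c f) (*-comm c _))

  S-const : (xs : List 𝔸) (c : ℕ) → S xs (λ _ → c) ≡ length xs * c
  S-const [] c = refl
  S-const (x ∷ xs) c = cong (c +_) (S-const xs c)

  S-0 : (xs : List 𝔸) → S xs (λ _ → 0) ≡ 0
  S-0 xs = trans (S-const xs 0) (*-zeroʳ (length xs))

  S-swap : (xs : List 𝔸) (ys : List 𝔹) (f : 𝔸 → 𝔹 → ℕ) →
    S xs (λ x → S ys (f x)) ≡ S ys (λ y → S xs (λ x → f x y))
  S-swap [] ys f = sym (S-0 ys)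
  S-swap (x ∷ xs) ys f rewrite S-swap xs ys f = sym (S-+ ys (f x) (λ y → S xs (λ x → f x y)))

  S-++ : (xs ys : List 𝔸) (f : 𝔸 → ℕ) → S (xs ++ ys) f ≡ S xs f + S ys f
  S-++ [] ys f = refl
  S-++ (x ∷ xs) ys f rewrite S-++ xs ys f = sym (+-assoc (f x) _ _)

  S-map : (g : 𝔸 → 𝔹) (xs : List 𝔸) (f : 𝔹 → ℕ) → S (map g xs) f ≡ S xs (f ∘ g)
  S-map g [] f = refl
  S-map g (x ∷ xs) f = cong (f (g x) +_) (S-map g xs f)

  S-concatMap : (g : 𝔸 → List 𝔹) (xs : List 𝔸) (f : 𝔹 → ℕ) → S (concatMap g xs) f ≡ S xs (λ x → S (g x) f)
  S-concatMap g [] f = refl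
  S-concatMap g (x ∷ xs) f = trans (S-++ (g x) _ f) (cong (S (g x) f +_) (S-concatMap g xs f))

  S-pos : (xs : List 𝔸) (f : 𝔸 → Bool) → 1 ≤ S xs (λ x → ⟦ f x ⟧) → ∃ λ x → f x ≡ true
  S-pos (x ∷ xs) f h with f x in e
  ... | true = x , e
  ... | false = S-pos xs f h

  any-S : (xs : List 𝔸) (f : 𝔸 → Bool) → 1 ≤ S xs (λ x → ⟦ f x ⟧) → any f xs ≡ true
  any-S (x ∷ xs) f h with f x
  ... | true = refl
  ... | false = any-S xs f h

  any≤S : (xs : List 𝔸) (f : 𝔸 → Bool) → ⟦ any f xs ⟧ ≤ S xs (λ x → ⟦ f x ⟧)
  any≤S [] f = z≤n
  any≤S (x ∷ xs) f = ≤-trans (⟦∨⟧≤ (f x) (any f xs)) (+-monoʳ-≤ ⟦ f x ⟧ (any≤S xs f))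

  S-[] : (f : 𝔸 → ℕ) → S [] f ≡ 0
  S-[] f = refl

  S-∷ : (x : 𝔸) (xs : List 𝔸) (f : 𝔸 → ℕ) → S (x ∷ xs) f ≡ f x + S xs f
  S-∷ x xs f = refl

  S-1 : (x : 𝔸) (f : 𝔸 → ℕ) → S (x ∷ []) f ≡ f x
  S-1 x f = +-identityʳ _

  fins : ∀ n → List (Fin n)
  fins n = allFin n

  fins-def : ∀ n → fins n ≡ allFin n
  fins-def n = refl

-- `δ` expresses that every element is listed exactly once, in the form that sums need: an indicator
-- can be inserted into a sum and the order of summation then changed.
record Enum (𝔸 : Set) : Set where
  field
    els : List 𝔸
    eq : 𝔸 → 𝔸 → Bool
    eq-t : ∀ {x y} → eq x y ≡ true → x ≡ y
    eq-r : ∀ x → eq x x ≡ true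
    δ : ∀ a (f : 𝔸 → ℕ) → S els (λ x → ⟦ eq x a ⟧ * f x) ≡ f a

open Enum public

S-term : (E : Enum 𝔸) (f : 𝔸 → ℕ) (a : 𝔸) → f a ≤ S (els E) f
S-term E f a = subst (_≤ S (els E) f) (δ E a f)
  (S-mono (els E) λ x → ≤-trans (*-monoˡ-≤ (f x) (⟦⟧≤1 (eq E x a))) (≤-reflexive (+-identityʳ (f x))))

any-in : (E : Enum 𝔸) {f : 𝔸 → Bool} {a : 𝔸} → f a ≡ true → any f (els E) ≡ true
any-in E {f} {a} h = any-S (els E) f (≤-trans (≤-reflexive (sym (cong ⟦_⟧ h))) (S-term E (λ x → ⟦ f x ⟧) a))

-- Write `f (σ x)` as a sum over y with the indicator of y = `σ x`, change the order of summation,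
-- and read the indicator as that of x = `σ y`.
S-involution : (E : Enum 𝔸) (σ : 𝔸 → 𝔸) → (∀ x → σ (σ x) ≡ x) → (f : 𝔸 → ℕ) →
  S (els E) (f ∘ σ) ≡ S (els E) f
S-involution E σ inv f =
  trans (S-cong xs (λ x → sym (δ E (σ x) f)))
  (trans (S-swap xs xs (λ x y → ⟦ eq E y (σ x) ⟧ * f y))
  (S-cong xs λ y → trans (S-cong xs (λ x → cong (λ b → ⟦ b ⟧ * f y) (flip-eq x y))) (δ E (σ y) (λ _ → f y))))
  where
  xs = els E
  flip-eq : ∀ x y → eq E y (σ x) ≡ eq E x (σ y)
  flip-eq x y = bool-ext
    (λ e → subst (λ z → eq E x z ≡ true) (sym (trans (cong σ (eq-t E e)) (inv x))) (eq-r E x))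
    (λ e → subst (λ z → eq E y z ≡ true) (sym (trans (cong σ (eq-t E e)) (inv y))) (eq-r E y))

∑ : (Fin n → ℕ) → ℕ
∑ {n} = S (fins n)

opaque
  unfolding S fins

  ∑-suc : (f : Fin (suc n) → ℕ) → ∑ f ≡ f Fin.zero + ∑ (f ∘ Fin.suc)
  ∑-suc f = cong (λ l → f Fin.zero + sum l)
    (trans (map-tabulate Fin.suc f) (sym (map-tabulate id (f ∘ Fin.suc))))

  length-fins : ∀ n → length (fins n) ≡ n
  length-fins n = Data.List.Properties.length-tabulate id

  S-bool : (f : Bool → ℕ) → S (true ∷ false ∷ []) f ≡ f true + f false
  S-bool f = cong (f true +_) (+-identityʳ _)

eqF-suc : (x y : Fin n) → eqF (Fin.suc x) (Fin.suc y) ≡ eqF x y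
eqF-suc x y = bool-ext (λ e → eqF-i (Finₚ.suc-injective (eqF-t {x = Fin.suc x} e))) (λ e → eqF-i (cong Fin.suc (eqF-t e)))

∑-δ : (a : Fin n) (f : Fin n → ℕ) → ∑ (λ x → ⟦ eqF x a ⟧ * f x) ≡ f a
∑-δ {suc n} Fin.zero f = trans (∑-suc (λ x → ⟦ eqF x Fin.zero ⟧ * f x))
  (trans (cong (f Fin.zero + 0 +_) (S-0 (fins n))) (trans (+-identityʳ _) (+-identityʳ _)))
∑-δ {suc n} (Fin.suc a) f = trans (∑-suc (λ x → ⟦ eqF x (Fin.suc a) ⟧ * f x))
  (trans (S-cong (fins n) (λ x → cong (λ b → ⟦ b ⟧ * f (Fin.suc x)) (eqF-suc x a))) (∑-δ a (f ∘ Fin.suc)))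

enumFin : ∀ n → Enum (Fin n)
enumFin n = record { els = fins n ; eq = eqF ; eq-t = eqF-t ; eq-r = eqF-r ; δ = ∑-δ }

eqB : Bool → Bool → Bool
eqB a b = a == b

enumBool : Enum Bool
enumBool = record { els = true ∷ false ∷ [] ; eq = eqB ; eq-t = λ {x} {y} → t x y ; eq-r = r ; δ = dl }
  where
  t : ∀ x y → eqB x y ≡ true → x ≡ y
  t true true _ = refl
  t false false _ = refl
  r : ∀ x → eqB x x ≡ true
  r true = refl
  r false = refl
  dl : ∀ a (f : Bool → ℕ) → S (true ∷ false ∷ []) (λ x → ⟦ eqB x a ⟧ * f x) ≡ f a
  dl true f = trans (S-bool _) (trans (+-identityʳ _) (+-identityʳ _))
  dl false f = trans (S-bool _) (+-identityʳ _)

enumProd : Enum 𝔸 → Enum 𝔹 → Enum (𝔸 × 𝔹)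
enumProd {𝔸} {𝔹} E F = record
  { els = concatMap (λ a → map (a ,_) (els F)) (els E)
  ; eq = eqp
  ; eq-t = λ {x} {y} e → cong₂ _,_ (eq-t E (∧-l e)) (eq-t F (∧-r {a = eq E (proj₁ x) (proj₁ y)} e))
  ; eq-r = λ x → ∧-i (eq-r E (proj₁ x)) (eq-r F (proj₂ x))
  ; δ = dl }
  where
  eqp : 𝔸 × 𝔹 → 𝔸 × 𝔹 → Bool
  eqp x y = eq E (proj₁ x) (proj₁ y) ∧ eq F (proj₂ x) (proj₂ y)
  dl : ∀ p (f : 𝔸 × 𝔹 → ℕ) → S (concatMap (λ a → map (a ,_) (els F)) (els E)) (λ x → ⟦ eqp x p ⟧ * f x) ≡ f p
  dl (a , b) f = trans (S-concatMap _ (els E) _)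
    (trans (S-cong (els E) (λ x → trans (S-map (x ,_) (els F) _)
      (trans (S-cong (els F) (λ y → trans (cong (_* f (x , y)) (⟦∧⟧ (eq E x a) (eq F y b))) (*-assoc ⟦ eq E x a ⟧ _ _)))
      (trans (S-* (els F) ⟦ eq E x a ⟧ _) (cong (⟦ eq E x a ⟧ *_) (δ F b (λ y → f (x , y))))))))
    (δ E a (λ x → f (x , b))))

eqVec : (𝔸 → 𝔸 → Bool) → ∀ {m} → Vec 𝔸 m → Vec 𝔸 m → Bool
eqVec e [] [] = true
eqVec e (x ∷ v) (y ∷ w) = e x y ∧ eqVec e v w

enumVec : Enum 𝔸 → ∀ m → Enum (Vec 𝔸 m)
enumVec {𝔸} E m = record { els = allVec m (els E) ; eq = eqVec (eq E) ; eq-t = t ; eq-r = r ; δ = dl }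
  where
  t : ∀ {m} {x y : Vec 𝔸 m} → eqVec (eq E) x y ≡ true → x ≡ y
  t {x = []} {[]} _ = refl
  t {x = x ∷ v} {y ∷ w} e = cong₂ _∷_ (eq-t E (∧-l e)) (t (∧-r {a = eq E x y} e))
  r : ∀ {m} (x : Vec 𝔸 m) → eqVec (eq E) x x ≡ true
  r [] = refl
  r (x ∷ v) = ∧-i (eq-r E x) (r v)
  dl : ∀ {m} a (f : Vec 𝔸 m → ℕ) → S (allVec m (els E)) (λ x → ⟦ eqVec (eq E) x a ⟧ * f x) ≡ f a
  dl [] f = trans (S-1 [] _) (+-identityʳ _)
  dl {suc m} (a ∷ v) f = trans (S-concatMap _ (els E) _)
    (trans (S-cong (els E) (λ x → trans (S-map (x ∷_) (allVec m (els E)) _)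
      (trans (S-cong (allVec m (els E)) (λ y → trans (cong (_* f (x ∷ y)) (⟦∧⟧ (eq E x a) (eqVec (eq E) y v))) (*-assoc ⟦ eq E x a ⟧ _ _)))
      (trans (S-* (allVec m (els E)) ⟦ eq E x a ⟧ _) (cong (⟦ eq E x a ⟧ *_) (dl v (λ y → f (x ∷ y))))))))
    (δ E a (λ x → f (x ∷ v))))

length-concatMap : (g : 𝔸 → List 𝔹) (xs : List 𝔸) → length (concatMap g xs) ≡ S xs (length ∘ g)
length-concatMap g [] = sym (S-[] _)
length-concatMap g (x ∷ xs) = trans (length-++ (g x)) (trans (cong (length (g x) +_) (length-concatMap g xs)) (sym (S-∷ x xs _)))

length-allVec : (m : ℕ) (xs : List 𝔸) → length (allVec m xs) ≡ length xs ^ m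
length-allVec zero xs = refl
length-allVec (suc m) xs = trans (length-concatMap (λ x → map (x ∷_) (allVec m xs)) xs)
  (trans (S-cong xs (λ x → trans (length-map (x ∷_) (allVec m xs)) (length-allVec m xs))) (S-const xs _))

length-prod : (E : Enum 𝔸) (F : Enum 𝔹) → length (els (enumProd E F)) ≡ length (els E) * length (els F)
length-prod E F = trans (length-concatMap (λ a → map (a ,_) (els F)) (els E))
  (trans (S-cong (els E) (λ a → length-map (a ,_) (els F))) (S-const (els E) _))

-- Regular graphs and the number of those in an event.

Gr : ℕ → Set
Gr n = Fin n → Fin n → Bool

# : (Fin n → Bool) → ℕ
# f = ∑ (λ x → ⟦ f x ⟧)

opaque
  unfolding S fins

  all-t : ∀ {A : Set} (f : A → Bool) xs → all f xs ≡ true → S xs (λ x → ⟦ not (f x) ⟧) ≡ 0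
  all-t f [] e = refl
  all-t f (x ∷ xs) e with f x
  ... | true = all-t f xs e

  all-i : ∀ {A : Set} (f : A → Bool) xs → (∀ x → f x ≡ true) → all f xs ≡ true
  all-i f [] h = refl
  all-i f (x ∷ xs) h rewrite h x = all-i f xs h

  countB-# : (f : Fin n → Bool) → countB f ≡ # f
  countB-# f = refl

  allB-def : (f : Fin n → Bool) → allB f ≡ all f (fins n)
  allB-def f = refl

f≤∑ : (f : Fin n → ℕ) (a : Fin n) → f a ≤ ∑ f
f≤∑ f a = S-term (enumFin _) f a

allB-t : {f : Fin n → Bool} → allB f ≡ true → ∀ x → f x ≡ true
allB-t {f = f} e x with f x in fx
... | true = refl
... | false = ⊥-elim (1+n≰n (≤-trans (subst (λ b → 1 ≤ ⟦ not b ⟧) (sym fx) ≤-refl)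
        (≤-trans (f≤∑ (λ x → ⟦ not (f x) ⟧) x) (≤-reflexive (all-t f (fins _) (trans (sym (allB-def f)) e))))))

allB-i : {f : Fin n → Bool} → (∀ x → f x ≡ true) → allB f ≡ true
allB-i {f = f} h = trans (allB-def f) (all-i f (fins _) h)

==-t : ∀ {a b} → (a == b) ≡ true → a ≡ b
==-t {true} {true} e = refl
==-t {false} {false} e = refl

==-i : ∀ {a b} → a ≡ b → (a == b) ≡ true
==-i {true} refl = refl
==-i {false} refl = refl

record IsReg {n} (d : ℕ) (G : Gr n) : Set where
  field
    irr : ∀ i → G i i ≡ false
    deg : ∀ i → # (G i) ≡ d
    symm : ∀ i j → G i j ≡ G j i
open IsReg public

isRegular-t : {M : Matrix n} → isRegular d M ≡ true → IsReg d (adj M)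
isRegular-t {d = d} {M} e = record
  { irr = λ i → not-t (∧-l (h i))
  ; deg = λ i → trans (sym (countB-# (adj M i))) (≡ᵇ-t (∧-l (∧-r {a = not (adj M i i)} (h i))))
  ; symm = λ i j → ==-t (allB-t (∧-r {a = countB (adj M i) ≡ᵇ d} (∧-r {a = not (adj M i i)} (h i))) j) }
  where h = allB-t e

isRegular-i : {M : Matrix n} → IsReg d (adj M) → isRegular d M ≡ true
isRegular-i {M = M} r = allB-i λ i → ∧-i (not-f (irr r i)) (∧-i (≡ᵇ-i (trans (countB-# (adj M i)) (deg r i))) (allB-i λ j → ==-i (symm r i j)))

Ms : ∀ n → Enum (Matrix n)
Ms n = enumVec (enumVec enumBool n) n

opaque
  unfolding S fins

  length-filter-S : ∀ {A : Set} (f : A → Bool) xs → length (filter (λ x → T? (f x)) xs) ≡ S xs (λ x → ⟦ f x ⟧)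
  length-filter-S f [] = refl
  length-filter-S f (x ∷ xs) with f x
  ... | true = cong suc (length-filter-S f xs)
  ... | false = length-filter-S f xs

opaque
  cnt : ∀ {n} → ℕ → (Gr n → Bool) → ℕ
  cnt {n} d A = S (allMatrices n) (λ M → ⟦ isRegular d M ∧ A (adj M) ⟧)

  numRegular-cnt : ∀ n d → numRegular n d ≡ cnt {n} d (λ _ → true)
  numRegular-cnt n d = trans (length-filter-S (isRegular d) (allMatrices n))
    (S-cong (allMatrices n) λ M → cong ⟦_⟧ (sym (Boolₚ.∧-identityʳ (isRegular d M))))

  cnt-mono : {A B : Gr n → Bool} → (∀ G → IsReg d G → A G ≡ true → B G ≡ true) → cnt d A ≤ cnt d B
  cnt-mono {n} {d} {A} {B} h = S-mono (allMatrices n) λ M → ⟦⟧-mono λ e →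
    ∧-i (∧-l e) (h (adj M) (isRegular-t {M = M} (∧-l e)) (∧-r {a = isRegular d M} e))

  cnt≤N : (A : Gr n → Bool) → cnt d A ≤ cnt {n} d (λ _ → true)
  cnt≤N {n} {d} A = cnt-mono {n} {d} {A} λ _ _ _ → refl

  cnt-def : (A : Gr n → Bool) → cnt d A ≡ S (allMatrices n) (λ M → ⟦ isRegular d M ∧ A (adj M) ⟧)
  cnt-def A = refl

-- Switchings.

pr : Fin n → Fin n → Fin n → Fin n → Bool
pr p q i j = (eqF i p ∧ eqF j q) ∨ (eqF i q ∧ eqF j p)

pr-sym : (p q i j : Fin n) → pr p q i j ≡ pr p q j i
pr-sym p q i j = trans (Boolₚ.∨-comm (eqF i p ∧ eqF j q) _)
  (cong₂ _∨_ (Boolₚ.∧-comm (eqF i q) _) (Boolₚ.∧-comm (eqF i p) _))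

tog : (a b z w i j : Fin n) → Bool
tog a b z w i j = pr a b i j ∨ (pr z w i j ∨ (pr a z i j ∨ pr b w i j))

tog-sym : (a b z w i j : Fin n) → tog a b z w i j ≡ tog a b z w j i
tog-sym a b z w i j = cong₂ _∨_ (pr-sym a b i j) (cong₂ _∨_ (pr-sym z w i j) (cong₂ _∨_ (pr-sym a z i j) (pr-sym b w i j)))

sw : (a b z w : Fin n) → Matrix n → Matrix n
sw a b z w M = tabulate λ i → tabulate λ j → adj M i j xor tog a b z w i j

adj-tab : (f : Gr n) (i j : Fin n) → adj (tabulate λ i → tabulate (f i)) i j ≡ f i j
adj-tab f i j rewrite lookup∘tabulate (λ i → tabulate (f i)) i = lookup∘tabulate (f i) j

adj-sw : (a b z w : Fin n) (M : Matrix n) → ∀ i j → adj (sw a b z w M) i j ≡ adj M i j xor tog a b z w i j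
adj-sw a b z w M = adj-tab (λ i j → adj M i j xor tog a b z w i j)

xor-inv : ∀ x y → (x xor y) xor y ≡ x
xor-inv true true = refl
xor-inv true false = refl
xor-inv false true = refl
xor-inv false false = refl

sw-inv : (a b z w : Fin n) (M : Matrix n) → sw a b z w (sw a b z w M) ≡ M
sw-inv a b z w M = trans (tabulate-cong λ i → trans (tabulate-cong λ j →
    trans (cong (_xor tog a b z w i j) (adj-sw a b z w M i j)) (xor-inv (adj M i j) _)) (tabulate∘lookup (lookup M i)))
  (tabulate∘lookup M)

-- A switching deletes the edges ab, zw and inserts az, bw.
record Switchable (G : Gr n) (a b z w : Fin n) : Set where
  constructor switchable
  field
    ab : G a b ≡ true
    zw : G z w ≡ true
    az : G a z ≡ false
    bw : G b w ≡ false
    a≢z : a ≢ z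
    b≢w : b ≢ w

-- Vertex i trades its neighbour p for q and keeps all others. A switching consists of four such
-- trades, so degrees, and changes of degrees into a set, are read off row by row.
record Row (G G' : Gr n) (i p q : Fin n) : Set where
  field
    p∈ : G i p ≡ true
    q∉ : G i q ≡ false
    p∉' : G' i p ≡ false
    q∈' : G' i q ≡ true
    oth : ∀ j → j ≢ p → j ≢ q → G' i j ≡ G i j

data Toggled {n} (a b z w : Fin n) : Fin n → Fin n → Set where
  c1 : Toggled a b z w a b
  c2 : Toggled a b z w b a
  c3 : Toggled a b z w z w
  c4 : Toggled a b z w w z
  c5 : Toggled a b z w a z
  c6 : Toggled a b z w z a
  c7 : Toggled a b z w b w
  c8 : Toggled a b z w w b

record Switching (G G' : Gr n) (a b z w : Fin n) : Set where
  field
    v : Switchable G a b z w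
    a≢b : a ≢ b
    a≢w : a ≢ w
    b≢z : b ≢ z
    z≢w : z ≢ w
    ra : Row G G' a b z
    rb : Row G G' b a w
    rz : Row G G' z w a
    rw : Row G G' w z b
    oth : ∀ i → i ≢ a → i ≢ b → i ≢ z → i ≢ w → ∀ j → G' i j ≡ G i j
    tc : ∀ i j → (G' i j ≡ G i j) ⊎ Toggled a b z w i j
  open Switchable v public

pr-e : (p q i j : Fin n) → pr p q i j ≡ true → (i ≡ p × j ≡ q) ⊎ (i ≡ q × j ≡ p)
pr-e p q i j e with ∨-e {eqF i p ∧ eqF j q} e
... | inj₁ h = inj₁ (eqF-t (∧-l h) , eqF-t (∧-r {a = eqF i p} h))
... | inj₂ h = inj₂ (eqF-t (∧-l h) , eqF-t (∧-r {a = eqF i q} h))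

tog-e : (a b z w i j : Fin n) → tog a b z w i j ≡ true → Toggled a b z w i j
tog-e a b z w i j e with ∨-e {pr a b i j} e
... | inj₁ h with pr-e a b i j h
...   | inj₁ (refl , refl) = c1
...   | inj₂ (refl , refl) = c2
tog-e a b z w i j e | inj₂ e' with ∨-e {pr z w i j} e'
... | inj₁ h with pr-e z w i j h
...   | inj₁ (refl , refl) = c3
...   | inj₂ (refl , refl) = c4
tog-e a b z w i j e | inj₂ e' | inj₂ e'' with ∨-e {pr a z i j} e''
... | inj₁ h with pr-e a z i j h
...   | inj₁ (refl , refl) = c5
...   | inj₂ (refl , refl) = c6
tog-e a b z w i j e | inj₂ e' | inj₂ e'' | inj₂ h with pr-e b w i j h
... | inj₁ (refl , refl) = c7
... | inj₂ (refl , refl) = c8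

pr-i : (p q : Fin n) → pr p q p q ≡ true
pr-i p q = ∨-i₁ (∧-i (eqF-r p) (eqF-r q))

tog-i : ∀ {a b z w i j : Fin n} → Toggled a b z w i j → tog a b z w i j ≡ true
tog-i {a = a} {b} {z} {w} = λ where
    c1 → t1
    c2 → trans (tog-sym a b z w b a) t1
    c3 → t3
    c4 → trans (tog-sym a b z w w z) t3
    c5 → t5
    c6 → trans (tog-sym a b z w z a) t5
    c7 → t7
    c8 → trans (tog-sym a b z w w b) t7
  where
  t1 : tog a b z w a b ≡ true
  t1 = ∨-i₁ (pr-i a b)
  t3 : tog a b z w z w ≡ true
  t3 = ∨-i₂ {pr a b z w} (∨-i₁ (pr-i z w))
  t5 : tog a b z w a z ≡ true
  t5 = ∨-i₂ {pr a b a z} (∨-i₂ {pr z w a z} (∨-i₁ (pr-i a z)))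
  t7 : tog a b z w b w ≡ true
  t7 = ∨-i₂ {pr a b b w} (∨-i₂ {pr z w b w} (∨-i₂ {pr a z b w} (pr-i b w)))

module _ {G : Gr n} (r : IsReg d G) where
  adj≢ : ∀ {i j} → G i j ≡ true → i ≢ j
  adj≢ {i} e refl = t≢f e (irr r i)

  -- Only a ≠ z and b ≠ w have to be assumed: a = w would turn the edge ba into the non-edge bw, b =
  -- z would turn ab into the non-edge az, and ab, zw are edges of a loopless graph. So the four
  -- vertices are distinct, and each of their rows trades one neighbour for one.
  switched : (G' : Gr n) {a b z w : Fin n} → Switchable G a b z w →
    (∀ i j → G' i j ≡ G i j xor tog a b z w i j) → Switching G G' a b z w × IsReg d G'
  switched G' {a} {b} {z} {w} v h = s , record { irr = irr' ; deg = deg' ; symm = symm' }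
    where
    open Switchable v
    ba = trans (symm r b a) ab
    wz = trans (symm r w z) zw
    za = trans (symm r z a) az
    wb = trans (symm r w b) bw
    a≢b = adj≢ ab
    z≢w = adj≢ zw
    a≢w : a ≢ w
    a≢w refl = t≢f ba bw
    b≢z : b ≢ z
    b≢z refl = t≢f ab az
    keep : ∀ {i j} → ¬ Toggled a b z w i j → G' i j ≡ G i j
    keep {i} {j} k = trans (h i j) (trans (cong (G i j xor_) (¬t→f (k ∘ tog-e a b z w i j))) (Boolₚ.xor-identityʳ (G i j)))
    flip-t : ∀ {i j} → Toggled a b z w i j → G i j ≡ true → G' i j ≡ false
    flip-t {i} {j} c e = trans (h i j) (cong₂ _xor_ e (tog-i c))
    flip-f : ∀ {i j} → Toggled a b z w i j → G i j ≡ false → G' i j ≡ true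
    flip-f {i} {j} c e = trans (h i j) (cong₂ _xor_ e (tog-i c))
    tc : ∀ i j → (G' i j ≡ G i j) ⊎ Toggled a b z w i j
    tc i j with tog a b z w i j in e
    ... | true = inj₂ (tog-e a b z w i j e)
    ... | false = inj₁ (trans (h i j) (trans (cong (G i j xor_) e) (Boolₚ.xor-identityʳ (G i j))))
    s : Switching G G' a b z w
    s = record
      { v = v ; tc = tc ; a≢b = a≢b ; a≢w = a≢w ; b≢z = b≢z ; z≢w = z≢w
      ; ra = record { p∈ = ab ; q∉ = az ; p∉' = flip-t c1 ab ; q∈' = flip-f c5 az
                    ; oth = λ j x y → keep λ { c1 → x refl ; c2 → a≢b refl ; c3 → a≢z refl ; c4 → a≢w refl
                                           ; c5 → y refl ; c6 → a≢z refl ; c7 → a≢b refl ; c8 → a≢w refl } }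
      ; rb = record { p∈ = ba ; q∉ = bw ; p∉' = flip-t c2 ba ; q∈' = flip-f c7 bw
                    ; oth = λ j x y → keep λ { c1 → a≢b refl ; c2 → x refl ; c3 → b≢z refl ; c4 → b≢w refl
                                           ; c5 → a≢b refl ; c6 → b≢z refl ; c7 → y refl ; c8 → b≢w refl } }
      ; rz = record { p∈ = zw ; q∉ = za ; p∉' = flip-t c3 zw ; q∈' = flip-f c6 za
                    ; oth = λ j x y → keep λ { c1 → a≢z refl ; c2 → b≢z refl ; c3 → x refl ; c4 → z≢w refl
                                           ; c5 → a≢z refl ; c6 → y refl ; c7 → b≢z refl ; c8 → z≢w refl } }
      ; rw = record { p∈ = wz ; q∉ = wb ; p∉' = flip-t c4 wz ; q∈' = flip-f c8 wb
                    ; oth = λ j x y → keep λ { c1 → a≢w refl ; c2 → b≢w refl ; c3 → z≢w refl ; c4 → x refl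
                                           ; c5 → a≢w refl ; c6 → z≢w refl ; c7 → b≢w refl ; c8 → y refl } }
      ; oth = λ i x y u t j → keep λ { c1 → x refl ; c2 → y refl ; c3 → u refl ; c4 → t refl
                                   ; c5 → x refl ; c6 → u refl ; c7 → y refl ; c8 → t refl } }
    symm' : ∀ i j → G' i j ≡ G' j i
    symm' i j = trans (h i j) (trans (cong₂ _xor_ (symm r i j) (tog-sym a b z w i j)) (sym (h j i)))
    irr' : ∀ i → G' i i ≡ false
    irr' i = trans (keep k) (irr r i)
      where
      k' : ∀ {i j} → Toggled a b z w i j → i ≢ j
      k' c1 = a≢b
      k' c2 = a≢b ∘ sym
      k' c3 = z≢w
      k' c4 = z≢w ∘ sym
      k' c5 = a≢z
      k' c6 = a≢z ∘ sym
      k' c7 = b≢w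
      k' c8 = b≢w ∘ sym
      k : ¬ Toggled a b z w i i
      k c = k' c refl
    rowdeg : ∀ {i p q} → Row G G' i p q → # (G' i) ≡ d
    rowdeg {i} {p} {q} R = +-cancelʳ-≡ 1 _ _ (trans (sym (cong (# (G' i) +_) (∑-δ p (λ _ → 1))))
      (trans (sym (S-+ (fins n) _ _)) (trans (S-cong (fins n) pt)
      (trans (S-+ (fins n) _ _) (cong₂ _+_ (deg r i) (∑-δ q (λ _ → 1)))))))
      where
      open Row R
      pt : ∀ j → ⟦ G' i j ⟧ + ⟦ eqF j p ⟧ * 1 ≡ ⟦ G i j ⟧ + ⟦ eqF j q ⟧ * 1
      pt j with j Fin.≟ p | j Fin.≟ q
      ... | yes refl | yes refl = ⊥-elim (t≢f p∈ q∉)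
      ... | yes refl | no _ rewrite p∈ | p∉' = refl
      ... | no _ | yes refl rewrite q∈' | q∉ = refl
      ... | no x | no y rewrite Row.oth R j x y = refl
    deg' : ∀ i → # (G' i) ≡ d
    deg' i with i Fin.≟ a | i Fin.≟ b | i Fin.≟ z | i Fin.≟ w
    ... | yes refl | _ | _ | _ = rowdeg (Switching.ra s)
    ... | _ | yes refl | _ | _ = rowdeg (Switching.rb s)
    ... | _ | _ | yes refl | _ = rowdeg (Switching.rz s)
    ... | _ | _ | _ | yes refl = rowdeg (Switching.rw s)
    ... | no x | no y | no u | no t = trans (S-cong (fins n) (λ j → cong ⟦_⟧ (Switching.oth s i x y u t j))) (deg r i)

-- Double counting of switchings.

S4 : (Fin n → Fin n → Fin n → Fin n → ℕ) → ℕ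
S4 g = ∑ λ a → ∑ λ b → ∑ λ z → ∑ λ w → g a b z w

S4-mono : {f g : Fin n → Fin n → Fin n → Fin n → ℕ} → (∀ a b z w → f a b z w ≤ g a b z w) → S4 f ≤ S4 g
S4-mono {n} h = S-mono (fins n) λ a → S-mono (fins n) λ b → S-mono (fins n) λ z → S-mono (fins n) λ w → h a b z w

S4-swap : ∀ {A : Set} (xs : List A) (g : A → Fin n → Fin n → Fin n → Fin n → ℕ) →
  S xs (λ x → S4 (g x)) ≡ S4 (λ a b z w → S xs (λ x → g x a b z w))
S4-swap {n} xs g = trans (S-swap xs F _) (S-cong F λ a → trans (S-swap xs F _) (S-cong F λ b →
  trans (S-swap xs F _) (S-cong F λ z → S-swap xs F _)))
  where F = fins n

S4-* : (c : ℕ) (g : Fin n → Fin n → Fin n → Fin n → ℕ) → S4 (λ a b z w → c * g a b z w) ≡ c * S4 g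
S4-* {n} c g = trans (S-cong F λ a → trans (S-cong F λ b → trans (S-cong F λ z → S-* F c _) (S-* F c _)) (S-* F c _)) (S-* F c _)
  where F = fins n

-- The switching at fixed a b z w xors a fixed pattern, hence is an involution on all matrices; no injectivity argument is needed.
double-count : (A B : Gr n → Bool) (f r : ℕ) (P R : Gr n → Fin n → Fin n → Fin n → Fin n → Bool) →
  (∀ G → IsReg d G → A G ≡ true → f ≤ S4 (λ a b z w → ⟦ P G a b z w ⟧)) →
  (∀ G a b z w → IsReg d G → A G ≡ true → P G a b z w ≡ true → Switchable G a b z w) →
  (∀ G G' a b z w → IsReg d G → IsReg d G' → A G ≡ true → P G a b z w ≡ true → Switching G G' a b z w →
     B G' ≡ true × R G' a b z w ≡ true) →
  (∀ G → IsReg d G → B G ≡ true → S4 (λ a b z w → ⟦ R G a b z w ⟧) ≤ r) →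
  cnt d A * f ≤ cnt d B * r
double-count {n} {d} A B f r P R hf hv hs hr =
  ≤-trans (≤-reflexive (cong (_* f) (cnt-def A))) (≤-trans (≤-reflexive (sym (S-*ʳ L f _)))
  (≤-trans (S-mono L (λ M → h1 M))
  (≤-trans (≤-reflexive (S4-swap L _))
  (≤-trans (S4-mono h2)
  (≤-trans (≤-reflexive (sym (S4-swap L _)))
  (≤-trans (S-mono L h3) (≤-trans (≤-reflexive (S-*ʳ L r _)) (≤-reflexive (cong (_* r) (sym (cnt-def B)))))))))))
  where
  L = allMatrices n
  iA iB : Matrix n → Bool
  iA M = isRegular d M ∧ A (adj M)
  iB M = isRegular d M ∧ B (adj M)
  h1 : ∀ M → ⟦ iA M ⟧ * f ≤ S4 (λ a b z w → ⟦ iA M ⟧ * ⟦ P (adj M) a b z w ⟧)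
  h1 M with iA M in e
  ... | false = z≤n
  ... | true = ≤-trans (*-monoʳ-≤ 1 (hf (adj M) (isRegular-t {M = M} (∧-l e)) (∧-r {a = isRegular d M} e)))
                 (≤-reflexive (sym (S4-* 1 _)))
  h3 : ∀ M → S4 (λ a b z w → ⟦ iB M ⟧ * ⟦ R (adj M) a b z w ⟧) ≤ ⟦ iB M ⟧ * r
  h3 M with iB M in e
  ... | false = ≤-reflexive (S4-* 0 (λ a b z w → ⟦ R (adj M) a b z w ⟧))
  ... | true = ≤-trans (≤-reflexive (S4-* 1 _)) (*-monoʳ-≤ 1 (hr (adj M) (isRegular-t {M = M} (∧-l e)) (∧-r {a = isRegular d M} e)))
  h2 : ∀ a b z w → S L (λ M → ⟦ iA M ⟧ * ⟦ P (adj M) a b z w ⟧) ≤ S L (λ M → ⟦ iB M ⟧ * ⟦ R (adj M) a b z w ⟧)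
  h2 a b z w = ≤-trans (S-mono L pt) (≤-reflexive (S-involution (Ms n) (sw a b z w) (sw-inv a b z w)
      (λ M → ⟦ iB M ⟧ * ⟦ R (adj M) a b z w ⟧)))
    where
    pt : ∀ M → ⟦ iA M ⟧ * ⟦ P (adj M) a b z w ⟧ ≤ ⟦ iB (sw a b z w M) ⟧ * ⟦ R (adj (sw a b z w M)) a b z w ⟧
    pt M = ≤-trans (≤-reflexive (sym (⟦∧⟧ (iA M) _))) (≤-trans (⟦⟧-mono k) (≤-reflexive (⟦∧⟧ (iB (sw a b z w M)) _)))
      where
      k : iA M ∧ P (adj M) a b z w ≡ true → iB (sw a b z w M) ∧ R (adj (sw a b z w M)) a b z w ≡ true
      k e = ∧-i (∧-i (isRegular-i {M = sw a b z w M} r') (proj₁ x)) (proj₂ x)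
        where
        r0 = isRegular-t {M = M} (∧-l (∧-l e))
        a0 = ∧-r {a = isRegular d M} (∧-l e)
        p0 = ∧-r {a = iA M} e
        s0 = switched r0 (adj (sw a b z w M)) (hv (adj M) a b z w r0 a0 p0) (adj-sw a b z w M)
        r' = proj₂ s0
        x = hs (adj M) (adj (sw a b z w M)) a b z w r0 r' a0 p0 (proj₁ s0)

#-mono : {f g : Fin n → Bool} → (∀ x → f x ≡ true → g x ≡ true) → # f ≤ # g
#-mono h = S-mono (fins _) λ x → ⟦⟧-mono (h x)

#-cong : {f g : Fin n → Bool} → (∀ x → f x ≡ g x) → # f ≡ # g
#-cong h = S-cong (fins _) λ x → cong ⟦_⟧ (h x)

#-true : ∀ n → # {n} (λ _ → true) ≡ n
#-true n = trans (S-const (fins n) 1) (trans (*-identityʳ _) (length-fins n))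

#≤n : (f : Fin n → Bool) → # f ≤ n
#≤n f = ≤-trans (#-mono (λ _ _ → refl)) (≤-reflexive (#-true _))

#-split : (f g : Fin n → Bool) → # f ≡ # (λ x → f x ∧ g x) + # (λ x → f x ∧ not (g x))
#-split f g = trans (S-cong (fins _) λ x → ⟦⟧-split (f x) (g x)) (S-+ (fins _) _ _)

#-compl : (f : Fin n → Bool) → n ≡ # f + # (λ x → not (f x))
#-compl f = trans (sym (#-true _)) (#-split (λ _ → true) f)

#-∨ : (f g : Fin n → Bool) → # (λ x → f x ∨ g x) ≤ # f + # g
#-∨ f g = ≤-trans (S-mono (fins _) λ x → ⟦∨⟧≤ (f x) (g x)) (≤-reflexive (S-+ (fins _) _ _))

#-eq : (a : Fin n) → # (λ x → eqF x a) ≡ 1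
#-eq a = trans (S-cong (fins _) λ x → sym (*-identityʳ _)) (∑-δ a (λ _ → 1))

#-pos : {f : Fin n → Bool} → 1 ≤ # f → ∃ λ x → f x ≡ true
#-pos {f = f} h = S-pos (fins _) f h

pos-# : {f : Fin n → Bool} {x : Fin n} → f x ≡ true → 1 ≤ # f
pos-# {f = f} {x} e = ≤-trans (≤-reflexive (cong ⟦_⟧ (sym e))) (f≤∑ (λ x → ⟦ f x ⟧) x)

eqF-sym : (x y : Fin n) → eqF x y ≡ eqF y x
eqF-sym x y = bool-ext (λ e → eqF-i (sym (eqF-t e))) (λ e → eqF-i (sym (eqF-t e)))

E2 : (Fin n → Fin n → Bool) → ℕ
E2 f = ∑ λ a → # (f a)

E2-mono : {f g : Fin n → Fin n → Bool} → (∀ a b → f a b ≡ true → g a b ≡ true) → E2 f ≤ E2 g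
E2-mono h = S-mono (fins _) λ a → #-mono (h a)

E2-swap : (f : Fin n → Fin n → Bool) → E2 f ≡ E2 (λ a b → f b a)
E2-swap f = S-swap (fins _) (fins _) (λ a b → ⟦ f a b ⟧)

E2-∨ : (f g : Fin n → Fin n → Bool) → E2 (λ a b → f a b ∨ g a b) ≤ E2 f + E2 g
E2-∨ f g = ≤-trans (S-mono (fins _) λ a → #-∨ (f a) (g a)) (≤-reflexive (S-+ (fins _) _ _))

∑-fac : (Q : Fin n → Bool) (g : Fin n → ℕ) (m : ℕ) → (∀ x → Q x ≡ true → g x ≡ m) → ∑ (λ x → ⟦ Q x ⟧ * g x) ≡ # Q * m
∑-fac Q g m h = trans (S-cong (fins _) pt) (S-*ʳ (fins _) m _) where
  pt : ∀ x → ⟦ Q x ⟧ * g x ≡ ⟦ Q x ⟧ * m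
  pt x with Q x in e
  ... | true = cong (_+ 0) (h x e)
  ... | false = refl

∑-fac≤ : (Q : Fin n → Bool) (g : Fin n → ℕ) (m : ℕ) → (∀ x → Q x ≡ true → g x ≤ m) → ∑ (λ x → ⟦ Q x ⟧ * g x) ≤ # Q * m
∑-fac≤ Q g m h = ≤-trans (S-mono (fins _) pt) (≤-reflexive (S-*ʳ (fins _) m _)) where
  pt : ∀ x → ⟦ Q x ⟧ * g x ≤ ⟦ Q x ⟧ * m
  pt x with Q x in e
  ... | true = +-monoˡ-≤ 0 (h x e)
  ... | false = z≤n

∑-fac≥ : (Q : Fin n → Bool) (g : Fin n → ℕ) (m : ℕ) → (∀ x → Q x ≡ true → m ≤ g x) → # Q * m ≤ ∑ (λ x → ⟦ Q x ⟧ * g x)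
∑-fac≥ Q g m h = ≤-trans (≤-reflexive (sym (S-*ʳ (fins _) m _))) (S-mono (fins _) pt) where
  pt : ∀ x → ⟦ Q x ⟧ * m ≤ ⟦ Q x ⟧ * g x
  pt x with Q x in e
  ... | true = +-monoˡ-≤ 0 (h x e)
  ... | false = z≤n

#-∧ : (c : Bool) (f : Fin n → Bool) → # (λ x → c ∧ f x) ≡ ⟦ c ⟧ * # f
#-∧ c f = trans (S-cong (fins _) λ x → ⟦∧⟧ c (f x)) (S-* (fins _) ⟦ c ⟧ _)

E2-∧ : (c : Bool) (f : Fin n → Fin n → Bool) → E2 (λ x y → c ∧ f x y) ≡ ⟦ c ⟧ * E2 f
E2-∧ c f = trans (S-cong (fins _) λ x → #-∧ c (f x)) (S-* (fins _) ⟦ c ⟧ _)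

E2-fac≤ : (Q : Fin n → Bool) (P : Fin n → Fin n → Bool) (m : ℕ) → (∀ x → Q x ≡ true → # (P x) ≤ m) → E2 (λ x y → Q x ∧ P x y) ≤ # Q * m
E2-fac≤ Q P m h = ≤-trans (≤-reflexive (S-cong (fins _) λ x → #-∧ (Q x) (P x))) (∑-fac≤ Q _ m h)

E2-fac : (Q : Fin n → Bool) (P : Fin n → Fin n → Bool) (m : ℕ) → (∀ x → Q x ≡ true → # (P x) ≡ m) → E2 (λ x y → Q x ∧ P x y) ≡ # Q * m
E2-fac Q P m h = trans (S-cong (fins _) λ x → #-∧ (Q x) (P x)) (∑-fac Q _ m h)

E2-fac≥ : (Q : Fin n → Bool) (P : Fin n → Fin n → Bool) (m : ℕ) → (∀ x → Q x ≡ true → m ≤ # (P x)) → # Q * m ≤ E2 (λ x y → Q x ∧ P x y)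
E2-fac≥ Q P m h = ≤-trans (∑-fac≥ Q _ m h) (≤-reflexive (sym (S-cong (fins _) λ x → #-∧ (Q x) (P x))))

private
  sumE : (Q : Fin n → Fin n → Bool) (m : ℕ) → ∑ (λ a → ∑ (λ b → ⟦ Q a b ⟧ * m)) ≡ E2 Q * m
  sumE Q m = trans (S-cong (fins _) λ a → S-*ʳ (fins _) m _) (S-*ʳ (fins _) m _)

S4≥ : (Q : Fin n → Fin n → Bool) (P : Fin n → Fin n → Fin n → Fin n → Bool) (m : ℕ) →
  (∀ a b → Q a b ≡ true → m ≤ E2 (P a b)) → E2 Q * m ≤ S4 (λ a b z w → ⟦ Q a b ∧ P a b z w ⟧)
S4≥ Q P m h = ≤-trans (≤-reflexive (sym (sumE Q m)))
    (S-mono (fins _) λ a → S-mono (fins _) λ b → ≤-trans (pt a b) (≤-reflexive (sym (E2-∧ (Q a b) (P a b))))) where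
  pt : ∀ a b → ⟦ Q a b ⟧ * m ≤ ⟦ Q a b ⟧ * E2 (P a b)
  pt a b with Q a b in e
  ... | true = +-monoˡ-≤ 0 (h a b e)
  ... | false = z≤n

S4≤ : (Q : Fin n → Fin n → Bool) (P : Fin n → Fin n → Fin n → Fin n → Bool) (m : ℕ) →
  (∀ a b → Q a b ≡ true → E2 (P a b) ≤ m) → S4 (λ a b z w → ⟦ Q a b ∧ P a b z w ⟧) ≤ E2 Q * m
S4≤ Q P m h = ≤-trans
    (S-mono (fins _) λ a → S-mono (fins _) λ b → ≤-trans (≤-reflexive (E2-∧ (Q a b) (P a b))) (pt a b))
    (≤-reflexive (sumE Q m)) where
  pt : ∀ a b → ⟦ Q a b ⟧ * E2 (P a b) ≤ ⟦ Q a b ⟧ * m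
  pt a b with Q a b in e
  ... | true = +-monoˡ-≤ 0 (h a b e)
  ... | false = z≤n

S4-bz : (f : Fin n → Fin n → Fin n → Fin n → ℕ) → S4 f ≡ S4 (λ a z b w → f a b z w)
S4-bz f = S-cong (fins _) λ a → S-swap (fins _) (fins _) _

-- Tail bounds for edge counts.

okv : Gr n → Fin n → Fin n → Bool
okv G a z = not (eqF z a) ∧ not (G a z)

#¬okv : {G : Gr n} → IsReg d G → ∀ a → # (λ z → not (okv G a z)) ≤ 1 + d
#¬okv {G = G} r a = ≤-trans (#-mono h) (≤-trans (#-∨ (λ z → eqF z a) (G a)) (+-mono-≤ (≤-reflexive (#-eq a)) (≤-reflexive (deg r a))))
  where
  h : ∀ x → not (okv G a x) ≡ true → eqF x a ∨ G a x ≡ true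
  h x e with eqF x a | G a x
  ... | true | _ = refl
  ... | false | true = refl

okV : {G : Gr n} {a b z w : Fin n} → G a b ≡ true → G z w ≡ true → okv G a z ≡ true → okv G b w ≡ true → Switchable G a b z w
okV {G = G} {a} {b} {z} {w} h k p q = switchable h k (not-t (∧-r {a = not (eqF z a)} p)) (not-t (∧-r {a = not (eqF w b)} q))
  (λ e → eqF-f (not-t (∧-l p)) (sym e)) (λ e → eqF-f (not-t (∧-l q)) (sym e))

module _ {G : Gr n} (r : IsReg d G) where
  edges-from : (A : Fin n → Bool) → E2 (λ z w → A z ∧ G z w) ≡ # A * d
  edges-from A = E2-fac A G d λ x _ → deg r x

  edges-to : (A : Fin n → Bool) → E2 (λ z w → G z w ∧ A w) ≡ # A * d
  edges-to A = trans (E2-swap _) (trans (S-cong (fins n) λ w → #-cong λ z → trans (Boolₚ.∧-comm (G z w) (A w)) (cong (A w ∧_) (symm r z w)))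
     (edges-from A))

  edges : E2 G ≡ n * d
  edges = trans (edges-from (λ _ → true)) (cong (_* d) (#-true n))

  -- A pair zw is forbidden if z equals or neighbours a, or w equals or neighbours b. That concerns
  -- 1 + d vertices on either side, each with d edges, which explains the loss 2(1 + d)d in the
  -- hypotheses on m below.
  avoid : (F : Fin n → Fin n → Bool) (a b : Fin n) →
    E2 (λ z w → F z w ∧ G z w) ≤ E2 (λ z w → F z w ∧ (G z w ∧ (okv G a z ∧ okv G b w))) + 2 * ((1 + d) * d)
  avoid F a b = ≤-trans (E2-mono h) (≤-trans (E2-∨ _ _) (+-monoʳ-≤ _ (≤-trans (E2-∨ _ _)
     (≤-trans (+-mono-≤ (≤-trans (≤-reflexive (edges-from _)) (*-monoˡ-≤ d (#¬okv r a)))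
                        (≤-trans (≤-reflexive (edges-to _)) (*-monoˡ-≤ d (#¬okv r b))))
       (≤-reflexive (cong ((1 + d) * d +_) (sym (+-identityʳ _))))))))
    where
    h : ∀ z w → F z w ∧ G z w ≡ true →
      (F z w ∧ (G z w ∧ (okv G a z ∧ okv G b w))) ∨ ((not (okv G a z) ∧ G z w) ∨ (G z w ∧ not (okv G b w))) ≡ true
    h z w e with F z w | G z w | okv G a z | okv G b w
    ... | true | true | true | true = refl
    ... | true | true | true | false = refl
    ... | true | true | false | _ = refl

lost : {G G' : Gr n} {a b z w : Fin n} → (r : IsReg d G) → Switching G G' a b z w → ∀ i j → G i j ≡ true →
  G' i j ∨ ((eqF i a ∧ eqF j b) ∨ ((eqF i b ∧ eqF j a) ∨ ((eqF i z ∧ eqF j w) ∨ (eqF i w ∧ eqF j z)))) ≡ true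
lost {G = G} {G'} {a} {b} {z} {w} r s i j e with Switching.tc s i j
... | inj₁ q = ∨-i₁ (trans q e)
... | inj₂ c = ∨-i₂ {G' i j} (go c) where
  go : Toggled a b z w i j → (eqF i a ∧ eqF j b) ∨ ((eqF i b ∧ eqF j a) ∨ ((eqF i z ∧ eqF j w) ∨ (eqF i w ∧ eqF j z))) ≡ true
  go c1 = ∨-i₁ (∧-i (eqF-r a) (eqF-r b))
  go c2 = ∨-i₂ {eqF b a ∧ eqF a b} (∨-i₁ (∧-i (eqF-r b) (eqF-r a)))
  go c3 = ∨-i₂ {eqF z a ∧ eqF w b} (∨-i₂ {eqF z b ∧ eqF w a} (∨-i₁ (∧-i (eqF-r z) (eqF-r w))))
  go c4 = ∨-i₂ {eqF w a ∧ eqF z b} (∨-i₂ {eqF w b ∧ eqF z a} (∨-i₂ {eqF w z ∧ eqF z w} (∧-i (eqF-r w) (eqF-r z))))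
  go c5 = ⊥-elim (t≢f e (Switching.az s))
  go c6 = ⊥-elim (t≢f (trans (symm r a z) e) (Switching.az s))
  go c7 = ⊥-elim (t≢f e (Switching.bw s))
  go c8 = ⊥-elim (t≢f (trans (symm r b w) e) (Switching.bw s))

gained : {G G' : Gr n} {a b z w : Fin n} → (r : IsReg d G) → Switching G G' a b z w → ∀ i j → G' i j ≡ true →
  G i j ∨ ((eqF i a ∧ eqF j z) ∨ ((eqF i z ∧ eqF j a) ∨ ((eqF i b ∧ eqF j w) ∨ (eqF i w ∧ eqF j b)))) ≡ true
gained {G = G} {G'} {a} {b} {z} {w} r s i j e with Switching.tc s i j
... | inj₁ q = ∨-i₁ (trans (sym q) e)
... | inj₂ c = ∨-i₂ {G i j} (go c) where
  go : Toggled a b z w i j → (eqF i a ∧ eqF j z) ∨ ((eqF i z ∧ eqF j a) ∨ ((eqF i b ∧ eqF j w) ∨ (eqF i w ∧ eqF j b))) ≡ true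
  go c5 = ∨-i₁ (∧-i (eqF-r a) (eqF-r z))
  go c6 = ∨-i₂ {eqF z a ∧ eqF a z} (∨-i₁ (∧-i (eqF-r z) (eqF-r a)))
  go c7 = ∨-i₂ {eqF b a ∧ eqF w z} (∨-i₂ {eqF b z ∧ eqF w a} (∨-i₁ (∧-i (eqF-r b) (eqF-r w))))
  go c8 = ∨-i₂ {eqF w a ∧ eqF b z} (∨-i₂ {eqF w z ∧ eqF b a} (∨-i₂ {eqF w b ∧ eqF b w} (∧-i (eqF-r w) (eqF-r b))))
  go c1 = ⊥-elim (t≢f e (Row.p∉' (Switching.ra s)))
  go c2 = ⊥-elim (t≢f e (Row.p∉' (Switching.rb s)))
  go c3 = ⊥-elim (t≢f e (Row.p∉' (Switching.rz s)))
  go c4 = ⊥-elim (t≢f e (Row.p∉' (Switching.rw s)))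

E2-pt : (a b : Fin n) → E2 (λ i j → eqF i a ∧ eqF j b) ≡ 1
E2-pt a b = trans (E2-fac (λ i → eqF i a) (λ _ j → eqF j b) 1 (λ _ _ → #-eq b)) (cong (_* 1) (#-eq a))

module _ (E : Fin n → Fin n → Bool) where
  eOn : Gr n → ℕ
  eOn G = E2 (λ i j → E i j ∧ G i j)

  private
    four : (a b p q : Fin n) → Fin n → Fin n → Bool
    four a b z w i j = (eqF i a ∧ eqF j b) ∨ ((eqF i b ∧ eqF j a) ∨ ((eqF i z ∧ eqF j w) ∨ (eqF i w ∧ eqF j z)))

    E2-four : ∀ a b z w → E2 (four a b z w) ≤ 4
    E2-four a b z w = ≤-trans (E2-∨ _ _) (+-mono-≤ (≤-reflexive (E2-pt a b)) (≤-trans (E2-∨ _ _)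
      (+-mono-≤ (≤-reflexive (E2-pt b a)) (≤-trans (E2-∨ _ _) (+-mono-≤ (≤-reflexive (E2-pt z w)) (≤-reflexive (E2-pt w z)))))))

    diff : {G G' : Gr n} (f : Fin n → Fin n → Bool) → (∀ i j → G i j ≡ true → G' i j ∨ f i j ≡ true) → eOn G ≤ eOn G' + E2 f
    diff {G} {G'} f h = ≤-trans (E2-mono k) (E2-∨ _ _) where
      k : ∀ i j → E i j ∧ G i j ≡ true → (E i j ∧ G' i j) ∨ f i j ≡ true
      k i j e with E i j
      ... | true = h i j e

  -- Two edges are deleted, that is four ordered pairs; hence edge counts move in steps of 4 below.
  eOn-lost : {G G' : Gr n} {a b z w : Fin n} → IsReg d G → Switching G G' a b z w → eOn G ≤ eOn G' + 4
  eOn-lost {a = a} {b} {z} {w} r s = ≤-trans (diff (four a b z w) (lost r s)) (+-monoʳ-≤ _ (E2-four a b z w))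

  eOn-gained : {G G' : Gr n} {a b z w : Fin n} → IsReg d G → Switching G G' a b z w → eOn G' ≤ eOn G + 4
  eOn-gained {a = a} {b} {z} {w} r s = ≤-trans (diff (four a z b w) (gained r s)) (+-monoʳ-≤ _ (E2-four a z b w))

-- Turns a double count with f switchings out and at most r ≤ f/q back into a factor q of decay. The
-- tails below iterate it through `geo`.
ratio : ∀ {A B f r} q → A * f ≤ B * r → q * r ≤ f → 0 < f → A * q ≤ B
ratio {A} {B} {f@(suc _)} {r} q h k _ = *-cancelʳ-≤ (A * q) B f (begin
  A * q * f ≡⟨ l1 A q f ⟩
  q * (A * f) ≤⟨ *-monoʳ-≤ q h ⟩
  q * (B * r) ≡⟨ l2 q B r ⟩
  B * (q * r) ≤⟨ *-monoʳ-≤ B k ⟩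
  B * f ∎)
  where
  open ≤-Reasoning
  l1 : ∀ A q f → A * q * f ≡ q * (A * f)
  l1 = solve-∀
  l2 : ∀ q B r → q * (B * r) ≡ B * (q * r)
  l2 = solve-∀

geo : ∀ {A B N} q k → A * q ≤ B → B * q ^ k ≤ N → A * q ^ suc k ≤ N
geo {A} {B} q k h g = ≤-trans (≤-reflexive (sym (*-assoc A q (q ^ k)))) (≤-trans (*-monoˡ-≤ (q ^ k) h) g)

module _ (E : Fin n → Fin n → Bool) (m : ℕ) (hm : m + 2 * ((1 + d) * d) ≤ n * d) where
  -- Switch away an edge ab in E. Forward there are at least x choices of ab and m of zw; backward
  -- ab is some pair of E, and z, w are neighbours of a, b. So sparseness of E drives the decay.
  upper-step : ∀ x → cnt d (λ G → x + 4 ≤b eOn E G) * (x * m) ≤ cnt d (λ G → x ≤b eOn E G) * (E2 E * (d * d))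
  upper-step x = double-count (λ G → x + 4 ≤b eOn E G) (λ G → x ≤b eOn E G) (x * m) (E2 E * (d * d))
    (λ G a b z w → (E a b ∧ G a b) ∧ (G z w ∧ (okv G a z ∧ okv G b w)))
    (λ G a b z w → E a b ∧ (G a z ∧ G b w))
    (λ G r e → ≤-trans (*-monoˡ-≤ m (≤-trans (m≤m+n x 4) (≤b-t e)))
      (S4≥ (λ a b → E a b ∧ G a b) (λ a b z w → G z w ∧ (okv G a z ∧ okv G b w)) m λ a b _ →
        +-cancelʳ-≤ _ m _ (≤-trans hm (≤-trans (≤-reflexive (sym (edges r))) (avoid r (λ _ _ → true) a b)))))
    (λ G a b z w r _ p → okV (∧-r {a = E a b} (∧-l p)) (∧-l (∧-r {a = E a b ∧ G a b} p))
      (∧-l (∧-r {a = G z w} (∧-r {a = E a b ∧ G a b} p))) (∧-r {a = okv G a z} (∧-r {a = G z w} (∧-r {a = E a b ∧ G a b} p))))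
    (λ G G' a b z w r r' e p s → ≤b-i (+-cancelʳ-≤ 4 _ _ (≤-trans (≤b-t e) (eOn-lost E r s))) ,
      ∧-i (∧-l {E a b} (∧-l p)) (∧-i (Row.q∈' (Switching.ra s)) (Row.q∈' (Switching.rb s))))
    (λ G r _ → S4≤ E (λ a b z w → G a z ∧ G b w) (d * d) λ a b _ → ≤-reflexive
      (trans (E2-fac (G a) (λ _ → G b) d (λ _ _ → deg r b)) (cong (_* d) (deg r a))))

  upper-tail : ∀ f q k → 0 < f * m → q * (E2 E * (d * d)) ≤ f * m →
    cnt d (λ G → f + k * 4 ≤b eOn E G) * q ^ k ≤ cnt {n} d (λ _ → true)
  upper-tail f q zero pos h = ≤-trans (≤-reflexive (*-identityʳ _)) (cnt≤N _)
  upper-tail f q (suc k) pos h = geo {cnt d (λ G → f + suc k * 4 ≤b eOn E G)} {cnt d (λ G → f + k * 4 ≤b eOn E G)} q k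
    (ratio {cnt d (λ G → f + suc k * 4 ≤b eOn E G)} q (subst (λ y → cnt d (λ G → y ≤b eOn E G) * ((f + k * 4) * m) ≤ cnt d
        (λ G → f + k * 4 ≤b eOn E G) * (E2 E * (d * d)))
               (lem f k) (upper-step (f + k * 4)))
      (≤-trans h mono) (<-≤-trans pos mono))
    (upper-tail f q k pos h)
    where
    mono : f * m ≤ (f + k * 4) * m
    mono = *-monoˡ-≤ m (m≤m+n f (k * 4))
    lem : ∀ f k → f + k * 4 + 4 ≡ f + suc k * 4
    lem = solve-∀

module _ (U S : Fin n → Bool) (m : ℕ) (hm : m + 2 * ((1 + d) * d) ≤ # S * d) where
  private
    E : Fin n → Fin n → Bool
    E a z = U a ∧ S z

  -- Dual to `upper-step`: delete ab with a in U and zw with z in S in order to insert az in U × S.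
  -- Forward there are |U|d choices of ab and m of zw; backward az is one of at most x + 4 edges of
  -- U × S and bw is any edge.
  lower-step : ∀ x → cnt d (λ G → eOn E G ≤b x) * (# U * d * m) ≤ cnt d (λ G → eOn E G ≤b x + 4) * ((x + 4) * (n * d))
  lower-step x = double-count (λ G → eOn E G ≤b x) (λ G → eOn E G ≤b x + 4) (# U * d * m) ((x + 4) * (n * d))
    (λ G a b z w → (U a ∧ G a b) ∧ (S z ∧ (G z w ∧ (okv G a z ∧ okv G b w))))
    (λ G a b z w → ((U a ∧ S z) ∧ G a z) ∧ G b w)
    (λ G r e → ≤-trans (≤-reflexive (cong (_* m) (sym (edges-from r U))))
      (S4≥ (λ a b → U a ∧ G a b) (λ a b z w → S z ∧ (G z w ∧ (okv G a z ∧ okv G b w))) m λ a b _ →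
        +-cancelʳ-≤ _ m _ (≤-trans hm (≤-trans (≤-reflexive (sym (edges-from r S))) (avoid r (λ z _ → S z) a b)))))
    (λ G a b z w r _ p → let q = ∧-r {a = S z} (∧-r {a = U a ∧ G a b} p) in
      okV (∧-r {a = U a} (∧-l p)) (∧-l q) (∧-l (∧-r {a = G z w} q)) (∧-r {a = okv G a z} (∧-r {a = G z w} q)))
    (λ G G' a b z w r r' e p s → ≤b-i (≤-trans (eOn-gained E r s) (+-monoˡ-≤ 4 (≤b-t e))) ,
      ∧-i (∧-i (∧-i (∧-l {U a} (∧-l p)) (∧-l {S z} (∧-r {a = U a ∧ G a b} p))) (Row.q∈' (Switching.ra s))) (Row.q∈' (Switching.rb s)))
    (λ G r e → ≤-trans (≤-reflexive (S4-bz (λ a b z w → ⟦ ((U a ∧ S z) ∧ G a z) ∧ G b w ⟧)))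
      (≤-trans (S4≤ (λ a z → (U a ∧ S z) ∧ G a z) (λ a z b w → G b w) (n * d) (λ _ _ _ → ≤-reflexive (edges r)))
        (*-monoˡ-≤ (n * d) {eOn E G} {x + 4} (≤b-t e))))

  lower-tail : ∀ k x → 0 < # U * d * m → 4 * ((x + k * 4) * (n * d)) ≤ # U * d * m →
    cnt d (λ G → eOn E G ≤b x) * 4 ^ k ≤ cnt {n} d (λ _ → true)
  lower-tail zero x pos h = ≤-trans (≤-reflexive (*-identityʳ _)) (cnt≤N _)
  lower-tail (suc k) x pos h = geo {cnt d (λ G → eOn E G ≤b x)} {cnt d (λ G → eOn E G ≤b x + 4)} 4 k
    (ratio {cnt d (λ G → eOn E G ≤b x)} 4 (lower-step x) (≤-trans (*-monoʳ-≤ 4 (*-monoˡ-≤ (n * d) (+-monoʳ-≤ x (m≤m+n 4 (k * 4))))) h) pos)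
    (lower-tail k (x + 4) pos (≤-trans (≤-reflexive (cong (λ y → 4 * (y * (n * d))) (+-assoc x 4 (k * 4)))) h))

rowCount : {G G' : Gr n} {i p q : Fin n} → Row G G' i p q → (X : Fin n → Bool) →
  # (λ j → X j ∧ G' i j) + ⟦ X p ⟧ ≡ # (λ j → X j ∧ G i j) + ⟦ X q ⟧
rowCount {n} {G} {G'} {i} {p} {q} R X = trans (cong (# (λ j → X j ∧ G' i j) +_) (sym (∑-δ p (λ j → ⟦ X j ⟧))))
  (trans (sym (S-+ (fins n) _ _)) (trans (S-cong (fins n) pt) (trans (S-+ (fins n) _ _)
    (cong (# (λ j → X j ∧ G i j) +_) (∑-δ q (λ j → ⟦ X j ⟧))))))
  where
  open Row R
  pt : ∀ j → ⟦ X j ∧ G' i j ⟧ + ⟦ eqF j p ⟧ * ⟦ X j ⟧ ≡ ⟦ X j ∧ G i j ⟧ + ⟦ eqF j q ⟧ * ⟦ X j ⟧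
  pt j with j Fin.≟ p | j Fin.≟ q
  ... | yes refl | yes refl = ⊥-elim (t≢f p∈ q∉)
  ... | yes refl | no _ rewrite p∈ | p∉' with X j
  ...   | true = refl
  ...   | false = refl
  pt j | no _ | yes refl rewrite q∈' | q∉ with X j
  ...   | true = refl
  ...   | false = refl
  pt j | no x | no y rewrite oth j x y = refl

data Which {n} {G G' : Gr n} {a b z w : Fin n} (s : Switching G G' a b z w) (i : Fin n) : Set where
  isa : i ≡ a → Which s i
  isb : i ≡ b → Which s i
  isz : i ≡ z → Which s i
  isw : i ≡ w → Which s i
  none : i ≢ a → i ≢ b → i ≢ z → i ≢ w → (∀ j → G' i j ≡ G i j) → Which s i

which : {G G' : Gr n} {a b z w : Fin n} (s : Switching G G' a b z w) (i : Fin n) → Which s i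
which {a = a} {b} {z} {w} s i with i Fin.≟ a | i Fin.≟ b | i Fin.≟ z | i Fin.≟ w
... | yes p | _ | _ | _ = isa p
... | no _ | yes p | _ | _ = isb p
... | no _ | no _ | yes p | _ = isz p
... | no _ | no _ | no _ | yes p = isw p
... | no x | no y | no u | no t = none x y u t (Switching.oth s i x y u t)

row-lost : {G G' : Gr n} {i p q : Fin n} → Row G G' i p q → # (λ j → G i j ∧ not (G' i j)) ≤ 1
row-lost {n} {G} {G'} {i} {p} {q} R = ≤-trans (#-mono h) (≤-reflexive (#-eq p)) where
  open Row R
  h : ∀ j → G i j ∧ not (G' i j) ≡ true → eqF j p ≡ true
  h j e with j Fin.≟ p | j Fin.≟ q
  ... | yes _ | _ = refl
  ... | no _ | yes refl = ⊥-elim (t≢f (∧-l e) q∉)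
  ... | no x | no y = ⊥-elim (t≢f (trans (oth j x y) (∧-l e)) (not-t (∧-r {a = G i j} e)))

any-lost : {G G' : Gr n} {a b z w : Fin n} → Switching G G' a b z w → ∀ i → # (λ j → G i j ∧ not (G' i j)) ≤ 1
any-lost s i with which s i
... | isa refl = row-lost (Switching.ra s)
... | isb refl = row-lost (Switching.rb s)
... | isz refl = row-lost (Switching.rz s)
... | isw refl = row-lost (Switching.rw s)
any-lost {n} {G} {G'} s i | none _ _ _ _ h = ≤-trans (#-mono {g = λ _ → false} k) (≤-trans (≤-reflexive (S-0 (fins n))) z≤n)
  where
  k : ∀ x → G i x ∧ not (G' i x) ≡ true → false ≡ true
  k x e = ⊥-elim (t≢f (trans (h x) (∧-l e)) (not-t (∧-r {a = G i x} e)))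

-- Tail bounds for codegrees.

module _ (u v : Fin n) (u≢v : u ≢ v) (m : ℕ) (hm : m + 2 * ((1 + d) * d) + 2 * d ≤ n * d) where
  codeg : Gr n → ℕ
  codeg G = # (λ x → G u x ∧ G v x)

  private
    codeg-lost : {G G' : Gr n} {a b z w : Fin n} → Switching G G' a b z w → codeg G ≤ codeg G' + 2
    codeg-lost {G} {G'} s = ≤-trans (#-mono h) (≤-trans (#-∨ _ _) (+-monoʳ-≤ _ (≤-trans (#-∨ _ _) (+-mono-≤ (any-lost s u) (any-lost s v)))))
      where
      h : ∀ x → G u x ∧ G v x ≡ true → (G' u x ∧ G' v x) ∨ ((G u x ∧ not (G' u x)) ∨ (G v x ∧ not (G' v x))) ≡ true
      h x e with G u x | G v x | G' u x | G' v x
      ... | true | true | true | true = refl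
      ... | true | true | true | false = refl
      ... | true | true | false | _ = refl

    F : Fin n → Fin n → Bool
    F z w = not (eqF z v) ∧ not (eqF w v)

    F-edges : {G : Gr n} → IsReg d G → n * d ≤ E2 (λ z w → F z w ∧ G z w) + 2 * d
    F-edges {G} r = ≤-trans (≤-reflexive (sym (edges r))) (≤-trans (E2-mono h) (≤-trans (E2-∨ _ _) (+-monoʳ-≤ _
       (≤-trans (E2-∨ _ _) (≤-reflexive (trans (cong₂ _+_ (edges-from r (λ z → eqF z v)) (edges-to r (λ w → eqF w v)))
          (cong (λ y → y * d + y * d) (#-eq v) ⟨trans⟩ lem d)))))))
      where
      infixl 1 _⟨trans⟩_
      _⟨trans⟩_ = trans
      lem : ∀ d → 1 * d + 1 * d ≡ 2 * d
      lem = solve-∀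
      h : ∀ z w → G z w ≡ true → (F z w ∧ G z w) ∨ ((eqF z v ∧ G z w) ∨ (G z w ∧ eqF w v)) ≡ true
      h z w e with G z w | eqF z v | eqF w v
      ... | true | true | _ = refl
      ... | true | false | true = refl
      ... | true | false | false = refl

  -- Delete the edge from u to a common neighbour b. As z and w avoid v (`F`), b remains a neighbour
  -- of v, so backward each of b, z, w has only d choices and no factor n appears. The rows of u and
  -- v lose at most one entry each, hence steps of 2.
  codeg-step : ∀ x → cnt d (λ G → x + 2 ≤b codeg G) * (x * m) ≤ cnt d (λ G → x ≤b codeg G) * (d * (d * d))
  codeg-step x = double-count (λ G → x + 2 ≤b codeg G) (λ G → x ≤b codeg G) (x * m) (d * (d * d))
    (λ G a b z w → (eqF a u ∧ (G u b ∧ G v b)) ∧ (F z w ∧ (G z w ∧ (okv G a z ∧ okv G b w))))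
    (λ G a b z w → (eqF a u ∧ G v b) ∧ (G a z ∧ G b w))
    (λ G r e → ≤-trans (*-monoˡ-≤ m (≤-trans (≤-trans (m≤m+n x 2) (≤b-t e))
        (≤-reflexive (sym (trans (E2-fac (λ a → eqF a u) (λ _ b → G u b ∧ G v b) (codeg G) (λ _ _ → refl))
            (trans (cong (_* codeg G) (#-eq u)) (*-identityˡ _)))))))
      (S4≥ (λ a b → eqF a u ∧ (G u b ∧ G v b)) (λ a b z w → F z w ∧ (G z w ∧ (okv G a z ∧ okv G b w))) m λ a b _ →
        +-cancelʳ-≤ (2 * ((1 + d) * d)) m _ (+-cancelʳ-≤ (2 * d) _ _
          (≤-trans hm (≤-trans (F-edges r) (+-monoˡ-≤ (2 * d) (avoid r F a b)))))))
    (λ G a b z w r _ p → let q = ∧-r {a = F z w} (∧-r {a = eqF a u ∧ (G u b ∧ G v b)} p)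
                             a≡u = eqF-t (∧-l (∧-l p)) in
      okV (subst (λ y → G y b ≡ true) (sym a≡u) (∧-l (∧-r {a = eqF a u} (∧-l p)))) (∧-l q)
        (∧-l (∧-r {a = G z w} q)) (∧-r {a = okv G a z} (∧-r {a = G z w} q)))
    (λ G G' a b z w r r' e p s → ≤b-i (+-cancelʳ-≤ 2 _ _ (≤-trans (≤b-t e) (codeg-lost s))) ,
      ∧-i (∧-i (∧-l {eqF a u} (∧-l p)) (keepv G G' s p r)) (∧-i (Row.q∈' (Switching.ra s)) (Row.q∈' (Switching.rb s))))
    (λ G r _ → ≤-trans (S4≤ (λ a b → eqF a u ∧ G v b) (λ a b z w → G a z ∧ G b w) (d * d) (λ a b _ → ≤-reflexive
        (trans (E2-fac (G a) (λ _ → G b) d (λ _ _ → deg r b)) (cong (_* d) (deg r a)))))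
      (≤-reflexive (cong (_* (d * d)) (trans (E2-fac (λ a → eqF a u) (λ _ → G v) d (λ _ _ → deg r v))
        (trans (cong (_* d) (#-eq u)) (*-identityˡ d))))))
    where
    keepv : ∀ G G' {a b z w} → Switching G G' a b z w →
      (eqF a u ∧ (G u b ∧ G v b)) ∧ (F z w ∧ (G z w ∧ (okv G a z ∧ okv G b w))) ≡ true → IsReg d G → G' v b ≡ true
    keepv G G' {a} {b} {z} {w} s p r with which s v
    ... | isa e = ⊥-elim (u≢v (trans (sym (eqF-t (∧-l (∧-l p)))) (sym e)))
    ... | isb e = ⊥-elim (t≢f (∧-r {a = G u b} (∧-r {a = eqF a u} (∧-l p))) (trans (cong (G v) (sym e)) (irr r v)))
    ... | isz e = ⊥-elim (eqF-f (not-t (∧-l {not (eqF z v)} (∧-l (∧-r {a = eqF a u ∧ (G u b ∧ G v b)} p)))) (sym e))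
    ... | isw e = ⊥-elim (eqF-f (not-t (∧-r {a = not (eqF z v)} (∧-l (∧-r {a = eqF a u ∧ (G u b ∧ G v b)} p)))) (sym e))
    ... | none _ _ _ _ h = trans (h b) (∧-r {a = G u b} (∧-r {a = eqF a u} (∧-l p)))

  codeg-tail : ∀ f q k → 0 < f * m → q * (d * (d * d)) ≤ f * m →
    cnt d (λ G → f + k * 2 ≤b codeg G) * q ^ k ≤ cnt {n} d (λ _ → true)
  codeg-tail f q zero pos h = ≤-trans (≤-reflexive (*-identityʳ _)) (cnt≤N _)
  codeg-tail f q (suc k) pos h = geo {cnt d (λ G → f + suc k * 2 ≤b codeg G)} {cnt d (λ G → f + k * 2 ≤b codeg G)} q k
    (ratio {cnt d (λ G → f + suc k * 2 ≤b codeg G)} q (subst (λ y → cnt d (λ G → y ≤b codeg G) * ((f + k * 2) * m) ≤ cnt d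
        (λ G → f + k * 2 ≤b codeg G) * (d * (d * d)))
               (lem f k) (codeg-step (f + k * 2)))
      (≤-trans h mono) (<-≤-trans pos mono))
    (codeg-tail f q k pos h)
    where
    mono : f * m ≤ (f + k * 2) * m
    mono = *-monoˡ-≤ m (m≤m+n f (k * 2))
    lem : ∀ f k → f + k * 2 + 2 ≡ f + suc k * 2
    lem = solve-∀

-- Sets with the same number of neighbours at almost all vertices.

S4-awzb : (f : Fin n → Fin n → Fin n → Fin n → ℕ) → S4 f ≡ S4 (λ a w z b → f a b z w)
S4-awzb {n} f = S-cong F λ a → trans (S-swap F F _) (trans (S-cong F λ z → S-swap F F _) (S-swap F F _))
  where F = fins n

module _ (S : Fin n → Bool) (c : ℕ) where
  degIn : Gr n → Fin n → ℕ
  degIn G u = # (λ x → S x ∧ G u x)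

  off : Gr n → ℕ
  off G = # (λ u → not (degIn G u =b c))

  private
    exact : Gr n → Fin n → Bool
    exact G u = not (S u) ∧ (degIn G u =b c)

    exact-deg : ∀ G {u} → exact G u ≡ true → degIn G u ≡ c
    exact-deg G {u} e = =b-t (∧-r {a = not (S u)} e)

    exact-out : ∀ G {u} → exact G u ≡ true → S u ≡ false
    exact-out G e = not-t (∧-l e)

    #exact : ∀ G → n ≤ # (exact G) + # S + off G
    #exact G = ≤-trans (≤-reflexive (sym (#-true n))) (≤-trans (#-mono h) (≤-trans (#-∨ _ _)
        (≤-trans (+-monoʳ-≤ _ (#-∨ _ _)) (≤-reflexive (sym (+-assoc (# (exact G)) _ _))))))
      where
      h : ∀ x → true ≡ true → exact G x ∨ (S x ∨ not (degIn G x =b c)) ≡ true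
      h x _ with S x | degIn G x =b c
      ... | true | _ = refl
      ... | false | true = refl
      ... | false | false = refl

    degIn-same : {G G' : Gr n} {a b z w : Fin n} → Switching G G' a b z w → S a ≡ false → S w ≡ false →
      ∀ u → u ≢ a → u ≢ w → degIn G' u ≡ degIn G u
    degIn-same {G} {G'} {a} {b} {z} {w} s sa sw' u x y with which s u
    ... | isa e = ⊥-elim (x e)
    ... | isw e = ⊥-elim (y e)
    ... | isb refl = +-cancelʳ-≡ 0 _ _ (subst₂ (λ p q → degIn G' b + ⟦ p ⟧ ≡ degIn G b + ⟦ q ⟧) sa sw' (rowCount (Switching.rb s) S))
    ... | isz refl = +-cancelʳ-≡ 0 _ _ (subst₂ (λ p q → degIn G' z + ⟦ p ⟧ ≡ degIn G z + ⟦ q ⟧) sw' sa (rowCount (Switching.rz s) S))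
    ... | none _ _ _ _ h = #-cong λ j → cong (S j ∧_) (h j)

  module _ (α m : ℕ) (hm : m + 2 * ((1 + d) * d) ≤ α * (d ∸ c)) where
    -- Move a neighbour b in S from an exact vertex a to an exact vertex w. As a and w lie outside
    -- S, the vertices b and z keep their degrees into S, so only a and w become exceptional.
    -- Backward both are among x + 2 exceptions, forward both range over at least `α` vertices: the
    -- gain is of order (`α`/(x + 2))².
    off-step : ∀ x → α + # S + x ≤ n →
      cnt d (λ G → off G ≤b x) * (α * c * m) ≤ cnt d (λ G → off G ≤b x + 2) * ((x + 2) * (x + 2) * (d * suc c))
    off-step x hx = double-count (λ G → off G ≤b x) (λ G → off G ≤b x + 2) (α * c * m) ((x + 2) * (x + 2) * (d * suc c))
      (λ G a b z w → (exact G a ∧ (S b ∧ G a b)) ∧ ((exact G w ∧ not (S z)) ∧ (G z w ∧ (okv G a z ∧ okv G b w))))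
      (λ G a b z w → Q G a w ∧ (G a z ∧ (S b ∧ G w b)))
      hf hv hs hr
      where
      Q : Gr n → Fin n → Fin n → Bool
      Q G a w = (not (degIn G a =b c) ∧ not (degIn G w =b c)) ∧ (degIn G w =b suc c)
      α≤ : ∀ G → (off G ≤b x) ≡ true → α ≤ # (exact G)
      α≤ G e = +-cancelʳ-≤ (# S + x) α _ (≤-trans (≤-reflexive (sym (+-assoc α _ _))) (≤-trans hx (≤-trans (#exact G)
        (≤-trans (+-monoʳ-≤ (# (exact G) + # S) (≤b-t e)) (≤-reflexive (+-assoc (# (exact G)) _ _))))))
      hf : ∀ G → IsReg d G → (off G ≤b x) ≡ true → α * c * m ≤
        S4 (λ a b z w → ⟦ (exact G a ∧ (S b ∧ G a b)) ∧ ((exact G w ∧ not (S z)) ∧ (G z w ∧ (okv G a z ∧ okv G b w))) ⟧)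
      hf G r e = ≤-trans (*-monoˡ-≤ m (≤-trans (*-monoˡ-≤ c (α≤ G e))
          (≤-reflexive (sym (E2-fac (exact G) (λ a b → S b ∧ G a b) c (λ a h → exact-deg G h))))))
        (S4≥ (λ a b → exact G a ∧ (S b ∧ G a b)) (λ a b z w → (exact G w ∧ not (S z)) ∧ (G z w ∧ (okv G a z ∧ okv G b w))) m λ a b _ →
          +-cancelʳ-≤ _ m _ (≤-trans hm (≤-trans (*-monoˡ-≤ (d ∸ c) (α≤ G e)) (≤-trans tot (avoid r (λ z w → exact G w ∧ not (S z)) a b)))))
        where
        tot : # (exact G) * (d ∸ c) ≤ E2 (λ z w → (exact G w ∧ not (S z)) ∧ G z w)
        tot = ≤-trans (E2-fac≥ (exact G) (λ w z → not (S z) ∧ G w z) (d ∸ c) λ w h →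
            ≤-trans (≤-reflexive (trans (cong₂ _∸_ (sym (deg r w)) (sym (exact-deg G h)))
              (trans (cong (_∸ degIn G w) (trans (#-split (G w) S) (cong₂ _+_ (#-cong (λ j → Boolₚ.∧-comm (G w j) (S j))) refl))) (m+n∸m≡n (degIn G w) _))))
              (≤-reflexive (#-cong λ j → Boolₚ.∧-comm (G w j) (not (S j)))))
          (≤-reflexive (trans (E2-swap _) (S-cong (fins n) λ z → #-cong λ w →
             trans (sym (Boolₚ.∧-assoc (exact G w) _ _)) (cong ((exact G w ∧ not (S z)) ∧_) (symm r w z)))))
      hv : ∀ G a b z w → IsReg d G → (off G ≤b x) ≡ true →
        (exact G a ∧ (S b ∧ G a b)) ∧ ((exact G w ∧ not (S z)) ∧ (G z w ∧ (okv G a z ∧ okv G b w))) ≡ true → Switchable G a b z w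
      hv G a b z w r _ p = let p1 = ∧-l {exact G a ∧ (S b ∧ G a b)} p
                               q = ∧-r {a = exact G w ∧ not (S z)} (∧-r {a = exact G a ∧ (S b ∧ G a b)} p) in
        okV (∧-r {a = S b} (∧-r {a = exact G a} p1)) (∧-l q) (∧-l (∧-r {a = G z w} q)) (∧-r {a = okv G a z} (∧-r {a = G z w} q))
      hs : ∀ G G' a b z w → IsReg d G → IsReg d G' → (off G ≤b x) ≡ true →
        (exact G a ∧ (S b ∧ G a b)) ∧ ((exact G w ∧ not (S z)) ∧ (G z w ∧ (okv G a z ∧ okv G b w))) ≡ true → Switching G G' a b z w →
        ((off G' ≤b x + 2) ≡ true) × (Q G' a w ∧ (G' a z ∧ (S b ∧ G' w b)) ≡ true)
      hs G G' a b z w r r' e p s = ≤b-i (≤-trans (#-mono off') (≤-trans (#-∨ _ _) (+-mono-≤ (≤b-t e)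
            (≤-trans (#-∨ _ _) (≤-reflexive (cong₂ _+_ (#-eq a) (#-eq w))))))) ,
          ∧-i (∧-i (∧-i (not-f (¬t→f λ h → 1+n≢n (trans da (sym (=b-t h))))) (not-f (¬t→f λ h → 1+n≢n (trans (sym dw) (=b-t h)))))
               (=b-i dw)) (∧-i (Row.q∈' (Switching.ra s)) (∧-i sb (Row.q∈' (Switching.rw s))))
        where
        p1 = ∧-l {exact G a ∧ (S b ∧ G a b)} p
        p2 = ∧-l {exact G w ∧ not (S z)} (∧-r {a = exact G a ∧ (S b ∧ G a b)} p)
        Aa = ∧-l {exact G a} p1
        Aw = ∧-l {exact G w} p2
        sb = ∧-l {S b} (∧-r {a = exact G a} p1)
        sz = not-t (∧-r {a = exact G w} p2)
        da : suc (degIn G' a) ≡ c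
        da = trans (+-comm 1 _) (trans (trans (subst₂ (λ p q → degIn G' a + ⟦ p ⟧ ≡ degIn G a + ⟦ q ⟧) sb sz (rowCount (Switching.ra s) S))
            (+-identityʳ _)) (exact-deg G Aa))
        dw : degIn G' w ≡ suc c
        dw = trans (sym (+-identityʳ _)) (trans (trans (subst₂ (λ p q → degIn G' w + ⟦ p ⟧ ≡ degIn G w + ⟦ q ⟧) sz sb (rowCount (Switching.rw s) S))
            (+-comm _ 1)) (cong suc (exact-deg G Aw)))
        off' : ∀ u → not (degIn G' u =b c) ≡ true → not (degIn G u =b c) ∨ (eqF u a ∨ eqF u w) ≡ true
        off' u h with u Fin.≟ a | u Fin.≟ w
        ... | yes _ | _ = ∨-i₂ {not (degIn G u =b c)} refl
        ... | no _ | yes _ = ∨-i₂ {not (degIn G u =b c)} refl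
        ... | no k | no l = ∨-i₁ (trans (cong (λ y → not (y =b c)) (sym (degIn-same s (exact-out G Aa) (exact-out G Aw) u k l))) h)
      hr : ∀ G → IsReg d G → (off G ≤b x + 2) ≡ true → S4 (λ a b z w → ⟦ Q G a w ∧ (G a z ∧ (S b ∧ G w b)) ⟧) ≤ (x + 2) * (x + 2) * (d * suc c)
      hr G r e = ≤-trans (≤-reflexive (S4-awzb (λ a b z w → ⟦ Q G a w ∧ (G a z ∧ (S b ∧ G w b)) ⟧)))
        (≤-trans (S4≤ (Q G) (λ a w z b → G a z ∧ (S b ∧ G w b)) (d * suc c) (λ a w q → ≤-reflexive
            (trans (E2-fac (G a) (λ _ b → S b ∧ G w b) (suc c) (λ _ _ → =b-t (∧-r {a = not (degIn G a =b c) ∧ not (degIn G w =b c)} q)))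
               (cong (_* suc c) (deg r a)))))
          (*-monoˡ-≤ (d * suc c) (≤-trans (E2-mono {g = λ a w → not (degIn G a =b c) ∧ not (degIn G w =b c)} (λ a w q → ∧-l q))
             (≤-trans (≤-reflexive (E2-fac (λ a → not (degIn G a =b c)) (λ _ w → not (degIn G w =b c)) (off G) (λ _ _ → refl)))
               (*-mono-≤ {off G} {x + 2} {off G} {x + 2} (≤b-t e) (≤b-t e))))))

    off-tail : ∀ q k x → α + # S + (x + k * 2) ≤ n → 0 < α * c * m →
      q * ((x + k * 2) * (x + k * 2) * (d * suc c)) ≤ α * c * m →
      cnt d (λ G → off G ≤b x) * q ^ k ≤ cnt {n} d (λ _ → true)
    off-tail q zero x _ pos h = ≤-trans (≤-reflexive (*-identityʳ _)) (cnt≤N _)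
    off-tail q (suc k) x hx pos h = geo {cnt d (λ G → off G ≤b x)} {cnt d (λ G → off G ≤b x + 2)} q k
      (ratio {cnt d (λ G → off G ≤b x)} q (off-step x (≤-trans (+-monoʳ-≤ (α + # S) (m≤m+n x _)) hx))
         (≤-trans (*-monoʳ-≤ q (*-monoˡ-≤ (d * suc c) (*-mono-≤ l l))) h) pos)
      (off-tail q k (x + 2) (subst (λ y → α + # S + y ≤ n) (sym (+-assoc x 2 (k * 2))) hx) pos
        (subst (λ y → q * (y * y * (d * suc c)) ≤ α * c * m) (sym (+-assoc x 2 (k * 2))) h))
      where
      l : x + 2 ≤ x + suc k * 2
      l = +-monoʳ-≤ x (m≤m+n 2 (k * 2))

-- Sums of counts over families of events.

cnt-sum≤ : (xs : List 𝕀) (P : 𝕀 → Gr n → Bool) (Q : Gr n → Bool) → (∀ G → Q G ≡ false → ∀ x → P x G ≡ false) →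
  (∀ G → S xs (λ x → ⟦ P x G ⟧) ≤ 1) → S xs (λ x → cnt d (P x)) ≤ cnt d Q
cnt-sum≤ {n = n} {d} xs P Q h0 h = ≤-trans (≤-reflexive (trans (S-cong xs λ x → cnt-def (P x)) (S-swap xs (allMatrices n) _)))
  (≤-trans (S-mono (allMatrices n) pt) (≤-reflexive (sym (cnt-def Q))))
  where
  pt : ∀ M → S xs (λ x → ⟦ isRegular d M ∧ P x (adj M) ⟧) ≤ ⟦ isRegular d M ∧ Q (adj M) ⟧
  pt M with isRegular d M | Q (adj M) in e
  ... | false | _ = ≤-reflexive (S-0 xs)
  ... | true | true = h (adj M)
  ... | true | false = ≤-reflexive (trans (S-cong xs λ x → cong ⟦_⟧ (h0 (adj M) e x)) (S-0 xs))

cnt-sum≥ : (xs : List 𝕀) (P : 𝕀 → Gr n → Bool) (Q : Gr n → Bool) →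
  (∀ G → IsReg d G → Q G ≡ true → 1 ≤ S xs (λ x → ⟦ P x G ⟧)) → cnt d Q ≤ S xs (λ x → cnt d (P x))
cnt-sum≥ {n = n} {d} xs P Q h = ≤-trans (≤-reflexive (cnt-def Q)) (≤-trans (S-mono (allMatrices n) pt)
    (≤-reflexive (trans (S-swap (allMatrices n) xs _) (sym (S-cong xs λ x → cnt-def (P x))))))
  where
  pt : ∀ M → ⟦ isRegular d M ∧ Q (adj M) ⟧ ≤ S xs (λ x → ⟦ isRegular d M ∧ P x (adj M) ⟧)
  pt M with isRegular d M in r | Q (adj M) in e
  ... | false | _ = z≤n
  ... | true | false = z≤n
  ... | true | true = h (adj M) (isRegular-t {M = M} r) e

cnt-∨ : (P Q R : Gr n → Bool) → (∀ G → IsReg d G → R G ≡ true → P G ∨ Q G ≡ true) → cnt d R ≤ cnt d P + cnt d Q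
cnt-∨ {d = d} P Q R h = ≤-trans (cnt-sum≥ (true ∷ false ∷ []) (λ b → if b then P else Q) R k) (≤-reflexive (S-bool _))
  where
  k : ∀ G → IsReg d G → R G ≡ true → 1 ≤ S (true ∷ false ∷ []) (λ b → ⟦ (if b then P else Q) G ⟧)
  k G r e = ≤-trans (≤-trans (≤-reflexive (cong ⟦_⟧ (sym (h G r e)))) (⟦∨⟧≤ (P G) (Q G))) (≤-reflexive (sym (S-bool _)))

uniq≤1 : {f : Fin n → Bool} → (∀ x y → f x ≡ true → f y ≡ true → x ≡ y) → # f ≤ 1
uniq≤1 {f = f} h with 1 ≤? # f
... | no k = ≤-trans (≮⇒≥ k) z≤n
... | yes k = let (a , e) = #-pos {f = f} k in
  ≤-trans (#-mono {g = λ x → eqF x a} λ x e' → eqF-i (h x a e' e)) (≤-reflexive (#-eq a))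

S-prod : ∀ {X Y : Set} (E : Enum X) (F : Enum Y) (f : X × Y → ℕ) → S (els (enumProd E F)) f ≡ S (els E) (λ a → S (els F) (λ b → f (a , b)))
S-prod E F f = trans (S-concatMap (λ a → map (a ,_) (els F)) (els E) f) (S-cong (els E) λ a → S-map (a ,_) (els F) f)

cnt-0 : (P : Gr n → Bool) → (∀ G → P G ≡ false) → cnt d P ≡ 0
cnt-0 P h = n≤0⇒n≡0 (≤-trans (cnt-sum≥ {𝕀 = ⊥} [] (λ ()) P (λ G _ e → ⊥-elim (t≢f e (h G)))) (≤-reflexive (S-[] _)))

-- Trading neighbours of two vertices.

pt-change : (f f' : Fin n → Bool) (b : Fin n) → f b ≡ true → f' b ≡ false → (∀ x → x ≢ b → f' x ≡ f x) → # f' + 1 ≡ # f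
pt-change {n} f f' b h h' o = trans (cong (# f' +_) (sym (#-eq b))) (trans (sym (S-+ (fins n) _ _)) (S-cong (fins n) pt))
  where
  pt : ∀ x → ⟦ f' x ⟧ + ⟦ eqF x b ⟧ ≡ ⟦ f x ⟧
  pt x with x Fin.≟ b
  ... | yes refl rewrite h | h' = refl
  ... | no k rewrite o x k = +-identityʳ _

-- The private neighbours of p in X, not shared with q: only these can be traded from p to q.
mx : (Fin n → Bool) → Fin n → Fin n → Gr n → ℕ
mx X p q G = # (λ x → X x ∧ (G p x ∧ not (G q x)))

-- Trading a neighbour of u in A for a neighbour of v in B raises the imbalance α₂ − α₁ of the A-degrees by 2, with
-- almost exactly as many switchings forth as back.  So the imbalances 0, 2, …, 2(K − 1) are about equally likely,
-- and equal A-degrees have probability at most 2/K.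
module Exchange (A B : Fin n → Bool) (dis : ∀ x → A x ≡ true → B x ≡ true → ⊥)
    (C : Gr n → Bool) (K : ℕ) (u v : Fin n) (uB : B u ≡ false) (vA : A v ≡ false)
    (inv : ∀ G G' b z → IsReg d G → A b ≡ true → B z ≡ true → Switching G G' u b z v → C G ≡ true → C G' ≡ true) where
  -- Of `J` = 2K levels the first K keep half of the weight. `L` ensures (2j + 1)(2J + 1) ≤ s + 1 at
  -- each level j < `J`, where s + 1 counts the tradable neighbours; this is 4J² + 3J ≤ 7J² in
  -- `ratio-arith`.
  J L : ℕ
  J = K + K
  L = 7 * (J * J)

  α₁ α₂ β₁ β₂ : Gr n → ℕ
  α₁ = mx A u v
  α₂ = mx A v u
  β₁ = mx B u v
  β₂ = mx B v u

  -- Level j is what j trades reach: each takes one from `α₁` and `β₂` and adds one to `α₂` and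
  -- `β₁`, so the imbalances shift by 2j and the thresholds by j. The bound on `β₁` caps the number
  -- of trades back.
  D : ℕ → Gr n → Bool
  D j G = C G ∧ ((α₂ G =b α₁ G + (j + j)) ∧ ((L ≤b α₁ G + j) ∧ ((L ≤b β₂ G + j) ∧ (β₁ G ≤b β₂ G + (j + j)))))

  -- With `α₁` and `β₂` fixed, the number of trades forward is exactly their product. Fibres of
  -- level j go to fibres of level j + 1 with both indices lowered by one, so summing over fibres
  -- loses nothing.
  Dk : ℕ → ℕ → ℕ → Gr n → Bool
  Dk j s t G = D j G ∧ ((α₁ G =b s) ∧ (β₂ G =b t))

  private
    module _ (j : ℕ) {G : Gr n} (e : D j G ≡ true) where
      dC = ∧-l {C G} e
      d1 = ∧-r {a = C G} e
      d2 = ∧-r {a = α₂ G =b α₁ G + (j + j)} d1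
      d3 = ∧-r {a = L ≤b α₁ G + j} d2
      D-α = =b-t (∧-l d1)
      D-L = ≤b-t (∧-l d2)
      D-M = ≤b-t (∧-l d3)
      D-β = ≤b-t (∧-r {a = L ≤b β₂ G + j} d3)

    pA pB : Gr n → Fin n → Fin n → Fin n → Bool
    pA G p q b = A b ∧ (G p b ∧ not (G q b))
    pB G p q b = B b ∧ (G p b ∧ not (G q b))

    P R : Gr n → Fin n → Fin n → Fin n → Fin n → Bool
    P G a b z w = (eqF a u ∧ pA G u v b) ∧ (eqF w v ∧ pB G v u z)
    R G a b z w = (eqF a u ∧ pA G v u b) ∧ (eqF w v ∧ pB G u v z)

    count : (f g : Fin n → Bool) → S4 (λ a b z w → ⟦ (eqF a u ∧ f b) ∧ (eqF w v ∧ g z) ⟧) ≡ # f * # g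
    count f g = ≤-antisym
        (≤-trans (S4≤ (λ a b → eqF a u ∧ f b) (λ _ _ z w → eqF w v ∧ g z) (# g) (λ _ _ _ → ≤-reflexive i)) (≤-reflexive (cong (_* # g) o)))
        (≤-trans (≤-reflexive (cong (_* # g) (sym o))) (S4≥ (λ a b → eqF a u ∧ f b) (λ _ _ z w → eqF w v ∧ g z) (# g) (λ _ _ _ → ≤-reflexive (sym i))))
      where
      o : E2 (λ a b → eqF a u ∧ f b) ≡ # f
      o = trans (E2-fac (λ a → eqF a u) (λ _ → f) (# f) (λ _ _ → refl)) (trans (cong (_* # f) (#-eq u)) (*-identityˡ _))
      i : E2 (λ z w → eqF w v ∧ g z) ≡ # g
      i = trans (E2-swap _) (trans (E2-fac (λ w → eqF w v) (λ _ → g) (# g) (λ _ _ → refl)) (trans (cong (_* # g) (#-eq v)) (*-identityˡ _)))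

    step-k : ∀ j s t → cnt d (Dk j (suc s) (suc t)) * (suc s * suc t) ≤
      cnt d (Dk (suc j) s t) * ((s + (suc j + suc j)) * (t + (suc j + suc j)))
    step-k j s t = double-count (Dk j (suc s) (suc t)) (Dk (suc j) s t) (suc s * suc t) ((s + (suc j + suc j)) * (t + (suc j + suc j))) P R
      (λ G r e → ≤-reflexive (sym (trans (count (pA G u v) (pB G v u))
        (cong₂ _*_ (=b-t (∧-l (∧-r {a = D j G} e))) (=b-t (∧-r {a = α₁ G =b suc s} (∧-r {a = D j G} e)))))))
      hv
      hs
      (λ G r e → ≤-trans (≤-reflexive (count (pA G v u) (pB G u v)))
         (*-mono-≤ (≤-reflexive (trans (D-α (suc j) (∧-l e)) (cong (_+ (suc j + suc j)) (=b-t (∧-l (∧-r {a = D (suc j) G} e))))))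
           (≤-trans (D-β (suc j) (∧-l e)) (≤-reflexive (cong (_+ (suc j + suc j)) (=b-t (∧-r {a = α₁ G =b s} (∧-r {a = D (suc j) G} e))))))))
      where
      module _ {G : Gr n} {a b z w : Fin n} (p : P G a b z w ≡ true) where
        pa = ∧-r {a = eqF a u} (∧-l {eqF a u ∧ pA G u v b} p)
        pb = ∧-r {a = eqF w v} (∧-r {a = eqF a u ∧ pA G u v b} p)
        P-a : a ≡ u
        P-a = eqF-t (∧-l (∧-l {eqF a u ∧ pA G u v b} p))
        P-w : w ≡ v
        P-w = eqF-t (∧-l (∧-r {a = eqF a u ∧ pA G u v b} p))
        P-Ab = ∧-l {A b} pa
        P-Bz = ∧-l {B z} pb
        P-ub = ∧-l {G u b} (∧-r {a = A b} pa)
        P-vb = not-t (∧-r {a = G u b} (∧-r {a = A b} pa))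
        P-vz = ∧-l {G v z} (∧-r {a = B z} pb)
        P-uz = not-t (∧-r {a = G v z} (∧-r {a = B z} pb))
      hv : ∀ G a b z w → IsReg d G → Dk j (suc s) (suc t) G ≡ true → P G a b z w ≡ true → Switchable G a b z w
      hv G a b z w r e p with P-a {G} {a} {b} {z} {w} p | P-w {G} {a} {b} {z} {w} p
      ... | refl | refl = switchable (P-ub {G} {u} {b} {z} {v} p) (trans (symm r z v) (P-vz {G} {u} {b} {z} {v} p)) (P-uz {G} {u} {b} {z} {v} p)
        (trans (symm r b v) (P-vb {G} {u} {b} {z} {v} p))
        (λ q → t≢f (P-Bz {G} {u} {b} {z} {v} p) (subst (λ y → B y ≡ false) q uB)) (λ q → t≢f (P-Ab {G} {u} {b} {z} {v} p) (subst (λ y → A y ≡ false) (sym q) vA))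
      hs : ∀ G G' a b z w → IsReg d G → IsReg d G' → Dk j (suc s) (suc t) G ≡ true → P G a b z w ≡ true → Switching G G' a b z w →
        (Dk (suc j) s t G' ≡ true) × (R G' a b z w ≡ true)
      hs G G' a b z w r r' e p sw0 with P-a {G} {a} {b} {z} {w} p | P-w {G} {a} {b} {z} {w} p
      ... | refl | refl =
          ∧-i (∧-i (inv G G' b z r Ab Bz sw0 (dC j eD)) (∧-i (=b-i α-eq) (∧-i (≤b-i L1) (∧-i (≤b-i L2) (≤b-i β≤)))))
              (∧-i (=b-i as) (=b-i bt)) ,
          ∧-i (∧-i (eqF-r u) (∧-i Ab (∧-i (Row.q∈' (Switching.rw sw0)) (not-f (Row.p∉' (Switching.ra sw0))))))
              (∧-i (eqF-r v) (∧-i Bz (∧-i (Row.q∈' (Switching.ra sw0)) (not-f (Row.p∉' (Switching.rw sw0))))))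
        where
        eD = ∧-l {D j G} e
        Ab = P-Ab {G} {u} {b} {z} {v} p
        Bz = P-Bz {G} {u} {b} {z} {v} p
        Az : A z ≡ false
        Az = ¬t→f (λ q → dis z q Bz)
        Bb : B b ≡ false
        Bb = ¬t→f (λ q → dis b Ab q)
        Eq : (Y : Fin n → Bool) (c o : Fin n) → Y o ≡ false → (∀ x → x ≢ c → x ≢ o → G' u x ≡ G u x) → (∀ x → x ≢ c → x ≢ o → G' v x ≡ G v x) →
          (∀ x → x ≢ c → (Y x ∧ (G' u x ∧ not (G' v x)) ≡ Y x ∧ (G u x ∧ not (G v x))) × (Y x ∧ (G' v x ∧ not (G' u x)) ≡ Y x ∧ (G v x ∧ not (G u x))))
        Eq Y c o yo h1 h2 x k with x Fin.≟ o
        ... | yes refl rewrite yo = refl , refl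
        ... | no k' rewrite h1 x k k' | h2 x k k' = refl , refl
        ru = Row.oth (Switching.ra sw0)
        rv = λ x k k' → Row.oth (Switching.rw sw0) x k k'
        a1 : α₁ G' + 1 ≡ α₁ G
        a1 = pt-change _ _ b (∧-i Ab (∧-i (P-ub {G} {u} {b} {z} {v} p) (not-f (P-vb {G} {u} {b} {z} {v} p))))
               (¬t→f λ q → t≢f (∧-l (∧-r {a = A b} q)) (Row.p∉' (Switching.ra sw0)))
               (λ x k → proj₁ (Eq A b z Az (λ x k k' → ru x k k') (λ x k k' → rv x k' k) x k))
        a2 : α₂ G + 1 ≡ α₂ G'
        a2 = pt-change _ _ b (∧-i Ab (∧-i (Row.q∈' (Switching.rw sw0)) (not-f (Row.p∉' (Switching.ra sw0)))))
               (¬t→f λ q → t≢f (∧-l (∧-r {a = A b} q)) (P-vb {G} {u} {b} {z} {v} p))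
               (λ x k → sym (proj₂ (Eq A b z Az (λ x k k' → ru x k k') (λ x k k' → rv x k' k) x k)))
        b1 : β₁ G + 1 ≡ β₁ G'
        b1 = pt-change _ _ z (∧-i Bz (∧-i (Row.q∈' (Switching.ra sw0)) (not-f (Row.p∉' (Switching.rw sw0)))))
               (¬t→f λ q → t≢f (∧-l (∧-r {a = B z} q)) (P-uz {G} {u} {b} {z} {v} p))
               (λ x k → sym (proj₁ (Eq B z b Bb (λ x k k' → ru x k' k) (λ x k k' → rv x k k') x k)))
        b2 : β₂ G' + 1 ≡ β₂ G
        b2 = pt-change _ _ z (∧-i Bz (∧-i (P-vz {G} {u} {b} {z} {v} p) (not-f (P-uz {G} {u} {b} {z} {v} p))))
               (¬t→f λ q → t≢f (∧-l (∧-r {a = B z} q)) (Row.p∉' (Switching.rw sw0)))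
               (λ x k → proj₂ (Eq B z b Bb (λ x k k' → ru x k' k) (λ x k k' → rv x k k') x k))
        l1 : ∀ x j → x + 1 + (j + j) + 1 ≡ x + (suc j + suc j)
        l1 = solve-∀
        l2 : ∀ x j → x + 1 + j ≡ x + suc j
        l2 = solve-∀
        α-eq : α₂ G' ≡ α₁ G' + (suc j + suc j)
        α-eq = trans (sym a2) (trans (cong (_+ 1) (trans (D-α j eD) (cong (_+ (j + j)) (sym a1)))) (l1 (α₁ G') j))
        L1 : L ≤ α₁ G' + suc j
        L1 = ≤-trans (D-L j eD) (≤-reflexive (trans (cong (_+ j) (sym a1)) (l2 _ j)))
        L2 : L ≤ β₂ G' + suc j
        L2 = ≤-trans (D-M j eD) (≤-reflexive (trans (cong (_+ j) (sym b2)) (l2 _ j)))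
        β≤ : β₁ G' ≤ β₂ G' + (suc j + suc j)
        β≤ = ≤-trans (≤-reflexive (sym b1)) (≤-trans (+-monoˡ-≤ 1 (≤-trans (D-β j eD) (≤-reflexive (cong (_+ (j + j)) (sym b2))))) (≤-reflexive (l1 _ j)))
        as : α₁ G' ≡ s
        as = +-cancelʳ-≡ 1 _ _ (trans a1 (trans (=b-t (∧-l (∧-r {a = D j G} e))) (+-comm 1 s)))
        bt : β₂ G' ≡ t
        bt = +-cancelʳ-≡ 1 _ _ (trans b2 (trans (=b-t (∧-r {a = α₁ G =b suc s} (∧-r {a = D j G} e))) (+-comm 1 t)))

    ratio-arith : ∀ j s → suc j ≤ J → L ≤ suc s + j → (s + (suc j + suc j)) * (2 * J + 1) ≤ suc s * (2 * J + 2)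
    ratio-arith j s hj hL = ≤-trans (≤-reflexive (l1 s j J)) (≤-trans (+-monoʳ-≤ (suc s * (2 * J + 1)) h) (≤-reflexive (l2 s J)))
      where
      l1 : ∀ s j J → (s + (suc j + suc j)) * (2 * J + 1) ≡ suc s * (2 * J + 1) + (2 * j + 1) * (2 * J + 1)
      l1 = solve-∀
      l2 : ∀ s J → suc s * (2 * J + 1) + suc s ≡ suc s * (2 * J + 2)
      l2 = solve-∀
      JJ : J ≤ J * J
      JJ = ≤-trans (≤-reflexive (sym (*-identityʳ J))) (*-monoʳ-≤ J (≤-trans (s≤s z≤n) hj))
      l3 : ∀ j → suc (2 * j + 1) ≡ 2 * suc j
      l3 = solve-∀
      h : (2 * j + 1) * (2 * J + 1) ≤ suc s
      h = +-cancelʳ-≤ j _ _ (begin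
        (2 * j + 1) * (2 * J + 1) + j ≤⟨ +-mono-≤ (*-monoˡ-≤ (2 * J + 1) (≤-trans (n≤1+n _) (≤-trans (≤-reflexive (l3 j)) (*-monoʳ-≤ 2 hj))))
            (≤-trans (n≤1+n j) hj) ⟩
        2 * J * (2 * J + 1) + J ≡⟨ l5 J ⟩
        4 * (J * J) + 3 * J ≤⟨ +-monoʳ-≤ (4 * (J * J)) (*-monoʳ-≤ 3 JJ) ⟩
        4 * (J * J) + 3 * (J * J) ≡⟨ l6 (J * J) ⟩
        L ≤⟨ hL ⟩
        suc s + j ∎)
        where
        open ≤-Reasoning
        l5 : ∀ J → 2 * J * (2 * J + 1) + J ≡ 4 * (J * J) + 3 * J
        l5 = solve-∀
        l6 : ∀ J → 4 * J + 3 * J ≡ 7 * J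
        l6 = solve-∀

    -- Each of the two factors loses at most (2J + 2)/(2J + 1), and 4J(J + 1) + 1 = (2J + 1)² bounds
    -- the product of the losses by (J + 1)/J. If s or t is below the threshold, the fibre is empty.
    fiber : ∀ j s t → suc j ≤ J → cnt d (Dk j (suc s) (suc t)) * J ≤ cnt d (Dk (suc j) s t) * suc J
    fiber j s t hj with L ≤? suc s + j | L ≤? suc t + j
    ... | no k | _ = ≤-trans (≤-reflexive (cong (_* J) (cnt-0 {d = d} (Dk j (suc s) (suc t)) λ G → ¬t→f λ e →
            k (≤-trans (D-L j (∧-l {D j G} e)) (≤-reflexive (cong (_+ j) (=b-t (∧-l (∧-r {a = D j G} e))))))))) z≤n
    ... | yes _ | no k = ≤-trans (≤-reflexive (cong (_* J) (cnt-0 {d = d} (Dk j (suc s) (suc t)) λ G → ¬t→f λ e →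
            k (≤-trans (D-M j (∧-l {D j G} e)) (≤-reflexive (cong (_+ j) (=b-t (∧-r {a = α₁ G =b suc s} (∧-r {a = D j G} e))))))))) z≤n
    ... | yes p | yes q = *-cancelʳ-≤ (X * J) (Y * suc J) (f * ((2 * J + 1) * (2 * J + 1))) {{nz}} (begin
        X * J * (f * ((2 * J + 1) * (2 * J + 1))) ≡⟨ l1 X J f (2 * J + 1) ⟩
        X * f * (J * ((2 * J + 1) * (2 * J + 1))) ≤⟨ *-monoˡ-≤ (J * ((2 * J + 1) * (2 * J + 1))) (step-k j s t) ⟩
        Y * (s' * t') * (J * ((2 * J + 1) * (2 * J + 1))) ≡⟨ l2 Y s' t' J (2 * J + 1) ⟩
        Y * J * ((s' * (2 * J + 1)) * (t' * (2 * J + 1))) ≤⟨ *-monoʳ-≤ (Y * J) (*-mono-≤ (ratio-arith j s hj p) (ratio-arith j t hj q)) ⟩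
        Y * J * ((suc s * (2 * J + 2)) * (suc t * (2 * J + 2))) ≡⟨ l3 Y J (suc s) (suc t) ⟩
        Y * f * (4 * (J * suc J) * suc J) ≤⟨ *-monoʳ-≤ (Y * f) (*-monoˡ-≤ (suc J) (≤-trans (n≤1+n _) (≤-reflexive (l4 J)))) ⟩
        Y * f * ((2 * J + 1) * (2 * J + 1) * suc J) ≡⟨ l5 Y f ((2 * J + 1) * (2 * J + 1)) (suc J) ⟩
        Y * suc J * (f * ((2 * J + 1) * (2 * J + 1))) ∎)
      where
      open ≤-Reasoning
      X = cnt d (Dk j (suc s) (suc t))
      Y = cnt d (Dk (suc j) s t)
      f = suc s * suc t
      s' = s + (suc j + suc j)
      t' = t + (suc j + suc j)
      nz : NonZero (f * ((2 * J + 1) * (2 * J + 1)))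
      nz = >-nonZero (*-mono-≤ {1} {f} {1} (s≤s z≤n) (*-mono-≤ {1} {2 * J + 1} {1} (m≤n+m 1 (2 * J)) (m≤n+m 1 (2 * J))))
      l1 : ∀ X J f q → X * J * (f * (q * q)) ≡ X * f * (J * (q * q))
      l1 = solve-∀
      l2 : ∀ Y s t J q → Y * (s * t) * (J * (q * q)) ≡ Y * J * ((s * q) * (t * q))
      l2 = solve-∀
      l3 : ∀ Y J s t → Y * J * ((s * (2 * J + 2)) * (t * (2 * J + 2))) ≡ Y * (s * t) * (4 * (J * suc J) * suc J)
      l3 = solve-∀
      l4 : ∀ J → suc (4 * (J * suc J)) ≡ (2 * J + 1) * (2 * J + 1)
      l4 = solve-∀
      l5 : ∀ Y f q c → Y * f * (q * c) ≡ Y * c * (f * q)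
      l5 = solve-∀

    XS : Enum (Fin (suc n) × Fin (suc n))
    XS = enumProd (enumFin (suc n)) (enumFin (suc n))

    level : ∀ j → suc j ≤ J → cnt d (D j) * J ≤ cnt d (D (suc j)) * suc J
    level j hj = ≤-trans (*-monoˡ-≤ J (cnt-sum≥ (els XS) (λ x → Dk j (suc (toℕ (proj₁ x))) (suc (toℕ (proj₂ x)))) (D j) big))
      (≤-trans (≤-reflexive (sym (S-*ʳ (els XS) J _)))
      (≤-trans (S-mono (els XS) (λ x → fiber j (toℕ (proj₁ x)) (toℕ (proj₂ x)) hj))
      (≤-trans (≤-reflexive (S-*ʳ (els XS) (suc J) _))
        (*-monoˡ-≤ (suc J) (cnt-sum≤ (els XS) (λ x → Dk (suc j) (toℕ (proj₁ x)) (toℕ (proj₂ x))) (D (suc j))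
          (λ G e x → cong (λ b → b ∧ ((α₁ G =b toℕ (proj₁ x)) ∧ (β₂ G =b toℕ (proj₂ x)))) e) small)))))
      where
      -- The threshold exceeds j, so `α₁` and `β₂` are positive on level j and every graph of the
      -- level lies in a fibre with successor indices.
      J<L : suc j ≤ L
      J<L = ≤-trans hj (≤-trans (≤-reflexive (sym (*-identityʳ J))) (≤-trans (*-monoʳ-≤ J (≤-trans (s≤s z≤n) hj)) (m≤m+n _ _)))
      pos : ∀ x → L ≤ x + j → 1 ≤ x
      pos x h = +-cancelʳ-≤ j 1 x (≤-trans J<L h)
      big : ∀ G → IsReg d G → D j G ≡ true → 1 ≤ S (els XS) (λ x → ⟦ Dk j (suc (toℕ (proj₁ x))) (suc (toℕ (proj₂ x))) G ⟧)
      big G r e = ≤-trans (≤-reflexive (sym (cong ⟦_⟧ (∧-i e (∧-i (=b-i (trans es (cong suc (sym (Finₚ.toℕ-fromℕ< hs')))))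
          (=b-i (trans et (cong suc (sym (Finₚ.toℕ-fromℕ< ht'))))))))))
          (S-term XS (λ x → ⟦ Dk j (suc (toℕ (proj₁ x))) (suc (toℕ (proj₂ x))) G ⟧) (fromℕ< hs' , fromℕ< ht'))
        where
        prd : ∀ {x} → 1 ≤ x → ∃ λ y → x ≡ suc y
        prd (s≤s {n = y} _) = y , refl
        ps = prd (pos _ (D-L j e))
        pt = prd (pos _ (D-M j e))
        es : α₁ G ≡ suc (proj₁ ps)
        es = proj₂ ps
        et : β₂ G ≡ suc (proj₁ pt)
        et = proj₂ pt
        hs' : proj₁ ps < suc n
        hs' = ≤-trans (≤-trans (≤-reflexive (sym es)) (#≤n (pA G u v))) (n≤1+n n)
        ht' : proj₁ pt < suc n
        ht' = ≤-trans (≤-trans (≤-reflexive (sym et)) (#≤n (pB G v u))) (n≤1+n n)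
      small : ∀ G → S (els XS) (λ x → ⟦ Dk (suc j) (toℕ (proj₁ x)) (toℕ (proj₂ x)) G ⟧) ≤ 1
      small G = ≤-trans (S-mono (els XS) {g = λ x → ⟦ (α₁ G =b toℕ (proj₁ x)) ∧ (β₂ G =b toℕ (proj₂ x)) ⟧} (λ x → ⟦⟧-mono (∧-r {a = D (suc j) G})))
        (≤-trans (≤-reflexive (S-prod (enumFin (suc n)) (enumFin (suc n)) _))
        (≤-trans (E2-fac≤ {suc n} (λ s → α₁ G =b toℕ s) (λ _ t → β₂ G =b toℕ t) 1 (λ _ _ → uniq≤1 (λ x y p q → Finₚ.toℕ-injective (trans (sym (=b-t p)) (=b-t q)))))
          (≤-trans (≤-reflexive (*-identityʳ _)) (uniq≤1 (λ x y p q → Finₚ.toℕ-injective (trans (sym (=b-t p)) (=b-t q)))))))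

    -- The losses (J + 1)/J of j levels compound to at most (J + 1)/(J + 1 - j), where r stands for
    -- J + 1 - j.
    decay : ∀ j r → j ≤ J → j + r ≡ suc J → cnt d (D 0) * r ≤ cnt d (D j) * suc J
    decay zero r _ refl = ≤-refl
    decay (suc j) r hj e = *-cancelʳ-≤ _ _ (suc J) (begin
        X * r * suc J ≤⟨ ≤-reflexive (*-assoc X r (suc J)) ⟩
        X * (r * suc J) ≤⟨ *-monoʳ-≤ X (≤-trans (≤-reflexive (*-suc r J)) (+-monoˡ-≤ (r * J) r≤J)) ⟩
        X * (suc r * J) ≡⟨ sym (*-assoc X (suc r) J) ⟩
        X * suc r * J ≤⟨ *-monoˡ-≤ J (decay j (suc r) (≤-trans (n≤1+n j) hj) (trans (+-suc j r) e)) ⟩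
        cnt d (D j) * suc J * J ≡⟨ l (cnt d (D j)) (suc J) J ⟩
        cnt d (D j) * J * suc J ≤⟨ *-monoˡ-≤ (suc J) (level j hj) ⟩
        cnt d (D (suc j)) * suc J * suc J ∎)
      where
      open ≤-Reasoning
      X = cnt d (D 0)
      l : ∀ a b c → a * b * c ≡ a * c * b
      l = solve-∀
      r≤J : r ≤ J
      r≤J = ≤-trans (m≤n+m r j) (≤-reflexive (suc-injective e))

    -- For j ≤ K the compounded loss is at most (2K + 1)/(K + 1) < 2.
    half : ∀ j → j ≤ K → cnt d (D 0) ≤ 2 * cnt d (D j)
    half j hj = *-cancelʳ-≤ _ _ (suc K) (begin
        X * suc K ≤⟨ *-monoʳ-≤ X (m≤m+n (suc K) (K ∸ j)) ⟩
        X * (suc K + (K ∸ j)) ≤⟨ decay j _ (≤-trans hj (m≤m+n K K)) (trans (l1 j K (K ∸ j)) (cong (λ y → suc (K + y)) (m+[n∸m]≡n hj))) ⟩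
        cnt d (D j) * suc J ≤⟨ *-monoʳ-≤ (cnt d (D j)) (≤-trans (n≤1+n _) (≤-reflexive (l2 K))) ⟩
        cnt d (D j) * (2 * suc K) ≡⟨ l3 (cnt d (D j)) (suc K) ⟩
        2 * cnt d (D j) * suc K ∎)
      where
      open ≤-Reasoning
      X = cnt d (D 0)
      l1 : ∀ j K y → j + (suc K + y) ≡ suc (K + (j + y))
      l1 = solve-∀
      l2 : ∀ K → suc (suc (K + K)) ≡ 2 * suc K
      l2 = solve-∀
      l3 : ∀ a b → a * (2 * b) ≡ 2 * a * b
      l3 = solve-∀

  -- The levels 0, ..., K - 1 are disjoint parts of C, as the imbalance determines the level, and
  -- each has at least half the weight of level 0.
  exchange : cnt d (D 0) * K ≤ 2 * cnt d C
  exchange = begin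
      X * K ≡⟨ *-comm X K ⟩
      K * X ≡⟨ sym (trans (S-const (fins K) X) (cong (_* X) (length-fins K))) ⟩
      S (fins K) (λ _ → X) ≤⟨ S-mono (fins K) (λ j → half (toℕ j) (<⇒≤ (Finₚ.toℕ<n j))) ⟩
      S (fins K) (λ j → 2 * cnt d (D (toℕ j))) ≡⟨ S-* (fins K) 2 _ ⟩
      2 * S (fins K) (λ j → cnt d (D (toℕ j))) ≤⟨ *-monoʳ-≤ 2 (cnt-sum≤ (fins K) (λ j → D (toℕ j)) C
         (λ G e j → ¬t→f (λ q → t≢f (dC (toℕ j) q) e)) (λ G → uniq≤1 (uniq G))) ⟩
      2 * cnt d C ∎
    where
    open ≤-Reasoning
    X = cnt d (D 0)
    dbl : ∀ x y → x + x ≡ y + y → x ≡ y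
    dbl x y e = *-cancelˡ-≡ x y 2 (trans (cong (x +_) (+-identityʳ x)) (trans e (cong (y +_) (sym (+-identityʳ y)))))
    uniq : ∀ G (x y : Fin K) → D (toℕ x) G ≡ true → D (toℕ y) G ≡ true → x ≡ y
    uniq G x y p q = Finₚ.toℕ-injective (dbl _ _ (+-cancelˡ-≡ (α₁ G) _ _ (trans (sym (D-α (toℕ x) p)) (D-α (toℕ y) q))))

-- Many coincidences at once.

module Pairs {g : ℕ} (A B : Fin g → Fin n → Bool)
    (disAB : ∀ h h' x → A h x ≡ true → B h' x ≡ true → ⊥)
    (disA : ∀ h h' x → A h x ≡ true → A h' x ≡ true → h ≡ h')
    (disB : ∀ h h' x → B h x ≡ true → B h' x ≡ true → h ≡ h') (q : ℕ) where
  -- The `L` of `Exchange` for K = 4q. A coincidence is covered by two exchanges, according to which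
  -- of u and v has more private neighbours in B; each has relative weight at most 2/(4q), together
  -- 1/q.
  Lq : ℕ
  Lq = 7 * ((4 * q + 4 * q) * (4 * q + 4 * q))

  Cons : Set
  Cons = (Fin n × Fin n) × Fin g

  con : Cons → Gr n → Bool
  con ((u , v) , h) G = (mx (A h) v u G =b mx (A h) u v G) ∧ ((Lq ≤b mx (A h) u v G) ∧ ((Lq ≤b mx (B h) u v G) ∧ (Lq ≤b mx (B h) v u G)))

  Outside : Fin n → Set
  Outside x = ∀ h → (A h x ≡ false) × (B h x ≡ false)

  Ok : Cons → Set
  Ok ((u , v) , h) = Outside u × Outside v

  -- Trades for one constraint leave the other intact: for different groups the traded targets lie
  -- outside the other target sets, and for disjoint pairs the rows of the other pair do not change,
  -- since targets belong to no pair.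
  Sep : Cons → Cons → Set
  Sep ((u , v) , h) ((u' , v') , h') = (h ≢ h') ⊎ ((u ≢ u' × u ≢ v') × (v ≢ u' × v ≢ v'))

  private
    mx-cong : (X : Fin n → Bool) {p q' : Fin n} {G G' : Gr n} → (∀ x → X x ≡ true → G' p x ≡ G p x) → (∀ x → X x ≡ true → G' q' x ≡ G q' x) →
      mx X p q' G' ≡ mx X p q' G
    mx-cong X {p} {q'} {G} {G'} h k = #-cong pt where
      pt : ∀ x → X x ∧ (G' p x ∧ not (G' q' x)) ≡ X x ∧ (G p x ∧ not (G q' x))
      pt x with X x in e
      ... | false = refl
      ... | true = cong₂ (λ a b → a ∧ not b) (h x e) (k x e)

    stable : (h : Fin g) (u v : Fin n) (h' : Fin g) (x : Fin n) (G G' : Gr n) (b z : Fin n) → A h b ≡ true → B h z ≡ true → Switching G G' u b z v →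
      Outside x → (h ≢ h') ⊎ (u ≢ x × v ≢ x) → ∀ y → (A h' y ∨ B h' y) ≡ true → G' x y ≡ G x y
    stable h u v h' x G G' b z Ab Bz s o sp y hy with which s x
    ... | isb refl = ⊥-elim (t≢f Ab (proj₁ (o h)))
    ... | isz refl = ⊥-elim (t≢f Bz (proj₂ (o h)))
    ... | none _ _ _ _ k = k y
    stable h u v h' x G G' b z Ab Bz s o (inj₂ (k , l)) y hy | isa refl = ⊥-elim (k refl)
    stable h u v h' x G G' b z Ab Bz s o (inj₂ (k , l)) y hy | isw refl = ⊥-elim (l refl)
    stable h u v h' x G G' b z Ab Bz s o (inj₁ k) y hy | isa refl = Row.oth (Switching.ra s) y (ne₁ h h' k b Ab y hy) (ne₂ h h' k z Bz y hy)
      where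
      ne₁ : ∀ h h' → h ≢ h' → ∀ b → A h b ≡ true → ∀ y → A h' y ∨ B h' y ≡ true → y ≢ b
      ne₁ h h' k b p y hy refl with ∨-e {A h' y} hy
      ... | inj₁ e = k (disA h h' y p e)
      ... | inj₂ e = disAB h h' y p e
      ne₂ : ∀ h h' → h ≢ h' → ∀ b → B h b ≡ true → ∀ y → A h' y ∨ B h' y ≡ true → y ≢ b
      ne₂ h h' k b p y hy refl with ∨-e {A h' y} hy
      ... | inj₁ e = disAB h' h y e p
      ... | inj₂ e = k (disB h h' y p e)
    stable h u v h' x G G' b z Ab Bz s o (inj₁ k) y hy | isw refl = Row.oth (Switching.rw s) y (ne₂ h h' k z Bz y hy) (ne₁ h h' k b Ab y hy)
      where
      ne₁ : ∀ h h' → h ≢ h' → ∀ b → A h b ≡ true → ∀ y → A h' y ∨ B h' y ≡ true → y ≢ b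
      ne₁ h h' k b p y hy refl with ∨-e {A h' y} hy
      ... | inj₁ e = k (disA h h' y p e)
      ... | inj₂ e = disAB h h' y p e
      ne₂ : ∀ h h' → h ≢ h' → ∀ b → B h b ≡ true → ∀ y → A h' y ∨ B h' y ≡ true → y ≢ b
      ne₂ h h' k b p y hy refl with ∨-e {A h' y} hy
      ... | inj₁ e = disAB h' h y e p
      ... | inj₂ e = k (disB h h' y p e)

    con-inv : (c c' : Cons) → Ok c' → Sep c c' → let ((u , v) , h) = c in (G G' : Gr n) (b z : Fin n) → A h b ≡ true → B h z ≡ true →
      Switching G G' u b z v ⊎ Switching G G' v b z u → con c' G ≡ con c' G'
    con-inv ((u , v) , h) ((u' , v') , h') (ou , ov) sp G G' b z Ab Bz s =
      cong₂ _∧_ (cong₂ _=b_ (eA v' u' fv fu) (eA u' v' fu fv)) (cong₂ _∧_ (cong (Lq ≤b_) (eA u' v' fu fv))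
        (cong₂ _∧_ (cong (Lq ≤b_) (eB u' v' fu fv)) (cong (Lq ≤b_) (eB v' u' fv fu))))
      where
      St : Fin n → Set
      St x = ∀ y → (A h' y ∨ B h' y) ≡ true → G' x y ≡ G x y
      c0 = ((u , v) , h)
      c1' = ((u' , v') , h')
      SwE = Switching G G' u b z v ⊎ Switching G G' v b z u
      fu' : SwE → Sep c0 c1' → St u'
      fu' s sp with s | sp
      ... | inj₁ s | inj₁ k = stable h u v h' u' G G' b z Ab Bz s ou (inj₁ k)
      ... | inj₁ s | inj₂ ((k , _) , (l , _)) = stable h u v h' u' G G' b z Ab Bz s ou (inj₂ (k , l))
      ... | inj₂ s | inj₁ k = stable h v u h' u' G G' b z Ab Bz s ou (inj₁ k)
      ... | inj₂ s | inj₂ ((k , _) , (l , _)) = stable h v u h' u' G G' b z Ab Bz s ou (inj₂ (l , k))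
      fv' : SwE → Sep c0 c1' → St v'
      fv' s sp with s | sp
      ... | inj₁ s | inj₁ k = stable h u v h' v' G G' b z Ab Bz s ov (inj₁ k)
      ... | inj₁ s | inj₂ ((_ , k) , (_ , l)) = stable h u v h' v' G G' b z Ab Bz s ov (inj₂ (k , l))
      ... | inj₂ s | inj₁ k = stable h v u h' v' G G' b z Ab Bz s ov (inj₁ k)
      ... | inj₂ s | inj₂ ((_ , k) , (_ , l)) = stable h v u h' v' G G' b z Ab Bz s ov (inj₂ (l , k))
      fu = fu' s sp
      fv = fv' s sp
      eA : ∀ p q' → St p → St q' → mx (A h') p q' G ≡ mx (A h') p q' G'
      eA p q' sp sq = sym (mx-cong (A h') {p} {q'} {G} {G'} (λ x e → sp x (∨-i₁ e)) (λ x e → sq x (∨-i₁ e)))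
      eB : ∀ p q' → St p → St q' → mx (B h') p q' G ≡ mx (B h') p q' G'
      eB p q' sp sq = sym (mx-cong (B h') {p} {q'} {G} {G'} (λ x e → sp x (∨-i₂ {A h' x} e)) (λ x e → sq x (∨-i₂ {A h' x} e)))

    all-inv : (c : Cons) (cs : List Cons) → All Ok cs → All (Sep c) cs → let ((u , v) , h) = c in (G G' : Gr n) (b z : Fin n) → A h b ≡ true → B h z ≡ true →
      Switching G G' u b z v ⊎ Switching G G' v b z u → all (λ c → con c G) cs ≡ true → all (λ c → con c G') cs ≡ true
    all-inv c [] _ _ G G' b z Ab Bz s e = refl
    all-inv c (c' ∷ cs) (o ∷ os) (p ∷ ps) G G' b z Ab Bz s e =
      ∧-i (trans (sym (con-inv c c' o p G G' b z Ab Bz s)) (∧-l e)) (all-inv c cs os ps G G' b z Ab Bz s (∧-r {a = con c' G} e))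

  -- The remaining constraints are invariant under the trades for c, so their conjunction serves as
  -- the side condition of both exchanges.
  one : (c : Cons) (cs : List Cons) → Ok c → All Ok cs → All (Sep c) cs →
    cnt d (λ G → all (λ c → con c G) (c ∷ cs)) * q ≤ cnt d (λ G → all (λ c → con c G) cs)
  one {d} c@((u , v) , h) cs (ou , ov) oks seps = *-cancelˡ-≤ 4 (begin
      4 * (X * q) ≡⟨ l X q ⟩
      X * (4 * q) ≤⟨ *-monoˡ-≤ (4 * q) (cnt-∨ (E₁.D 0) (E₂.D 0) (λ G → all (λ c → con c G) (c ∷ cs)) split) ⟩
      (cnt d (E₁.D 0) + cnt d (E₂.D 0)) * (4 * q) ≡⟨ *-distribʳ-+ (4 * q) (cnt d (E₁.D 0)) _ ⟩
      cnt d (E₁.D 0) * (4 * q) + cnt d (E₂.D 0) * (4 * q) ≤⟨ +-mono-≤ E₁.exchange E₂.exchange ⟩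
      2 * cnt d C + 2 * cnt d C ≡⟨ l' (cnt d C) ⟩
      4 * cnt d C ∎)
    where
    open ≤-Reasoning
    C : Gr n → Bool
    C G = all (λ c → con c G) cs
    X = cnt d (λ G → all (λ c → con c G) (c ∷ cs))
    l : ∀ a b → 4 * (a * b) ≡ a * (4 * b)
    l = solve-∀
    l' : ∀ a → 2 * a + 2 * a ≡ 4 * a
    l' = solve-∀
    module E₁ = Exchange {n} {d} (A h) (B h) (disAB h h) C (4 * q) u v (proj₂ (ou h)) (proj₁ (ov h))
      (λ G G' b z _ Ab Bz s → all-inv c cs oks seps G G' b z Ab Bz (inj₁ s))
    module E₂ = Exchange {n} {d} (A h) (B h) (disAB h h) C (4 * q) v u (proj₂ (ov h)) (proj₁ (ou h))
      (λ G G' b z _ Ab Bz s → all-inv c cs oks seps G G' b z Ab Bz (inj₂ s))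
    split : ∀ G → IsReg d G → all (λ c → con c G) (c ∷ cs) ≡ true → E₁.D 0 G ∨ E₂.D 0 G ≡ true
    split G r e = go (≤-total b₁ b₂)
      where
      cC = ∧-r {a = con c G} e
      k = ∧-l {con c G} e
      a₁ = mx (A h) u v G
      a₂ = mx (A h) v u G
      b₁ = mx (B h) u v G
      b₂ = mx (B h) v u G
      aa : a₂ ≡ a₁
      aa = =b-t (∧-l k)
      k' = ∧-r {a = a₂ =b a₁} k
      La : Lq ≤ a₁
      La = ≤b-t (∧-l k')
      Lb : Lq ≤ b₁
      Lb = ≤b-t (∧-l (∧-r {a = Lq ≤b a₁} k'))
      Lc : Lq ≤ b₂
      Lc = ≤b-t (∧-r {a = Lq ≤b b₁} (∧-r {a = Lq ≤b a₁} k'))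
      z+ : ∀ {x y} → x ≤ y → x ≤ y + 0
      z+ h = ≤-trans h (m≤m+n _ 0)
      go : b₁ ≤ b₂ ⊎ b₂ ≤ b₁ → E₁.D 0 G ∨ E₂.D 0 G ≡ true
      go (inj₁ p) = ∨-i₁ (∧-i cC (∧-i (=b-i (trans aa (sym (+-identityʳ _)))) (∧-i (≤b-i (z+ La)) (∧-i (≤b-i (z+ Lc)) (≤b-i (z+ p))))))
      go (inj₂ p) = ∨-i₂ {E₁.D 0 G} (∧-i cC (∧-i (=b-i (trans (sym aa) (sym (+-identityʳ _)))) (∧-i (≤b-i (z+ (≤-trans La (≤-reflexive (sym aa)))))
        (∧-i (≤b-i (z+ Lb)) (≤b-i (z+ p))))))

  pairs-bound : (cs : List Cons) → All Ok cs → AllPairs Sep cs →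
    cnt d (λ G → all (λ c → con c G) cs) * q ^ length cs ≤ cnt {n} d (λ _ → true)
  pairs-bound [] _ _ = ≤-reflexive (*-identityʳ _)
  pairs-bound {d} (c ∷ cs) (o ∷ os) (p ∷ ps) = geo {cnt d (λ G → all (λ c → con c G) (c ∷ cs))} q (length cs) (one c cs o os p) (pairs-bound cs os ps)

-- Balls, and vertices that stay outside them.

cntw≤ : (xs : List 𝕀) (P : 𝕀 → Gr n → Bool) (Q : Gr n → Bool) (y : ℕ) → (∀ G → Q G ≡ false → ∀ x → P x G ≡ false) →
  (∀ G → IsReg d G → Q G ≡ true → S xs (λ x → ⟦ P x G ⟧) ≤ y) → S xs (λ x → cnt d (P x)) ≤ cnt d Q * y
cntw≤ {n = n} {d} xs P Q y h0 h = ≤-trans (≤-reflexive (trans (S-cong xs λ x → cnt-def (P x)) (S-swap xs (allMatrices n) _)))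
  (≤-trans (S-mono (allMatrices n) pt) (≤-reflexive (trans (S-*ʳ (allMatrices n) y _) (cong (_* y) (sym (cnt-def Q))))))
  where
  pt : ∀ M → S xs (λ x → ⟦ isRegular d M ∧ P x (adj M) ⟧) ≤ ⟦ isRegular d M ∧ Q (adj M) ⟧ * y
  pt M with isRegular d M in r | Q (adj M) in e
  ... | false | _ = ≤-reflexive (S-0 xs)
  ... | true | true = ≤-trans (h (adj M) (isRegular-t {M = M} r) e) (m≤m+n y 0)
  ... | true | false = ≤-reflexive (trans (S-cong xs λ x → cong ⟦_⟧ (h0 (adj M) e x)) (S-0 xs))

cntw≥ : (xs : List 𝕀) (P : 𝕀 → Gr n → Bool) (Q : Gr n → Bool) (y : ℕ) →
  (∀ G → IsReg d G → Q G ≡ true → y ≤ S xs (λ x → ⟦ P x G ⟧)) → cnt d Q * y ≤ S xs (λ x → cnt d (P x))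
cntw≥ {n = n} {d} xs P Q y h = ≤-trans (≤-reflexive (trans (cong (_* y) (cnt-def Q)) (sym (S-*ʳ (allMatrices n) y _)))) (≤-trans (S-mono (allMatrices n) pt)
    (≤-reflexive (trans (S-swap (allMatrices n) xs _) (sym (S-cong xs λ x → cnt-def (P x))))))
  where
  pt : ∀ M → ⟦ isRegular d M ∧ Q (adj M) ⟧ * y ≤ S xs (λ x → ⟦ isRegular d M ∧ P x (adj M) ⟧)
  pt M with isRegular d M in r | Q (adj M) in e
  ... | false | _ = z≤n
  ... | true | false = z≤n
  ... | true | true = ≤-trans (≤-reflexive (+-identityʳ y)) (h (adj M) (isRegular-t {M = M} r) e)

degTo : (Fin n → Bool) → Gr n → Fin n → ℕ
degTo A G x = # (λ y → A y ∧ G x y)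

grow : Gr n → (Fin n → Bool) → ℕ → Fin n → Bool
grow G A zero x = A x
grow G A (suc i) x = grow G A i x ∨ (1 ≤b degTo (grow G A i) G x)

grow-≤ : (G : Gr n) (A : Fin n → Bool) {i j : ℕ} → i ≤ j → ∀ x → grow G A i x ≡ true → grow G A j x ≡ true
grow-≤ G A {i} {j} h x e with m≤n⇒m<n∨m≡n h
... | inj₂ refl = e
grow-≤ G A {i} {suc j} h x e | inj₁ (s≤s k) = ∨-i₁ (grow-≤ G A k x e)

grow-adj : {G : Gr n} (A : Fin n → Bool) (i : ℕ) {x y : Fin n} → grow G A i y ≡ true → G x y ≡ true → grow G A (suc i) x ≡ true
grow-adj {G = G} A i {x} {y} h e = ∨-i₂ {grow G A i x} (≤b-i (pos-# {f = λ y → grow G A i y ∧ G x y} {y} (∧-i h e)))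

-- The neighbourhoods up to t + 1 are determined by the edges at vertices of the t-th one; symmetry
-- lets such an edge be read from its other end.
grow-stable : {G G' : Gr n} (A : Fin n → Bool) (t : ℕ) → IsReg d G → IsReg d G' →
  (∀ x → grow G A t x ≡ true → ∀ y → G' x y ≡ G x y) → ∀ j → j ≤ suc t → ∀ x → grow G' A j x ≡ grow G A j x
grow-stable A t r r' h zero _ x = refl
grow-stable {G = G} {G'} A t r r' h (suc j) (s≤s hj) x = cong₂ _∨_ (ih x) (cong (1 ≤b_) (#-cong pt))
  where
  ih = grow-stable A t r r' h j (≤-trans hj (n≤1+n t))
  pt : ∀ y → grow G' A j y ∧ G' x y ≡ grow G A j y ∧ G x y
  pt y rewrite ih y with grow G A j y in e
  ... | false = refl
  ... | true = trans (symm r' x y) (trans (h y (grow-≤ G A hj y e) x) (symm r y x))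

module Escape (A : Fin n → Bool) (t Z m κ : ℕ) (hm : m + 2 * ((1 + d) * d) ≤ Z * d) (m>0 : 0 < m) (hκ : d * (n * d) ≤ m * κ) where
  Ball F F⁺ : Gr n → Fin n → Bool
  Ball G = grow G A (suc t)
  F G x = not (Ball G x)
  F⁺ G x = not (grow G A (suc (suc t)) x)

  private
    module _ (u : Fin n) where
      Le : Gr n → ℕ
      Le G = degTo (Ball G) G u

      base : ℕ → Gr n → Bool
      base x G = (Z ≤b # (F G)) ∧ (F G u ∧ (# (F⁺ G) ≤b x))

      𝒜 𝒲 : ℕ → ℕ → Gr n → Bool
      𝒜 i x G = base x G ∧ (Le G =b i)
      𝒲 i x G = base x G ∧ (Le G ≤b i)

      -- Replace an edge from u into the ball by an edge uz with z outside. Forward there are at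
      -- least m choices, backward d for z and nd for bw; by `hκ` the cost is a factor κ that is
      -- bounded when d is.
      step : ∀ i x → cnt d (𝒜 (suc i) x) * m ≤ cnt d (𝒜 i (x + 2)) * (d * (n * d))
      step i x = double-count (𝒜 (suc i) x) (𝒜 i (x + 2)) m (d * (n * d))
        (λ G a b z w → (eqF a u ∧ (Ball G b ∧ G u b)) ∧ (F G z ∧ (G z w ∧ (okv G a z ∧ okv G b w))))
        (λ G a b z w → (eqF a u ∧ G a z) ∧ G b w)
        hf hv hs hr
        where
        hf : ∀ G → IsReg d G → 𝒜 (suc i) x G ≡ true →
          m ≤ S4 (λ a b z w → ⟦ (eqF a u ∧ (Ball G b ∧ G u b)) ∧ (F G z ∧ (G z w ∧ (okv G a z ∧ okv G b w))) ⟧)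
        hf G r e = ≤-trans (≤-trans (≤-reflexive (sym (*-identityˡ m))) (*-monoˡ-≤ m one≤))
          (S4≥ (λ a b → eqF a u ∧ (Ball G b ∧ G u b)) (λ a b z w → F G z ∧ (G z w ∧ (okv G a z ∧ okv G b w))) m λ a b _ →
            +-cancelʳ-≤ _ m _ (≤-trans hm (≤-trans (*-monoˡ-≤ d (≤b-t (∧-l (∧-l e))))
                (≤-trans (≤-reflexive (sym (edges-from r (F G)))) (avoid r (λ z _ → F G z) a b)))))
          where
          one≤ : 1 ≤ E2 (λ a b → eqF a u ∧ (Ball G b ∧ G u b))
          one≤ = ≤-trans (≤-trans (s≤s z≤n) (≤-reflexive (sym (=b-t (∧-r {a = base x G} e)))))
            (≤-reflexive (sym (trans (E2-fac (λ a → eqF a u) (λ _ b → Ball G b ∧ G u b) (Le G) (λ _ _ → refl)) (trans (cong (_* Le G) (#-eq u)) (*-identityˡ _)))))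
        hv : ∀ G a b z w → IsReg d G → 𝒜 (suc i) x G ≡ true → (eqF a u ∧ (Ball G b ∧ G u b)) ∧ (F G z ∧ (G z w ∧ (okv G a z ∧ okv G b w))) ≡ true →
            Switchable G a b z w
        hv G a b z w r _ p = let q = ∧-r {a = F G z} (∧-r {a = eqF a u ∧ (Ball G b ∧ G u b)} p) in
          okV (subst (λ y → G y b ≡ true) (sym (eqF-t (∧-l (∧-l {eqF a u ∧ (Ball G b ∧ G u b)} p)))) (∧-r {a = Ball G b} (∧-r {a = eqF a u} (∧-l p))))
            (∧-l q) (∧-l (∧-r {a = G z w} q)) (∧-r {a = okv G a z} (∧-r {a = G z w} q))
        hr : ∀ G → IsReg d G → 𝒜 i (x + 2) G ≡ true → S4 (λ a b z w → ⟦ (eqF a u ∧ G a z) ∧ G b w ⟧) ≤ d * (n * d)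
        hr G r _ = ≤-trans (≤-reflexive (S4-bz (λ a b z w → ⟦ (eqF a u ∧ G a z) ∧ G b w ⟧)))
          (≤-trans (S4≤ (λ a z → eqF a u ∧ G a z) (λ a z b w → G b w) (n * d) (λ _ _ _ → ≤-reflexive (edges r)))
            (≤-reflexive (cong (_* (n * d)) (trans (E2-fac (λ a → eqF a u) G d (λ a _ → deg r a)) (trans (cong (_* d) (#-eq u)) (*-identityˡ d))))))
        hs : ∀ G G' a b z w → IsReg d G → IsReg d G' → 𝒜 (suc i) x G ≡ true →
          (eqF a u ∧ (Ball G b ∧ G u b)) ∧ (F G z ∧ (G z w ∧ (okv G a z ∧ okv G b w))) ≡ true → Switching G G' a b z w →
          (𝒜 i (x + 2) G' ≡ true) × ((eqF a u ∧ G' a z) ∧ G' b w ≡ true)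
        hs G G' a b z w r r' e p s with eqF-t {x = a} {u} (∧-l (∧-l p))
        ... | refl = ∧-i (∧-i (≤b-i (≤-trans (≤b-t (∧-l eb)) (≤-reflexive (sym (#-cong F-eq))))) (∧-i (trans (F-eq u) Fu)
                (≤b-i (≤-trans (#-mono F⁺') (≤-trans (#-∨ _ _) (+-mono-≤ (≤b-t (∧-r {a = F G u} (∧-r {a = Z ≤b # (F G)} eb)))
                  (≤-trans (#-∨ _ _) (≤-reflexive (cong₂ _+_ (#-eq u) (#-eq z))))))))))
              (=b-i Le') ,
            ∧-i (∧-i (eqF-r u) (Row.q∈' (Switching.ra s))) (Row.q∈' (Switching.rb s))
          where
          eb = ∧-l {base x G} e
          Fu : F G u ≡ true
          Fu = ∧-l (∧-r {a = Z ≤b # (F G)} eb)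
          Bb : Ball G b ≡ true
          Bb = ∧-l (∧-r {a = eqF u u} (∧-l p))
          Fz : F G z ≡ true
          Fz = ∧-l (∧-r {a = eqF u u ∧ (Ball G b ∧ G u b)} p)
          old : Fin n → Bool
          old = grow G A t
          out : ∀ {x y} → F G x ≡ true → G x y ≡ true → old y ≡ false
          out {x} {y} f g = ¬t→f λ o → t≢f (grow-adj {G = G} A t {x} {y} o g) (not-t f)
          lo : ∀ {x} → F G x ≡ true → old x ≡ false
          lo {x} f = ¬t→f λ o → t≢f (grow-≤ G A (n≤1+n t) x o) (not-t f)
          -- The four changed rows belong to vertices outside `old`: u and z lie outside the ball,
          -- which is one step larger, and b and w are adjacent to them.
          rows : ∀ x → old x ≡ true → ∀ y → G' x y ≡ G x y
          rows x o y with which s x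
          ... | none _ _ _ _ k = k y
          ... | isa refl = ⊥-elim (t≢f o (lo Fu))
          ... | isb refl = ⊥-elim (t≢f o (out Fu (Switching.ab s)))
          ... | isz refl = ⊥-elim (t≢f o (lo Fz))
          ... | isw refl = ⊥-elim (t≢f o (out Fz (Switching.zw s)))
          st = grow-stable A t r r' rows
          Ball-eq : ∀ x → Ball G' x ≡ Ball G x
          Ball-eq = st (suc t) ≤-refl
          F-eq : ∀ x → F G' x ≡ F G x
          F-eq x = cong not (Ball-eq x)
          degB : ∀ x → degTo (Ball G') G' x ≡ degTo (Ball G) G' x
          degB x = #-cong λ y → cong (_∧ G' x y) (Ball-eq y)
          Le' : Le G' ≡ i
          Le' = +-cancelʳ-≡ 1 _ _ (trans (cong (_+ 1) (degB u))
             (trans (subst₂ (λ p q → degTo (Ball G) G' u + ⟦ p ⟧ ≡ Le G + ⟦ q ⟧) Bb (not-t Fz) (rowCount (Switching.ra s) (Ball G)))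
             (trans (+-identityʳ _) (trans (=b-t (∧-r {a = base x G} e)) (+-comm 1 i)))))
          -- Only u and z can newly escape the larger ball: b lies in the ball, and w becomes a
          -- neighbour of b. Hence x grows by 2 per switching.
          F⁺' : ∀ y → F⁺ G' y ≡ true → F⁺ G y ∨ (eqF y u ∨ eqF y z) ≡ true
          F⁺' y h = go (which s y)
            where
            h1 = ∨-f₁ {Ball G' y} (not-t h)
            h2 : (1 ≤b degTo (Ball G) G' y) ≡ false
            h2 = trans (cong (1 ≤b_) (sym (degB y))) (∨-f₂ {Ball G' y} (not-t h))
            go : Which s y → F⁺ G y ∨ (eqF y u ∨ eqF y z) ≡ true
            go (isa q) = ∨-i₂ {F⁺ G y} (∨-i₁ (eqF-i q))
            go (isz q) = ∨-i₂ {F⁺ G y} (∨-i₂ {eqF y u} (eqF-i q))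
            go (isb refl) = ⊥-elim (t≢f Bb (trans (sym (Ball-eq b)) h1))
            go (isw refl) = ⊥-elim (t≢f (≤b-i (pos-# {f = λ y → Ball G y ∧ G' w y} {b} (∧-i Bb (Row.q∈' (Switching.rw s))))) h2)
            go (none _ _ _ _ k) = ∨-i₁ (not-f (cong₂ _∨_ (trans (sym (Ball-eq y)) h1)
              (trans (cong (1 ≤b_) (#-cong λ j → cong (Ball G j ∧_) (sym (k j)))) h2)))

      wstep : ∀ i x → cnt d (𝒲 (suc i) x) ≤ cnt d (𝒲 i (x + 2)) * (1 + κ)
      wstep i x = ≤-trans (cnt-∨ (𝒲 i (x + 2)) (𝒜 (suc i) x) (𝒲 (suc i) x) spl)
        (≤-trans (+-monoʳ-≤ (cnt d (𝒲 i (x + 2))) a≤) (≤-reflexive (sym (*-suc (cnt d (𝒲 i (x + 2))) κ))))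
        where
        wk : ∀ G → base x G ≡ true → base (x + 2) G ≡ true
        wk G e = ∧-i (∧-l {Z ≤b # (F G)} e) (∧-i (∧-l {F G u} (∧-r {a = Z ≤b # (F G)} e))
            (≤b-i (≤-trans (≤b-t (∧-r {a = F G u} (∧-r {a = Z ≤b # (F G)} e))) (m≤m+n x 2))))
        spl : ∀ G → IsReg d G → 𝒲 (suc i) x G ≡ true → 𝒲 i (x + 2) G ∨ 𝒜 (suc i) x G ≡ true
        spl G _ e with m≤n⇒m<n∨m≡n (≤b-t {Le G} {suc i} (∧-r {a = base x G} e))
        ... | inj₁ (s≤s k) = ∨-i₁ (∧-i (wk G (∧-l e)) (≤b-i k))
        ... | inj₂ k = ∨-i₂ {𝒲 i (x + 2) G} (∧-i (∧-l e) (=b-i k))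
        a≤ : cnt d (𝒜 (suc i) x) ≤ cnt d (𝒲 i (x + 2)) * κ
        a≤ = *-cancelʳ-≤ _ _ m {{>-nonZero m>0}} (≤-trans (step i x) (≤-trans (*-mono-≤ {cnt d (𝒜 i (x + 2))} {cnt d (𝒲 i (x + 2))}
              (cnt-mono λ G _ e → ∧-i (∧-l e) (≤b-i (≤-reflexive (=b-t (∧-r {a = base (x + 2) G} e))))) hκ)
              (≤-reflexive (l (cnt d (𝒲 i (x + 2))) m κ))))
          where
          l : ∀ a b c → a * (b * c) ≡ a * c * b
          l = solve-∀

      wsteps : ∀ i x → cnt d (𝒲 i x) ≤ cnt d (𝒲 0 (x + i * 2)) * (1 + κ) ^ i
      wsteps zero x = ≤-reflexive (trans (cong (λ y → cnt d (𝒲 0 y)) (sym (+-identityʳ x))) (sym (*-identityʳ _)))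
      wsteps (suc i) x = ≤-trans (wstep i x) (≤-trans (*-monoˡ-≤ (1 + κ) (wsteps i (x + 2)))
        (≤-reflexive (trans (cong (λ y → cnt d (𝒲 0 y) * (1 + κ) ^ i * (1 + κ)) (+-assoc x 2 (i * 2))) (l (cnt d (𝒲 0 (x + (2 + i * 2)))) ((1 + κ) ^ i) (1 + κ)))))
        where
        l : ∀ a b c → a * b * c ≡ a * (c * b)
        l = solve-∀

  stuck : ℕ → Gr n → Bool
  stuck x G = (Z ≤b # (F G)) ∧ (# (F⁺ G) ≤b x)

  -- Count pairs of a graph and a vertex u outside the ball. At first u has at least Z choices;
  -- after at most d switchings u is cut off from the ball, so it is one of at most x + 2d escaped
  -- vertices. The ratio outweighs the bounded cost (1 + κ)^d once Z is large.
  stuck-step : ∀ x → cnt d (stuck x) * Z ≤ cnt d (stuck (x + d * 2)) * ((1 + κ) ^ d * (x + d * 2))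
  stuck-step x = begin
    cnt d (stuck x) * Z ≤⟨ cntw≥ (fins n) (λ u → 𝒲 u d x) (stuck x) Z lower ⟩
    ∑ (λ u → cnt d (𝒲 u d x)) ≤⟨ S-mono (fins n) (λ u → wsteps u d x) ⟩
    ∑ (λ u → cnt d (𝒲 u 0 y) * (1 + κ) ^ d) ≡⟨ S-*ʳ (fins n) ((1 + κ) ^ d) _ ⟩
    ∑ (λ u → cnt d (𝒲 u 0 y)) * (1 + κ) ^ d ≤⟨ *-monoˡ-≤ ((1 + κ) ^ d) (cntw≤ (fins n) (λ u → 𝒲 u 0 y) (stuck y) y none' upper) ⟩
    cnt d (stuck y) * y * (1 + κ) ^ d ≡⟨ l (cnt d (stuck y)) y ((1 + κ) ^ d) ⟩
    cnt d (stuck y) * ((1 + κ) ^ d * y) ∎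
    where
    open ≤-Reasoning
    y = x + d * 2
    l : ∀ a b c → a * b * c ≡ a * (c * b)
    l = solve-∀
    lower : ∀ G → IsReg d G → stuck x G ≡ true → Z ≤ S (fins n) (λ u → ⟦ 𝒲 u d x G ⟧)
    lower G r e = ≤-trans (≤b-t (∧-l e)) (#-mono λ u h → ∧-i (∧-i (∧-l {Z ≤b # (F G)} e) (∧-i h (∧-r {a = Z ≤b # (F G)} e)))
      (≤b-i (≤-trans (#-mono λ z h → ∧-r {a = Ball G z} h) (≤-reflexive (deg r u)))))
    none' : ∀ G → stuck y G ≡ false → ∀ u → 𝒲 u 0 y G ≡ false
    none' G e u = ¬t→f λ h → t≢f (∧-i (∧-l (∧-l {base u y G} h)) (∧-r {a = F G u} (∧-r {a = Z ≤b # (F G)} (∧-l {base u y G} h)))) e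
    upper : ∀ G → IsReg d G → stuck y G ≡ true → S (fins n) (λ u → ⟦ 𝒲 u 0 y G ⟧) ≤ y
    upper G r e = ≤-trans (#-mono λ u h → not-f (cong₂ _∨_ (not-t (∧-l (∧-r {a = Z ≤b # (F G)} (∧-l {base u y G} h))))
        (¬t→f λ q → 1+n≰n (≤-trans (≤b-t q) (≤b-t (∧-r {a = base u y G} h)))))) (≤b-t (∧-r {a = Z ≤b # (F G)} e))

  stuck-tail : ∀ k x → 0 < Z → 2 * ((1 + κ) ^ d * (x + k * (d * 2))) ≤ Z → cnt d (stuck x) * 2 ^ k ≤ cnt {n} d (λ _ → true)
  stuck-tail zero x _ _ = ≤-trans (≤-reflexive (*-identityʳ _)) (cnt≤N _)
  stuck-tail (suc k) x pos h = geo {cnt d (stuck x)} {cnt d (stuck (x + d * 2))} 2 k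
    (ratio {cnt d (stuck x)} 2 (stuck-step x) (≤-trans (*-monoʳ-≤ 2 (*-monoʳ-≤ ((1 + κ) ^ d) (+-monoʳ-≤ x (m≤m+n (d * 2) _)))) h) pos)
    (stuck-tail k (x + d * 2) pos (≤-trans (≤-reflexive (cong (λ y → 2 * ((1 + κ) ^ d * y)) (+-assoc x (d * 2) _))) h))

-- Rare events and union bounds.

tot : ∀ n → ℕ → ℕ
tot n d = cnt {n} d (λ _ → true)

Rare : ∀ {n} → ℕ → ℕ → (Gr n → Bool) → Set
Rare {n} d b Ev = cnt d Ev * b ≤ tot n d

rare-≤ : (Ev : Gr n → Bool) {x y : ℕ} → y ≤ x → Rare d x Ev → Rare d y Ev
rare-≤ {d = d} Ev h r = ≤-trans (*-monoʳ-≤ (cnt d Ev) h) r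

rare-∨ : (P Q : Gr n → Bool) → Rare d (2 * b) P → Rare d (2 * b) Q → Rare d b (λ G → P G ∨ Q G)
rare-∨ {d = d} {b} P Q p q = *-cancelˡ-≤ 2 (≤-trans (*-monoʳ-≤ 2 (*-monoˡ-≤ b (cnt-∨ P Q (λ G → P G ∨ Q G) (λ _ _ e → e))))
  (≤-trans (≤-reflexive (l (cnt d P) (cnt d Q) b)) (≤-trans (+-mono-≤ p q) (≤-reflexive (l' (tot _ d))))))
  where
  l : ∀ x y b → 2 * ((x + y) * b) ≡ x * (2 * b) + y * (2 * b)
  l = solve-∀
  l' : ∀ x → x + x ≡ 2 * x
  l' = solve-∀

-- The union bound runs over the indices selected by c only, so that sets of a given size are
-- charged a binomial coefficient instead of 2^n.
rare-any : (xs : List 𝕀) (c : 𝕀 → Bool) (P : 𝕀 → Gr n → Bool) (M : ℕ) → S xs (λ x → ⟦ c x ⟧) ≤ M →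
  (∀ x → c x ≡ true → Rare d (M * b) (P x)) → Rare d b (λ G → any (λ x → c x ∧ P x G) xs)
rare-any {𝕀} {n} {d} {b} xs c P M hM h with M in eM
... | suc M' = *-cancelʳ-≤ _ _ (suc M') (≤-trans (≤-reflexive (*-assoc A b (suc M'))) (≤-trans (*-monoʳ-≤ A (≤-reflexive (*-comm b (suc M'))))
      (≤-trans (*-monoˡ-≤ (suc M' * b) le) (≤-trans (≤-reflexive (sym (S-*ʳ xs (suc M' * b) _))) (≤-trans (S-mono xs pt)
        (≤-trans (≤-reflexive (S-*ʳ xs (tot n d) _)) (≤-trans (*-monoˡ-≤ (tot n d) hM) (≤-reflexive (*-comm (suc M') _)))))))))
  where
  A = cnt d (λ G → any (λ x → c x ∧ P x G) xs)
  le : A ≤ S xs (λ x → cnt d (λ G → c x ∧ P x G))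
  le = cnt-sum≥ xs (λ x G → c x ∧ P x G) (λ G → any (λ x → c x ∧ P x G) xs) (λ G _ e → ≤-trans (≤-reflexive (cong ⟦_⟧ (sym e))) (any≤S xs _))
  pt : ∀ x → cnt d (λ G → c x ∧ P x G) * (suc M' * b) ≤ ⟦ c x ⟧ * tot n d
  pt x with c x in e
  ... | true = ≤-trans (h x e) (m≤m+n _ 0)
  ... | false = ≤-reflexive (cong (_* (suc M' * b)) (cnt-0 {d = d} (λ G → false) (λ _ → refl)))
... | zero = ≤-trans (≤-reflexive (cong (_* b) (n≤0⇒n≡0 (≤-trans le (≤-trans (S-mono xs pt)
    (≤-trans (≤-reflexive (S-*ʳ xs (tot n d) _)) (*-monoˡ-≤ (tot n d) hM))))))) z≤n
  where
  A = cnt d (λ G → any (λ x → c x ∧ P x G) xs)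
  le : A ≤ S xs (λ x → cnt d (λ G → c x ∧ P x G))
  le = cnt-sum≥ xs (λ x G → c x ∧ P x G) (λ G → any (λ x → c x ∧ P x G) xs) (λ G _ e → ≤-trans (≤-reflexive (cong ⟦_⟧ (sym e))) (any≤S xs _))
  pt : ∀ x → cnt d (λ G → c x ∧ P x G) ≤ ⟦ c x ⟧ * tot n d
  pt x with c x
  ... | true = ≤-trans (cnt≤N {d = d} (P x)) (m≤m+n _ 0)
  ... | false = ≤-reflexive (cnt-0 {d = d} (λ G → false) (λ _ → refl))

any-f : (E : Enum 𝕀) {f : 𝕀 → Bool} → any f (els E) ≡ false → ∀ a → f a ≡ false
any-f E e a = ¬t→f λ h → t≢f (any-in E h) e

-- Counting sets and comparing powers.

Sets : ∀ n → Enum (Vec Bool n)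
Sets n = enumVec enumBool n

-- Binomial coefficients, by Pascal's rule.
ch : ℕ → ℕ → ℕ
ch n zero = 1
ch zero (suc s) = 0
ch (suc n) (suc s) = ch n s + ch n (suc s)

#-cons : (x : Bool) (v : Vec Bool n) → # (lookup (x ∷ v)) ≡ ⟦ x ⟧ + # (lookup v)
#-cons x v = ∑-suc (λ i → ⟦ lookup (x ∷ v) i ⟧)

Sets-size : ∀ n s → S (els (Sets n)) (λ v → ⟦ # (lookup v) =b s ⟧) ≡ ch n s
Sets-size zero zero = trans (S-1 [] _) (cong ⟦_⟧ (=b-i (S-nil)))
  where
  S-nil : # {0} (lookup []) ≡ 0
  S-nil = n≤0⇒n≡0 (#≤n {0} (lookup []))
Sets-size zero (suc s) = trans (S-1 [] _) (cong ⟦_⟧ (¬t→f λ e → 1+n≰n (≤-trans (s≤s z≤n) (≤-trans (≤-reflexive (sym (=b-t e))) (#≤n {0} (lookup []))))))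
Sets-size (suc n) s = trans (S-concatMap (λ x → map (x ∷_) (els (Sets n))) (true ∷ false ∷ []) _) (trans (S-bool _) (trans (cong₂ _+_
    (trans (S-map (true ∷_) (els (Sets n)) _) (S-cong (els (Sets n)) λ v → cong (λ y → ⟦ y =b s ⟧) (#-cons true v)))
    (trans (S-map (false ∷_) (els (Sets n)) _) (S-cong (els (Sets n)) λ v → cong (λ y → ⟦ y =b s ⟧) (#-cons false v)))) (go s)))
  where
  go : ∀ s → S (els (Sets n)) (λ v → ⟦ suc (# (lookup v)) =b s ⟧) + S (els (Sets n)) (λ v → ⟦ # (lookup v) =b s ⟧) ≡ ch (suc n) s
  go zero = cong₂ _+_ (trans (S-cong (els (Sets n)) λ v → cong ⟦_⟧ (¬t→f {suc (# (lookup v)) =b 0} λ e → 1+n≢0 (=b-t e))) (S-0 (els (Sets n))))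
      (trans (Sets-size n 0) refl)
  go (suc s) = cong₂ _+_ (trans (S-cong (els (Sets n)) λ v → cong ⟦_⟧ (bool-ext (λ e → =b-i (suc-injective (=b-t e)))
      (λ e → =b-i (cong suc (=b-t e))))) (Sets-size n s)) (Sets-size n (suc s))

infix 9 _!
_! : ℕ → ℕ
zero ! = 1
suc n ! = suc n * n !

!-pos : ∀ n → 1 ≤ n !
!-pos zero = ≤-refl
!-pos (suc n) = *-mono-≤ {1} {suc n} (s≤s z≤n) (!-pos n)

bernoulli : ∀ n b → n ^ suc b + suc b * n ^ b ≤ suc n ^ suc b
bernoulli n zero = ≤-reflexive (l n) where
  l : ∀ n → n * 1 + 1 * 1 ≡ suc n * 1
  l = solve-∀
bernoulli n (suc b) = ≤-trans (≤-trans (m≤m+n _ (suc b * n ^ b)) (≤-reflexive (l n b (n ^ b)))) (*-monoʳ-≤ (suc n) (bernoulli n b)) where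
  l : ∀ n b p → n * (n * p) + suc (suc b) * (n * p) + suc b * p ≡ suc n * (n * p + suc b * p)
  l = solve-∀

ch-up : ∀ n s → ch n s * s ! ≤ n ^ s
ch-up n zero = ≤-refl
ch-up zero (suc s) = z≤n
ch-up (suc n) (suc s) = ≤-trans (≤-reflexive (l (ch n s) (ch n (suc s)) (suc s) (s !))) (≤-trans (+-mono-≤ (ch-up n (suc s)) (*-monoʳ-≤ (suc s) (ch-up n s))) (bernoulli n s)) where
  l : ∀ x y s f → (x + y) * (s * f) ≡ y * (s * f) + s * (x * f)
  l = solve-∀

ch-up' : ∀ n s b → s ≤ b → b ≤ n → ch n s * b ! ≤ n ^ b
ch-up' n s b h k with m≤n⇒m<n∨m≡n h
... | inj₂ refl = ch-up n s
ch-up' n s (suc b) h k | inj₁ (s≤s q) = ≤-trans (≤-reflexive (l (ch n s) (suc b) (b !))) (*-mono-≤ k (ch-up' n s b q (≤-trans (n≤1+n b) k))) where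
  l : ∀ x s f → x * (s * f) ≡ s * (x * f)
  l = solve-∀

ch-low : ∀ m b → m ^ b ≤ ch (m + b) b * b !
ch-low m zero = ≤-refl
ch-low zero (suc b) = z≤n
ch-low (suc m) (suc b) = ≤-trans (bern' m b) (≤-trans (+-mono-≤ (≤-trans (ch-low m (suc b))
    (≤-reflexive (cong (λ y → ch y (suc b) * suc b !) (+-suc m b)))) (*-monoʳ-≤ (suc b) (ch-low (suc m) b)))
    (≤-reflexive (trans (l (ch (suc (m + b)) b) (ch (suc (m + b)) (suc b)) (suc b) (b !)) (cong (λ y → ch (suc y) (suc b) * (suc b * b !)) (sym (+-suc m b))))))
  where
  l : ∀ x y s f → y * (s * f) + s * (x * f) ≡ (x + y) * (s * f)
  l = solve-∀
  bern' : ∀ m b → suc m ^ suc b ≤ m ^ suc b + suc b * suc m ^ b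
  bern' m zero = ≤-reflexive (l' m) where
    l' : ∀ m → suc m * 1 ≡ m * 1 + 1 * 1
    l' = solve-∀
  bern' m (suc b) = ≤-trans (≤-reflexive (l1 (suc m ^ suc b) m)) (≤-trans (+-monoˡ-≤ (suc m ^ suc b) (*-monoʳ-≤ m (bern' m b)))
     (≤-trans (+-monoˡ-≤ (suc m ^ suc b) (≤-trans (≤-reflexive (l2 m (m ^ suc b) (suc b) (suc m ^ b)))
         (+-monoʳ-≤ (m * m ^ suc b) (*-monoʳ-≤ (suc b) (*-monoˡ-≤ (suc m ^ b) (n≤1+n m))))))
       (≤-reflexive (l3 (m * m ^ suc b) (suc b) (suc m ^ suc b)))))
    where
    l1 : ∀ p m → suc m * p ≡ m * p + p
    l1 = solve-∀
    l2 : ∀ m p s q → m * (p + s * q) ≡ m * p + s * (m * q)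
    l2 = solve-∀
    l3 : ∀ x s p → x + s * p + p ≡ x + suc s * p
    l3 = solve-∀

ch-2^ : ∀ n s → ch n s ≤ 2 ^ n
ch-2^ n zero = m^n>0 2 n
ch-2^ zero (suc s) = z≤n
ch-2^ (suc n) (suc s) = +-mono-≤ (ch-2^ n s) (≤-trans (ch-2^ n (suc s)) (m≤m+n _ 0))

*-^ : ∀ a b k → (a * b) ^ k ≡ a ^ k * b ^ k
*-^ a b zero = refl
*-^ a b (suc k) rewrite *-^ a b k = l a b (a ^ k) (b ^ k) where
  l : ∀ a b c e → a * b * (c * e) ≡ a * c * (b * e)
  l = solve-∀

self-pow : ∀ b → b ^ b ≤ 4 ^ b * b !
self-pow b = ≤-trans (ch-low b b) (*-monoˡ-≤ (b !) (≤-trans (ch-2^ (b + b) b) (≤-reflexive (trans (^-distribˡ-+-* 2 b b) (sym (*-^ 2 2 b))))))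

-- The usual bound (en/b)^b with 4 in place of e: b^b ≤ 4^b b! follows from the central binomial
-- coefficient being at most 4^b.
ch-bound : ∀ n s b → s ≤ b → b ≤ n → ch n s * b ^ b ≤ (4 * n) ^ b
ch-bound n s b h k = ≤-trans (*-monoʳ-≤ (ch n s) (self-pow b)) (≤-trans (≤-reflexive (l (ch n s) (4 ^ b) (b !)))
    (≤-trans (*-monoʳ-≤ (4 ^ b) (ch-up' n s b h k)) (≤-reflexive (sym (*-^ 4 n b)))))
  where
  l : ∀ x y z → x * (y * z) ≡ y * (x * z)
  l = solve-∀

n<2^n : ∀ n → n < 2 ^ n
n<2^n zero = ≤-refl
n<2^n (suc n) = ≤-trans (s≤s (n<2^n n)) (+-mono-≤ (m^n>0 2 n) (≤-reflexive (sym (+-identityʳ _))))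

opaque
  -- For j = k/4 rounded down, 2^k contains 2^j · (2^j)³; the first factor absorbs (8C)³ and the
  -- second j³.
  pow-beats : ∀ C → ∃ λ k₀ → ∀ k → k₀ ≤ k → (C * k) ^ 3 ≤ 2 ^ k
  pow-beats C = 4 * suc ((8 * C) ^ 3) , go where
    go : ∀ k → 4 * suc ((8 * C) ^ 3) ≤ k → (C * k) ^ 3 ≤ 2 ^ k
    go k h = begin
        (C * k) ^ 3 ≤⟨ ^-monoˡ-≤ 3 (*-monoʳ-≤ C k≤) ⟩
        (C * (8 * j)) ^ 3 ≡⟨ cong (_^ 3) (l C j) ⟩
        (8 * C * j) ^ 3 ≡⟨ *-^ (8 * C) j 3 ⟩
        (8 * C) ^ 3 * j ^ 3 ≤⟨ *-mono-≤ (≤-trans (n≤1+n _) (≤-trans j≥ (<⇒≤ (n<2^n j)))) (^-monoˡ-≤ 3 (<⇒≤ (n<2^n j))) ⟩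
        2 ^ j * (2 ^ j) ^ 3 ≡⟨ cong (2 ^ j *_) (^-*-assoc 2 j 3) ⟩
        2 ^ j * 2 ^ (j * 3) ≡⟨ sym (^-distribˡ-+-* 2 j (j * 3)) ⟩
        2 ^ (j + j * 3) ≤⟨ ^-monoʳ-≤ 2 (≤-trans (≤-reflexive (l' j)) (m/n*n≤m k 4)) ⟩
        2 ^ k ∎
      where
      open ≤-Reasoning
      j : ℕ
      j = k / 4
      l : ∀ C j → C * (8 * j) ≡ 8 * C * j
      l = solve-∀
      l' : ∀ j → j + j * 3 ≡ j * 4
      l' = solve-∀
      k<4 : k < 4 * suc j
      k<4 = ≤-trans (≤-reflexive (cong suc (m≡m%n+[m/n]*n k 4))) (≤-trans (+-monoˡ-≤ (j * 4) (m%n<n k 4)) (≤-reflexive (l'' j))) where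
        l'' : ∀ j → 4 + j * 4 ≡ 4 * suc j
        l'' = solve-∀
      j≥ : suc ((8 * C) ^ 3) ≤ j
      j≥ = ≤-pred (*-cancelˡ-< 4 _ _ (≤-<-trans h k<4))
      k≤ : k ≤ 8 * j
      k≤ = ≤-trans (<⇒≤ k<4) (≤-trans (*-monoʳ-≤ 4 (≤-trans (+-monoˡ-≤ j (≤-trans (s≤s z≤n) j≥)) (≤-reflexive (cong (j +_) (sym (+-identityʳ j)))))) (≤-reflexive (l3 j))) where
        l3 : ∀ j → 4 * (2 * j) ≡ 8 * j
        l3 = solve-∀

-- Typical properties of random regular graphs.

lk : Vec Bool n → Fin n → Bool
lk = lookup

rect : (S B : Fin n → Bool) → Fin n → Fin n → Bool
rect S B a z = S a ∧ B z

E2-rect : (S B : Fin n → Bool) → E2 (rect S B) ≡ # S * # B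
E2-rect S B = E2-fac S (λ _ → B) (# B) (λ _ _ → refl)

slack : ∀ X Y → 2 * Y ≤ X → ∃ λ m → (m + Y ≤ X) × (X ≤ 2 * m)
slack X Y h = X ∸ Y , ≤-reflexive e , ≤-trans (≤-reflexive (sym e))
    (+-monoʳ-≤ (X ∸ Y) (≤-trans (+-cancelʳ-≤ Y Y (X ∸ Y) (≤-trans (≤-reflexive (cong (Y +_) (sym (+-identityʳ Y))))
        (≤-trans h (≤-reflexive (sym e))))) (≤-reflexive (sym (+-identityʳ _)))))
  where
  e : X ∸ Y + Y ≡ X
  e = m∸n+n≡m (≤-trans (m≤m+n Y _) h)

divide : ∀ m D → 1 ≤ D → ∃ λ q → (q * D ≤ m) × (m < suc q * D)
divide m D@(suc _) _ = m / D , m/n*n≤m m D , ≤-trans (≤-reflexive (cong suc (m≡m%n+[m/n]*n m D))) (+-monoˡ-≤ ((m / D) * D) (m%n<n m D))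

b≤q^b : ∀ q b → 2 ≤ q → b ≤ q ^ b
b≤q^b q b h = ≤-trans (<⇒≤ (n<2^n b)) (^-monoˡ-≤ b h)

nbd : Gr n → (Fin n → Bool) → Fin n → Bool
nbd G S x = 1 ≤b degTo S G x

nbd-in : {G : Gr n} {S : Fin n → Bool} → IsReg d G → ∀ {a x} → S a ≡ true → G a x ≡ true → nbd G S x ≡ true
nbd-in {G = G} {S} r {a} {x} s e = ≤b-i (pos-# {f = λ y → S y ∧ G x y} {a} (∧-i s (trans (symm r x a) e)))

Pairs-of-sets : ∀ n → Enum (Vec Bool n × Vec Bool n)
Pairs-of-sets n = enumProd (Sets n) (Sets n)

Idx² : ∀ n → Enum (Fin (suc n) × Fin (suc n))
Idx² n = enumProd (enumFin (suc n)) (enumFin (suc n))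

S-length : ∀ {I : Set} (xs : List I) (c : I → Bool) → S xs (λ x → ⟦ c x ⟧) ≤ length xs
S-length xs c = ≤-trans (S-mono xs (λ x → ⟦⟧≤1 (c x))) (≤-reflexive (trans (S-const xs 1) (*-identityʳ _)))

length-Idx² : ∀ n → length (els (Idx² n)) ≡ suc n * suc n
length-Idx² n = trans (length-prod (enumFin (suc n)) (enumFin (suc n))) (cong₂ _*_ (length-fins (suc n)) (length-fins (suc n)))

ofSet : (Fin n → Bool) → Vec Bool n
ofSet = tabulate

lk-of : (S : Fin n → Bool) → ∀ x → lk (ofSet S) x ≡ S x
lk-of S x = lookup∘tabulate S x

toFin : ∀ {s n} → s ≤ n → Fin (suc n)
toFin h = fromℕ< (s≤s h)

toℕ-toFin : ∀ {s n} (h : s ≤ n) → toℕ (toFin h) ≡ s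
toℕ-toFin h = Finₚ.toℕ-fromℕ< (s≤s h)

module Expansion (n d c : ℕ) where
  size² : ℕ → ℕ → Vec Bool n × Vec Bool n → Bool
  size² s b (S , B) = (# (lk S) =b s) ∧ (# (lk B) =b b)

  full : ℕ → Vec Bool n × Vec Bool n → Gr n → Bool
  full s (S , B) G = d * s ≤b eOn (rect (lk S) (lk B)) G

  cond : Fin (suc n) × Fin (suc n) → Bool
  cond (s , b) = (1 ≤b toℕ b) ∧ ((32 * toℕ b ≤b n) ∧ ((suc (8 * (c * toℕ b)) ≤b d * toℕ s) ∧ (toℕ s ≤b toℕ b)))

  -- Some S of size s has all its edges inside S × B for some B of size b, where 8cb < ds and 32b ≤ n.
  bad : Gr n → Bool
  bad G = any (λ sb → cond sb ∧ any (λ x → size² (toℕ (proj₁ sb)) (toℕ (proj₂ sb)) x ∧ full (toℕ (proj₁ sb)) x G) (els (Pairs-of-sets n))) (els (Idx² n))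

  module _ (hc : 18 ≤ c) (hd : 1 ≤ d) (hn : 4 * (1 + d) ≤ n) where
    private
      -- The edge count ds is lowered cb times by 4 and never falls below half, since 8cb < ds. Each
      -- step gains q because S × B has only sb pairs, while n ≥ 4bq.
      tail : ∀ S B s b q → # (lk S) ≡ s → # (lk B) ≡ b → suc (8 * (c * b)) ≤ d * s → q * (4 * b) ≤ n →
        cnt d (full s (S , B)) * q ^ (c * b) ≤ tot n d
      tail S B s b q refl refl h hq = subst (λ y → cnt d (λ G → y ≤b eOn E G) * q ^ (c * b) ≤ tot n d) fk
          (upper-tail E m (proj₁ (proj₂ sl)) f q (c * b) (*-mono-≤ {1} {f} {1} {m} f≥1 m≥1) (*-cancelˡ-≤ 4 (begin
            4 * (q * (E2 E * (d * d))) ≡⟨ cong (λ y → 4 * (q * (y * (d * d)))) (E2-rect (lk S) (lk B)) ⟩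
            4 * (q * (s * b * (d * d))) ≡⟨ l1 q s b d ⟩
            q * (4 * b) * (s * (d * d)) ≤⟨ *-monoˡ-≤ (s * (d * d)) hq ⟩
            n * (s * (d * d)) ≡⟨ l2 n s d ⟩
            (d * s) * (n * d) ≤⟨ *-mono-≤ 2f (proj₂ (proj₂ sl)) ⟩
            (2 * f) * (2 * m) ≡⟨ l3 f m ⟩
            4 * (f * m) ∎)))
        where
        open ≤-Reasoning
        E = rect (lk S) (lk B)
        l0 : ∀ d → 2 * (2 * ((1 + d) * d)) ≡ 4 * (1 + d) * d
        l0 = solve-∀
        sl = slack (n * d) (2 * ((1 + d) * d)) (≤-trans (≤-reflexive (l0 d)) (*-monoˡ-≤ d hn))
        m = proj₁ sl
        f = d * s ∸ c * b * 4
        4≤8 : c * b * 4 + c * b * 4 ≤ d * s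
        4≤8 = ≤-trans (≤-reflexive (l4 (c * b))) (≤-trans (n≤1+n _) h) where
          l4 : ∀ x → x * 4 + x * 4 ≡ 8 * x
          l4 = solve-∀
        fk : f + c * b * 4 ≡ d * s
        fk = m∸n+n≡m (≤-trans (m≤m+n (c * b * 4) (c * b * 4)) 4≤8)
        2f : d * s ≤ 2 * f
        2f = ≤-trans (≤-reflexive (sym fk)) (+-monoʳ-≤ f (≤-trans (+-cancelʳ-≤ (c * b * 4) _ _ (≤-trans 4≤8 (≤-reflexive (sym fk))))
            (≤-reflexive (sym (+-identityʳ f)))))
        pos2 : ∀ {y x} → 1 ≤ y → y ≤ 2 * x → 1 ≤ x
        pos2 {x = zero} p k = ≤-trans p k
        pos2 {x = suc x} p k = s≤s z≤n
        f≥1 : 1 ≤ f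
        f≥1 = pos2 (≤-trans (s≤s z≤n) h) 2f
        m≥1 : 1 ≤ m
        m≥1 = pos2 (*-mono-≤ {1} {n} {1} {d} (≤-trans (s≤s z≤n) hn) hd) (proj₂ (proj₂ sl))
        l1 : ∀ q s b d → 4 * (q * (s * b * (d * d))) ≡ q * (4 * b) * (s * (d * d))
        l1 = solve-∀
        l2 : ∀ n s d → n * (s * (d * d)) ≡ (d * s) * (n * d)
        l2 = solve-∀
        l3 : ∀ f m → (2 * f) * (2 * m) ≡ 4 * (f * m)
        l3 = solve-∀

      -- Everything is measured in powers of q ≥ 8, which 32b ≤ n provides: the two binomials cost
      -- q^(3b) each and the three factors of size about n cost q^(4b) each. This is where 18 = 3 +
      -- 3 + 4 + 4 + 4 comes from.
      cost : ∀ s b q → 1 ≤ b → 32 * b ≤ n → s ≤ b → q * (4 * b) ≤ n → n < suc q * (4 * b) → ∀ Bt → Bt ≤ n →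
        ch n s * ch n b * (suc n * suc n * Bt) ≤ q ^ (c * b)
      cost s b@(suc _) q hb h32 hs hq hq' Bt hB = begin
          ch n s * ch n b * (suc n * suc n * Bt) ≤⟨ *-mono-≤ (*-mono-≤ (chq s hs) (chq b ≤-refl)) (*-mono-≤ (*-mono-≤ nq nq) (≤-trans hB (≤-trans (n≤1+n n) nq))) ⟩
          (q ^ 3) ^ b * (q ^ 3) ^ b * (q ^ 3 * q ^ b * (q ^ 3 * q ^ b) * (q ^ 3 * q ^ b)) ≤⟨ *-monoʳ-≤ ((q ^ 3) ^ b * (q ^ 3) ^ b) (*-mono-≤ (*-mono-≤ q4 q4) q4) ⟩
          (q ^ 3) ^ b * (q ^ 3) ^ b * ((q ^ 4) ^ b * (q ^ 4) ^ b * (q ^ 4) ^ b) ≡⟨ cong₂ (λ x y → x * x * (y * y * y)) (^-*-assoc q 3 b) (^-*-assoc q 4 b) ⟩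
          q ^ (3 * b) * q ^ (3 * b) * (q ^ (4 * b) * q ^ (4 * b) * q ^ (4 * b)) ≡⟨ sym pw ⟩
          q ^ (18 * b) ≤⟨ ^-monoʳ-≤ q (*-monoˡ-≤ b hc) ⟩
          q ^ (c * b) ∎
        where
        open ≤-Reasoning
        q≥8 : 8 ≤ q
        q≥8 = ≤-pred (*-cancelʳ-< (4 * b) 8 (suc q) (≤-<-trans (≤-trans (≤-reflexive (sym (*-assoc 8 4 b))) h32) hq'))
        instance
          nz : NonZero q
          nz = >-nonZero (≤-trans (s≤s z≤n) q≥8)
        pw : q ^ (18 * b) ≡ q ^ (3 * b) * q ^ (3 * b) * (q ^ (4 * b) * q ^ (4 * b) * q ^ (4 * b))
        pw = trans (cong (q ^_) (l b)) (trans (^-distribˡ-+-* q (3 * b + 3 * b) _) (cong₂ _*_ (^-distribˡ-+-* q (3 * b) _)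
               (trans (^-distribˡ-+-* q (4 * b + 4 * b) _) (cong (_* q ^ (4 * b)) (^-distribˡ-+-* q (4 * b) _)))))
          where
          l : ∀ b → 18 * b ≡ 3 * b + 3 * b + (4 * b + 4 * b + 4 * b)
          l = solve-∀
        b≤n : b ≤ n
        b≤n = ≤-trans (m≤n*m b 32) h32
        n≤ : n ≤ 8 * (b * q)
        n≤ = ≤-trans (<⇒≤ hq') (≤-trans (*-monoˡ-≤ (4 * b) (+-monoˡ-≤ q (≤-trans (s≤s z≤n) q≥8))) (≤-reflexive (l q b)))
          where
          l : ∀ q b → (q + q) * (4 * b) ≡ 8 * (b * q)
          l = solve-∀
        chq : ∀ s → s ≤ b → ch n s ≤ (q ^ 3) ^ b
        chq s hs = *-cancelʳ-≤ _ _ (b ^ b) {{m^n≢0 b b}} (≤-trans (ch-bound n s b hs b≤n) (≤-trans (^-monoˡ-≤ b n4) (≤-reflexive (*-^ (q ^ 3) b b))))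
          where
          n4 : 4 * n ≤ q ^ 3 * b
          n4 = ≤-trans (*-monoʳ-≤ 4 n≤) (≤-trans (≤-reflexive (l q b)) (≤-trans (*-monoˡ-≤ (b * q) (≤-trans (m≤m+n 32 32) (*-mono-≤ q≥8 q≥8)))
              (≤-reflexive (l' q b))))
            where
            l : ∀ q b → 4 * (8 * (b * q)) ≡ 32 * (b * q)
            l = solve-∀
            l' : ∀ q b → q * q * (b * q) ≡ q * (q * (q * 1)) * b
            l' = solve-∀
        nq : suc n ≤ q ^ 3 * q ^ b
        nq = begin
          suc n ≤⟨ s≤s n≤ ⟩
          1 + 8 * (b * q) ≤⟨ +-monoˡ-≤ (8 * (b * q)) (*-mono-≤ {1} {b} {1} {q} hb (≤-trans (s≤s z≤n) q≥8)) ⟩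
          9 * (b * q) ≤⟨ *-monoˡ-≤ (b * q) (≤-trans (m≤m+n 9 55) (*-mono-≤ q≥8 q≥8)) ⟩
          q * q * (b * q) ≡⟨ l q b ⟩
          q ^ 3 * b ≤⟨ *-monoʳ-≤ (q ^ 3) (b≤q^b q b (≤-trans (s≤s (s≤s z≤n)) q≥8)) ⟩
          q ^ 3 * q ^ b ∎
          where
          l : ∀ q b → q * q * (b * q) ≡ q * (q * (q * 1)) * b
          l = solve-∀
        q4 : q ^ 3 * q ^ b ≤ (q ^ 4) ^ b
        q4 = ≤-trans (≤-reflexive (sym (^-distribˡ-+-* q 3 b))) (≤-trans (^-monoʳ-≤ q (≤-trans (+-monoˡ-≤ b (*-monoʳ-≤ 3 hb)) (≤-reflexive (l b))))
            (≤-reflexive (sym (^-*-assoc q 4 b))))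
          where
          l : ∀ b → 3 * b + b ≡ 4 * b
          l = solve-∀

    bad-rare : ∀ Bt → Bt ≤ n → Rare d Bt bad
    bad-rare Bt hB = rare-any (els (Idx² n)) cond _ (suc n * suc n) (≤-trans (S-length (els (Idx² n)) cond) (≤-reflexive (length-Idx² n)))
      λ { (s' , b') e → let s = toℕ s' ; b = toℕ b'
                            e1 = ∧-r {a = 1 ≤b b} e
                            e2 = ∧-r {a = 32 * b ≤b n} e1
                            hb = ≤b-t (∧-l {1 ≤b b} e)
                            h32 = ≤b-t (∧-l {32 * b ≤b n} e1)
                            h8 = ≤b-t (∧-l {suc (8 * (c * b)) ≤b d * s} e2)
                            hs = ≤b-t (∧-r {a = suc (8 * (c * b)) ≤b d * s} e2)
                            qq = divide n (4 * b) (≤-trans hb (m≤n*m b 4))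
                            q = proj₁ qq in
        rare-any (els (Pairs-of-sets n)) (size² s b) (full s) (ch n s * ch n b) (≤-reflexive (sizes s b))
          λ { (S , B) f → rare-≤ (full s (S , B)) (cost s b q hb h32 hs (proj₁ (proj₂ qq)) (proj₂ (proj₂ qq)) Bt hB)
                (tail S B s b q (=b-t (∧-l f)) (=b-t (∧-r {a = # (lk S) =b s} f)) h8 (proj₁ (proj₂ qq))) } }
      where
      sizes : ∀ s b → S (els (Pairs-of-sets n)) (λ x → ⟦ size² s b x ⟧) ≡ ch n s * ch n b
      sizes s b = trans (S-prod (Sets n) (Sets n) _) (trans (S-cong (els (Sets n)) λ S' →
          trans (S-cong (els (Sets n)) λ B → ⟦∧⟧ (# (lk S') =b s) (# (lk B) =b b))
              (trans (S-* (els (Sets n)) ⟦ # (lk S') =b s ⟧ (λ B → ⟦ # (lk B) =b b ⟧)) (cong (⟦ # (lk S') =b s ⟧ *_) (Sets-size n b))))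
        (trans (S-*ʳ (els (Sets n)) (ch n b) _) (cong (_* ch n b) (Sets-size n s))))

    -- With B = `nbd G S` all d|S| edges at S lie in S × B, and |S| ≤ |B| by regularity. The second
    -- alternative is the range of sizes of B that the union bound does not cover.
    expands : {G : Gr n} → IsReg d G → bad G ≡ false → ∀ S → 1 ≤ # S → (d * # S ≤ 8 * (c * # (nbd G S))) ⊎ (n < 32 * # (nbd G S))
    expands {G} r e S hS with d * # S ≤? 8 * (c * # (nbd G S)) | n <? 32 * # (nbd G S)
    ... | yes p | _ = inj₁ p
    ... | no _ | yes p = inj₂ p
    ... | no p | no p' = ⊥-elim (t≢f ev e)
      where
      N = nbd G S
      a = proj₁ (#-pos {f = S} hS)
      Sa = proj₂ (#-pos {f = S} hS)
      all-in : eOn (rect S N) G ≡ # S * d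
      all-in = trans (S-cong (fins n) λ a → #-cong λ z → pt a z) (edges-from r S)
        where
        pt : ∀ a z → rect S N a z ∧ G a z ≡ S a ∧ G a z
        pt a z with S a in sa | G a z in g
        ... | false | _ = refl
        ... | true | false = Boolₚ.∧-zeroʳ _
        ... | true | true = trans (Boolₚ.∧-identityʳ _) (nbd-in r sa g)
      N≥1 : 1 ≤ # N
      N≥1 = let (z , g) = #-pos {f = G a} (≤-trans hd (≤-reflexive (sym (deg r a)))) in pos-# {f = N} {z} (nbd-in r Sa g)
      s≤b : # S ≤ # N
      s≤b = *-cancelʳ-≤ _ _ d {{>-nonZero hd}} (≤-trans (≤-reflexive (sym all-in)) (≤-trans (E2-mono h) (≤-reflexive (edges-to r N))))
        where
        h : ∀ a z → rect S N a z ∧ G a z ≡ true → G a z ∧ N z ≡ true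
        h a z q = ∧-i (∧-r {a = rect S N a z} q) (∧-r {a = S a} (∧-l q))
      sF = toFin (#≤n S)
      bF = toFin (#≤n N)
      es = toℕ-toFin (#≤n S)
      eb = toℕ-toFin (#≤n N)
      cc : cond (sF , bF) ≡ true
      cc rewrite es | eb = ∧-i (≤b-i N≥1) (∧-i (≤b-i (≮⇒≥ p')) (∧-i (≤b-i (≰⇒> p)) (≤b-i s≤b)))
      inner : size² (toℕ sF) (toℕ bF) (ofSet S , ofSet N) ∧ full (toℕ sF) (ofSet S , ofSet N) G ≡ true
      inner rewrite es | eb = ∧-i (∧-i (=b-i (#-cong (lk-of S))) (=b-i (#-cong (lk-of N))))
        (≤b-i (≤-reflexive (trans (*-comm d (# S)) (trans (sym all-in) (sym (S-cong (fins n) λ a → #-cong λ z →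
          cong₂ (λ x y → (x ∧ y) ∧ G a z) (lk-of S a) (lk-of N z)))))))
      ev : bad G ≡ true
      ev = any-in (Idx² n) {a = sF , bF} (∧-i cc (any-in (Pairs-of-sets n) {a = ofSet S , ofSet N} inner))

length-Sets : ∀ n → length (els (Sets n)) ≡ 2 ^ n
length-Sets n = length-allVec n (true ∷ false ∷ [])

module Dense (n d P κ : ℕ) where
  cond : Vec Bool n × Vec Bool n → Bool
  cond (U , S) = (n ≤b P * # (lk U)) ∧ (n ≤b P * # (lk S))

  sparse : Vec Bool n × Vec Bool n → Gr n → Bool
  sparse (U , S) G = eOn (rect (lk U) (lk S)) G ≤b κ * n

  bad : Gr n → Bool
  bad G = any (λ x → cond x ∧ sparse x G) (els (Pairs-of-sets n))

  module _ (hd : 1 ≤ d) (hn : 4 * ((1 + d) * P) ≤ n) (hκ : 8 * (P * P * (κ + 8)) ≤ d) (n≥1 : 1 ≤ n) where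
    private
      -- Raising the count 2n times by 4 from κn ends at (κ + 8)n, which `hκ` keeps far enough below
      -- the typical count, at least of order dn/P², for a gain of 4 per step. Then 4^(2n) beats the
      -- 4^n pairs of sets with 4^n ≥ n to spare.
      tail : ∀ U S → n ≤ P * # (lk U) → n ≤ P * # (lk S) → cnt d (sparse (U , S)) * 4 ^ (2 * n) ≤ tot n d
      tail U S hU hS = lower-tail (lk U) (lk S) m (proj₁ (proj₂ sl)) (2 * n) (κ * n) pos (*-cancelˡ-≤ (2 * (P * P)) {{nzP}} (begin
          2 * (P * P) * (4 * ((κ * n + 2 * n * 4) * (n * d))) ≡⟨ l1 P κ n d ⟩
          8 * (P * P * (κ + 8)) * (n * (n * d)) ≤⟨ *-monoˡ-≤ (n * (n * d)) hκ ⟩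
          d * (n * (n * d)) ≤⟨ *-monoʳ-≤ d (*-mono-≤ hU (*-monoˡ-≤ d hS)) ⟩
          d * (P * u * (P * s * d)) ≡⟨ l2 d P u s ⟩
          P * P * (u * d) * (s * d) ≤⟨ *-monoʳ-≤ (P * P * (u * d)) (proj₂ (proj₂ sl)) ⟩
          P * P * (u * d) * (2 * m) ≡⟨ l3 P (u * d) m ⟩
          2 * (P * P) * (u * d * m) ∎))
        where
        open ≤-Reasoning
        u = # (lk U)
        s = # (lk S)
        pos3 : ∀ {P s} → 1 ≤ P * s → 1 ≤ P × 1 ≤ s
        pos3 {suc P} {suc s} _ = s≤s z≤n , s≤s z≤n
        pos3 {suc P} {zero} h = ⊥-elim (1+n≰n (≤-trans h (≤-reflexive (*-zeroʳ (suc P)))))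
        P≥1 = proj₁ (pos3 {P} {s} (≤-trans n≥1 hS))
        s≥1 = proj₂ (pos3 {P} {s} (≤-trans n≥1 hS))
        u≥1 = proj₂ (pos3 {P} {u} (≤-trans n≥1 hU))
        nzP : NonZero (2 * (P * P))
        nzP = >-nonZero (*-mono-≤ {1} {2} {1} (s≤s z≤n) (*-mono-≤ {1} {P} {1} P≥1 P≥1))
        4≤s : 4 * (1 + d) ≤ s
        4≤s = *-cancelˡ-≤ P {{>-nonZero P≥1}} (≤-trans (≤-reflexive (l P d)) (≤-trans hn hS)) where
          l : ∀ P d → P * (4 * (1 + d)) ≡ 4 * ((1 + d) * P)
          l = solve-∀
        l0 : ∀ d → 2 * (2 * ((1 + d) * d)) ≡ 4 * (1 + d) * d
        l0 = solve-∀
        sl = slack (s * d) (2 * ((1 + d) * d)) (≤-trans (≤-reflexive (l0 d)) (*-monoˡ-≤ d 4≤s))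
        m = proj₁ sl
        pos2 : ∀ {y x} → 1 ≤ y → y ≤ 2 * x → 1 ≤ x
        pos2 {x = zero} p k = ≤-trans p k
        pos2 {x = suc x} p k = s≤s z≤n
        pos : 0 < u * d * m
        pos = *-mono-≤ {1} {u * d} {1} (*-mono-≤ {1} {u} {1} u≥1 hd) (pos2 (*-mono-≤ {1} {s} {1} s≥1 hd) (proj₂ (proj₂ sl)))
        l1 : ∀ P κ n d → 2 * (P * P) * (4 * ((κ * n + 2 * n * 4) * (n * d))) ≡ 8 * (P * P * (κ + 8)) * (n * (n * d))
        l1 = solve-∀
        l2 : ∀ d P u s → d * (P * u * (P * s * d)) ≡ P * P * (u * d) * (s * d)
        l2 = solve-∀
        l3 : ∀ P x m → P * P * x * (2 * m) ≡ 2 * (P * P) * (x * m)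
        l3 = solve-∀

    bad-rare : ∀ Bt → Bt ≤ n → Rare d Bt bad
    bad-rare Bt hB = rare-any (els (Pairs-of-sets n)) cond sparse (4 ^ n) (≤-trans (S-length (els (Pairs-of-sets n)) cond)
        (≤-reflexive (trans (length-prod (Sets n) (Sets n)) (trans (cong₂ _*_ (length-Sets n) (length-Sets n)) (sym (*-^ 2 2 n))))))
      λ { (U , S) e → rare-≤ (sparse (U , S)) le (tail U S (≤b-t (∧-l e)) (≤b-t (∧-r {a = n ≤b P * # (lk U)} e))) }
      where
      le : 4 ^ n * Bt ≤ 4 ^ (2 * n)
      le = ≤-trans (*-monoʳ-≤ (4 ^ n) (≤-trans hB (b≤q^b 4 n (s≤s (s≤s z≤n)))))
        (≤-reflexive (trans (sym (^-distribˡ-+-* 4 n n)) (cong (λ y → 4 ^ (n + y)) (sym (+-identityʳ n)))))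

  dense : {G : Gr n} → bad G ≡ false → ∀ U S → n ≤ P * # U → n ≤ P * # S → κ * n < eOn (rect U S) G
  dense {G} e U S hU hS with eOn (rect U S) G ≤? κ * n
  ... | no p = ≰⇒> p
  ... | yes p = ⊥-elim (t≢f (any-in (Pairs-of-sets n) {a = ofSet U , ofSet S} (∧-i (∧-i (≤b-i (sz U hU)) (≤b-i (sz S hS)))
      (≤b-i (≤-trans (≤-reflexive (S-cong (fins n) λ a → #-cong λ z → cong₂ (λ x y → (x ∧ y) ∧ G a z) (lk-of U a) (lk-of S z))) p)))) e)
    where
    sz : ∀ U → n ≤ P * # U → n ≤ P * # (lk (ofSet U))
    sz U h = ≤-trans h (≤-reflexive (cong (P *_) (sym (#-cong (lk-of U)))))

module Twins (n d c e : ℕ) where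
  cond : Fin n × Fin n → Bool
  cond (u , v) = not (eqF u v)

  -- The threshold 6e consists of 2e, where the decay starts, and 2e steps of 2.
  common : Fin n × Fin n → Gr n → Bool
  common (u , v) G = 2 * e + 2 * e * 2 ≤b # (λ x → G u x ∧ G v x)

  bad : Gr n → Bool
  bad G = any (λ x → cond x ∧ common x G) (els (enumProd (enumFin n) (enumFin n)))

  module _ (hd : 1 ≤ d) (hc : 1 ≤ c) (h2 : d ≤ c * e) (h4 : 4 ≤ e) (hn : 4 * (2 + d) ≤ n) (hq : (8 * c ^ 6) * (c * d) ≤ n) where
    private
      qq = divide n (c * d) (*-mono-≤ {1} {c} {1} hc hd)
      q = proj₁ qq
      c6≥1 : 1 ≤ c ^ 6
      c6≥1 = m^n>0 c {{>-nonZero hc}} 6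
      q≥ : 8 * c ^ 6 ≤ q
      q≥ = ≤-pred (*-cancelʳ-< (c * d) _ (suc q) (≤-<-trans hq (proj₂ (proj₂ qq))))
      q≥8 : 8 ≤ q
      q≥8 = ≤-trans (*-monoʳ-≤ 8 c6≥1) q≥
      instance
        nzq : NonZero q
        nzq = >-nonZero (≤-trans (s≤s z≤n) q≥8)

      tail : ∀ u v → u ≢ v → cnt d (common (u , v)) * q ^ (2 * e) ≤ tot n d
      tail u v k = codeg-tail u v k m hm (2 * e) q (2 * e) (*-mono-≤ {1} {2 * e} {1} (≤-trans (≤-trans (s≤s z≤n) h4) (m≤n*m e 2)) m≥1) (*-cancelˡ-≤ 2 (begin
          2 * (q * (d * (d * d))) ≤⟨ *-monoʳ-≤ 2 (*-monoʳ-≤ q (*-monoʳ-≤ d (*-monoʳ-≤ d h2))) ⟩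
          2 * (q * (d * (d * (c * e)))) ≡⟨ l1 q d c e ⟩
          q * (c * d) * (2 * e * d) ≤⟨ *-monoˡ-≤ (2 * e * d) (proj₁ (proj₂ qq)) ⟩
          n * (2 * e * d) ≡⟨ l2 n e d ⟩
          2 * e * (n * d) ≤⟨ *-monoʳ-≤ (2 * e) (proj₂ (proj₂ sl)) ⟩
          2 * e * (2 * m) ≡⟨ l3 e m ⟩
          2 * (2 * e * m) ∎))
        where
        open ≤-Reasoning
        l0 : ∀ d → 2 * (2 * ((1 + d) * d) + 2 * d) ≡ 4 * (2 + d) * d
        l0 = solve-∀
        sl = slack (n * d) (2 * ((1 + d) * d) + 2 * d) (≤-trans (≤-reflexive (l0 d)) (*-monoˡ-≤ d hn))
        m = proj₁ sl
        hm : m + 2 * ((1 + d) * d) + 2 * d ≤ n * d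
        hm = ≤-trans (≤-reflexive (+-assoc m _ _)) (proj₁ (proj₂ sl))
        pos2 : ∀ {y x} → 1 ≤ y → y ≤ 2 * x → 1 ≤ x
        pos2 {x = zero} p k = ≤-trans p k
        pos2 {x = suc x} p k = s≤s z≤n
        m≥1 : 1 ≤ m
        m≥1 = pos2 (*-mono-≤ {1} {n} {1} {d} (≤-trans (s≤s z≤n) hn) hd) (proj₂ (proj₂ sl))
        l1 : ∀ q d c e → 2 * (q * (d * (d * (c * e)))) ≡ q * (c * d) * (2 * e * d)
        l1 = solve-∀
        l2 : ∀ n e d → n * (2 * e * d) ≡ 2 * e * (n * d)
        l2 = solve-∀
        l3 : ∀ e m → 2 * e * (2 * m) ≡ 2 * (2 * e * m)
        l3 = solve-∀

      -- From n ≤ 2c²eq one gets n³ ≤ 8c⁶ e³ q³. Here q absorbs 8c⁶, which uses that d is small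
      -- against n, and q^e absorbs e³; the rest q⁴ is at most q^e as e ≥ 4. So bounded and growing
      -- d are treated alike.
      cost : n * n * n ≤ q ^ (2 * e)
      cost = begin
          n * n * n ≤⟨ *-mono-≤ (*-mono-≤ n≤ n≤) n≤ ⟩
          c * c * (e * q) * 2 * (c * c * (e * q) * 2) * (c * c * (e * q) * 2) ≡⟨ l c e q ⟩
          (8 * c ^ 6) * (q ^ 3 * e ^ 3) ≤⟨ *-mono-≤ q≥ (*-monoʳ-≤ (q ^ 3) e³) ⟩
          q * (q ^ 3 * q ^ e) ≡⟨ sym (*-assoc q (q ^ 3) (q ^ e)) ⟩
          q ^ 4 * q ^ e ≤⟨ *-monoˡ-≤ (q ^ e) (^-monoʳ-≤ q h4) ⟩
          q ^ e * q ^ e ≡⟨ sym (^-distribˡ-+-* q e e) ⟩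
          q ^ (e + e) ≡⟨ cong (q ^_) (cong (e +_) (sym (+-identityʳ e))) ⟩
          q ^ (2 * e) ∎
        where
        open ≤-Reasoning
        n≤ : n ≤ c * c * (e * q) * 2
        n≤ = ≤-trans (<⇒≤ (proj₂ (proj₂ qq))) (≤-trans (*-mono-≤ (+-monoˡ-≤ q (≤-trans (s≤s z≤n) q≥8)) (*-monoʳ-≤ c h2)) (≤-reflexive (l' q c e)))
          where
          l' : ∀ q c e → (q + q) * (c * (c * e)) ≡ c * c * (e * q) * 2
          l' = solve-∀
        e³ : e ^ 3 ≤ q ^ e
        e³ = ≤-trans (^-monoˡ-≤ 3 (<⇒≤ (n<2^n e))) (≤-trans (≤-reflexive (trans (^-*-assoc 2 e 3)
            (trans (cong (2 ^_) (*-comm e 3)) (sym (^-*-assoc 2 3 e))))) (^-monoˡ-≤ e q≥8))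
        l : ∀ c e q → c * c * (e * q) * 2 * (c * c * (e * q) * 2) * (c * c * (e * q) * 2) ≡ (8 * (c * (c * (c * (c * (c * (c * 1))))))) *
            (q * (q * (q * 1)) * (e * (e * (e * 1))))
        l = solve-∀

    bad-rare : ∀ Bt → Bt ≤ n → Rare d Bt bad
    bad-rare Bt hB = rare-any (els (enumProd (enumFin n) (enumFin n))) cond common (n * n) (≤-trans (S-length (els (enumProd (enumFin n) (enumFin n))) cond)
        (≤-reflexive (trans (length-prod (enumFin n) (enumFin n)) (cong₂ _*_ (length-fins n) (length-fins n)))))
      λ { (u , v) h → rare-≤ (common (u , v)) (≤-trans (*-monoʳ-≤ (n * n) hB) cost) (tail u v (eqF-f (not-t h))) }

  few-common : {G : Gr n} → bad G ≡ false → ∀ u v → u ≢ v → # (λ x → G u x ∧ G v x) < 2 * e + 2 * e * 2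
  few-common {G} h u v k = ≤b-f (¬t→f λ p → t≢f (any-in (enumProd (enumFin n) (enumFin n)) {a = u , v} (∧-i (not-f (eqF-n k)) p)) h)

module Uneven (n d w r : ℕ) where
  cond : (Fin (suc n) × Fin (suc n)) → Bool
  cond (s , a) = (toℕ s ≤b w) ∧ ((1 ≤b toℕ a) ∧ (4 * toℕ a ≤b d))

  even : ℕ → Vec Bool n → Gr n → Bool
  even a S G = off (lk S) a G ≤b 2 * w

  bad : Gr n → Bool
  bad G = any (λ sa → cond sa ∧ any (λ S → (# (lk S) =b toℕ (proj₁ sa)) ∧ even (toℕ (proj₂ sa)) S G) (els (Sets n))) (els (Idx² n))

  module _ (hd : 1 ≤ d) (hn : 16 * (1 + d) ≤ n) (hr : 480 ≤ r) (hw : 60 * r * w ≤ n) (hw' : n ≤ 120 * r * w) (h3 : 3 ≤ w) where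
    private
      instance
        nzr : NonZero r
        nzr = >-nonZero (≤-trans (s≤s z≤n) hr)
      w≤n : w ≤ n
      w≤n = ≤-trans (m≤n*m w (60 * r) {{m*n≢0 60 r}}) hw
      22w : 22 * w ≤ n
      22w = ≤-trans (*-monoˡ-≤ w (≤-trans (m≤m+n 22 38) (m≤m*n 60 r))) hw

      tail : ∀ S a → # (lk S) ≤ w → 1 ≤ a → 4 * a ≤ d → cnt d (even a S) * (r * r) ^ (4 * w) ≤ tot n d
      tail S a hs ha had = off-tail (lk S) a α m (proj₁ (proj₂ sl)) (r * r) (4 * w) (2 * w) hα pos hq
        where
        open ≤-Reasoning
        s = # (lk S)
        -- The 11w consist of w for S, 2w for the exceptions at the start and 8w for the 4w steps of
        -- 2.
        α = n ∸ 11 * w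
        11w≤ : 11 * w ≤ n
        11w≤ = ≤-trans (*-monoˡ-≤ w (m≤m+n 11 11)) 22w
        αe : α + 11 * w ≡ n
        αe = m∸n+n≡m 11w≤
        2α : n ≤ 2 * α
        2α = lin 0 (≤-trans 22w (≤-reflexive (sym αe))) (trans (cong (λ y → y + (α + 11 * w) + 0) (sym αe)) (l α w)) where
          l : ∀ α w → α + 11 * w + (α + 11 * w) + 0 ≡ 22 * w + 2 * α
          l = solve-∀
        hα : α + s + (2 * w + 4 * w * 2) ≤ n
        hα = ≤-trans (+-monoˡ-≤ (2 * w + 4 * w * 2) (+-monoʳ-≤ α hs)) (≤-reflexive (trans (l α w) αe)) where
          l : ∀ α w → α + w + (2 * w + 4 * w * 2) ≡ α + 11 * w
          l = solve-∀
        a≤d : a ≤ d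
        a≤d = ≤-trans (m≤n*m a 4) had
        3d : 3 * d ≤ 4 * (d ∸ a)
        3d = lin 0 had (trans (cong (λ y → 3 * y + y + 0) (sym e)) (l (d ∸ a) a)) where
          e : d ∸ a + a ≡ d
          e = m∸n+n≡m a≤d
          l : ∀ x a → 3 * (x + a) + (x + a) + 0 ≡ 4 * a + 4 * x
          l = solve-∀
        nd : 3 * (n * d) ≤ 8 * (α * (d ∸ a))
        nd = begin
          3 * (n * d) ≡⟨ l n d ⟩
          n * (3 * d) ≤⟨ *-mono-≤ 2α 3d ⟩
          2 * α * (4 * (d ∸ a)) ≡⟨ l' α (d ∸ a) ⟩
          8 * (α * (d ∸ a)) ∎
          where
          l : ∀ n d → 3 * (n * d) ≡ n * (3 * d)
          l = solve-∀
          l' : ∀ α d → 2 * α * (4 * d) ≡ 8 * (α * d)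
          l' = solve-∀
        sl = slack (α * (d ∸ a)) (2 * ((1 + d) * d)) (*-cancelˡ-≤ 8 (begin
          8 * (2 * (2 * ((1 + d) * d))) ≡⟨ l d ⟩
          2 * (16 * (1 + d) * d) ≤⟨ *-monoʳ-≤ 2 (*-monoˡ-≤ d hn) ⟩
          2 * (n * d) ≤⟨ *-monoˡ-≤ (n * d) (n≤1+n 2) ⟩
          3 * (n * d) ≤⟨ nd ⟩
          8 * (α * (d ∸ a)) ∎))
          where
          l : ∀ d → 8 * (2 * (2 * ((1 + d) * d))) ≡ 2 * (16 * (1 + d) * d)
          l = solve-∀
        m = proj₁ sl
        m≥ : 3 * (n * d) ≤ 16 * m
        m≥ = ≤-trans nd (≤-trans (*-monoʳ-≤ 8 (proj₂ (proj₂ sl))) (≤-reflexive (sym (*-assoc 8 2 m))))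
        -- 36 = 2 · 2 · 9 pays for a + 1 ≤ 2a, n ≤ 2α and nd ≤ 9m. On the other side 36 r²(10w)² =
        -- (60rw)² ≤ n², with 10w the final number of exceptions.
        hq : r * r * ((2 * w + 4 * w * 2) * (2 * w + 4 * w * 2) * (d * suc a)) ≤ α * a * m
        hq = *-cancelˡ-≤ 36 (begin
          36 * (r * r * ((2 * w + 4 * w * 2) * (2 * w + 4 * w * 2) * (d * suc a))) ≡⟨ l r w d a ⟩
          (60 * r * w) * (60 * r * w) * (d * suc a) ≤⟨ *-monoˡ-≤ (d * suc a) (*-mono-≤ hw hw) ⟩
          n * n * (d * suc a) ≤⟨ *-monoʳ-≤ (n * n) (*-monoʳ-≤ d (+-monoˡ-≤ a ha)) ⟩
          n * n * (d * (a + a)) ≡⟨ l2 n d a ⟩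
          2 * (n * a * (n * d)) ≤⟨ *-monoʳ-≤ 2 (*-monoˡ-≤ (n * d) (*-monoˡ-≤ a 2α)) ⟩
          2 * (2 * α * a * (n * d)) ≡⟨ l3 α a (n * d) ⟩
          4 * (α * a) * (n * d) ≤⟨ *-monoʳ-≤ (4 * (α * a)) nd9 ⟩
          4 * (α * a) * (9 * m) ≡⟨ l4 (α * a) m ⟩
          36 * (α * a * m) ∎)
          where
          nd9 : n * d ≤ 9 * m
          nd9 = *-cancelˡ-≤ 3 (≤-trans m≥ (≤-trans (*-monoˡ-≤ m (m≤m+n 16 11)) (≤-reflexive (*-assoc 3 9 m))))
          l : ∀ r w d a → 36 * (r * r * ((2 * w + 4 * w * 2) * (2 * w + 4 * w * 2) * (d * suc a))) ≡ (60 * r * w) * (60 * r * w) * (d * suc a)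
          l = solve-∀
          l2 : ∀ n d a → n * n * (d * (a + a)) ≡ 2 * (n * a * (n * d))
          l2 = solve-∀
          l3 : ∀ α a x → 2 * (2 * α * a * x) ≡ 4 * (α * a) * x
          l3 = solve-∀
          l4 : ∀ x m → 4 * x * (9 * m) ≡ 36 * (x * m)
          l4 = solve-∀
        pos2 : ∀ {y k x} → 1 ≤ y → y ≤ k * x → 1 ≤ x
        pos2 {k = k} {zero} p h = ≤-trans p (≤-trans h (≤-reflexive (*-zeroʳ k)))
        pos2 {x = suc x} p h = s≤s z≤n
        n≥1 : 1 ≤ n
        n≥1 = ≤-trans (s≤s z≤n) hn
        pos : 0 < α * a * m
        pos = *-mono-≤ {1} {α * a} {1} (*-mono-≤ {1} {α} {1} (pos2 {k = 2} n≥1 2α) ha)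
          (pos2 {y = 3 * (n * d)} {k = 16} (*-mono-≤ {1} {3} {1} (s≤s z≤n) (*-mono-≤ {1} {n} {1} n≥1 hd)) m≥)

      -- As r ≥ 480 = 4 · 120, 4n ≤ r²w and the binomial is at most r^(2w). The three factors of
      -- size about n cost r^(2 + w) each, and w ≥ 3 brings the total below r^(8w).
      cost : ∀ s Bt → s ≤ w → Bt ≤ n → ch n s * (suc n * suc n * Bt) ≤ (r * r) ^ (4 * w)
      cost s Bt hs hB = begin
          ch n s * (suc n * suc n * Bt) ≤⟨ *-mono-≤ chs (*-mono-≤ (*-mono-≤ nq nq) (≤-trans hB (≤-trans (n≤1+n n) nq))) ⟩
          (r ^ 2) ^ w * (r ^ 2 * r ^ w * (r ^ 2 * r ^ w) * (r ^ 2 * r ^ w)) ≡⟨ cong₂ _*_ (^-*-assoc r 2 w) (l (r ^ 2) (r ^ w)) ⟩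
          r ^ (2 * w) * ((r ^ 2) ^ 3 * (r ^ w) ^ 3) ≡⟨ cong (r ^ (2 * w) *_) (cong₂ _*_ (^-*-assoc r 2 3) (^-*-assoc r w 3)) ⟩
          r ^ (2 * w) * (r ^ 6 * r ^ (w * 3)) ≡⟨ sym (trans (^-distribˡ-+-* r (2 * w) (6 + w * 3)) (cong (r ^ (2 * w) *_) (^-distribˡ-+-* r 6 (w * 3)))) ⟩
          r ^ (2 * w + (6 + w * 3)) ≤⟨ ^-monoʳ-≤ r (≤-trans (+-monoʳ-≤ (2 * w) (+-monoˡ-≤ (w * 3) (*-monoʳ-≤ 2 h3)))
              (≤-trans (≤-reflexive (l2 w)) (*-monoˡ-≤ w (n≤1+n 7)))) ⟩
          r ^ (8 * w) ≡⟨ trans (cong (r ^_) (l5 w)) (trans (sym (^-*-assoc r 2 (4 * w))) (cong (λ y → (r * y) ^ (4 * w)) (*-identityʳ r))) ⟩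
          (r * r) ^ (4 * w) ∎
        where
        open ≤-Reasoning
        l : ∀ x y → x * y * (x * y) * (x * y) ≡ x * (x * (x * 1)) * (y * (y * (y * 1)))
        l = solve-∀
        l2 : ∀ w → 2 * w + (2 * w + w * 3) ≡ 7 * w
        l2 = solve-∀
        l5 : ∀ w → 8 * w ≡ 2 * (4 * w)
        l5 = solve-∀
        rr : ∀ k → k * r * w ≤ k * (r * w)
        rr k = ≤-reflexive (*-assoc k r w)
        r2 : ∀ x → r * (r * x) ≡ r ^ 2 * x
        r2 x = trans (sym (*-assoc r r x)) (cong (λ y → r * y * x) (sym (*-identityʳ r)))
        nq : suc n ≤ r ^ 2 * r ^ w
        nq = begin
          suc n ≤⟨ s≤s (≤-trans hw' (rr 120)) ⟩
          1 + 120 * (r * w) ≤⟨ +-monoˡ-≤ (120 * (r * w)) (*-mono-≤ {1} {r} {1} {w} (≤-trans (s≤s z≤n) hr) (≤-trans (s≤s z≤n) h3)) ⟩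
          121 * (r * w) ≤⟨ *-monoˡ-≤ (r * w) (≤-trans (m≤m+n 121 359) hr) ⟩
          r * (r * w) ≡⟨ r2 w ⟩
          r ^ 2 * w ≤⟨ *-monoʳ-≤ (r ^ 2) (b≤q^b r w (≤-trans (s≤s (s≤s z≤n)) hr)) ⟩
          r ^ 2 * r ^ w ∎
        chs : ch n s ≤ (r ^ 2) ^ w
        chs = *-cancelʳ-≤ _ _ (w ^ w) {{m^n≢0 w w {{>-nonZero (≤-trans (s≤s z≤n) h3)}}}} (≤-trans (ch-bound n s w hs w≤n)
          (≤-trans (^-monoˡ-≤ w (≤-trans (*-monoʳ-≤ 4 (≤-trans hw' (rr 120))) (≤-trans (≤-reflexive (sym (*-assoc 4 120 (r * w))))
              (≤-trans (*-monoˡ-≤ (r * w) hr) (≤-reflexive (r2 w))))))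
            (≤-reflexive (*-^ (r ^ 2) w w))))

    bad-rare : ∀ Bt → Bt ≤ n → Rare d Bt bad
    bad-rare Bt hB = rare-any (els (Idx² n)) cond _ (suc n * suc n) (≤-trans (S-length (els (Idx² n)) cond) (≤-reflexive (length-Idx² n)))
      λ { (s' , a') e → let e1 = ∧-r {a = toℕ s' ≤b w} e in
        rare-any (els (Sets n)) (λ S → # (lk S) =b toℕ s') (even (toℕ a')) (ch n (toℕ s')) (≤-reflexive (Sets-size n (toℕ s')))
          λ S f → rare-≤ (even (toℕ a') S) (cost (toℕ s') Bt (≤b-t (∧-l {toℕ s' ≤b w} e)) hB)
             (tail S (toℕ a') (≤-trans (≤-reflexive (=b-t f)) (≤b-t (∧-l {toℕ s' ≤b w} e))) (≤b-t (∧-l {1 ≤b toℕ a'} e1)) (≤b-t (∧-r {a = 1 ≤b toℕ a'} e1))) }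

  uneven : {G : Gr n} → bad G ≡ false → ∀ S a → # S ≤ w → 1 ≤ a → 4 * a ≤ d → a ≤ n → 2 * w < off S a G
  uneven {G} h S a hs ha had han = ≤b-f (¬t→f λ p → t≢f (ev p) h)
    where
    sF = toFin (#≤n S)
    aF = toFin han
    es = toℕ-toFin (#≤n S)
    ea = toℕ-toFin han
    offs : off (lk (ofSet S)) a G ≡ off S a G
    offs = #-cong λ u → cong (λ y → not (y =b a)) (#-cong λ x → cong (_∧ G u x) (lk-of S x))
    ev : (off S a G ≤b 2 * w) ≡ true → bad G ≡ true
    ev p = any-in (Idx² n) {a = sF , aF} (∧-i c (any-in (Sets n) {a = ofSet S} i))
      where
      c : cond (sF , aF) ≡ true
      c rewrite es | ea = ∧-i (≤b-i hs) (∧-i (≤b-i ha) (≤b-i had))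
      i : (# (lk (ofSet S)) =b toℕ sF) ∧ even (toℕ aF) (ofSet S) G ≡ true
      i rewrite es | ea = ∧-i (=b-i (#-cong (lk-of S))) (≤b-i (≤-trans (≤-reflexive offs) (≤b-t p)))

single : Fin n → Fin n → Bool
single v x = eqF x v

outside : Gr n → (Fin n → Bool) → ℕ → ℕ
outside G A t = # (λ x → not (grow G A t x))

module Far (n d K Z k : ℕ) where
  cond : Fin n × Fin (suc (2 * n)) → Bool
  cond _ = true

  swallow : Fin n × Fin (suc (2 * n)) → Gr n → Bool
  swallow (v , t) G = (Z ≤b outside G (single v) (suc (toℕ t))) ∧ (outside G (single v) (suc (suc (toℕ t))) ≤b k)

  idx : Enum (Fin n × Fin (suc (2 * n)))
  idx = enumProd (enumFin n) (enumFin (suc (2 * n)))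

  bad : Gr n → Bool
  bad G = any (λ x → cond x ∧ swallow x G) (els idx)

  module _ (hd : 1 ≤ d) (hZ : n ≤ 2 * (K * Z)) (h4 : 4 * (1 + d) ≤ Z)
      (hk : 2 * ((1 + 4 * (K * d)) ^ d * (k + k * (d * 2))) ≤ Z) (h2 : 2 * suc n ^ 3 ≤ 2 ^ k) where
    private
      l0 : ∀ d → 2 * (2 * ((1 + d) * d)) ≡ 4 * (1 + d) * d
      l0 = solve-∀
      sl = slack (Z * d) (2 * ((1 + d) * d)) (≤-trans (≤-reflexive (l0 d)) (*-monoˡ-≤ d h4))
      m = proj₁ sl
      Z≥1 : 1 ≤ Z
      Z≥1 = ≤-trans (s≤s z≤n) h4
      m≥1 : 1 ≤ m
      m≥1 = pos2 (*-mono-≤ {1} {Z} {1} {d} Z≥1 hd) (proj₂ (proj₂ sl)) where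
        pos2 : ∀ {y x} → 1 ≤ y → y ≤ 2 * x → 1 ≤ x
        pos2 {x = zero} p k = ≤-trans p k
        pos2 {x = suc x} p k = s≤s z≤n
      -- By n ≤ 2KZ and Zd ≤ 2m one switching costs at most the factor 1 + 4Kd, whatever n is.
      hκ : d * (n * d) ≤ m * (4 * (K * d))
      hκ = ≤-trans (*-monoʳ-≤ d (*-monoˡ-≤ d hZ)) (≤-trans (≤-reflexive (l d K Z)) (≤-trans (*-monoʳ-≤ (2 * (K * d)) (proj₂ (proj₂ sl))) (≤-reflexive (l' K d m))))
        where
        l : ∀ d K Z → d * (2 * (K * Z) * d) ≡ 2 * (K * d) * (Z * d)
        l = solve-∀
        l' : ∀ K d m → 2 * (K * d) * (2 * m) ≡ m * (4 * (K * d))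
        l' = solve-∀

    bad-rare : ∀ Bt → Bt ≤ n → Rare d Bt bad
    bad-rare Bt hB = rare-any (els idx) cond swallow (n * suc (2 * n)) (≤-trans (S-length (els idx) cond)
        (≤-reflexive (trans (length-prod (enumFin n) (enumFin (suc (2 * n)))) (cong₂ _*_ (length-fins n) (length-fins (suc (2 * n)))))))
      λ { (v , t) _ → rare-≤ (swallow (v , t)) le (Escape.stuck-tail {n} {d} (single v) (toℕ t) Z m (4 * (K * d)) (proj₁ (proj₂ sl)) m≥1 hκ k k Z≥1 hk) }
      where
      le : n * suc (2 * n) * Bt ≤ 2 ^ k
      le = ≤-trans (*-mono-≤ (*-mono-≤ (n≤1+n n) (s≤s (≤-trans (n≤1+n (2 * n)) (≤-reflexive (l₁ n))))) (≤-trans hB (n≤1+n n))) (≤-trans (≤-reflexive (l (suc n))) h2)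
        where
        l₁ : ∀ n → suc (2 * n) ≡ n + suc (n + 0)
        l₁ = solve-∀
        l : ∀ x → x * (x + (x + 0)) * x ≡ 2 * (x * (x * (x * 1)))
        l = solve-∀

  far : {G : Gr n} → bad G ≡ false → ∀ v t → t ≤ 2 * n → Z ≤ outside G (single v) (suc t) → k < outside G (single v) (suc (suc t))
  far {G} e v t ht h = ≤b-f (¬t→f λ p → t≢f (any-in idx {a = v , toFin ht} (ev p)) e)
    where
    ev : (outside G (single v) (suc (suc t)) ≤b k) ≡ true → cond (v , toFin ht) ∧ swallow (v , toFin ht) G ≡ true
    ev p rewrite toℕ-toFin ht = ∧-i (≤b-i h) p

-- A set of pairs is encoded by labelling the vertices at both ends and a table of admissible label pairs,
-- so that the number of encoded sets is exponential in n with a base depending only on the numbers of labels.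
module Labelled (n d L L' P q k₀ : ℕ) where
  Idx : Set
  Idx = (Vec (Fin (suc L)) n × Vec (Fin L') n) × Vec (Vec Bool L') (suc L)

  idx : Enum Idx
  idx = enumProd (enumProd (enumVec (enumFin (suc L)) n) (enumVec (enumFin L') n)) (enumVec (enumVec enumBool L') (suc L))

  -- The sources of the encoded pairs; label zero marks a vertex that is not a source.
  Q : Idx → Fin n → Bool
  Q ((lab , lab') , tab) a = not (eqF (lookup lab a) Fin.zero)

  E : Idx → Fin n → Fin n → Bool
  E ((lab , lab') , tab) a z = lookup (lookup tab (lookup lab a)) (lookup lab' z)

  cond : Idx → Bool
  cond i = (E2 (E i) * (4 * q) ≤b # (Q i) * n) ∧ (n ≤b P * # (Q i))

  fits : Idx → Gr n → Bool
  fits i G = d * # (Q i) ≤b eOn (E i) G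

  bad : Gr n → Bool
  bad G = any (λ i → cond i ∧ fits i G) (els idx)

  module _ (hd : 1 ≤ d) (hn : 4 * (1 + d) ≤ n) (hk₀ : 8 * (k₀ * P) ≤ d) (hq : 4 * (L' * suc L) ≤ q ^ k₀) (hL : L' * suc L ≤ n) where
    private
      l0 : ∀ d → 2 * (2 * ((1 + d) * d)) ≡ 4 * (1 + d) * d
      l0 = solve-∀
      sl = slack (n * d) (2 * ((1 + d) * d)) (≤-trans (≤-reflexive (l0 d)) (*-monoˡ-≤ d hn))
      m = proj₁ sl
      n≥1 : 1 ≤ n
      n≥1 = ≤-trans (s≤s z≤n) hn
      pos2 : ∀ {y x} → 1 ≤ y → y ≤ 2 * x → 1 ≤ x
      pos2 {x = zero} p k = ≤-trans p k
      pos2 {x = suc x} p k = s≤s z≤n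
      k = n * k₀

      -- The nk₀ steps of 4 keep the count above half of d|Q|, since 8k₀P ≤ d and |Q| ≥ n/P. Each
      -- gains q because E has at most |Q|n/(4q) pairs.
      tail : ∀ i → E2 (E i) * (4 * q) ≤ # (Q i) * n → n ≤ P * # (Q i) → cnt d (fits i) * q ^ k ≤ tot n d
      tail i h1 h2 = subst (λ y → cnt d (λ G → y ≤b eOn (E i) G) * q ^ k ≤ tot n d) fk
          (upper-tail (E i) m (proj₁ (proj₂ sl)) f q k (*-mono-≤ {1} {f} {1} {m} f≥1 m≥1) (*-cancelˡ-≤ 4 (begin
            4 * (q * (E2 (E i) * (d * d))) ≡⟨ l1 q (E2 (E i)) d ⟩
            E2 (E i) * (4 * q) * (d * d) ≤⟨ *-monoˡ-≤ (d * d) h1 ⟩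
            s * n * (d * d) ≡⟨ l2 s n d ⟩
            (d * s) * (n * d) ≤⟨ *-mono-≤ 2f (proj₂ (proj₂ sl)) ⟩
            (2 * f) * (2 * m) ≡⟨ l3 f m ⟩
            4 * (f * m) ∎)))
        where
        open ≤-Reasoning
        s = # (Q i)
        f = d * s ∸ k * 4
        pos3 : ∀ {P s} → 1 ≤ P * s → 1 ≤ s
        pos3 {P} {suc s} _ = s≤s z≤n
        pos3 {P} {zero} h = ⊥-elim (1+n≰n (≤-trans h (≤-reflexive (*-zeroʳ P))))
        s≥1 = pos3 {P} {s} (≤-trans n≥1 h2)
        4≤8 : k * 4 + k * 4 ≤ d * s
        4≤8 = ≤-trans (≤-reflexive (l4 n k₀)) (≤-trans (*-monoˡ-≤ (8 * k₀) h2) (≤-trans (≤-reflexive (l5 P s k₀)) (*-monoˡ-≤ s hk₀))) where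
          l4 : ∀ n k → n * k * 4 + n * k * 4 ≡ n * (8 * k)
          l4 = solve-∀
          l5 : ∀ P s k → P * s * (8 * k) ≡ 8 * (k * P) * s
          l5 = solve-∀
        fk : f + k * 4 ≡ d * s
        fk = m∸n+n≡m (≤-trans (m≤m+n (k * 4) (k * 4)) 4≤8)
        2f : d * s ≤ 2 * f
        2f = ≤-trans (≤-reflexive (sym fk)) (+-monoʳ-≤ f (≤-trans (+-cancelʳ-≤ (k * 4) _ _ (≤-trans 4≤8 (≤-reflexive (sym fk))))
            (≤-reflexive (sym (+-identityʳ f)))))
        f≥1 : 1 ≤ f
        f≥1 = pos2 (*-mono-≤ {1} {d} {1} hd s≥1) 2f
        m≥1 : 1 ≤ m
        m≥1 = pos2 (*-mono-≤ {1} {n} {1} {d} n≥1 hd) (proj₂ (proj₂ sl))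
        l1 : ∀ q e d → 4 * (q * (e * (d * d))) ≡ e * (4 * q) * (d * d)
        l1 = solve-∀
        l2 : ∀ s n d → s * n * (d * d) ≡ (d * s) * (n * d)
        l2 = solve-∀
        l3 : ∀ f m → (2 * f) * (2 * m) ≡ 4 * (f * m)
        l3 = solve-∀

    bad-rare : ∀ Bt → Bt ≤ n → Rare d Bt bad
    bad-rare Bt hB = rare-any (els idx) cond fits (suc L ^ n * L' ^ n * (2 ^ L') ^ suc L) (≤-trans (S-length (els idx) cond) (≤-reflexive len))
      λ i e → rare-≤ (fits i) le (tail i (≤b-t (∧-l {E2 (E i) * (4 * q) ≤b # (Q i) * n} e)) (≤b-t (∧-r {a = E2 (E i) * (4 * q) ≤b # (Q i) * n} e)))
      where
      len : length (els idx) ≡ suc L ^ n * L' ^ n * (2 ^ L') ^ suc L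
      len = trans (length-prod (enumProd (enumVec (enumFin (suc L)) n) (enumVec (enumFin L') n)) (enumVec (enumVec enumBool L') (suc L))) (cong₂ _*_
        (trans (length-prod (enumVec (enumFin (suc L)) n) (enumVec (enumFin L') n)) (cong₂ _*_
          (trans (length-allVec n (fins (suc L))) (cong (_^ n) (length-fins (suc L))))
          (trans (length-allVec n (fins L')) (cong (_^ n) (length-fins L')))))
        (trans (length-allVec (suc L) (allVec L' (true ∷ false ∷ []))) (cong (_^ suc L) (length-allVec L' (true ∷ false ∷ [])))))
      -- There are at most 2^n tables by `hL`, and `Bt` is at most 2^n: together the factor 4 per
      -- vertex in `hq`.
      le : suc L ^ n * L' ^ n * (2 ^ L') ^ suc L * Bt ≤ q ^ k
      le = begin
          suc L ^ n * L' ^ n * (2 ^ L') ^ suc L * Bt ≤⟨ *-mono-≤ (*-monoʳ-≤ (suc L ^ n * L' ^ n)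
              (≤-trans (≤-reflexive (^-*-assoc 2 L' (suc L))) (^-monoʳ-≤ 2 hL))) (≤-trans hB (<⇒≤ (n<2^n n))) ⟩
          suc L ^ n * L' ^ n * 2 ^ n * 2 ^ n ≡⟨ sym (trans (*-^ (suc L * L' * 2) 2 n)
              (cong (_* 2 ^ n) (trans (*-^ (suc L * L') 2 n) (cong (_* 2 ^ n) (*-^ (suc L) L' n))))) ⟩
          (suc L * L' * 2 * 2) ^ n ≤⟨ ^-monoˡ-≤ n (≤-trans (≤-reflexive (l (suc L) L')) hq) ⟩
          (q ^ k₀) ^ n ≡⟨ ^-*-assoc q k₀ n ⟩
          q ^ (k₀ * n) ≡⟨ cong (q ^_) (*-comm k₀ n) ⟩
          q ^ k ∎
        where
        open ≤-Reasoning
        l : ∀ x y → x * y * 2 * 2 ≡ 4 * (y * x)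
        l = solve-∀

  labelled : {G : Gr n} → bad G ≡ false → (lab : Fin n → Fin (suc L)) (lab' : Fin n → Fin L') (tab : Fin (suc L) → Fin L' → Bool) →
    let Qf = λ a → not (eqF (lab a) Fin.zero) ; Ef = λ a z → tab (lab a) (lab' z) in
    E2 Ef * (4 * q) ≤ # Qf * n → n ≤ P * # Qf → d * # Qf ≤ eOn Ef G → ⊥
  labelled {G} e lab lab' tab h1 h2 h3 = t≢f (any-in idx {a = i} (∧-i (∧-i (≤b-i h1') (≤b-i h2')) (≤b-i h3'))) e
    where
    i : Idx
    i = (tabulate lab , tabulate lab') , tabulate (λ x → tabulate (tab x))
    Ee : ∀ a z → E i a z ≡ tab (lab a) (lab' z)
    Ee a z rewrite lookup∘tabulate lab a | lookup∘tabulate lab' z | lookup∘tabulate (λ x → tabulate (tab x)) (lab a) = lookup∘tabulate (tab (lab a)) (lab' z)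
    Qe : # (Q i) ≡ # (λ a → not (eqF (lab a) Fin.zero))
    Qe = #-cong λ a → cong (λ y → not (eqF y Fin.zero)) (lookup∘tabulate lab a)
    h1' : E2 (E i) * (4 * q) ≤ # (Q i) * n
    h1' = subst₂ (λ x y → x * (4 * q) ≤ y * n) (sym (S-cong (fins n) λ a → #-cong (Ee a))) (sym Qe) h1
    h2' : n ≤ P * # (Q i)
    h2' = subst (λ y → n ≤ P * y) (sym Qe) h2
    h3' : d * # (Q i) ≤ eOn (E i) G
    h3' = subst₂ (λ x y → d * x ≤ y) (sym Qe) (sym (S-cong (fins n) λ a → #-cong λ z → cong (_∧ G a z) (Ee a z))) h3

-- Balanced pairings are rare.

opaque
  unfolding fins
  fins-unique : ∀ n → Unique (fins n)
  fins-unique n = Uniqueₚ.allFin⁺ n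

pairUp : List 𝕀 → List (𝕀 × 𝕀)
pairUp (x ∷ y ∷ r) = (x , y) ∷ pairUp r
pairUp _ = []

pairUp-All : {P : 𝕀 → Set} {xs : List 𝕀} → All P xs → All (λ p → P (proj₁ p) × P (proj₂ p)) (pairUp xs)
pairUp-All [] = []
pairUp-All (p ∷ []) = []
pairUp-All (p ∷ q ∷ ps) = (p , q) ∷ pairUp-All ps

Disj : 𝕀 × 𝕀 → 𝕀 × 𝕀 → Set
Disj (u , v) (u' , v') = (u ≢ u' × u ≢ v') × (v ≢ u' × v ≢ v')

pairUp-Disj : {xs : List 𝕀} → Unique xs → AllPairs Disj (pairUp xs)
pairUp-Disj [] = []
pairUp-Disj (_ ∷ []) = []
pairUp-Disj {xs = x ∷ y ∷ r} ((_ ∷ xr) ∷ (yr ∷ u)) =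
  All.map (λ { ((a , b) , (c , e)) → (a , c) , (b , e) }) (pairUp-All (All.zip (xr , yr))) ∷ pairUp-Disj u

pairUp-≢ : {xs : List 𝕀} → Unique xs → All (λ p → proj₁ p ≢ proj₂ p) (pairUp xs)
pairUp-≢ [] = []
pairUp-≢ (_ ∷ []) = []
pairUp-≢ ((k ∷ _) ∷ (_ ∷ u)) = k ∷ pairUp-≢ u

pairUp-length : (xs : List 𝕀) → length xs ≤ 2 * length (pairUp xs) + 1
pairUp-length [] = z≤n
pairUp-length (x ∷ []) = ≤-refl
pairUp-length (x ∷ y ∷ r) = ≤-trans (s≤s (s≤s (pairUp-length r))) (≤-reflexive (l (length (pairUp r)))) where
  l : ∀ a → 2 + (2 * a + 1) ≡ 2 * suc a + 1
  l = solve-∀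

-- lab is 0 at unused vertices and otherwise names the group in which a vertex is paired off; half marks the vertices
-- serving as targets, and grp assigns to a target one of the g pairs (A , B) of sets and a side of it.
module Exchangeable (n d ℓ g P p e : ℕ) where
  Idx : Set
  Idx = Vec (Fin (suc ℓ)) n × (Vec (Fin g × Bool) n × Vec Bool n)

  idx : Enum Idx
  idx = enumProd (enumVec (enumFin (suc ℓ)) n) (enumProd (enumVec (enumProd (enumFin g) enumBool) n) (enumVec enumBool n))

  module Fam (lab : Fin n → Fin (suc ℓ)) (grp : Fin n → Fin g × Bool) (half : Fin n → Bool) where
    A B : Fin g → Fin n → Bool
    A h x = half x ∧ (eqF (proj₁ (grp x)) h ∧ proj₂ (grp x))
    B h x = half x ∧ (eqF (proj₁ (grp x)) h ∧ not (proj₂ (grp x)))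

    Q : Fin ℓ → Fin n → Bool
    Q i x = not (half x) ∧ eqF (lab x) (Fin.suc i)

    Q' : Fin n → Bool
    Q' x = not (half x) ∧ not (eqF (lab x) Fin.zero)

    cls : Fin ℓ → List (Fin n)
    cls i = filter (λ x → T? (Q i x)) (fins n)

    ps : List (Fin n × Fin n)
    ps = concatMap (λ i → pairUp (cls i)) (fins ℓ)

    cs : List ((Fin n × Fin n) × Fin g)
    cs = concatMap (λ p → map (p ,_) (fins g)) ps

    A-grp : ∀ h x → A h x ≡ true → proj₁ (grp x) ≡ h × proj₂ (grp x) ≡ true × half x ≡ true
    A-grp h x e = eqF-t (∧-l (∧-r {a = half x} e)) , ∧-r {a = eqF (proj₁ (grp x)) h} (∧-r {a = half x} e) , ∧-l {half x} e

    B-grp : ∀ h x → B h x ≡ true → proj₁ (grp x) ≡ h × proj₂ (grp x) ≡ false × half x ≡ true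
    B-grp h x e = eqF-t (∧-l (∧-r {a = half x} e)) , not-t (∧-r {a = eqF (proj₁ (grp x)) h} (∧-r {a = half x} e)) , ∧-l {half x} e

    module PP = Pairs {n} {g} A B
      (λ h h' x a b → t≢f (proj₁ (proj₂ (A-grp h x a))) (proj₁ (proj₂ (B-grp h' x b))))
      (λ h h' x a b → trans (sym (proj₁ (A-grp h x a))) (proj₁ (A-grp h' x b)))
      (λ h h' x a b → trans (sym (proj₁ (B-grp h x a))) (proj₁ (B-grp h' x b))) (p ^ e)

    cls-Q : ∀ i → All (λ x → Q i x ≡ true) (cls i)
    cls-Q i = All.map (λ {x} t → T-t t) (Allₚ.all-filter (λ x → T? (Q i x)) (fins n)) where
      T-t : ∀ {b} → T b → b ≡ true
      T-t {true} _ = refl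

    cls-unique : ∀ i → Unique (cls i)
    cls-unique i = Uniqueₚ.filter⁺ (λ x → T? (Q i x)) (fins-unique n)

    Good-pair : Fin n × Fin n → Set
    Good-pair (u , v) = u ≢ v × ∃ λ i → Q i u ≡ true × Q i v ≡ true

    ps-good : All Good-pair ps
    ps-good = Allₚ.concat⁺ (Allₚ.map⁺ (All.universal (λ i → All.zipWith (λ { (k , (a , b)) → k , i , a , b })
      (pairUp-≢ (cls-unique i) , pairUp-All (cls-Q i))) (fins ℓ)))

    Q-lab : ∀ {i x} → Q i x ≡ true → lab x ≡ Fin.suc i
    Q-lab {i} {x} q = eqF-t (∧-r {a = not (half x)} q)

    Q-sep : ∀ {i j x y} → i ≢ j → Q i x ≡ true → Q j y ≡ true → x ≢ y
    Q-sep {i} {j} {x} k qx qy refl = k (Finₚ.suc-injective (trans (sym (Q-lab {i} {x} qx)) (Q-lab {j} {x} qy)))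

    ps-disj : AllPairs Disj ps
    ps-disj = AllPairsₚ.concat⁺ (Allₚ.map⁺ (All.universal (λ i → pairUp-Disj (cls-unique i)) (fins ℓ)))
      (AllPairsₚ.map⁺ (AllPairs.map (λ {i} {j} k → All.map (λ { (a , b) → All.map (λ { (a' , b') →
        (Q-sep k a a' , Q-sep k a b') , (Q-sep k b a' , Q-sep k b b') }) (pairUp-All (cls-Q j)) }) (pairUp-All (cls-Q i))) (fins-unique ℓ)))

    cs-sep : AllPairs PP.Sep cs
    cs-sep = AllPairsₚ.concat⁺ (Allₚ.map⁺ (All.universal (λ p → AllPairsₚ.map⁺ (AllPairs.map inj₁ (fins-unique g))) ps))
      (AllPairsₚ.map⁺ (AllPairs.map (λ D → Allₚ.map⁺ (All.universal (λ h → Allₚ.map⁺ (All.universal (λ h' → inj₂ D) (fins g))) (fins g))) ps-disj))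

    Q-out : ∀ i x → Q i x ≡ true → PP.Outside x
    Q-out i x q h = cong (λ b → b ∧ (eqF (proj₁ (grp x)) h ∧ proj₂ (grp x))) (not-t (∧-l {not (half x)} q)) , cong
        (λ b → b ∧ (eqF (proj₁ (grp x)) h ∧ not (proj₂ (grp x)))) (not-t (∧-l {not (half x)} q))

    cs-ok : All PP.Ok cs
    cs-ok = Allₚ.concat⁺ (Allₚ.map⁺ (All.map (λ { {u , v} (_ , i , a , b) → Allₚ.map⁺ (All.universal (λ h → Q-out i u a , Q-out i v b) (fins g)) }) ps-good))

    cs-length : length cs ≡ length ps * g
    cs-length = trans (length-concatMap (λ p → map (p ,_) (fins g)) ps) (trans (S-cong ps (λ p → trans (length-map (p ,_) (fins g)) (length-fins g))) (S-const ps g))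

    -- Pairing off leaves at most one vertex over in each of the ℓ groups.
    ps-length : # Q' ≤ 2 * length ps + ℓ
    ps-length = begin
        # Q' ≤⟨ S-mono (fins n) wit ⟩
        ∑ (λ x → S (fins ℓ) (λ i → ⟦ Q i x ⟧)) ≡⟨ S-swap (fins n) (fins ℓ) _ ⟩
        S (fins ℓ) (λ i → # (Q i)) ≡⟨ S-cong (fins ℓ) (λ i → sym (length-filter-S (Q i) (fins n))) ⟩
        S (fins ℓ) (λ i → length (cls i)) ≤⟨ S-mono (fins ℓ) (λ i → pairUp-length (cls i)) ⟩
        S (fins ℓ) (λ i → 2 * length (pairUp (cls i)) + 1) ≡⟨ S-+ (fins ℓ) _ _ ⟩
        S (fins ℓ) (λ i → 2 * length (pairUp (cls i))) + S (fins ℓ) (λ i → 1) ≡⟨ cong₂ _+_ (S-* (fins ℓ) 2 _)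
            (trans (S-const (fins ℓ) 1) (trans (*-identityʳ _) (length-fins ℓ))) ⟩
        2 * S (fins ℓ) (λ i → length (pairUp (cls i))) + ℓ ≡⟨ cong (λ y → 2 * y + ℓ) (sym (length-concatMap (λ i → pairUp (cls i)) (fins ℓ))) ⟩
        2 * length ps + ℓ ∎
      where
      open ≤-Reasoning
      wit : ∀ x → ⟦ Q' x ⟧ ≤ S (fins ℓ) (λ i → ⟦ Q i x ⟧)
      wit x with half x | lab x
      ... | true | _ = z≤n
      ... | false | Fin.zero = z≤n
      ... | false | Fin.suc i = ≤-trans (≤-reflexive (cong ⟦_⟧ (sym (eqF-r (Fin.suc i))))) (f≤∑ (λ j → ⟦ eqF (Fin.suc i) (Fin.suc j) ⟧) i)

  labf : Idx → Fin n → Fin (suc ℓ)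
  labf i = lookup (proj₁ i)
  grpf : Idx → Fin n → Fin g × Bool
  grpf i = lookup (proj₁ (proj₂ i))
  halff : Idx → Fin n → Bool
  halff i = lookup (proj₂ (proj₂ i))

  cond : Idx → Bool
  cond i = n ≤b P * # (Fam.Q' (labf i) (grpf i) (halff i))

  balanced : Idx → Gr n → Bool
  balanced i G = all (λ c → Fam.PP.con (labf i) (grpf i) (halff i) c G) (Fam.cs (labf i) (grpf i) (halff i))

  bad : Gr n → Bool
  bad G = any (λ i → cond i ∧ balanced i G) (els idx)

  module _ (c₀ : ℕ) (hp : 1 ≤ p) (hℓ : 2 * (ℓ * P) ≤ n) (hc : 4 * (P * c₀) ≤ e * g) (h8 : 8 * (g * suc ℓ) ≤ p ^ c₀) where
    -- A vertex has (ℓ + 1) · 2g · 2 codings, and another factor 2 covers `Bt`: this is 8g(ℓ + 1).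
    -- In return at least n/(4P) pairs with g constraints each gain p^e apiece, so eg ≥ 4P`c₀`
    -- suffices. Either e or g can be the large parameter; a large g leaves the thresholds `Lq` low.
    bad-rare : ∀ Bt → Bt ≤ n → Rare d Bt bad
    bad-rare Bt hB = rare-any (els idx) cond balanced (suc ℓ ^ n * ((g * 2) ^ n * 2 ^ n)) (≤-trans (S-length (els idx) cond) (≤-reflexive len))
      λ i h → rare-≤ (balanced i) (≤-trans cost (gain i (≤b-t h))) (Fam.PP.pairs-bound (labf i) (grpf i) (halff i) _
          (Fam.cs-ok (labf i) (grpf i) (halff i)) (Fam.cs-sep (labf i) (grpf i) (halff i)))
      where
      instance
        nzp : NonZero p
        nzp = >-nonZero hp
      len : length (els idx) ≡ suc ℓ ^ n * ((g * 2) ^ n * 2 ^ n)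
      len = trans (length-prod (enumVec (enumFin (suc ℓ)) n) (enumProd (enumVec (enumProd (enumFin g) enumBool) n) (enumVec enumBool n))) (cong₂ _*_
        (trans (length-allVec n (fins (suc ℓ))) (cong (_^ n) (length-fins (suc ℓ))))
        (trans (length-prod (enumVec (enumProd (enumFin g) enumBool) n) (enumVec enumBool n)) (cong₂ _*_
          (trans (length-allVec n (els (enumProd (enumFin g) enumBool))) (cong (_^ n) (trans (length-prod (enumFin g) enumBool) (cong (_* 2) (length-fins g)))))
          (length-allVec n (true ∷ false ∷ [])))))
      cost : suc ℓ ^ n * ((g * 2) ^ n * 2 ^ n) * Bt ≤ p ^ (c₀ * n)
      cost = begin
          suc ℓ ^ n * ((g * 2) ^ n * 2 ^ n) * Bt ≤⟨ *-monoʳ-≤ (suc ℓ ^ n * ((g * 2) ^ n * 2 ^ n)) (≤-trans hB (<⇒≤ (n<2^n n))) ⟩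
          suc ℓ ^ n * ((g * 2) ^ n * 2 ^ n) * 2 ^ n ≡⟨ sym (trans (*-^ (suc ℓ * (g * 2 * 2)) 2 n)
              (cong (_* 2 ^ n) (trans (*-^ (suc ℓ) (g * 2 * 2) n) (cong (suc ℓ ^ n *_) (*-^ (g * 2) 2 n))))) ⟩
          (suc ℓ * (g * 2 * 2) * 2) ^ n ≤⟨ ^-monoˡ-≤ n (≤-trans (≤-reflexive (l (suc ℓ) g)) h8) ⟩
          (p ^ c₀) ^ n ≡⟨ ^-*-assoc p c₀ n ⟩
          p ^ (c₀ * n) ∎
        where
        open ≤-Reasoning
        l : ∀ x g → x * (g * 2 * 2) * 2 ≡ 8 * (g * x)
        l = solve-∀
      gain : ∀ i → n ≤ P * # (Fam.Q' (labf i) (grpf i) (halff i)) → p ^ (c₀ * n) ≤ (p ^ e) ^ length (Fam.cs (labf i) (grpf i) (halff i))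
      gain i h = ≤-trans (^-monoʳ-≤ p (≤-trans c≤ (≤-reflexive (cong (e *_) (sym (Fam.cs-length (labf i) (grpf i) (halff i)))))))
          (≤-reflexive (sym (^-*-assoc p e _)))
        where
        t = length (Fam.ps (labf i) (grpf i) (halff i))
        n≤ : n ≤ 4 * (P * t)
        n≤ = +-cancelʳ-≤ n n _ (≤-trans (≤-reflexive (cong (n +_) (sym (+-identityʳ n))))
            (≤-trans (*-monoʳ-≤ 2 (≤-trans h (*-monoʳ-≤ P (Fam.ps-length (labf i) (grpf i) (halff i)))))
             (≤-trans (≤-reflexive (l P t ℓ)) (+-monoʳ-≤ (4 * (P * t)) hℓ))))
          where
          l : ∀ P t ℓ → 2 * (P * (2 * t + ℓ)) ≡ 4 * (P * t) + 2 * (ℓ * P)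
          l = solve-∀
        c≤ : c₀ * n ≤ e * (t * g)
        c≤ = ≤-trans (*-monoʳ-≤ c₀ n≤) (≤-trans (≤-reflexive (l c₀ P t)) (≤-trans (*-monoˡ-≤ t hc) (≤-reflexive (l' e g t))))
          where
          l : ∀ c P t → c * (4 * (P * t)) ≡ 4 * (P * c) * t
          l = solve-∀
          l' : ∀ e g t → e * g * t ≡ e * (t * g)
          l' = solve-∀

  Lq : ℕ
  Lq = 7 * ((4 * (p ^ e) + 4 * (p ^ e)) * (4 * (p ^ e) + 4 * (p ^ e)))

  exchangeable : {G : Gr n} → bad G ≡ false → (lab : Fin n → Fin (suc ℓ)) (grp : Fin n → Fin g × Bool) (half : Fin n → Bool) →
    let open Fam lab grp half in n ≤ P * # Q' →
    (∀ i u v h → u ≢ v → Q i u ≡ true → Q i v ≡ true → (mx (A h) v u G ≡ mx (A h) u v G) × (Lq ≤ mx (A h) u v G) × (Lq ≤ mx (B h) u v G)) → ⊥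
  exchangeable {G} e lab grp half hQ hc = t≢f (any-in idx {a = i} (∧-i (≤b-i (≤-trans hQ (*-monoʳ-≤ P (≤-reflexive (#-cong λ x →
      sym (cong₂ (λ b c → not b ∧ not (eqF c Fin.zero)) (lookup∘tabulate half x) (lookup∘tabulate lab x))))))) bal)) e
    where
    i : Idx
    i = tabulate lab , tabulate grp , tabulate half
    module F = Fam (labf i) (grpf i) (halff i)
    module F₀ = Fam lab grp half
    QQ : ∀ j x → F.Q j x ≡ true → F₀.Q j x ≡ true
    QQ j x q = trans (sym (cong₂ (λ b c → not b ∧ eqF c (Fin.suc j)) (lookup∘tabulate half x) (lookup∘tabulate lab x))) q
    AA : ∀ h x → F.A h x ≡ F₀.A h x
    AA h x = cong₂ (λ b c → b ∧ (eqF (proj₁ c) h ∧ proj₂ c)) (lookup∘tabulate half x) (lookup∘tabulate grp x)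
    BB : ∀ h x → F.B h x ≡ F₀.B h x
    BB h x = cong₂ (λ b c → b ∧ (eqF (proj₁ c) h ∧ not (proj₂ c))) (lookup∘tabulate half x) (lookup∘tabulate grp x)
    mxA : ∀ h u v → mx (F.A h) u v G ≡ mx (F₀.A h) u v G
    mxA h u v = #-cong λ x → cong (_∧ (G u x ∧ not (G v x))) (AA h x)
    mxB : ∀ h u v → mx (F.B h) u v G ≡ mx (F₀.B h) u v G
    mxB h u v = #-cong λ x → cong (_∧ (G u x ∧ not (G v x))) (BB h x)
    all-true : ∀ cs → All (λ c → F.PP.con c G ≡ true) cs → all (λ c → F.PP.con c G) cs ≡ true
    all-true [] [] = refl
    all-true (c ∷ cs) (h ∷ hs) = ∧-i h (all-true cs hs)
    bal : balanced i G ≡ true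
    bal = all-true F.cs (Allₚ.concat⁺ (Allₚ.map⁺ (All.map (λ { {u , v} (k , j , a , b) → Allₚ.map⁺ (All.universal (λ h →
        let (x , y , z) = hc j u v h k (QQ j u a) (QQ j v b)
            -- The hypothesis for the reversed pair supplies the private neighbours of v in B.
            (_ , _ , z') = hc j v u h (k ∘ sym) (QQ j v b) (QQ j u a) in
        ∧-i (=b-i (trans (mxA h v u) (trans x (sym (mxA h u v))))) (∧-i (≤b-i (≤-trans y (≤-reflexive (sym (mxA h u v)))))
          (∧-i (≤b-i (≤-trans z (≤-reflexive (sym (mxB h u v))))) (≤b-i (≤-trans z' (≤-reflexive (sym (mxB h v u)))))))) (fins g)) }) F.ps-good)))

-- Colour classes and unions of them.

least : (f : Fin n → Bool) → (∃ λ x → f x ≡ true) → Σ (Fin n) λ x → f x ≡ true × (∀ y → f y ≡ true → toℕ x ≤ toℕ y)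
least {suc n} f (x , e) with f Fin.zero in e0
... | true = Fin.zero , e0 , λ _ _ → z≤n
least {suc n} f (Fin.zero , e) | false = ⊥-elim (t≢f e e0)
least {suc n} f (Fin.suc x , e) | false = let (y , fy , l) = least (f ∘ Fin.suc) (x , e) in
  Fin.suc y , fy , λ { Fin.zero p → ⊥-elim (t≢f p e0) ; (Fin.suc z) p → s≤s (l z p) }

pick : ∀ {L} → (Fin L → Bool) → Fin (suc L)
pick {zero} f = Fin.zero
pick {suc L} f with f Fin.zero
... | true = Fin.suc Fin.zero
... | false with pick {L} (f ∘ Fin.suc)
...   | Fin.zero = Fin.zero
...   | Fin.suc k = Fin.suc (Fin.suc k)

pick-sound : ∀ {L} (f : Fin L → Bool) {k} → pick f ≡ Fin.suc k → f k ≡ true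
pick-sound {suc L} f e with f Fin.zero in e0
pick-sound {suc L} f refl | true = e0
... | false with pick {L} (f ∘ Fin.suc) in p
pick-sound {suc L} f refl | false | Fin.suc k = pick-sound (f ∘ Fin.suc) p

pick-complete : ∀ {L} (f : Fin L → Bool) {k} → f k ≡ true → ∃ λ k' → pick f ≡ Fin.suc k'
pick-complete {suc L} f {k} e with f Fin.zero in e0
... | true = Fin.zero , refl
pick-complete {suc L} f {Fin.zero} e | false = ⊥-elim (t≢f e e0)
pick-complete {suc L} f {Fin.suc k} e | false with pick {L} (f ∘ Fin.suc) | pick-complete (f ∘ Fin.suc) e
... | Fin.suc k' | _ = Fin.suc k' , refl

search : (P : ℕ → Bool) (N : ℕ) → P N ≡ true → ∃ λ m → m ≤ N × P m ≡ true × (∀ j → j < m → P j ≡ false)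
search P zero e = 0 , z≤n , e , λ _ ()
search P (suc N) e with P 0 in e0
... | true = 0 , z≤n , e0 , λ _ ()
... | false = let (m , a , b , c) = search (P ∘ suc) N e in suc m , s≤s a , b , λ { zero _ → e0 ; (suc j) (s≤s l) → c j l }

-- A discrete intermediate value: the first value at or above c overshoots by at most one increment.
first-reach : (h : ℕ → ℕ) (σ c N : ℕ) → h 0 ≡ 0 → (∀ m → h (suc m) ≤ h m + σ) → c ≤ h N →
  ∃ λ m → m ≤ N × c ≤ h m × h m ≤ c + σ × (∀ j → j < m → h j < c)
first-reach h σ c N h0 hs hN with search (λ m → c ≤b h m) N (≤b-i hN)
... | zero , a , b , k = 0 , z≤n , ≤b-t b , ≤-trans (≤-reflexive h0) z≤n , λ _ ()
... | suc m , a , b , k = suc m , a , ≤b-t b , ≤-trans (hs m) (+-monoˡ-≤ σ (<⇒≤ (≤b-f (k m ≤-refl)))) , λ j l → ≤b-f (k j l)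

-- These laws are all that is used of colour refinement. `step` compares neighbours in single
-- classes; `deg-eq` extends it to unions.
record Refinement {n} (G : Gr n) (R : ℕ → Fin n → Fin n → Bool) : Set where
  field
    rf : ∀ t u → R t u u ≡ true
    sy : ∀ t {u v} → R t u v ≡ true → R t v u ≡ true
    tr : ∀ t {u v w} → R t u v ≡ true → R t v w ≡ true → R t u w ≡ true
    mono : ∀ t {u v} → R (suc t) u v ≡ true → R t u v ≡ true
    step : ∀ t {u v} → R (suc t) u v ≡ true → ∀ w → # (λ x → G u x ∧ R t x w) ≡ # (λ x → G v x ∧ R t x w)

sameColour-refinement : (M : Matrix n) (p : Fin n → Bool) → Refinement (adj M) (sameColour M p)
sameColour-refinement {n} M p = record { rf = rf ; sy = sy ; tr = tr ; mono = λ t e → ∧-l e ; step = step }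
  where
  rf : ∀ t u → sameColour M p t u u ≡ true
  rf zero u = ==-i {p u} {p u} refl
  rf (suc t) u = ∧-i (rf t u) (allB-i λ w → ≡ᵇ-i {countB (λ x → adj M u x ∧ sameColour M p t x w)} refl)
  cond : ∀ t u v → sameColour M p (suc t) u v ≡ true → ∀ w →
    countB (λ x → adj M u x ∧ sameColour M p t x w) ≡ countB (λ x → adj M v x ∧ sameColour M p t x w)
  cond t u v e w = ≡ᵇ-t (allB-t (∧-r {a = sameColour M p t u v} e) w)
  sy : ∀ t {u v} → sameColour M p t u v ≡ true → sameColour M p t v u ≡ true
  sy zero {u} {v} e = ==-i {p v} {p u} (sym (==-t {p u} {p v} e))
  sy (suc t) {u} {v} e = ∧-i (sy t (∧-l e)) (allB-i λ w → ≡ᵇ-i (sym (cond t u v e w)))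
  tr : ∀ t {u v w} → sameColour M p t u v ≡ true → sameColour M p t v w ≡ true → sameColour M p t u w ≡ true
  tr zero {u} {v} {w} e f = ==-i {p u} {p w} (trans (==-t {p u} {p v} e) (==-t {p v} {p w} f))
  tr (suc t) {u} {v} {w} e f = ∧-i (tr t (∧-l e) (∧-l f)) (allB-i λ x → ≡ᵇ-i (trans (cond t u v e x) (cond t v w f x)))
  step : ∀ t {u v} → sameColour M p (suc t) u v ≡ true → ∀ w →
    # (λ x → adj M u x ∧ sameColour M p t x w) ≡ # (λ x → adj M v x ∧ sameColour M p t x w)
  step t {u} {v} e w = trans (sym (countB-# _)) (trans (cond t u v e w) (countB-# _))

module Classes {G : Gr n} {R : ℕ → Fin n → Fin n → Bool} (F : Refinement G R) where
  open Refinement F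

  Closed : ℕ → (Fin n → Bool) → Set
  Closed t A = ∀ u v → R t u v ≡ true → A u ≡ A v

  closed-suc : ∀ {t A} → Closed t A → Closed (suc t) A
  closed-suc {t} c u v e = c u v (mono t e)

  closed-+ : ∀ {t A} j → Closed t A → Closed (j + t) A
  closed-+ zero c = c
  closed-+ (suc j) c = closed-suc (closed-+ j c)

  size : ℕ → Fin n → ℕ
  size t w = # (λ z → R t z w)

  size-mono : ∀ j t w → size (j + t) w ≤ size t w
  size-mono zero t w = ≤-refl
  size-mono (suc j) t w = ≤-trans (#-mono λ z e → mono (j + t) e) (size-mono j t w)

  module _ (t : ℕ) where
    private
      lr : ∀ z → Σ (Fin n) λ x → R t x z ≡ true × (∀ y → R t y z ≡ true → toℕ x ≤ toℕ y)
      lr z = least (λ x → R t x z) (z , rf t z)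

    rep : Fin n → Fin n
    rep z = proj₁ (lr z)

    rep-R : ∀ z → R t (rep z) z ≡ true
    rep-R z = proj₁ (proj₂ (lr z))

    rep-eq : ∀ {u v} → R t u v ≡ true → rep u ≡ rep v
    rep-eq {u} {v} e = Finₚ.toℕ-injective (≤-antisym (proj₂ (proj₂ (lr u)) (rep v) (tr t (rep-R v) (sy t e))) (proj₂ (proj₂ (lr v)) (rep u) (tr t (rep-R u) e)))

    eq-rep : ∀ {u v} → rep u ≡ rep v → R t u v ≡ true
    eq-rep {u} {v} e = tr t (sy t (rep-R u)) (subst (λ x → R t x v ≡ true) (sym e) (rep-R v))

    by-classes : (f : Fin n → ℕ) → ∑ f ≡ ∑ (λ w → ∑ (λ z → ⟦ eqF (rep z) w ⟧ * f z))
    by-classes f = trans (S-cong (fins n) λ z → sym (trans (S-*ʳ (fins n) (f z) _)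
        (trans (cong (_* f z) (trans (#-cong λ w → eqF-sym (rep z) w) (#-eq (rep z)))) (*-identityˡ (f z)))))
      (S-swap (fins n) (fins n) _)

    -- Split the neighbours by the representatives of their classes: a class lies in A or misses it,
    -- and `step` equates the counts class by class.
    deg-eq : ∀ {A} → Closed t A → ∀ {u v} → R (suc t) u v ≡ true → degTo A G u ≡ degTo A G v
    deg-eq {A} cl {u} {v} e = trans (by-classes _) (trans (S-cong (fins n) pt) (sym (by-classes _)))
      where
      one : ∀ w x → ∑ (λ z → ⟦ eqF (rep z) w ⟧ * ⟦ A z ∧ G x z ⟧) ≡ ⟦ eqF (rep w) w ∧ A w ⟧ * # (λ z → G x z ∧ R t z w)
      one w x = trans (S-cong (fins n) q) (S-* (fins n) ⟦ eqF (rep w) w ∧ A w ⟧ _)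
        where
        q : ∀ z → ⟦ eqF (rep z) w ⟧ * ⟦ A z ∧ G x z ⟧ ≡ ⟦ eqF (rep w) w ∧ A w ⟧ * ⟦ G x z ∧ R t z w ⟧
        q z with rep z Fin.≟ w | rep w Fin.≟ w
        ... | yes refl | no k = ⊥-elim (k (rep-eq (rep-R z)))
        ... | no k | no l = refl
        ... | no k | yes l rewrite ¬t→f {R t z w} (λ r → k (trans (rep-eq r) l)) | Boolₚ.∧-zeroʳ (G x z) = sym (*-zeroʳ ⟦ A w ⟧)
        ... | yes refl | yes l rewrite sy t (rep-R z) | cl z (rep z) (sy t (rep-R z)) | Boolₚ.∧-identityʳ (G x z) =
          trans (+-identityʳ _) (⟦∧⟧ (A (rep z)) (G x z))
      pt : ∀ w → ∑ (λ z → ⟦ eqF (rep z) w ⟧ * ⟦ A z ∧ G u z ⟧) ≡ ∑ (λ z → ⟦ eqF (rep z) w ⟧ * ⟦ A z ∧ G v z ⟧)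
      pt w = trans (one w u) (trans (cong (⟦ eqF (rep w) w ∧ A w ⟧ *_) (step t e w)) (sym (one w v)))

    nbr-eq : ∀ {u v x} → R (suc t) u v ≡ true → G u x ≡ true → ∃ λ y → G v y ≡ true × R t y x ≡ true
    nbr-eq {u} {v} {x} e g = let (y , h) = #-pos {f = λ y → G v y ∧ R t y x} (≤-trans (pos-# {f = λ y → G u y ∧ R t y x} {x} (∧-i g (rf t x))) (≤-reflexive (step t e x))) in
      y , ∧-l h , ∧-r {a = G v y} h

    -- The number of vertices whose class precedes that of x, the classes being ordered by their least elements.
    val : Fin n → ℕ
    val x = # (λ y → suc (toℕ (rep y)) ≤b toℕ (rep x))

    val-closed : ∀ {u v} → R t u v ≡ true → val u ≡ val v
    val-closed {u} {v} e = cong (λ z → # (λ y → suc (toℕ (rep y)) ≤b toℕ z)) (rep-eq e)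

    val<n : ∀ x → val x < n
    val<n x = ≤-trans (≤-reflexive (+-comm 1 _)) (≤-trans (+-monoʳ-≤ (val x) (pos-# {f = λ y → not (suc (toℕ (rep y)) ≤b toℕ (rep x))} {x}
        (not-f (¬t→f λ e → 1+n≰n (≤b-t e)))))
      (≤-reflexive (sym (#-compl (λ y → suc (toℕ (rep y)) ≤b toℕ (rep x))))))

    -- The vertices with `val` below c form an initial segment of classes, namely those that begin
    -- before c vertices are collected; its last class causes the overshoot σ.
    val-count : ∀ σ → (∀ w → size t w ≤ σ) → ∀ c → c ≤ n → (c ≤ # (λ x → suc (val x) ≤b c)) × (# (λ x → suc (val x) ≤b c) ≤ c + σ)
    val-count σ hσ c hc with first-reach cum σ c n c0 cs cN
      where
      cum : ℕ → ℕ
      cum m = # (λ y → suc (toℕ (rep y)) ≤b m)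
      c0 : cum 0 ≡ 0
      c0 = trans (#-cong {g = λ _ → false} λ y → ¬t→f λ e → n≮0 (≤b-t e)) (S-0 (fins n))
      cN : c ≤ cum n
      cN = ≤-trans hc (≤-reflexive (sym (trans (#-cong {g = λ _ → true} λ y → ≤b-i (Finₚ.toℕ<n (rep y))) (#-true n))))
      cs : ∀ m → cum (suc m) ≤ cum m + σ
      cs m = ≤-trans (#-mono {g = λ y → (suc (toℕ (rep y)) ≤b m) ∨ (toℕ (rep y) =b m)} sp) (≤-trans (#-∨ _ _) (+-monoʳ-≤ (cum m) last))
        where
        sp : ∀ y → (suc (toℕ (rep y)) ≤b suc m) ≡ true → (suc (toℕ (rep y)) ≤b m) ∨ (toℕ (rep y) =b m) ≡ true
        sp y e with m≤n⇒m<n∨m≡n (≤-pred (≤b-t e))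
        ... | inj₁ l = ∨-i₁ (≤b-i l)
        ... | inj₂ l = ∨-i₂ {suc (toℕ (rep y)) ≤b m} (=b-i l)
        last : # (λ y → toℕ (rep y) =b m) ≤ σ
        last with 1 ≤? # (λ y → toℕ (rep y) =b m)
        ... | no k = ≤-trans (≮⇒≥ k) z≤n
        ... | yes k = let (y , e) = #-pos {f = λ y → toℕ (rep y) =b m} k in
          ≤-trans (#-mono {g = λ z → R t z y} λ z e' → eq-rep (Finₚ.toℕ-injective (trans (=b-t e') (sym (=b-t e))))) (hσ y)
    ... | m , m≤n , lo , hi , bef = ≤-trans lo (≤-reflexive eqc) , ≤-trans (≤-reflexive (sym eqc)) hi
      where
      eqc : # (λ y → suc (toℕ (rep y)) ≤b m) ≡ # (λ x → suc (val x) ≤b c)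
      eqc = #-cong λ x → bool-ext (λ e → ≤b-i (bef (toℕ (rep x)) (≤b-t e)))
        (λ e → ≤b-i (≰⇒> λ k → <⇒≱ (≤b-t {suc (val x)} {c} e) (≤-trans lo (#-mono λ y q → ≤b-i (≤-trans (≤b-t q) k)))))

    balanced-union : ∀ σ w → (∀ x → size t x ≤ σ) → w + w + σ ≤ n → ∃ λ A → Closed t A × w ≤ # A × w ≤ # (λ x → not (A x))
    balanced-union σ w hσ h = A , (λ u v e → cong (λ y → suc y ≤b w) (val-closed e)) , proj₁ vc ,
        +-cancelˡ-≤ (w + σ) _ _ (≤-trans (≤-reflexive (l w σ)) (≤-trans h (≤-trans (≤-reflexive (#-compl A)) (+-monoˡ-≤ _ (proj₂ vc)))))
      where
      A : Fin n → Bool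
      A x = suc (val x) ≤b w
      vc = val-count σ hσ w (≤-trans (m≤m+n w (w + σ)) (≤-trans (≤-reflexive (sym (+-assoc w w σ))) h))
      l : ∀ w σ → w + σ + w ≡ w + w + σ
      l = solve-∀

    -- Part i collects the vertices with in/k ≤ `val` < (i + 1)n/k. The cuts are exact up to σ and
    -- the rounding of in/k, so sizes deviate from n/k by at most σ + 1, which the hypothesis bounds
    -- by 2n/(3k).
    partition : ∀ σ k → 1 ≤ k → (∀ x → size t x ≤ σ) → 3 * (k * suc σ) ≤ 2 * n → Σ (Fin n → Fin k) λ f →
      (∀ i → n ≤ 3 * k * # (λ x → eqF (f x) i) × k * # (λ x → eqF (f x) i) ≤ 3 * n) × (∀ u v → R t u v ≡ true → f u ≡ f v)
    partition σ k hk hσ h = f , bounds , λ u v e → Finₚ.toℕ-injective (trans (tof u) (trans (cong (λ y → q (k * y)) (val-closed e)) (sym (tof v))))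
      where
      instance
        nzn : NonZero n
        nzn = >-nonZero (pos n (≤-trans (*-mono-≤ {1} {3} {1} (s≤s z≤n) (*-mono-≤ {1} {k} {1} {suc σ} hk (s≤s z≤n))) h))
          where
          pos : ∀ n → 1 ≤ 2 * n → 1 ≤ n
          pos (suc n) _ = s≤s z≤n
        nzk : NonZero k
        nzk = >-nonZero hk
      q : ℕ → ℕ
      q m = m / n
      q-lo : ∀ m → q m * n ≤ m
      q-lo m = m/n*n≤m m n
      q-hi : ∀ m → m < suc (q m) * n
      q-hi m = ≤-trans (≤-reflexive (cong suc (m≡m%n+[m/n]*n m n))) (+-monoˡ-≤ (q m * n) (m%n<n m n))
      q<k : ∀ x → q (k * val x) < k
      q<k x = *-cancelʳ-< n _ _ (≤-<-trans (q-lo (k * val x)) (*-monoʳ-< k (val<n x)))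
      f : Fin n → Fin k
      f x = fromℕ< (q<k x)
      tof : ∀ x → toℕ (f x) ≡ q (k * val x)
      tof x = Finₚ.toℕ-fromℕ< (q<k x)
      H : ℕ → ℕ
      H i = # (λ x → suc (k * val x) ≤b i * n)
      Hb : ∀ i → i ≤ k → (i * n ≤ k * H i) × (k * H i ≤ i * n + k + k * σ)
      Hb i hi = ≤-trans ceil≥ (*-monoʳ-≤ k (≤-trans (proj₁ vc) (≤-reflexive (sym He)))) ,
          ≤-trans (*-monoʳ-≤ k (≤-trans (≤-reflexive He) (proj₂ vc))) (≤-trans (≤-reflexive (*-distribˡ-+ k c σ)) (+-monoˡ-≤ (k * σ) ceil≤))
        where
        -- c = ⌈ i n / k ⌉
        c = (i * n + (k ∸ 1)) / k
        k-1 : suc (k ∸ 1) ≡ k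
        k-1 = m+[n∸m]≡n hk
        ceil≤ : k * c ≤ i * n + k
        ceil≤ = ≤-trans (≤-reflexive (*-comm k c)) (≤-trans (m/n*n≤m (i * n + (k ∸ 1)) k) (+-monoʳ-≤ (i * n) (m∸n≤m k 1)))
        ceil≥ : i * n ≤ k * c
        ceil≥ = +-cancelʳ-≤ k _ _ (≤-trans (≤-trans (≤-reflexive (trans (cong (i * n +_) (sym k-1)) (+-suc (i * n) (k ∸ 1))))
               (≤-trans (≤-reflexive (cong suc (m≡m%n+[m/n]*n (i * n + (k ∸ 1)) k))) (+-monoˡ-≤ (c * k) (m%n<n (i * n + (k ∸ 1)) k))))
                   (≤-reflexive (trans (+-comm k (c * k)) (cong (_+ k) (*-comm c k)))))
        c≤n : c ≤ n
        c≤n = ≤-pred (*-cancelˡ-< k c (suc n) (≤-<-trans (≤-trans (≤-reflexive (*-comm k c)) (m/n*n≤m (i * n + (k ∸ 1)) k))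
                (≤-trans (≤-reflexive (trans (sym (+-suc (i * n) (k ∸ 1))) (cong (i * n +_) k-1)))
                    (≤-trans (+-monoˡ-≤ k (*-monoˡ-≤ n hi)) (≤-reflexive (trans (+-comm (k * n) k) (sym (*-suc k n))))))))
        vc = val-count σ hσ c c≤n
        He : H i ≡ # (λ x → suc (val x) ≤b c)
        He = #-cong λ x → bool-ext
          (λ e → ≤b-i (*-cancelˡ-< k (val x) c (<-≤-trans (≤b-t {suc (k * val x)} e) ceil≥)))
          (λ e → ≤b-i (+-cancelʳ-≤ (k ∸ 1) _ _ (≤-trans (≤-trans (≤-reflexive (trans (sym (+-suc (k * val x) (k ∸ 1)))
              (trans (cong (k * val x +_) k-1) (trans (+-comm (k * val x) k) (sym (*-suc k (val x)))))))
                   (*-monoʳ-≤ k (≤b-t {suc (val x)} e))) (≤-trans (≤-reflexive (*-comm k c)) (m/n*n≤m (i * n + (k ∸ 1)) k)))))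
      part : ∀ i → H (toℕ i) + # (λ x → eqF (f x) i) ≡ H (suc (toℕ i))
      part i = trans (sym (S-+ (fins n) _ _)) (S-cong (fins n) pt)
        where
        pt : ∀ x → ⟦ suc (k * val x) ≤b toℕ i * n ⟧ + ⟦ eqF (f x) i ⟧ ≡ ⟦ suc (k * val x) ≤b suc (toℕ i) * n ⟧
        pt x with f x Fin.≟ i
        ... | yes e rewrite ¬t→f {suc (k * val x) ≤b toℕ i * n} (λ z → <⇒≱ (≤b-t z)
            (≤-trans (≤-reflexive (cong (_* n) (trans (cong toℕ (sym e)) (tof x)))) (q-lo (k * val x)))) =
          sym (cong ⟦_⟧ (≤b-i (≤-trans (q-hi (k * val x)) (≤-reflexive (cong (λ y → suc y * n) (trans (sym (tof x)) (cong toℕ e)))))))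
        ... | no k' = trans (+-identityʳ _) (cong ⟦_⟧ (bool-ext (λ e → ≤b-i (≤-trans (≤b-t {suc (k * val x)} e) (m≤n+m _ n))) (λ e → ≤b-i (back (≤b-t e)))))
          where
          back : k * val x < suc (toℕ i) * n → k * val x < toℕ i * n
          back l with suc (q (k * val x)) ≤? toℕ i
          ... | yes p = ≤-trans (q-hi (k * val x)) (*-monoˡ-≤ n p)
          ... | no p = ⊥-elim (k' (Finₚ.toℕ-injective (trans (tof x) (≤-antisym (≤-pred (*-cancelʳ-< n _ _ (≤-<-trans (q-lo (k * val x)) l))) (≤-pred (≰⇒> p))))))
      bounds : ∀ i → n ≤ 3 * k * # (λ x → eqF (f x) i) × k * # (λ x → eqF (f x) i) ≤ 3 * n
      bounds i = lin 0 (+-mono-≤ h (*-monoʳ-≤ 3 (+-mono-≤ (proj₂ hb) (proj₁ hb'))))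
            (trans (cong (λ y → n + (2 * n + 3 * (toℕ i * n + k + k * σ + k * y)) + 0) (sym (part i))) (l1 n (toℕ i) k σ (H (toℕ i)) pz)) ,
          lin (2 * (k * suc σ)) (+-mono-≤ (+-mono-≤ (proj₂ hb') (proj₁ hb)) h)
            (trans (l2 n (toℕ i) k σ (H (toℕ i)) pz) (cong (λ y → k * y + toℕ i * n + 3 * (k * suc σ) + 3 * n) (part i)))
        where
        pz = # (λ x → eqF (f x) i)
        hb = Hb (toℕ i) (<⇒≤ (Finₚ.toℕ<n i))
        hb' = Hb (suc (toℕ i)) (Finₚ.toℕ<n i)
        l1 : ∀ n i k σ H p → n + (2 * n + 3 * (i * n + k + k * σ + k * (H + p))) + 0 ≡ 3 * (k * suc σ) + 3 * (k * H + suc i * n) + 3 * k * p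
        l1 = solve-∀
        l2 : ∀ n i k σ H p → k * p + (suc i * n + k + k * σ + k * H + 2 * n) + 2 * (k * suc σ) ≡ k * (H + p) + i * n + 3 * (k * suc σ) + 3 * n
        l2 = solve-∀

allB-f : {f : Fin n → Bool} → allB f ≡ false → ∃ λ x → f x ≡ false
allB-f {f = f} e with 1 ≤? # (λ x → not (f x))
... | yes k = let (x , h) = #-pos {f = λ x → not (f x)} k in x , not-t h
... | no k = ⊥-elim (t≢f (allB-i {f = f} λ x → tru x) e)
  where
  tru : ∀ x → f x ≡ true
  tru x with f x in fx
  ... | true = refl
  ... | false = ⊥-elim (k (pos-# {f = λ x → not (f x)} {x} (not-f fx)))

-- Many tradable neighbours at most vertices.

mx-deg : (X : Fin n → Bool) (u v : Fin n) (G : Gr n) → degTo X G u ≡ # (λ x → X x ∧ (G u x ∧ G v x)) + mx X u v G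
mx-deg X u v G = trans (#-split (λ x → X x ∧ G u x) (λ x → G v x)) (cong₂ _+_ (#-cong λ x → Boolₚ.∧-assoc (X x) _ _) (#-cong λ x → Boolₚ.∧-assoc (X x) _ _))

module Mixing {G : Gr n} (ℓ g P PD p e κ c τ : ℕ) (dn : Dense.bad n d P κ G ≡ false) (tw : Twins.bad n d c τ G ≡ false)
    (ex : Exchangeable.bad n d ℓ g (2 * PD) p e G ≡ false) (hκ : Exchangeable.Lq n d ℓ g (2 * PD) p e + (2 * τ + 2 * τ * 2) ≤ κ)
    (hP : 4 * (g * PD) ≤ P) (hg : 1 ≤ g) where
  module Ex = Exchangeable n d ℓ g (2 * PD) p e

  low : (Fin n → Bool) → Fin n → Bool
  low X x = suc (degTo X G x) ≤b κ

  -- Otherwise `low X` and X would both have n/P vertices but at most κn edges between them, against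
  -- `Dense`.
  low-small : ∀ X → n ≤ P * # X → P * # (low X) < n
  low-small X hX with n ≤? P * # (low X)
  ... | no k = ≰⇒> k
  ... | yes k = ⊥-elim (<⇒≱ (Dense.dense n d P κ {G} dn (low X) X k hX) (≤-trans (E2-mono {g = λ a z → low X a ∧ (X z ∧ G a z)} as)
      (≤-trans (E2-fac≤ (low X) (λ a z → X z ∧ G a z) κ (λ a q → ≤-trans (n≤1+n _) (≤b-t q)))
          (≤-trans (≤-reflexive (*-comm (# (low X)) κ)) (*-monoʳ-≤ κ (#≤n (low X)))))))
    where
    as : ∀ a z → (low X a ∧ X z) ∧ G a z ≡ true → low X a ∧ (X z ∧ G a z) ≡ true
    as a z q = trans (sym (Boolₚ.∧-assoc (low X a) (X z) (G a z))) q

  module _ (lab₀ : Fin n → Fin (suc ℓ)) (grp : Fin n → Fin g × Bool) (half : Fin n → Bool) where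
    private
      module F₀ = Ex.Fam lab₀ grp half
    -- Vertices with fewer than κ neighbours in some target set lose their label; these are at most
    -- 2gn/P, so half of the labelled ones survive. Two survivors share fewer than 6τ neighbours,
    -- hence each has at least `Lq` private ones in every target set, and equal A-degrees mean
    -- equally many private ones. `Exchangeable` excludes this.
    mixing : n ≤ PD * # F₀.Q' → (∀ h → n ≤ P * # (F₀.A h)) → (∀ h → n ≤ P * # (F₀.B h)) →
      (∀ i u v h → F₀.Q i u ≡ true → F₀.Q i v ≡ true → degTo (F₀.A h) G u ≡ degTo (F₀.A h) G v) → ⊥
    mixing hD hA hB hdeg = Ex.exchangeable {G} ex lab grp half hQ con
      where
      good : Fin n → Bool
      good x = allB {g} (λ h → not (low (F₀.A h) x) ∧ not (low (F₀.B h) x))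
      lab : Fin n → Fin (suc ℓ)
      lab x = if good x then lab₀ x else Fin.zero
      module F = Ex.Fam lab grp half
      lows : ℕ
      lows = S (fins g) (λ h → # (low (F₀.A h)) + # (low (F₀.B h)))
      P-lows : P * lows ≤ 2 * (g * n)
      P-lows = ≤-trans (≤-reflexive (sym (S-* (fins g) P _))) (≤-trans (S-mono (fins g) (λ h → ≤-trans (≤-reflexive (*-distribˡ-+ P _ _))
          (+-mono-≤ (<⇒≤ (low-small (F₀.A h) (hA h))) (<⇒≤ (low-small (F₀.B h) (hB h))))))
              (≤-reflexive (trans (S-const (fins g) (n + n)) (trans (cong (_* (n + n)) (length-fins g)) (l g n)))))
        where
        l : ∀ g n → g * (n + n) ≡ 2 * (g * n)
        l = solve-∀
      D≤ : # F₀.Q' ≤ # F.Q' + lows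
      D≤ = ≤-trans (S-mono (fins n) pt) (≤-trans (≤-reflexive (S-+ (fins n) _ _))
          (+-monoʳ-≤ (# F.Q') (≤-reflexive (trans (S-swap (fins n) (fins g) _) (S-cong (fins g) λ h → S-+ (fins n) _ _)))))
        where
        pt : ∀ x → ⟦ F₀.Q' x ⟧ ≤ ⟦ F.Q' x ⟧ + S (fins g) (λ h → ⟦ low (F₀.A h) x ⟧ + ⟦ low (F₀.B h) x ⟧)
        pt x with good x in gx
        ... | true = m≤m+n _ _
        ... | false = ≤-trans (⟦⟧≤1 _) (≤-trans one (m≤n+m _ _))
          where
          w = allB-f gx
          h = proj₁ w
          one : 1 ≤ S (fins g) (λ h → ⟦ low (F₀.A h) x ⟧ + ⟦ low (F₀.B h) x ⟧)
          one = ≤-trans (go (low (F₀.A h) x) (low (F₀.B h) x) (proj₂ w)) (f≤∑ (λ h → ⟦ low (F₀.A h) x ⟧ + ⟦ low (F₀.B h) x ⟧) h)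
            where
            go : ∀ a b → not a ∧ not b ≡ false → 1 ≤ ⟦ a ⟧ + ⟦ b ⟧
            go true b _ = s≤s z≤n
            go false true _ = s≤s z≤n
      hQ : n ≤ 2 * PD * # F.Q'
      hQ = *-cancelˡ-≤ (2 * g) {{>-nonZero (*-mono-≤ {1} {2} {1} (s≤s z≤n) hg)}}
        (lin 0 (+-mono-≤ (*-monoʳ-≤ (4 * g) (≤-trans hD (*-monoʳ-≤ PD D≤))) (≤-trans (*-monoˡ-≤ lows hP) P-lows)) (l g n PD (# F.Q') lows))
        where
        l : ∀ g n PD q s → 2 * g * n + (4 * g * (PD * (q + s)) + 2 * (g * n)) + 0 ≡ 4 * g * n + 4 * (g * PD) * s + 2 * g * (2 * PD * q)
        l = solve-∀
      lab-good : ∀ {i x} → F.Q i x ≡ true → good x ≡ true × F₀.Q i x ≡ true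
      lab-good {i} {x} q with good x
      ... | true = refl , q
      ... | false = ⊥-elim (z≢s (eqF-t {x = Fin.zero} {Fin.suc i} (∧-r {a = not (half x)} q)))
        where
        z≢s : Fin.zero ≢ Fin.suc i
        z≢s ()
      con : ∀ i u v h → u ≢ v → F.Q i u ≡ true → F.Q i v ≡ true → (mx (F₀.A h) v u G ≡ mx (F₀.A h) u v G) × (Ex.Lq ≤ mx (F₀.A h) u v G) × (Ex.Lq ≤ mx (F₀.B h) u v G)
      con i u v h k qu qv = +-cancelˡ-≡ (cd (F₀.A h) u v) _ _ (trans (cong (_+ mx (F₀.A h) v u G) (cd-sym (F₀.A h))) (trans (sym (mx-deg (F₀.A h) v u G))
            (trans (hdeg i v u h (proj₂ (lab-good qv)) (proj₂ (lab-good qu))) (mx-deg (F₀.A h) u v G)))) ,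
          big (F₀.A h) (∧-l {not (low (F₀.A h) u)} (gh h)) , big (F₀.B h) (∧-r {a = not (low (F₀.A h) u)} (gh h))
        where
        cd : (Fin n → Bool) → Fin n → Fin n → ℕ
        cd X a b = # (λ x → X x ∧ (G a x ∧ G b x))
        cd-sym : ∀ X → cd X u v ≡ cd X v u
        cd-sym X = #-cong λ x → cong (X x ∧_) (Boolₚ.∧-comm (G u x) (G v x))
        gh = allB-t (proj₁ (lab-good qu))
        big : ∀ X → not (low X u) ≡ true → Ex.Lq ≤ mx X u v G
        big X nl = +-cancelʳ-≤ (2 * τ + 2 * τ * 2) _ _ (≤-trans hκ (≤-trans (≤-pred (≤b-f (not-t nl)))
            (≤-trans (≤-reflexive (trans (mx-deg X u v G) (+-comm _ (mx X u v G))))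
          (+-monoʳ-≤ (mx X u v G) (≤-trans (#-mono λ x q → ∧-r {a = X x} q) (<⇒≤ (Twins.few-common n d c τ {G} tw u v k)))))))

-- Walks and the spreading of large classes.

module Walks {G : Gr n} (r : IsReg d G) where
  nbs : Fin n → List (Fin n)
  nbs u = filter (λ x → T? (G u x)) (fins n)

  nbs-length : ∀ u → length (nbs u) ≡ d
  nbs-length u = trans (length-filter-S (G u) (fins n)) (deg r u)

  nb : Fin n → Fin d → Fin n
  nb u i = List.lookup (nbs u) (Fin.cast (sym (nbs-length u)) i)

  nb-all : ∀ {u x} → G u x ≡ true → ∃ λ i → nb u i ≡ x
  nb-all {u} {x} e = Fin.cast (nbs-length u) (index m) , trans (cong (List.lookup (nbs u))
      (trans (Finₚ.cast-trans (nbs-length u) (sym (nbs-length u)) (index m)) (Finₚ.cast-is-id _ (index m)))) (sym (lookup-index m))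
    where
    m : x ∈ nbs u
    m = ∈-filter⁺ (λ x → T? (G u x)) (subst (x ∈_) (sym (fins-def n)) (∈-allFin x)) (subst T (sym e) _)

  -- The d^i walks of length i from u, numbered; walks may repeat vertices, so no distances enter.
  end : Fin n → ∀ i → Fin (d ^ i) → Fin n
  end u zero k = u
  end u (suc i) k = nb (end u i (proj₂ (Fin.remQuot {d} (d ^ i) k))) (proj₁ (Fin.remQuot {d} (d ^ i) k))

  end-nb : ∀ u i k x → G (end u i k) x ≡ true → ∃ λ k' → end u (suc i) k' ≡ x
  end-nb u i k x e = let (a , h) = nb-all e in Fin.combine a k ,
    trans (cong₂ (λ y z → nb (end u i y) z) (cong proj₂ (Finₚ.remQuot-combine {d} {d ^ i} a k)) (cong proj₁ (Finₚ.remQuot-combine {d} {d ^ i} a k))) h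

  W : (Fin n → Bool) → ℕ → Fin n → Bool
  W U zero = U
  W U (suc i) = nbd G (W U i)

  module _ {R : ℕ → Fin n → Fin n → Bool} (F : Refinement G R) where
    open Refinement F
    open Classes F

    -- Follow the walk from the class of u to x and copy each step at u by `nbr-eq`, which costs one
    -- round: agreement in round i + t at the start leaves agreement in round t at the end.
    cover : ∀ u T i t x → T ≡ i + t → W (λ z → R T z u) i x ≡ true → ∃ λ k → R t x (end u i k) ≡ true
    cover u T zero t x refl h = Fin.zero , h
    cover u T (suc i) t x e h =
      let (y , q) = #-pos {f = λ y → W (λ z → R T z u) i y ∧ G x y} (≤b-t h)
          (k , ry) = cover u T i (suc t) y (trans e (sym (+-suc i t))) (∧-l q)
          (z , gz , rz) = nbr-eq t ry (trans (symm r y x) (∧-r {a = W (λ z → R T z u) i y} q))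
          (k' , ek) = end-nb u i k z gz in
      k' , subst (λ v → R t x v ≡ true) (sym ek) (sy t rz)

  module _ (c : ℕ) (ebad : Expansion.bad n d c G ≡ false) (hc : 18 ≤ c) (hd : 16 * c ≤ d) (hn : 4 * (1 + d) ≤ n) where
    d≥1 : 1 ≤ d
    d≥1 = ≤-trans (s≤s z≤n) (≤-trans hc (≤-trans (m≤n*m c 16) hd))

    expand : ∀ S → 1 ≤ # S → (d * # S ≤ 8 * (c * # (nbd G S))) ⊎ (n < 32 * # (nbd G S))
    expand = Expansion.expands n d c hc d≥1 hn r ebad

    double : ∀ S → 1 ≤ # S → (2 * # S ≤ # (nbd G S)) ⊎ (n < 32 * # (nbd G S))
    double S h with expand S h
    ... | inj₂ k = inj₂ k
    ... | inj₁ k = inj₁ (*-cancelˡ-≤ (8 * c) {{>-nonZero (*-mono-≤ {1} {8} {1} (s≤s z≤n) (≤-trans (s≤s z≤n) hc))}}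
        (≤-trans (≤-reflexive (l c (# S))) (≤-trans (*-monoˡ-≤ (# S) hd) (≤-trans k (≤-reflexive (sym (*-assoc 8 c _)))))))
      where
      l : ∀ c s → 8 * c * (2 * s) ≡ 16 * c * s
      l = solve-∀

    grow-W : ∀ U → 1 ≤ # U → ∀ i → 1 ≤ # (W U i) × ((2 ^ i * # U ≤ # (W U i)) ⊎ (n < 32 * # (W U i)))
    grow-W U h zero = h , inj₁ (≤-reflexive (*-identityˡ (# U)))
    grow-W U h (suc i) with grow-W U h i
    ... | p , q with double (W U i) p
    ... | inj₂ k = pos3 (≤-trans (s≤s z≤n) k) , inj₂ k
      where
      pos3 : ∀ {s} → 1 ≤ 32 * s → 1 ≤ s
      pos3 {suc s} _ = s≤s z≤n
    ... | inj₁ k = ≤-trans p (≤-trans (m≤n*m (# (W U i)) 2) k) , go q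
      where
      go : (2 ^ i * # U ≤ # (W U i)) ⊎ (n < 32 * # (W U i)) → (2 ^ suc i * # U ≤ # (W U (suc i))) ⊎ (n < 32 * # (W U (suc i)))
      go (inj₁ a) = inj₁ (≤-trans (≤-reflexive (*-assoc 2 (2 ^ i) (# U))) (≤-trans (*-monoʳ-≤ 2 a) k))
      go (inj₂ a) = inj₂ (<-≤-trans a (*-monoʳ-≤ 32 (≤-trans (m≤n*m (# (W U i)) 2) k)))

    wide : ∀ U j → 1 ≤ # U → n ≤ 2 ^ j * # U → n ≤ 32 * # (W U j)
    wide U j h hj with proj₂ (grow-W U h j)
    ... | inj₁ a = ≤-trans hj (≤-trans a (m≤n*m (# (W U j)) 32))
    ... | inj₂ a = <⇒≤ a

    module Spread {R : ℕ → Fin n → Fin n → Bool} (F : Refinement G R) where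
      open Refinement F
      open Classes F

      -- Every vertex within distance j of the class of u shares its colour with the end of a walk of length j from u,
      -- and its neighbours with ends of walks of length j + 1.  These labels encode a set containing all edges at
      -- such vertices; were the class of u large, this set would be untypically sparse for so many edges.
      spread : ∀ t σ j q k₀ → Labelled.bad n d (d ^ j) (suc (d ^ suc j)) 32 q k₀ G ≡ false →
        (∀ x → size t x ≤ σ) → d * σ * (4 * q) ≤ n → ∀ u → n ≤ 2 ^ j * size (j + suc t) u → ⊥
      spread t σ j q k₀ lb hσ hq u hu = Labelled.labelled n d (d ^ j) (suc (d ^ suc j)) 32 q k₀ lb lab lab' tab E≤ Q≥ fit
        where
        T' = j + suc t
        U : Fin n → Bool
        U z = R T' z u
        Wj = W U j
        fl : Fin n → Fin (d ^ j) → Bool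
        fl x k = Wj x ∧ R (suc t) x (end u j k)
        lab : Fin n → Fin (suc (d ^ j))
        lab x = pick (fl x)
        fl' : Fin n → Fin (d ^ suc j) → Bool
        fl' z k = R t z (end u (suc j) k)
        lab' : Fin n → Fin (suc (d ^ suc j))
        lab' z = pick (fl' z)
        near : Fin (d ^ j) → Fin n → Bool
        near k v = 1 ≤b # (λ y → G (end u j k) y ∧ R t y v)
        tab : Fin (suc (d ^ j)) → Fin (suc (d ^ suc j)) → Bool
        tab Fin.zero _ = false
        tab (Fin.suc k) Fin.zero = false
        tab (Fin.suc k) (Fin.suc k') = near k (end u (suc j) k')
        Qf : Fin n → Bool
        Qf a = not (eqF (lab a) Fin.zero)
        Ef : Fin n → Fin n → Bool
        Ef a z = tab (lab a) (lab' z)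
        Q≥ : n ≤ 32 * # Qf
        Q≥ = ≤-trans (wide U j (pos-# {f = U} {u} (rf T' u)) hu) (*-monoʳ-≤ 32 (#-mono w→q))
          where
          w→q : ∀ x → Wj x ≡ true → Qf x ≡ true
          w→q x h = let (k , e) = cover F u T' j (suc t) x refl h
                        (k' , e') = pick-complete (fl x) (∧-i h e) in cong (λ y → not (eqF y Fin.zero)) e'
        fit : d * # Qf ≤ eOn Ef G
        fit = ≤-trans (≤-reflexive (trans (*-comm d (# Qf)) (sym (edges-from r Qf)))) (E2-mono sub)
          where
          sub : ∀ a z → Qf a ∧ G a z ≡ true → Ef a z ∧ G a z ≡ true
          sub a z h = ∧-i (go (lab a) refl (∧-l h)) gz
            where
            gz = ∧-r {a = Qf a} h
            go : ∀ l → lab a ≡ l → not (eqF l Fin.zero) ≡ true → tab l (lab' z) ≡ true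
            go (Fin.suc k) e _ =
              let rk = ∧-r {a = Wj a} (pick-sound (fl a) e)
                  (y , gy , ry) = nbr-eq t rk gz
                  (k₁ , ek) = end-nb u j k y gy
                  (k' , e') = pick-complete (fl' z) {k₁} (subst (λ v → R t z v ≡ true) (sym ek) (sy t ry))
                  rz = pick-sound (fl' z) e' in
              subst (λ l → tab (Fin.suc k) l ≡ true) (sym e') (≤b-i (pos-# {f = λ y → G (end u j k) y ∧ R t y (end u (suc j) k')} {y} (∧-i gy (tr t ry rz))))
        -- The label k of a admits only vertices z with the round-t colour of one of the d
        -- neighbours of `end u j k`, and each such class has at most σ vertices.
        row : ∀ a → Qf a ≡ true → # (Ef a) ≤ d * σ
        row a qa = go (lab a) refl qa
          where
          go : ∀ l → lab a ≡ l → not (eqF l Fin.zero) ≡ true → # (Ef a) ≤ d * σ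
          go (Fin.suc k) e _ = begin
              # (Ef a) ≤⟨ S-mono (fins n) pt ⟩
              ∑ (λ z → # (λ y → G (end u j k) y ∧ R t z y)) ≡⟨ S-swap (fins n) (fins n) _ ⟩
              E2 (λ y z → G (end u j k) y ∧ R t z y) ≤⟨ E2-fac≤ (G (end u j k)) (λ y z → R t z y) σ (λ y _ → hσ y) ⟩
              # (G (end u j k)) * σ ≡⟨ cong (_* σ) (deg r _) ⟩
              d * σ ∎
            where
            open ≤-Reasoning
            pt : ∀ z → ⟦ Ef a z ⟧ ≤ # (λ y → G (end u j k) y ∧ R t z y)
            pt z with Ef a z in ez
            ... | false = z≤n
            ... | true = go' (lab' z) refl (subst (λ l → tab l (lab' z) ≡ true) e ez)
              where
              go' : ∀ l' → lab' z ≡ l' → tab (Fin.suc k) l' ≡ true → 1 ≤ # (λ y → G (end u j k) y ∧ R t z y)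
              go' (Fin.suc k') e' h = let (y , q) = #-pos {f = λ y → G (end u j k) y ∧ R t y (end u (suc j) k')} (≤b-t h) in
                pos-# {f = λ y → G (end u j k) y ∧ R t z y} {y} (∧-i (∧-l q) (tr t (pick-sound (fl' z) e') (sy t (∧-r {a = G (end u j k) y} q))))
        E≤ : E2 Ef * (4 * q) ≤ # Qf * n
        E≤ = ≤-trans (*-monoˡ-≤ (4 * q) (≤-trans (E2-mono {g = λ a z → Qf a ∧ Ef a z} m) (E2-fac≤ Qf Ef (d * σ) row)))
            (≤-trans (≤-reflexive (*-assoc (# Qf) (d * σ) (4 * q))) (*-monoʳ-≤ (# Qf) hq))
          where
          m : ∀ a z → Ef a z ≡ true → Qf a ∧ Ef a z ≡ true
          m a z h = ∧-i (go (lab a) h) h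
            where
            go : ∀ l → tab l (lab' z) ≡ true → not (eqF l Fin.zero) ≡ true
            go (Fin.suc k) _ = refl

-- Two ways to shrink the classes.

bisect : (U : Fin n → Bool) (c : ℕ) → c ≤ # U → ∃ λ D → (∀ x → D x ≡ true → U x ≡ true) × c ≤ # D × # D ≤ c + 1
bisect {n} U c hc = D , (λ x → ∧-l) , proj₁ (proj₂ (proj₂ fr)) , proj₁ (proj₂ (proj₂ (proj₂ fr)))
  where
  h : ℕ → ℕ
  h m = # (λ x → U x ∧ (suc (toℕ x) ≤b m))
  fr = first-reach h 1 c n (trans (#-cong {g = λ _ → false} λ x → ¬t→f λ e → n≮0 (≤b-t (∧-r {a = U x} e))) (S-0 (fins n)))
    (λ m → ≤-trans (#-mono {g = λ x → (U x ∧ (suc (toℕ x) ≤b m)) ∨ (toℕ x =b m)} (sp m)) (≤-trans (#-∨ _ _) (+-monoʳ-≤ (h m)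
      (uniq≤1 λ x y p q → Finₚ.toℕ-injective (trans (=b-t p) (sym (=b-t q)))))))
    (≤-trans hc (#-mono λ x e → ∧-i e (≤b-i (Finₚ.toℕ<n x))))
    where
    sp : ∀ m x → U x ∧ (suc (toℕ x) ≤b suc m) ≡ true → (U x ∧ (suc (toℕ x) ≤b m)) ∨ (toℕ x =b m) ≡ true
    sp m x e with m≤n⇒m<n∨m≡n (≤-pred (≤b-t (∧-r {a = U x} e)))
    ... | inj₁ l = ∨-i₁ (∧-i (∧-l {U x} e) (≤b-i l))
    ... | inj₂ l = ∨-i₂ {U x ∧ (suc (toℕ x) ≤b m)} (=b-i l)
  D : Fin n → Bool
  D x = U x ∧ (suc (toℕ x) ≤b proj₁ fr)

module Shrink {G : Gr n} {R : ℕ → Fin n → Fin n → Bool} (F : Refinement G R) (c τ κ P : ℕ)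
    (dn : Dense.bad n d P κ G ≡ false) (tw : Twins.bad n d c τ G ≡ false) where
  open Refinement F
  open Classes F

  -- A class U with n/PX vertices would have constant degree into A. Pair off one half D of it; the
  -- side of A that misses U is the target set A, and everything else outside D is the target set B,
  -- large because it contains the other half of U. `mixing` excludes this.
  shrink-balanced : ∀ PX PA p e → Exchangeable.bad n d 1 1 (2 * (4 * PX)) p e G ≡ false →
    Exchangeable.Lq n d 1 1 (2 * (4 * PX)) p e + (2 * τ + 2 * τ * 2) ≤ κ → 4 * (1 * (4 * PX)) ≤ P → PA ≤ P → 6 * PX ≤ n → 1 ≤ PX →
    ∀ t A → Closed t A → n ≤ PA * # A → n ≤ PA * # (λ x → not (A x)) → ∀ u → PX * size (suc t) u < n
  shrink-balanced PX PA p e ex hκ hP hPA h6 hX t A cl hA hA' u with n ≤? PX * size (suc t) u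
  ... | no k = ≰⇒> k
  ... | yes k = ⊥-elim (mixing lab₀ grp half hD hTA hTB hdeg)
    where
    open Mixing {d = d} 1 1 P (4 * PX) p e κ c τ dn tw ex hκ hP ≤-refl
    U : Fin n → Bool
    U z = R (suc t) z u
    s = # U
    s≥6 : 6 ≤ s
    s≥6 = *-cancelˡ-≤ PX {{>-nonZero hX}} (≤-trans (≤-reflexive (*-comm PX 6)) (≤-trans h6 k))
    dv = divide s 2 (s≤s z≤n)
    h = proj₁ dv
    h≥3 : 3 ≤ h
    h≥3 = ≤-pred (*-cancelʳ-< 2 3 (suc h) (≤-<-trans s≥6 (proj₂ (proj₂ dv))))
    bs = bisect U h (≤-trans (m≤m*n h 2) (proj₁ (proj₂ dv)))
    D = proj₁ bs
    D⊆U = proj₁ (proj₂ bs)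
    D≥ : h ≤ # D
    D≥ = proj₁ (proj₂ (proj₂ bs))
    D≤ : # D ≤ h + 1
    D≤ = proj₂ (proj₂ (proj₂ bs))
    s≤ : s ≤ 2 * h + 1
    s≤ = ≤-pred (≤-trans (proj₂ (proj₂ dv)) (≤-reflexive (l h))) where
      l : ∀ h → suc h * 2 ≡ suc (2 * h + 1)
      l = solve-∀
    s≤4D : s ≤ 4 * # D
    s≤4D = ≤-trans s≤ (≤-trans (lin 5 (*-monoʳ-≤ 2 h≥3) (l h)) (*-monoʳ-≤ 4 D≥)) where
      l : ∀ h → 2 * h + 1 + 2 * h + 5 ≡ 2 * 3 + 4 * h
      l = solve-∀
    -- This is A or its complement, whichever misses U, so D is disjoint from it.
    T₁ : Fin n → Bool
    T₁ x = A x xor A u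
    U-T₁ : ∀ x → U x ≡ true → T₁ x ≡ false
    U-T₁ x e = trans (cong (_xor A u) (cl x u (mono t e))) (Boolₚ.xor-same (A u))
    lab₀ : Fin n → Fin 2
    lab₀ x = if D x then Fin.suc Fin.zero else Fin.zero
    grp : Fin n → Fin 1 × Bool
    grp x = Fin.zero , T₁ x
    half : Fin n → Bool
    half x = not (D x)
    open Ex.Fam lab₀ grp half using () renaming (A to TA; B to TB; Q to Qf; Q' to Qf')
    hD : n ≤ 4 * PX * # Qf'
    hD = ≤-trans k (≤-trans (*-monoʳ-≤ PX s≤4D) (≤-trans (≤-reflexive (l PX (# D))) (*-monoʳ-≤ (4 * PX) (#-mono q))))
      where
      l : ∀ P D → P * (4 * D) ≡ 4 * P * D
      l = solve-∀
      q : ∀ x → D x ≡ true → Qf' x ≡ true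
      q x e rewrite e = refl
    TA-eq : ∀ h x → TA h x ≡ T₁ x
    TA-eq Fin.zero x with D x in e
    ... | false = refl
    ... | true = sym (U-T₁ x (D⊆U x e))
    hTA : ∀ h → n ≤ P * # (TA h)
    hTA h = ≤-trans (≤-trans nT (*-monoˡ-≤ (# T₁) hPA)) (*-monoʳ-≤ P (≤-reflexive (sym (#-cong (TA-eq h)))))
      where
      nT : n ≤ PA * # T₁
      nT with A u
      ... | true = ≤-trans hA' (*-monoʳ-≤ PA (≤-reflexive (#-cong λ x → sym (Boolₚ.xor-comm (A x) true))))
      ... | false = ≤-trans hA (*-monoʳ-≤ PA (≤-reflexive (#-cong λ x → sym (Boolₚ.xor-identityʳ (A x)))))
    hTB : ∀ h → n ≤ P * # (TB h)
    hTB Fin.zero = ≤-trans k (≤-trans (*-monoʳ-≤ PX s≤4B) (≤-trans (≤-reflexive (l PX (# (TB Fin.zero))))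
        (*-monoˡ-≤ (# (TB Fin.zero)) (≤-trans (m≤m+n (4 * PX) _) (≤-trans (≤-reflexive (l' PX)) hP)))))
      where
      l : ∀ P D → P * (4 * D) ≡ 4 * P * D
      l = solve-∀
      l' : ∀ P → 4 * P + 12 * P ≡ 4 * (1 * (4 * P))
      l' = solve-∀
      sB : s ≤ # D + # (TB Fin.zero)
      sB = ≤-trans (#-mono {g = λ x → D x ∨ TB Fin.zero x} q) (#-∨ _ _)
        where
        q : ∀ x → U x ≡ true → D x ∨ TB Fin.zero x ≡ true
        q x e with D x
        ... | true = refl
        ... | false rewrite U-T₁ x e = refl
      s≤4B : s ≤ 4 * # (TB Fin.zero)
      s≤4B = lin 2 (+-mono-≤ (+-mono-≤ (*-monoʳ-≤ 4 (≤-trans sB (+-monoˡ-≤ (# (TB Fin.zero)) D≤))) (*-monoʳ-≤ 3 (proj₁ (proj₂ dv))))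
          (*-monoʳ-≤ 2 h≥3)) (l'' s h (# (TB Fin.zero)))
        where
        l'' : ∀ s h B → s + (4 * (h + 1 + B) + 3 * s + 2 * h) + 2 ≡ 4 * s + 3 * (h * 2) + 2 * 3 + 4 * B
        l'' = solve-∀
    closedT : Closed t T₁
    closedT x y e = cong (_xor A u) (cl x y e)
    hdeg : ∀ i x y h → Qf i x ≡ true → Qf i y ≡ true → degTo (TA h) G x ≡ degTo (TA h) G y
    hdeg i x y h qx qy = trans (toT x) (trans (deg-eq t closedT (tr (suc t) (D⊆U x (inD x qx)) (sy (suc t) (D⊆U y (inD y qy))))) (sym (toT y)))
      where
      toT : ∀ x → degTo (TA h) G x ≡ degTo T₁ G x
      toT x = #-cong λ y → cong (_∧ G x y) (TA-eq h y)
      inD : ∀ x → Qf i x ≡ true → D x ≡ true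
      inD x q with D x
      ... | true = refl

  module _ (r : IsReg d G) (c′ : ℕ) (ebad : Expansion.bad n d c′ G ≡ false) (hc : 18 ≤ c′) (hd : 16 * c′ ≤ d) (hn : 4 * (1 + d) ≤ n) where
    open Walks r

    -- If U had n/(Kd) vertices, its neighbourhood would have linear size by expansion. Each vertex
    -- there shares its colour of round t + 1 with one of the d neighbours of u, which becomes its
    -- label; equal labels give equal degrees into every union of classes of round t, in particular
    -- into g target sets at once.
    shrink-fine : ∀ K g p e → 4 ≤ K → 1 ≤ g → Exchangeable.bad n d (d ^ 1) g (2 * (2 * (8 * (c′ * K)))) p e G ≡ false →
      Exchangeable.Lq n d (d ^ 1) g (2 * (2 * (8 * (c′ * K)))) p e + (2 * τ + 2 * τ * 2) ≤ κ → 4 * (g * (2 * (8 * (c′ * K)))) ≤ P → 3 * (2 * (g * 2)) ≤ P →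
      ∀ t σ → (∀ x → size t x ≤ σ) → 3 * (2 * (g * 2) * suc σ) ≤ 2 * n → ∀ u → n ≤ K * (d * size (suc (suc t)) u) → ⊥
    shrink-fine K g p e hK hg ex hκ hP hP' t σ hσ hσ' u hu = go (≤-total (# (Db b0)) (# (Db b1)))
      where
      open Mixing {d = d} (d ^ 1) g P (2 * (8 * (c′ * K))) p e κ c τ dn tw ex hκ hP hg
      kk = 2 * (g * 2)
      part = partition t σ kk (*-mono-≤ {1} {2} {1} (s≤s z≤n) (*-mono-≤ {1} {g} {1} hg (s≤s z≤n))) hσ hσ'
      f = proj₁ part
      -- The 4g parts code a side, a group and one of A and B. The side with more labelled vertices
      -- keeps them and the other supplies the targets, so paired vertices and targets are disjoint.
      side : Fin n → Fin 2
      side x = proj₁ (Fin.remQuot {2} (g * 2) (f x))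
      gg : Fin n → Fin g × Fin 2
      gg x = Fin.remQuot {g} 2 (proj₂ (Fin.remQuot {2} (g * 2) (f x)))
      grp : Fin n → Fin g × Bool
      grp x = proj₁ (gg x) , eqF (proj₂ (gg x)) Fin.zero
      b0 b1 : Fin 2
      b0 = Fin.zero
      b1 = Fin.suc Fin.zero
      U : Fin n → Bool
      U z = R (suc (suc t)) z u
      fl : Fin n → Fin (d ^ 1) → Bool
      fl x k = W U 1 x ∧ R (suc t) x (end u 1 k)
      lab₀ : Fin n → Fin (suc (d ^ 1))
      lab₀ x = pick (fl x)
      nz : Fin n → Bool
      nz x = not (eqF (lab₀ x) Fin.zero)
      Db : Fin 2 → Fin n → Bool
      Db b x = not (not (eqF (side x) b)) ∧ nz x
      W≤ : # (W U 1) ≤ # nz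
      W≤ = #-mono λ x h → let (k , e) = cover F u (suc (suc t)) 1 (suc t) x refl h
                              (k' , e') = pick-complete (fl x) {k} (∧-i h e) in cong (λ y → not (eqF y Fin.zero)) e'
      nW : n ≤ 8 * (c′ * K) * # (W U 1)
      nW with expand c′ ebad hc hd hn U (pos-# {f = U} {u} (rf (suc (suc t)) u))
      ... | inj₁ k = ≤-trans hu (≤-trans (*-monoʳ-≤ K k) (≤-reflexive (l K c′ (# (W U 1))))) where
        l : ∀ K c w → K * (8 * (c * w)) ≡ 8 * (c * K) * w
        l = solve-∀
      ... | inj₂ k = ≤-trans (<⇒≤ k) (*-monoˡ-≤ (# (W U 1)) (*-monoʳ-≤ 8 (≤-trans hK (m≤n*m K c′ {{>-nonZero (≤-trans (s≤s z≤n) hc)}}))))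
      split : # nz ≤ # (Db b0) + # (Db b1)
      split = ≤-trans (#-mono {g = λ x → Db b0 x ∨ Db b1 x} q) (#-∨ _ _)
        where
        q : ∀ x → nz x ≡ true → Db b0 x ∨ Db b1 x ≡ true
        q x h with side x
        ... | Fin.zero = ∨-i₁ h
        ... | Fin.suc Fin.zero = h
      finish : (b b' : Fin 2) → b ≢ b' → # nz ≤ # (Db b) + # (Db b) → ⊥
      finish b b' bb hb = mixing lab₀ grp half hD (λ h → big (TA h) (Fin.combine b' (Fin.combine h Fin.zero)) (inA h))
          (λ h → big (TB h) (Fin.combine b' (Fin.combine h b1)) (inB h)) hdeg
        where
        half : Fin n → Bool
        half x = not (eqF (side x) b)
        open Ex.Fam lab₀ grp half using () renaming (A to TA; B to TB; Q to Qf; Q' to Qf')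
        hD : n ≤ 2 * (8 * (c′ * K)) * # Qf'
        hD = ≤-trans nW (≤-trans (*-monoʳ-≤ (8 * (c′ * K)) (≤-trans W≤ hb)) (≤-reflexive (l (8 * (c′ * K)) (# Qf')))) where
          l : ∀ x D → x * (D + D) ≡ 2 * x * D
          l = solve-∀
        big : (X : Fin n → Bool) (i : Fin kk) → (∀ x → f x ≡ i → X x ≡ true) → n ≤ P * # X
        big X i h = ≤-trans (proj₁ (proj₁ (proj₂ part) i)) (*-mono-≤ hP' (#-mono λ x e → h x (eqF-t e)))
        loc : ∀ x h b2 → f x ≡ Fin.combine b' (Fin.combine h b2) → side x ≡ b' × gg x ≡ (h , b2)
        loc x h b2 e = trans (cong (λ y → proj₁ (Fin.remQuot {2} (g * 2) y)) e) (cong proj₁ (Finₚ.remQuot-combine {2} {g * 2} b' (Fin.combine h b2))) ,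
          trans (cong (λ y → Fin.remQuot {g} 2 (proj₂ (Fin.remQuot {2} (g * 2) y))) e)
              (trans (cong (λ y → Fin.remQuot {g} 2 (proj₂ y)) (Finₚ.remQuot-combine {2} {g * 2} b' (Fin.combine h b2))) (Finₚ.remQuot-combine {g} {2} h b2))
        hf : ∀ x → side x ≡ b' → half x ≡ true
        hf x e = not-f (eqF-n λ q → bb (trans (sym q) e))
        inA : ∀ h x → f x ≡ Fin.combine b' (Fin.combine h Fin.zero) → TA h x ≡ true
        inA h x e = let (s , q) = loc x h Fin.zero e in ∧-i (hf x s) (∧-i (eqF-i (cong proj₁ q)) (cong (λ y → eqF (proj₂ y) Fin.zero) q))
        inB : ∀ h x → f x ≡ Fin.combine b' (Fin.combine h b1) → TB h x ≡ true
        inB h x e = let (s , q) = loc x h b1 e in ∧-i (hf x s) (∧-i (eqF-i (cong proj₁ q)) (cong (λ y → not (eqF (proj₂ y) Fin.zero)) q))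
        closedA : ∀ h → Closed t (TA h)
        closedA h x y e = cong (λ i → not (eqF (proj₁ (Fin.remQuot {2} (g * 2) i)) b) ∧
            (eqF (proj₁ (Fin.remQuot {g} 2 (proj₂ (Fin.remQuot {2} (g * 2) i)))) h ∧ eqF (proj₂ (Fin.remQuot {g} 2 (proj₂ (Fin.remQuot {2} (g * 2) i)))) Fin.zero))
          (proj₂ (proj₂ part) x y e)
        hdeg : ∀ i x y h → Qf i x ≡ true → Qf i y ≡ true → degTo (TA h) G x ≡ degTo (TA h) G y
        hdeg i x y h qx qy = deg-eq t (closedA h) (tr (suc t) (at x qx) (sy (suc t) (at y qy)))
          where
          at : ∀ x → Qf i x ≡ true → R (suc t) x (end u 1 i) ≡ true
          at x q = ∧-r {a = W U 1 x} (pick-sound (fl x) (eqF-t (∧-r {a = not (half x)} q)))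
      go : # (Db b0) ≤ # (Db b1) ⊎ # (Db b1) ≤ # (Db b0) → ⊥
      go (inj₁ l) = finish b1 b0 (λ ()) (≤-trans split (+-monoˡ-≤ (# (Db b1)) l))
      go (inj₂ l) = finish b0 b1 (λ ()) (≤-trans split (+-monoʳ-≤ (# (Db b0)) l))

-- Growing the smaller side of the partition.

reach-grow : (M : Matrix n) (A : Fin n → Bool) → IsReg d (adj M) → ∀ D i u v → grow (adj M) A i u ≡ true → Reach M D u v → grow (adj M) A (D + i) v ≡ true
reach-grow M A r zero i u .u h refl = h
reach-grow M A r (suc D) i u .u h (inj₁ refl) = grow-≤ (adj M) A (m≤n+m i (suc D)) u h
reach-grow M A r (suc D) i u v h (inj₂ (x , e , q)) = subst (λ j → grow (adj M) A j v ≡ true) (+-suc D i)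
  (reach-grow M A r D (suc i) x v (grow-adj {G = adj M} A i {x} {u} h (trans (symm r x u) e)) q)

grow-size : {G : Gr n} → IsReg d G → ∀ A i → # (grow G A (suc i)) ≤ (1 + d) * # (grow G A i)
grow-size {n} {d} {G} r A i = ≤-trans (#-∨ (B) (λ x → 1 ≤b degTo B G x)) (+-monoʳ-≤ (# B) (≤-trans (S-mono (fins n) pt)
    (≤-trans (≤-reflexive (S-swap (fins n) (fins n) _)) (≤-reflexive (trans (S-cong (fins n) λ y → #-cong λ x → cong (B y ∧_) (symm r x y))
        (trans (edges-from r B) (*-comm (# B) d)))))))
  where
  B = grow G A i
  pt : ∀ x → ⟦ 1 ≤b degTo B G x ⟧ ≤ # (λ y → B y ∧ G x y)
  pt x with 1 ≤b degTo B G x in e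
  ... | true = ≤b-t e
  ... | false = z≤n

grow-mono : (G : Gr n) {A A' : Fin n → Bool} → (∀ x → A x ≡ true → A' x ≡ true) → ∀ i x → grow G A i x ≡ true → grow G A' i x ≡ true
grow-mono G h zero x e = h x e
grow-mono G {A} {A'} h (suc i) x e with ∨-e {grow G A i x} e
... | inj₁ q = ∨-i₁ (grow-mono G h i x q)
... | inj₂ q = ∨-i₂ {grow G A' i x} (≤b-i (≤-trans (≤b-t q) (#-mono λ y k → ∧-i (grow-mono G h i y (∧-l k)) (∧-r {a = grow G A i y} k))))

module BFS (M : Matrix n) (p : Fin n → Bool) (r : IsReg d (adj M)) (c : ℕ) (ebad : Expansion.bad n d c (adj M) ≡ false)
    (hc : 18 ≤ c) (hd : 16 * c ≤ d) (hn : 4 * (1 + d) ≤ n) where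
  G = adj M
  R = sameColour M p
  F = sameColour-refinement M p
  open Refinement F
  open Classes F
  open Walks r

  d≥8 : 8 ≤ d
  d≥8 = ≤-trans (m≤m+n 8 8) (≤-trans (m≤m*n 16 c {{>-nonZero (≤-trans (s≤s z≤n) hc)}}) hd)

  module FromSide (S₀ : Fin n → Bool) (S₀≥1 : 1 ≤ # S₀) (S₀≤ : 2 * # S₀ ≤ n) (cl₀ : Closed 0 S₀) where
    Sᵢ : ℕ → Fin n → Bool
    Sᵢ = grow G S₀

    closedS : ∀ i → Closed i (Sᵢ i)
    closedS zero = cl₀
    closedS (suc i) u v e = cong₂ _∨_ (closedS i u v (mono i e)) (cong (1 ≤b_) (deg-eq i (closedS i) e))

    S-grows : ∀ i → 1 ≤ # (Sᵢ i)
    S-grows i = ≤-trans S₀≥1 (#-mono (grow-≤ G S₀ {0} {i} z≤n))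

    reaches : ∀ i → (2 ^ i ≤ # (Sᵢ i)) ⊎ (n ≤ 4 * (d * # (Sᵢ i)))
    reaches zero = inj₁ S₀≥1
    reaches (suc i) with reaches i | double c ebad hc hd hn (Sᵢ i) (S-grows i)
    ... | inj₂ k | _ = inj₂ (≤-trans k (*-monoʳ-≤ 4 (*-monoʳ-≤ d (#-mono λ x → ∨-i₁))))
    ... | inj₁ k | inj₁ q = inj₁ (≤-trans (*-monoʳ-≤ 2 k) (≤-trans q (#-mono λ x → ∨-i₂ {Sᵢ i x})))
    ... | inj₁ k | inj₂ q = inj₂ (≤-trans (<⇒≤ q) (≤-trans (≤-reflexive (*-assoc 4 8 (# (nbd G (Sᵢ i))))) (*-monoʳ-≤ 4 (*-mono-≤ d≥8 (#-mono λ x → ∨-i₂ {Sᵢ i x})))))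

    opaque
      first-big : ∃ λ s → s ≤ n × (n ≤ 4 * (d * # (Sᵢ s))) × (∀ j → j < s → 4 * (d * # (Sᵢ j)) < n)
      first-big = let (s , a , b , k) = search (λ i → n ≤b 4 * (d * # (Sᵢ i))) n (≤b-i (at-n (reaches n))) in s , a , ≤b-t b , λ j l → ≤b-f (k j l)
        where
        at-n : (2 ^ n ≤ # (Sᵢ n)) ⊎ (n ≤ 4 * (d * # (Sᵢ n))) → n ≤ 4 * (d * # (Sᵢ n))
        at-n (inj₂ k) = k
        at-n (inj₁ k) = ≤-trans (<⇒≤ (n<2^n n)) (≤-trans k (≤-trans (m≤n*m (# (Sᵢ n)) d {{>-nonZero (≤-trans (s≤s z≤n) d≥8)}}) (m≤n*m (d * # (Sᵢ n)) 4)))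

    s = proj₁ first-big
    s≤n = proj₁ (proj₂ first-big)
    s-big = proj₁ (proj₂ (proj₂ first-big))
    s-first = proj₂ (proj₂ (proj₂ first-big))

    2d : 2 * (1 + d) ≤ 4 * d
    2d = ≤-trans (*-monoʳ-≤ 2 (+-monoˡ-≤ d (≤-trans (s≤s z≤n) d≥8))) (≤-reflexive (l d)) where
      l : ∀ d → 2 * (d + d) ≡ 4 * d
      l = solve-∀

    -- The preceding neighbourhood has fewer than n/(4d) vertices, and one step multiplies by at
    -- most 1 + d ≤ 2d; for s = 0 it is the choice of the smaller side.
    s-half : 2 * # (Sᵢ s) ≤ n
    s-half = go s s-first
      where
      go : ∀ s → (∀ j → j < s → 4 * (d * # (Sᵢ j)) < n) → 2 * # (Sᵢ s) ≤ n
      go zero _ = S₀≤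
      go (suc s') k = ≤-trans (*-monoʳ-≤ 2 (grow-size r S₀ s')) (≤-trans (≤-reflexive (sym (*-assoc 2 (1 + d) _)))
          (≤-trans (*-monoˡ-≤ (# (Sᵢ s')) 2d) (≤-trans (≤-reflexive (*-assoc 4 d _)) (<⇒≤ (k s' ≤-refl)))))

    v₀ : Fin n
    v₀ = proj₁ (#-pos {f = S₀} S₀≥1)

    v₀∈ : S₀ v₀ ≡ true
    v₀∈ = proj₂ (#-pos {f = S₀} S₀≥1)

    covers : ∀ D → DiamLe M D → ∀ A v → A v ≡ true → # (grow G A D) ≡ n
    covers D h A v e = trans (#-cong {g = λ _ → true} λ x → subst (λ j → grow G A j x ≡ true) (+-identityʳ D) (reach-grow M A r D 0 v x e (h v x))) (#-true n)

    s≤D : ∀ D → DiamLe M D → s ≤ D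
    s≤D D h with s ≤? D
    ... | yes k = k
    ... | no k = ⊥-elim (<⇒≱ (s-first D (≰⇒> k)) (≤-trans (m≤n*m n d {{>-nonZero (≤-trans (s≤s z≤n) d≥8)}})
        (≤-trans (m≤n*m (d * n) 4) (*-monoʳ-≤ 4 (*-monoʳ-≤ d (≤-reflexive (sym (covers D h S₀ v₀ v₀∈))))))))

    -- A large s-th neighbourhood S' serves itself, as it has at most n/2 vertices. Otherwise no
    -- class of round s + 1 has more than n - 2w vertices: its vertices have equally many neighbours
    -- in S', a positive number because `nbd G S'` has at least 2w vertices and meets the class, and
    -- at most d/4 by counting the edges at S'. `Uneven` excludes this.
    balanced-at : ∀ w rr PA → Uneven.bad n d w rr G ≡ false → 64 * (c * w) ≤ n → 1 ≤ w → n ≤ PA * w → d ≤ n →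
      ∃ λ A → Closed (suc s) A × n ≤ PA * # A × n ≤ PA * # (λ x → not (A x))
    balanced-at w rr PA ub h64 hw hPA hdn with w ≤? # (Sᵢ s)
    ... | yes k = Sᵢ s , closed-suc {s} {Sᵢ s} (closedS s) , ≤-trans hPA (*-monoʳ-≤ PA k) , ≤-trans hPA (*-monoʳ-≤ PA (≤-trans k
           (+-cancelˡ-≤ (# (Sᵢ s)) _ _ (≤-trans (≤-reflexive (cong (# (Sᵢ s) +_) (sym (+-identityʳ _)))) (≤-trans s-half (≤-reflexive (#-compl (Sᵢ s))))))))
    ... | no k = let (A , cl , a , b) = balanced-union (suc s) (n ∸ (w + w)) w small (≤-reflexive (m+[n∸m]≡n 2w≤n)) in
           A , cl , ≤-trans hPA (*-monoʳ-≤ PA a) , ≤-trans hPA (*-monoʳ-≤ PA b)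
      where
      open ≤-Reasoning
      S' = Sᵢ s
      c≥1 : 1 ≤ c
      c≥1 = ≤-trans (s≤s z≤n) hc
      64w : 64 * w ≤ n
      64w = ≤-trans (*-monoʳ-≤ 64 (m≤n*m w c {{>-nonZero c≥1}})) h64
      2w≤n : w + w ≤ n
      2w≤n = ≤-trans (≤-reflexive (cong (w +_) (sym (+-identityʳ w)))) (≤-trans (*-monoˡ-≤ w (m≤m+n 2 62)) 64w)
      small : ∀ u → size (suc s) u ≤ n ∸ (w + w)
      small u with size (suc s) u ≤? n ∸ (w + w)
      ... | yes q = q
      ... | no q = ⊥-elim (<⇒≱ (Uneven.uneven n d w rr {G} ub S' a (<⇒≤ (≰⇒> k)) a≥1 4a a≤n) off≤)
        where
        U : Fin n → Bool
        U z = R (suc s) z u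
        a = degTo S' G u
        U-deg : ∀ x → U x ≡ true → degTo S' G x ≡ a
        U-deg x e = deg-eq s {S'} (closedS s) {x} {u} e
        nU : n < # U + (w + w)
        nU = ≤-trans (s≤s (≤-reflexive (sym (m∸n+n≡m 2w≤n)))) (+-monoˡ-≤ (w + w) (≰⇒> q))
        off≤ : off S' a G ≤ 2 * w
        off≤ = +-cancelˡ-≤ (# U) _ _ (≤-trans (+-monoʳ-≤ (# U) (#-mono {g = λ x → not (U x)} λ x e → not-f (¬t→f λ ux → t≢f (=b-i (U-deg x ux)) (not-t e))))
                 (≤-trans (≤-reflexive (sym (#-compl U))) (≤-trans (<⇒≤ nU) (≤-reflexive (cong (λ y → # U + (w + y)) (sym (+-identityʳ w)))))))
        N = nbd G S'
        nN : n ≤ 32 * c * # N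
        nN with expand c ebad hc hd hn S' (S-grows s)
        ... | inj₁ e = ≤-trans s-big (≤-trans (*-monoʳ-≤ 4 e) (≤-reflexive (l c (# N)))) where
          l : ∀ c x → 4 * (8 * (c * x)) ≡ 32 * c * x
          l = solve-∀
        ... | inj₂ e = ≤-trans (<⇒≤ e) (*-monoˡ-≤ (# N) (m≤m*n 32 c {{>-nonZero c≥1}}))
        2w≤N : w + w ≤ # N
        2w≤N = *-cancelˡ-≤ (32 * c) {{>-nonZero (*-mono-≤ {1} {32} {1} (s≤s z≤n) c≥1)}} (≤-trans (≤-reflexive (l c w)) (≤-trans h64 nN)) where
          l : ∀ c w → 32 * c * (w + w) ≡ 64 * (c * w)
          l = solve-∀
        meet : 1 ≤ # (λ x → U x ∧ N x)
        meet = +-cancelʳ-≤ n 1 _ (≤-trans (<-≤-trans nU (+-monoʳ-≤ (# U) 2w≤N)) (≤-trans (≤-reflexive (cong (_+ # N) (#-split U N)))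
            (≤-trans (≤-reflexive (+-assoc (# (λ x → U x ∧ N x)) _ _)) (+-monoʳ-≤ (# (λ x → U x ∧ N x)) (≤-trans (+-monoˡ-≤ (# N) (#-mono λ x e → ∧-r {a = U x} e))
              (≤-reflexive (trans (+-comm _ (# N)) (sym (#-compl N)))))))))
        a≥1 : 1 ≤ a
        a≥1 = let (x , e) = #-pos {f = λ x → U x ∧ N x} meet in ≤-trans (≤b-t (∧-r {a = U x} e)) (≤-reflexive (U-deg x (∧-l e)))
        Ua : # U * a ≤ w * d
        Ua = ≤-trans (≤-reflexive (sym (E2-fac U (λ u x → S' x ∧ G u x) a U-deg))) (≤-trans (E2-mono {g = λ u x → G u x ∧ S' x} λ u x e → let q = ∧-r {a = U u} e in ∧-i (∧-r {a = S' x} q) (∧-l q))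
               (≤-trans (≤-reflexive (edges-to r S')) (*-monoˡ-≤ d (<⇒≤ (≰⇒> k)))))
        n≤2U : n ≤ 2 * # U
        n≤2U = lin (60 * w) (+-mono-≤ (*-monoʳ-≤ 2 (<⇒≤ nU)) 64w) (l n (# U) w) where
          l : ∀ n U w → n + (2 * (U + (w + w)) + n) + 60 * w ≡ 2 * n + 64 * w + 2 * U
          l = solve-∀
        4a : 4 * a ≤ d
        4a = *-cancelˡ-≤ (2 * w) {{>-nonZero (*-mono-≤ {1} {2} {1} (s≤s z≤n) hw)}} (begin
          2 * w * (4 * a) ≡⟨ l1 w a ⟩
          8 * w * a ≤⟨ *-monoˡ-≤ a (≤-trans (*-monoˡ-≤ w (m≤m+n 8 56)) 64w) ⟩
          n * a ≤⟨ *-monoˡ-≤ a n≤2U ⟩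
          2 * # U * a ≡⟨ *-assoc 2 (# U) a ⟩
          2 * (# U * a) ≤⟨ *-monoʳ-≤ 2 Ua ⟩
          2 * (w * d) ≡⟨ sym (*-assoc 2 w d) ⟩
          2 * w * d ∎)
          where
          l1 : ∀ w a → 2 * w * (4 * a) ≡ 8 * w * a
          l1 = solve-∀
        a≤n : a ≤ n
        a≤n = ≤-trans (≤-trans (m≤n*m a 4) 4a) hdn

    -- The first s - 1 neighbourhoods of v₀ lie in those of S₀, which have fewer than n/(4d) vertices.
    ball-half : ∀ A → A v₀ ≡ true → (∀ x → A x ≡ true → S₀ x ≡ true) → # A ≡ 1 → n ≤ 2 * # (λ x → not (grow G A (suc (pred s)) x))
    ball-half A Av sub A1 = +-cancelˡ-≤ n _ _ (begin
        n + n ≡⟨ cong₂ _+_ refl (sym (+-identityʳ n)) ⟩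
        2 * n ≡⟨ cong (2 *_) (#-compl B) ⟩
        2 * (# B + # (λ x → not (B x))) ≡⟨ *-distribˡ-+ 2 (# B) _ ⟩
        2 * # B + 2 * # (λ x → not (B x)) ≤⟨ +-monoˡ-≤ _ (≤-trans (*-monoʳ-≤ 2 (grow-size r A s')) (≤-trans (≤-reflexive (sym (*-assoc 2 (1 + d) _)))
           (≤-trans (*-monoˡ-≤ (# (grow G A s')) 2d) (≤-trans (≤-reflexive (*-assoc 4 d _)) (ball s s-first))))) ⟩
        n + 2 * # (λ x → not (B x)) ∎)
      where
      open ≤-Reasoning
      s' = pred s
      B = grow G A (suc s')
      ball : ∀ s → (∀ j → j < s → 4 * (d * # (Sᵢ j)) < n) → 4 * (d * # (grow G A (pred s))) ≤ n
      ball zero _ = ≤-trans (*-monoʳ-≤ 4 (≤-trans (≤-reflexive (trans (cong (d *_) A1) (*-identityʳ d))) (n≤1+n d))) hn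
      ball (suc s') k = ≤-trans (*-monoʳ-≤ 4 (*-monoʳ-≤ d (#-mono (grow-mono G sub s')))) (<⇒≤ (k s' ≤-refl))

-- Constants and the events common to both ranges of the degree.

opaque
  -- 18 is what `Expansion` demands and 480 what `Uneven` demands.
  cc rr : ℕ
  cc = 18
  rr = 480

  cc≥ : 18 ≤ cc
  cc≥ = ≤-refl

  rr≥ : 480 ≤ rr
  rr≥ = ≤-refl

  64cc≤60rr : 64 * cc ≤ 60 * rr
  64cc≤60rr = ≤ᵇ⇒≤ (64 * 18) (60 * 480) _

good-at : (M : Matrix n) (p : Fin n → Bool) (t σ k : ℕ) → 1 ≤ k → (∀ x → # (λ z → sameColour M p t z x) ≤ σ) → 3 * (k * suc σ) ≤ 2 * n →
  ∃ λ (f : Fin n → Fin k) → ((i : Fin k) → n ≤ 3 * k * partSize f i × k * partSize f i ≤ 3 * n) × ((u v : Fin n) → sameColour M p t u v ≡ true → f u ≡ f v)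
good-at {n} M p t σ k hk hσ h = let (f , b , c) = Classes.partition (sameColour-refinement M p) t σ k hk hσ h in
  f , (λ i → subst (λ y → n ≤ 3 * k * y × k * y ≤ 3 * n) (sym (countB-# (λ x → eqF (f x) i))) (b i)) , c

smaller-side : (M : Matrix n) (p : Fin n → Bool) → (∃ λ u → p u ≡ true) → (∃ λ v → p v ≡ false) →
  ∃ λ S₀ → (1 ≤ # S₀) × (2 * # S₀ ≤ n) × Classes.Closed (sameColour-refinement M p) 0 S₀
smaller-side {n} M p (u , pu) (v , pv) with ≤-total (# p) (# (λ x → not (p x)))
... | inj₁ h = p , pos-# {f = p} pu , ≤-trans (+-monoʳ-≤ (# p) (≤-trans (≤-reflexive (+-identityʳ _)) h)) (≤-reflexive (sym (#-compl p))) , λ x y e → ==-t e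
... | inj₂ h = (λ x → not (p x)) , pos-# {f = λ x → not (p x)} (not-f pv) ,
  ≤-trans (≤-trans (≤-reflexive (cong (# (λ x → not (p x)) +_) (+-identityʳ _))) (+-monoˡ-≤ _ h)) (≤-reflexive (sym (#-compl p))) , λ x y e → cong not (==-t e)

σ-of : ∀ D n → 1 ≤ D → ∃ λ σ → (σ * D ≤ n) × (∀ s → D * s < n → s ≤ σ)
σ-of D n h = let (q , a , b) = divide n D h in q , a , λ s l → ≤-pred (*-cancelʳ-< D s (suc q) (≤-<-trans (≤-reflexive (*-comm s D)) (<-trans l b)))

part-arith : ∀ k σ n → σ * (6 * k) ≤ n → 6 * k ≤ n → 3 * (k * suc σ) ≤ 2 * n
part-arith k σ n h h' = ≤-trans (*-cancelˡ-≤ 2 (lin 0 (+-mono-≤ h h') (l k σ n))) (m≤n*m n 2)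
  where
  l : ∀ k σ n → 2 * (3 * (k * suc σ)) + (n + n) + 0 ≡ σ * (6 * k) + 6 * k + 2 * n
  l = solve-∀

ct : ℕ → ℕ
ct P = 192 * (P * P)

-- `Dense` with κ = 12τ needs about 96P²τ ≤ d; the doubled constant 192 absorbs rounding and lower
-- terms. Of κ, 6τ is spent on common neighbours and the rest leaves room for L.
choose-τ : ∀ P L → 1 ≤ P → ∀ d → ct P * (4 + L) ≤ d → ∃ λ τ → (d ≤ ct P * τ) × (4 ≤ τ) × (8 * (P * P * (12 * τ + 8)) ≤ d) × (L + (2 * τ + 2 * τ * 2) ≤ 12 * τ)
choose-τ P L hP d h = suc q , ≤-trans (<⇒≤ (proj₂ (proj₂ dv))) (≤-reflexive (*-comm (suc q) (ct P))) , ≤-trans (m≤m+n 4 L) (≤-trans qL (n≤1+n q)) , big ,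
    ≤-trans (+-monoˡ-≤ _ (≤-trans (≤-trans (m≤n+m L 4) qL) (n≤1+n q))) (lin 0 (*-monoˡ-≤ (suc q) (m≤m+n 1 5)) (l (suc q)))
  where
  ct≥1 : 1 ≤ ct P
  ct≥1 = *-mono-≤ {1} {192} {1} (s≤s z≤n) (*-mono-≤ {1} {P} {1} hP hP)
  dv = divide d (ct P) ct≥1
  q = proj₁ dv
  qL : 4 + L ≤ q
  qL = ≤-pred (*-cancelʳ-< (ct P) (4 + L) (suc q) (≤-<-trans (≤-trans (≤-reflexive (*-comm (4 + L) (ct P))) h) (proj₂ (proj₂ dv))))
  l : ∀ x → x + (2 * x + 2 * x * 2) + 6 * x + 0 ≡ 1 * x + 12 * x
  l = solve-∀
  big : 8 * (P * P * (12 * suc q + 8)) ≤ d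
  big = begin
      8 * (P * P * (12 * suc q + 8)) ≡⟨ l₁ (P * P) q ⟩
      96 * (P * P * q) + 40 * (P * P * 4) ≤⟨ +-monoʳ-≤ (96 * (P * P * q)) (*-mono-≤ {40} {96} (m≤m+n 40 56) (*-monoʳ-≤ (P * P) (≤-trans (m≤m+n 4 L) qL))) ⟩
      96 * (P * P * q) + 96 * (P * P * q) ≡⟨ l₂ (P * P) q ⟩
      q * (192 * (P * P)) ≤⟨ proj₁ (proj₂ dv) ⟩
      d ∎
    where
    open ≤-Reasoning
    l₁ : ∀ X q → 8 * (X * (12 * suc q + 8)) ≡ 96 * (X * q) + 40 * (X * 4)
    l₁ = solve-∀
    l₂ : ∀ X q → 96 * (X * q) + 96 * (X * q) ≡ q * (192 * X)
    l₂ = solve-∀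

-- One multiple of d that dominates all multiples of d the base events have to compare with n.
sparsity : ℕ → ℕ
sparsity P = 8 * P + 12 + 32 + 8 * ct P ^ 6 * ct P

module Base (n d P τ : ℕ) (hP : 1 ≤ P) (hd : 1 ≤ d) (hdn : sparsity P * d ≤ n) (h180 : 180 * rr ≤ n)
    (t1 : d ≤ ct P * τ) (t2 : 4 ≤ τ) (t3 : 8 * (P * P * (12 * τ + 8)) ≤ d) where
  private
    below : ∀ X → X ≤ sparsity P → X * d ≤ n
    below X h = ≤-trans (*-monoˡ-≤ d h) hdn
    1+d : 1 + d ≤ 2 * d
    1+d = ≤-trans (+-monoˡ-≤ d hd) (≤-reflexive (cong (d +_) (sym (+-identityʳ d))))

    wd = divide n (60 * rr) (*-mono-≤ {1} {60} {1} (s≤s z≤n) (≤-trans (s≤s z≤n) rr≥))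

  w : ℕ
  w = proj₁ wd

  private
    w≥3 : 3 ≤ w
    w≥3 = ≤-pred (*-cancelʳ-< (60 * rr) 3 (suc w) (≤-<-trans (≤-trans (≤-reflexive (sym (*-assoc 3 60 rr))) h180) (proj₂ (proj₂ wd))))

  w≥1 : 1 ≤ w
  w≥1 = ≤-trans (s≤s z≤n) w≥3

  w-lo : 60 * rr * w ≤ n
  w-lo = ≤-trans (≤-reflexive (*-comm (60 * rr) w)) (proj₁ (proj₂ wd))

  w-hi : n ≤ 120 * rr * w
  w-hi = ≤-trans (<⇒≤ (proj₂ (proj₂ wd))) (≤-trans (*-monoˡ-≤ (60 * rr) (+-monoˡ-≤ w w≥1)) (≤-reflexive (l rr w))) where
    l : ∀ r w → (w + w) * (60 * r) ≡ 120 * r * w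
    l = solve-∀

  w-64 : 64 * (cc * w) ≤ n
  w-64 = ≤-trans (≤-reflexive (sym (*-assoc 64 cc w))) (≤-trans (*-monoˡ-≤ w 64cc≤60rr) w-lo)

  4d : 4 * (1 + d) ≤ n
  4d = ≤-trans (*-monoʳ-≤ 4 1+d) (≤-trans (≤-reflexive (sym (*-assoc 4 2 d))) (below 8
      (≤-trans (≤-trans (m≤m+n 8 4) (m≤n+m 12 (8 * P))) (≤-trans (m≤m+n (8 * P + 12) 32) (m≤m+n _ _)))))

  d≤n : d ≤ n
  d≤n = ≤-trans (≤-trans (n≤1+n d) (m≤n*m (1 + d) 4)) 4d

  n≥1 : 1 ≤ n
  n≥1 = ≤-trans hd d≤n

  bad : Gr n → Bool
  bad G = (Expansion.bad n d cc G ∨ Uneven.bad n d w rr G) ∨ (Dense.bad n d P (12 * τ) G ∨ Twins.bad n d (ct P) τ G)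

  bad-rare : ∀ Bt → 4 * Bt ≤ n → Rare d Bt bad
  bad-rare Bt hB = rare-∨ _ _ (rare-∨ _ _ (Expansion.bad-rare n d cc cc≥ hd 4d (2 * (2 * Bt)) hB')
      (Uneven.bad-rare n d w rr hd 16d rr≥ w-lo w-hi w≥3 (2 * (2 * Bt)) hB'))
      (rare-∨ _ _ (Dense.bad-rare n d P (12 * τ) hd Pd t3 n≥1 (2 * (2 * Bt)) hB') (Twins.bad-rare n d (ct P) τ hd ct≥1 t1 t2 8d ctd (2 * (2 * Bt)) hB'))
    where
    hB' : 2 * (2 * Bt) ≤ n
    hB' = ≤-trans (≤-reflexive (sym (*-assoc 2 2 Bt))) hB
    ct≥1 : 1 ≤ ct P
    ct≥1 = *-mono-≤ {1} {192} {1} (s≤s z≤n) (*-mono-≤ {1} {P} {1} hP hP)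
    16d : 16 * (1 + d) ≤ n
    16d = ≤-trans (*-monoʳ-≤ 16 1+d) (≤-trans (≤-reflexive (sym (*-assoc 16 2 d))) (below 32 (≤-trans (m≤n+m 32 (8 * P + 12)) (m≤m+n _ _))))
    Pd : 4 * ((1 + d) * P) ≤ n
    Pd = ≤-trans (*-monoʳ-≤ 4 (*-monoˡ-≤ P 1+d)) (≤-trans (≤-reflexive (l d P)) (below (8 * P) (≤-trans (m≤m+n (8 * P) 12) (≤-trans (m≤m+n (8 * P + 12) 32) (m≤m+n _ _))))) where
      l : ∀ d P → 4 * (2 * d * P) ≡ 8 * P * d
      l = solve-∀
    8d : 4 * (2 + d) ≤ n
    8d = ≤-trans (*-monoʳ-≤ 4 (+-monoˡ-≤ d (*-monoʳ-≤ 2 hd))) (≤-trans (≤-reflexive (l d)) (below 12 (≤-trans (m≤n+m 12 (8 * P)) (≤-trans (m≤m+n (8 * P + 12) 32) (m≤m+n _ _))))) where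
      l : ∀ d → 4 * (2 * d + d) ≡ 12 * d
      l = solve-∀
    ctd : 8 * ct P ^ 6 * (ct P * d) ≤ n
    ctd = ≤-trans (≤-reflexive (sym (*-assoc (8 * ct P ^ 6) (ct P) d))) (below (8 * ct P ^ 6 * ct P) (m≤n+m _ (8 * P + 12 + 32)))

  module _ {G : Gr n} (e : bad G ≡ false) where
    e₁ : Expansion.bad n d cc G ≡ false
    e₁ = ∨-f₁ (∨-f₁ {Expansion.bad n d cc G ∨ Uneven.bad n d w rr G} e)
    e₂ : Uneven.bad n d w rr G ≡ false
    e₂ = ∨-f₂ {Expansion.bad n d cc G} (∨-f₁ {Expansion.bad n d cc G ∨ Uneven.bad n d w rr G} e)
    e₃ : Dense.bad n d P (12 * τ) G ≡ false
    e₃ = ∨-f₁ (∨-f₂ {Expansion.bad n d cc G ∨ Uneven.bad n d w rr G} e)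
    e₄ : Twins.bad n d (ct P) τ G ≡ false
    e₄ = ∨-f₂ {Dense.bad n d P (12 * τ) G} (∨-f₂ {Expansion.bad n d cc G ∨ Uneven.bad n d w rr G} e)

-- The bad event has probability of order B/n: `Bt` may be any number up to n/B.
Outcome : ℕ → ℕ → ℕ → ℕ → Set
Outcome n d k B = ∃ λ (bad : Gr n → Bool) → (∀ Bt → B * Bt ≤ n → Rare d Bt bad) × (∀ M → IsReg d (adj M) → bad (adj M) ≡ false → Good k M)

-- With one group and one label besides zero, the cost per vertex is 8 · (1 · 2) = 16, so p = 16 and
-- `c₀` = 1 fit, and e = 4PE follows. The threshold L is then a constant depending on PX, which d
-- has to exceed.
module SplitParameters (PX : ℕ) where
  PE eX : ℕ
  PE = 2 * (4 * PX)
  eX = 4 * PE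

  L : ℕ
  L = 7 * ((4 * (16 ^ eX) + 4 * (16 ^ eX)) * (4 * (16 ^ eX) + 4 * (16 ^ eX)))

  rare : ∀ n d → 2 * (1 * PE) ≤ n → ∀ Bt → Bt ≤ n → Rare d Bt (Exchangeable.bad n d 1 1 PE 16 eX)
  rare n d h = Exchangeable.bad-rare n d 1 1 PE 16 eX 1 (s≤s z≤n) h (≤-reflexive (l PE)) ≤-refl
    where
    l : ∀ x → 4 * (x * 1) ≡ 4 * x * 1
    l = solve-∀

-- Large degree.

P-large : ℕ → ℕ
P-large k = 4 * (1 * (4 * (6 * k))) + 120 * rr

large-degree : ∀ k → 1 ≤ k → ∃ λ d₁ → ∃ λ N → ∀ n d → d₁ ≤ d → sparsity (P-large k) * d ≤ n → N ≤ n → Outcome n d k 8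
large-degree k hk = 16 * cc + ct P * (4 + X.L) , 180 * rr + (6 * PX + 2 * (1 * X.PE)) , go
  where
  PX = 6 * k
  P = P-large k
  module X = SplitParameters PX
  P≥1 : 1 ≤ P
  P≥1 = ≤-trans (≤-trans (≤-trans (s≤s z≤n) rr≥) (m≤n*m rr 120)) (m≤n+m (120 * rr) (4 * (1 * (4 * PX))))
  PX≥1 : 1 ≤ PX
  PX≥1 = ≤-trans hk (m≤n*m k 6)
  go : ∀ n d → 16 * cc + ct P * (4 + X.L) ≤ d → sparsity P * d ≤ n → 180 * rr + (6 * PX + 2 * (1 * X.PE)) ≤ n → Outcome n d k 8
  go n d hd₁ hC hN = bad , rare , good
    where
    16c : 16 * cc ≤ d
    16c = ≤-trans (m≤m+n (16 * cc) _) hd₁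
    hd : 1 ≤ d
    hd = ≤-trans (≤-trans (≤-trans (s≤s z≤n) cc≥) (m≤n*m cc 16)) 16c
    tt = choose-τ P X.L P≥1 d (≤-trans (m≤n+m (ct P * (4 + X.L)) (16 * cc)) hd₁)
    τ = proj₁ tt
    module B = Base n d P τ P≥1 hd hC (≤-trans (m≤m+n (180 * rr) _) hN) (proj₁ (proj₂ tt)) (proj₁ (proj₂ (proj₂ tt))) (proj₁ (proj₂ (proj₂ (proj₂ tt))))
    exb = Exchangeable.bad n d 1 1 X.PE 16 X.eX
    bad : Gr n → Bool
    bad G = B.bad G ∨ exb G
    6PX : 6 * PX ≤ n
    6PX = ≤-trans (≤-trans (m≤m+n (6 * PX) (2 * (1 * X.PE))) (m≤n+m _ (180 * rr))) hN
    rare : ∀ Bt → 8 * Bt ≤ n → Rare d Bt bad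
    rare Bt hB = rare-∨ B.bad exb (B.bad-rare (2 * Bt) (≤-trans (≤-reflexive (sym (*-assoc 4 2 Bt))) hB))
      (X.rare n d (≤-trans (≤-trans (m≤n+m (2 * (1 * X.PE)) (6 * PX)) (m≤n+m _ (180 * rr))) hN) (2 * Bt) (≤-trans (*-monoˡ-≤ Bt (m≤m+n 2 6)) hB))
    good : ∀ M → IsReg d (adj M) → bad (adj M) ≡ false → Good k M
    good M r e p hu hv = suc (suc T.s) , bound , good-at M p (suc (suc T.s)) σ k hk (λ x → proj₂ (proj₂ so) _ (shrunk x))
        (part-arith k σ n (proj₁ (proj₂ so)) (≤-trans (m≤n*m (6 * k) 6) 6PX))
      where
      eB : B.bad (adj M) ≡ false
      eB = ∨-f₁ e
      side = smaller-side M p hu hv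
      module Q = BFS M p r cc (B.e₁ {adj M} eB) cc≥ 16c B.4d
      module T = Q.FromSide (proj₁ side) (proj₁ (proj₂ side)) (proj₁ (proj₂ (proj₂ side))) (proj₂ (proj₂ (proj₂ side)))
      bal = T.balanced-at B.w rr (120 * rr) (B.e₂ {adj M} eB) B.w-64 B.w≥1 B.w-hi B.d≤n
      shrunk : ∀ x → PX * # (λ z → sameColour M p (suc (suc T.s)) z x) < n
      shrunk = Shrink.shrink-balanced {d = d} (sameColour-refinement M p) (ct P) τ (12 * τ) P (B.e₃ {adj M} eB) (B.e₄ {adj M} eB) PX (120 * rr) 16 X.eX
        (∨-f₂ {B.bad (adj M)} e) (proj₂ (proj₂ (proj₂ (proj₂ tt)))) (m≤m+n _ _) (m≤n+m _ (4 * (1 * (4 * PX)))) 6PX PX≥1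
        (suc T.s) (proj₁ bal) (proj₁ (proj₂ bal)) (proj₁ (proj₂ (proj₂ bal))) (proj₂ (proj₂ (proj₂ bal)))
      so = σ-of PX n PX≥1
      σ = proj₁ so
      bound : ∀ D → DiamLe M D → suc (suc T.s) ≤ D + 2
      bound D h = ≤-trans (s≤s (s≤s (T.s≤D D h))) (≤-reflexive (+-comm 2 D))

-- Bounded degree.

root4 : ∀ d → ∃ λ p → (p ^ 4 ≤ d) × (d < suc p ^ 4)
root4 d with search (λ m → suc d ≤b suc m ^ 4) d (≤b-i (≤-trans (≤-reflexive (sym (*-identityʳ (suc d)))) (^-monoʳ-≤ (suc d) {1} {4} (s≤s z≤n))))
... | zero , _ , a , _ = 0 , z≤n , ≤b-t a
... | suc p , _ , a , k = suc p , ≤-pred (≤b-f (k p ≤-refl)) , ≤b-t a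

log2 : ∀ d → ∃ λ D → D ≤ d × (d ≤ 2 ^ D) × (∀ j → j < D → 2 ^ j < d)
log2 d = let (D , a , b , k) = search (λ m → d ≤b 2 ^ m) d (≤b-i (<⇒≤ (n<2^n d))) in D , a , ≤b-t b , λ j l → ≤b-f (k j l)

never : Gr n → Bool
never _ = false

rare-never : ∀ b → Rare {n} d b never
rare-never {n} {d} b = ≤-trans (≤-reflexive (cong (_* b) (cnt-0 {n} {d} never (λ _ → refl)))) z≤n

-- Each use of `Far` leaves more than k = Z/C vertices outside the next ball, with C depending only
-- on K and d₁. So a linear number survives each of the i steps, K growing with every step.
far-chain : ∀ d₁ i K → 1 ≤ K → ∃ λ N → ∀ n d Z → N ≤ n → 1 ≤ d → d ≤ d₁ → n ≤ 2 * (K * Z) → ∃ λ (bad : Gr n → Bool) →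
  (∀ Bt → 2 ^ i * Bt ≤ n → Rare d Bt bad) × (∀ G → bad G ≡ false → ∀ v t → t + i ≤ 2 * n → Z ≤ outside G (single v) (suc t) → 1 ≤ outside G (single v) (suc (t + i)))
far-chain d₁ zero K hK = 1 , λ n d Z hN hd hd₁ hZ → never , (λ Bt _ → rare-never {n} {d} Bt) , λ G _ v t _ h →
  ≤-trans (≤-trans (pos3 n Z hN hZ) h) (≤-reflexive (cong (λ y → outside G (single v) (suc y)) (sym (+-identityʳ t))))
  where
  pos3 : ∀ n Z → 1 ≤ n → n ≤ 2 * (K * Z) → 1 ≤ Z
  pos3 n zero h k = ≤-trans h (≤-trans k (≤-reflexive (trans (cong (2 *_) (*-zeroʳ K)) refl)))
  pos3 n (suc Z) _ _ = s≤s z≤n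
far-chain d₁ (suc i) K hK = N' , go
  where
  C = 2 * (suc (4 * (K * d₁)) ^ d₁ * (1 + d₁ * 2))
  C≥1 : 1 ≤ C
  C≥1 = *-mono-≤ {1} {2} {1} (s≤s z≤n) (*-mono-≤ {1} {suc (4 * (K * d₁)) ^ d₁} {1} (m^n>0 (suc (4 * (K * d₁))) d₁) (s≤s z≤n))
  K' = 2 * (K * C)
  K'≥1 : 1 ≤ K'
  K'≥1 = *-mono-≤ {1} {2} {1} (s≤s z≤n) (*-mono-≤ {1} {K} {1} hK C≥1)
  ih = far-chain d₁ i K' K'≥1
  pb = pow-beats (8 * K')
  k₀ = proj₁ pb
  N' = proj₁ ih + (2 * (K * (4 * (1 + d₁))) + 2 * (K' * suc k₀))
  go : ∀ n d Z → N' ≤ n → 1 ≤ d → d ≤ d₁ → n ≤ 2 * (K * Z) → ∃ λ (bad : Gr n → Bool) →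
    (∀ Bt → 2 ^ suc i * Bt ≤ n → Rare d Bt bad) × (∀ G → bad G ≡ false → ∀ v t → t + suc i ≤ 2 * n → Z ≤ outside G (single v) (suc t) → 1 ≤ outside G
        (single v) (suc (t + suc i)))
  go n d Z hN hd hd₁ hZ = (λ G → F.bad G ∨ proj₁ rec G) ,
      (λ Bt hB → rare-∨ F.bad (proj₁ rec) (F.bad-rare hd hZ h4 hk h2 (2 * Bt) (≤-trans (*-monoˡ-≤ Bt (^-monoʳ-≤ 2 {1} {suc i} (s≤s z≤n))) hB))
          (proj₁ (proj₂ rec) (2 * Bt) (≤-trans (≤-reflexive (l₀ (2 ^ i) Bt)) hB))) ,
      λ G e v t ht h → subst (λ y → 1 ≤ outside G (single v) (suc y)) (sym (+-suc t i))
        (proj₂ (proj₂ rec) G (∨-f₂ {F.bad G} e) v (suc t) (≤-trans (≤-reflexive (sym (+-suc t i))) ht)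
            (<⇒≤ (F.far {G} (∨-f₁ e) v t (≤-trans (m≤m+n t (suc i)) ht) h)))
    where
    open ≤-Reasoning
    l₀ : ∀ x b → x * (2 * b) ≡ 2 * x * b
    l₀ = solve-∀
    dv = divide Z C C≥1
    k = proj₁ dv
    module F = Far n d K Z k
    Zge : ∀ X → 2 * (K * X) ≤ n → X ≤ Z
    Zge X h = *-cancelˡ-≤ K {{>-nonZero hK}} (*-cancelˡ-≤ 2 (≤-trans h hZ))
    h4 : 4 * (1 + d) ≤ Z
    h4 = ≤-trans (*-monoʳ-≤ 4 (+-monoʳ-≤ 1 hd₁)) (Zge (4 * (1 + d₁)) (≤-trans (≤-trans (m≤m+n (2 * (K * (4 * (1 + d₁)))) _) (m≤n+m _ (proj₁ ih))) hN))
    k≥ : suc k₀ ≤ k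
    k≥ = ≤-pred (*-cancelʳ-< C (suc k₀) (suc k) (≤-<-trans (Zge (suc k₀ * C) (≤-trans (≤-reflexive (l₁ K C (suc k₀)))
        (≤-trans (m≤n*m (K' * suc k₀) 2) (≤-trans (≤-trans (m≤n+m (2 * (K' * suc k₀)) (2 * (K * (4 * (1 + d₁))))) (m≤n+m _ (proj₁ ih))) hN)))) (proj₂ (proj₂ dv))))
      where
      l₁ : ∀ K C x → 2 * (K * (x * C)) ≡ 2 * (K * C) * x
      l₁ = solve-∀
    hk : 2 * ((1 + 4 * (K * d)) ^ d * (k + k * (d * 2))) ≤ Z
    hk = begin
        2 * ((1 + 4 * (K * d)) ^ d * (k + k * (d * 2))) ≤⟨ *-monoʳ-≤ 2 (*-mono-≤
            (≤-trans (^-monoˡ-≤ d (+-monoʳ-≤ 1 (*-monoʳ-≤ 4 (*-monoʳ-≤ K hd₁)))) (^-monoʳ-≤ (suc (4 * (K * d₁))) hd₁))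
            (+-monoʳ-≤ k (*-monoʳ-≤ k (*-monoˡ-≤ 2 hd₁)))) ⟩
        2 * (suc (4 * (K * d₁)) ^ d₁ * (k + k * (d₁ * 2))) ≡⟨ l₂ (suc (4 * (K * d₁)) ^ d₁) k d₁ ⟩
        k * C ≤⟨ proj₁ (proj₂ dv) ⟩
        Z ∎
      where
      l₂ : ∀ x k d → 2 * (x * (k + k * (d * 2))) ≡ k * (2 * (x * (1 + d * 2)))
      l₂ = solve-∀
    n≤K' : n ≤ 2 * (K' * k)
    n≤K' = begin
        n ≤⟨ hZ ⟩
        2 * (K * Z) ≤⟨ *-monoʳ-≤ 2 (*-monoʳ-≤ K (≤-trans (<⇒≤ (proj₂ (proj₂ dv))) (*-monoˡ-≤ C (+-monoˡ-≤ k (≤-trans (s≤s z≤n) k≥))))) ⟩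
        2 * (K * ((k + k) * C)) ≡⟨ l₃ K k C ⟩
        2 * (K' * k) ∎
      where
      l₃ : ∀ K k C → 2 * (K * ((k + k) * C)) ≡ 2 * (2 * (K * C) * k)
      l₃ = solve-∀
    h2 : 2 * suc n ^ 3 ≤ 2 ^ k
    h2 = begin
        2 * suc n ^ 3 ≤⟨ *-monoʳ-≤ 2 (^-monoˡ-≤ 3 (≤-trans (s≤s n≤K') (+-monoˡ-≤ (2 * (K' * k))
            (*-mono-≤ {1} {2} {1} (s≤s z≤n) (*-mono-≤ {1} {K'} {1} K'≥1 (≤-trans (s≤s z≤n) k≥)))))) ⟩
        2 * (2 * (K' * k) + 2 * (K' * k)) ^ 3 ≤⟨ *-monoˡ-≤ ((2 * (K' * k) + 2 * (K' * k)) ^ 3) (m≤m+n 2 6) ⟩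
        8 * (2 * (K' * k) + 2 * (K' * k)) ^ 3 ≡⟨ trans (sym (*-^ 2 (2 * (K' * k) + 2 * (K' * k)) 3)) (cong (_^ 3) (l₄ K' k)) ⟩
        (8 * K' * k) ^ 3 ≤⟨ proj₂ pb k (≤-trans (n≤1+n k₀) k≥) ⟩
        2 ^ k ∎
      where
      l₄ : ∀ K k → 2 * (2 * (K * k) + 2 * (K * k)) ≡ 8 * K * k
      l₄ = solve-∀
    rec = proj₂ ih n d k (≤-trans (m≤m+n (proj₁ ih) _) hN) hd hd₁ n≤K'

^-cancel-< : ∀ a b → a ^ 4 < suc b ^ 4 → a ≤ b
^-cancel-< a b h with a ≤? b
... | yes k = k
... | no k = ⊥-elim (<⇒≱ h (^-monoˡ-≤ 4 (≰⇒> k)))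

n≤1+pred : ∀ n → n ≤ suc (pred n)
n≤1+pred zero = z≤n
n≤1+pred (suc n) = ≤-refl

module SmallDegree (K g PX P : ℕ) (hK : 4 * 2 ^ 5 ≤ K) (hg : 4 * (2 * (2 * (8 * (cc * K))) * 8) ≤ 1 * g) (hg1 : 1 ≤ g) (hPX : PX ≡ 6 * (2 * (g * 2)))
    (hP₁ : 4 * (1 * (4 * PX)) ≤ P) (hP₂ : 120 * rr ≤ P) (hP₃ : 4 * (g * (2 * (8 * (cc * K)))) ≤ P) (hP₄ : 3 * (2 * (g * 2)) ≤ P) where
  PE : ℕ
  PE = 2 * (2 * (8 * (cc * K)))
  kk : ℕ
  kk = 2 * (g * 2)
  module X = SplitParameters PX
  P≥1 : 1 ≤ P
  P≥1 = ≤-trans (≤-trans (≤-trans (s≤s z≤n) rr≥) (m≤n*m rr 120)) hP₂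
  kk≥1 : 1 ≤ kk
  kk≥1 = *-mono-≤ {1} {2} {1} (s≤s z≤n) (*-mono-≤ {1} {g} {1} hg1 (s≤s z≤n))
  PX≥1 : 1 ≤ PX
  PX≥1 = ≤-trans (≤-trans kk≥1 (m≤n*m kk 6)) (≤-reflexive (sym hPX))

  -- Lower bound for p, the fourth root of d. The constant 448 = 7 · 8² is that of `Lq`: 448p² must
  -- stay below τ, which is of order d. On the other hand 256g makes p⁸ exceed 8g(d + 1), the price
  -- of d labels.
  pmin : ℕ
  pmin = 448 * ct P + 256 * g

  -- For logarithm D + 1 the product 8 · 32 · `k₀-of` is at most 7680D² ≤ (20D)³.
  pb = pow-beats 20

  Dmin : ℕ
  Dmin = suc (proj₁ pb)

  -- The summands serve expansion, the choice of τ, the fourth root p, and the comparison of d with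
  -- its squared logarithm. None of them involves k.
  d₀ : ℕ
  d₀ = 16 * cc + (ct P * (4 + X.L) + (pmin ^ 4 + suc (2 ^ Dmin)))

  k₀-of : ℕ → ℕ
  k₀-of D = D * (2 * D + 9) + 4

  log-small : ∀ d → suc (2 ^ Dmin) ≤ d → ∃ λ D → D ≤ d × (d ≤ 2 ^ D) × (8 * (k₀-of D * 32) ≤ d)
  log-small d h with log2 d
  ... | zero , _ , b , _ = ⊥-elim (<⇒≱ (≤-trans (s≤s (m^n>0 2 Dmin)) h) b)
  ... | suc D , a , b , k = suc D , a , b , ≤-trans arith (≤-trans (proj₂ pb D (≤-trans (n≤1+n _) D≥)) (<⇒≤ (k D ≤-refl)))
    where
    D≥ : Dmin ≤ D
    D≥ with Dmin ≤? D
    ... | yes q = q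
    ... | no q = ⊥-elim (<⇒≱ h (≤-trans b (^-monoʳ-≤ 2 (≰⇒> q))))
    D≥1 : 1 ≤ D
    D≥1 = ≤-trans (s≤s z≤n) D≥
    arith : 8 * (k₀-of (suc D) * 32) ≤ (20 * D) ^ 3
    arith = begin
        8 * ((suc D * (2 * suc D + 9) + 4) * 32) ≤⟨ *-monoʳ-≤ 8 (*-monoˡ-≤ 32 (+-mono-≤
            (*-mono-≤ (+-monoˡ-≤ D D≥1) (≤-trans (≤-reflexive (l₁ D)) (+-monoʳ-≤ (2 * D) (*-monoʳ-≤ 11 D≥1)))) (*-monoʳ-≤ 4 (*-mono-≤ D≥1 D≥1)))) ⟩
        8 * (((D + D) * (2 * D + 11 * D) + 4 * (D * D)) * 32) ≡⟨ trans (cong (λ y → 8 * (y * 32)) (l₂ D)) (l₄ 8 30 32 (D * D)) ⟩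
        7680 * (D * D * 1) ≤⟨ *-mono-≤ (m≤m+n 7680 320) (*-monoʳ-≤ (D * D) D≥1) ⟩
        8000 * (D * D * D) ≡⟨ sym (trans (*-^ 20 D 3) (cong (8000 *_) (l₃ D))) ⟩
        (20 * D) ^ 3 ∎
      where
      open ≤-Reasoning
      l₁ : ∀ D → 2 * suc D + 9 ≡ 2 * D + 11 * 1
      l₁ = solve-∀
      l₂ : ∀ D → (D + D) * (2 * D + 11 * D) + 4 * (D * D) ≡ 30 * (D * D)
      l₂ = solve-∀
      l₄ : ∀ a b c x → a * (b * x * c) ≡ a * b * c * (x * 1)
      l₄ = solve-∀
      l₃ : ∀ D → D * (D * (D * 1)) ≡ D * D * D
      l₃ = solve-∀

  -- The walk length of stage m: 2 to this power is 2^D · 4 · 2^(6 + m), at least the factor d · 4 ·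
  -- 2^(6 + m) by which the stage is to push classes below n.
  jj : ℕ → ℕ → ℕ
  jj D m = 5 + m + 3 + D

  -- The labels have exponent about D(2j + 1) with j = m + D + 8, the right-hand side (5 +
  -- m)`k₀-of D`. The base 2^(5 + m) pays for the walks growing with m, so the exponent depends on D
  -- only.
  label-cost : ∀ d D m → d ≤ 2 ^ D → 4 * (suc (d ^ suc (jj D m)) * suc (d ^ jj D m)) ≤ (2 ^ (5 + m)) ^ k₀-of D
  label-cost d D m h = begin
      4 * (suc (d ^ suc j) * suc (d ^ j)) ≤⟨ *-monoʳ-≤ 4 (*-mono-≤ (bd (suc j)) (bd j)) ⟩
      4 * (2 ^ suc (D * suc j) * 2 ^ suc (D * j)) ≡⟨ sym (trans (^-distribˡ-+-* 2 2 (suc (D * suc j) + suc (D * j)))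
          (cong (4 *_) (^-distribˡ-+-* 2 (suc (D * suc j)) (suc (D * j))))) ⟩
      2 ^ (2 + (suc (D * suc j) + suc (D * j))) ≤⟨ ^-monoʳ-≤ 2 {2 + (suc (D * suc j) + suc (D * j))} {(5 + m) * k₀-of D}
          (lin (m * (D * (2 * D + 7)) + 4 * (D * (2 * D + 7)) + 16 + 4 * m) (z≤n {0}) (l D m)) ⟩
      2 ^ ((5 + m) * k₀-of D) ≡⟨ sym (^-*-assoc 2 (5 + m) (k₀-of D)) ⟩
      (2 ^ (5 + m)) ^ k₀-of D ∎
    where
    open ≤-Reasoning
    j = jj D m
    bd : ∀ i → suc (d ^ i) ≤ 2 ^ suc (D * i)
    bd i = ≤-trans (s≤s (≤-trans (^-monoˡ-≤ i h) (≤-reflexive (^-*-assoc 2 D i))))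
        (≤-trans (+-monoˡ-≤ (2 ^ (D * i)) (m^n>0 2 (D * i))) (≤-reflexive (cong (2 ^ (D * i) +_) (sym (+-identityʳ _)))))
    l : ∀ D m → 2 + (suc (D * suc (5 + m + 3 + D)) + suc (D * (5 + m + 3 + D))) + 0 + (m * (D * (2 * D + 7)) + 4 * (D * (2 * D + 7)) + 16 + 4 * m) ≡ 0
        + (5 + m) * (D * (2 * D + 9) + 4)
    l = solve-∀

  time : ℕ → ℕ → ℕ → ℕ
  time D t zero = t
  time D t (suc m) = jj D m + suc (time D t m)

  time-≤ : ∀ D t k m → m ≤ k → time D t m ≤ t + m * (k + 9 + D)
  time-≤ D t k zero h = m≤m+n t 0
  time-≤ D t k (suc m) h = ≤-trans (≤-reflexive (l₁ m D (time D t m))) (≤-trans (+-mono-≤ (+-monoˡ-≤ D (+-monoˡ-≤ 9 (≤-trans (n≤1+n m) h)))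
      (time-≤ D t k m (≤-trans (n≤1+n m) h))) (≤-reflexive (l₂ t (k + 9 + D) m)))
    where
    l₁ : ∀ m D x → 5 + m + 3 + D + suc x ≡ m + 9 + D + x
    l₁ = solve-∀
    l₂ : ∀ t x m → x + (t + m * x) ≡ t + suc m * x
    l₂ = solve-∀

  small-degree : ∀ k → 1 ≤ k → ∀ d₁ → ∃ λ B → ∃ λ N → ∀ n d → d₀ ≤ d → d ≤ d₁ → N ≤ n → Outcome n d k B
  small-degree k hk d₁ = 16 + (8 * k + 2 ^ Rm * 4) , N , go
    where
    -- Bounds the rounds after the s-th: four until the classes have at most n/(128d) vertices, then
    -- k stages of at most k + 9 + d₁ rounds.
    Rm = 4 + k * (k + 9 + d₁)
    fc = far-chain d₁ Rm 2 (s≤s z≤n)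
    Jm = 5 + k + 3 + d₁
    LN = suc (suc d₁ ^ suc Jm) * suc (suc d₁ ^ Jm)
    N = proj₁ fc + (sparsity P * d₁ + (180 * rr + (6 * PX + (2 * (1 * X.PE) + (2 * (d₁ * PE) + (LN + (6 * k + Rm)))))))
    go : ∀ n d → d₀ ≤ d → d ≤ d₁ → N ≤ n → Outcome n d k (16 + (8 * k + 2 ^ Rm * 4))
    go n d hd₀ hd₁ hN = bad , rare , good
      where
      r0 = ≤-trans (m≤m+n (proj₁ fc) _) hN
      s1 = ≤-trans (m≤n+m _ (proj₁ fc)) hN
      r1 = ≤-trans (m≤m+n (sparsity P * d₁) _) s1
      s2 = ≤-trans (m≤n+m _ (sparsity P * d₁)) s1
      r2 = ≤-trans (m≤m+n (180 * rr) _) s2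
      s3 = ≤-trans (m≤n+m _ (180 * rr)) s2
      r3 = ≤-trans (m≤m+n (6 * PX) _) s3
      s4 = ≤-trans (m≤n+m _ (6 * PX)) s3
      r4 = ≤-trans (m≤m+n (2 * (1 * X.PE)) _) s4
      s5 = ≤-trans (m≤n+m _ (2 * (1 * X.PE))) s4
      r5 = ≤-trans (m≤m+n (2 * (d₁ * PE)) _) s5
      s6 = ≤-trans (m≤n+m _ (2 * (d₁ * PE))) s5
      r6 : LN ≤ n
      r6 = ≤-trans (m≤m+n LN _) s6
      s7 = ≤-trans (m≤n+m (6 * k + Rm) LN) s6
      r7 : 6 * k ≤ n
      r7 = ≤-trans (m≤m+n (6 * k) Rm) s7
      r8 : Rm ≤ n
      r8 = ≤-trans (m≤n+m Rm (6 * k)) s7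
      16c : 16 * cc ≤ d
      16c = ≤-trans (m≤m+n (16 * cc) _) hd₀
      hd : 1 ≤ d
      hd = ≤-trans (≤-trans (≤-trans (s≤s z≤n) cc≥) (m≤n*m cc 16)) 16c
      q1 = ≤-trans (m≤n+m _ (16 * cc)) hd₀
      tt = choose-τ P X.L P≥1 d (≤-trans (m≤m+n (ct P * (4 + X.L)) _) q1)
      τ = proj₁ tt
      τ₁ = proj₁ (proj₂ tt)
      q2 = ≤-trans (m≤n+m (pmin ^ 4 + suc (2 ^ Dmin)) (ct P * (4 + X.L))) q1
      rt = root4 d
      p' = proj₁ rt
      p≥ : pmin ≤ p'
      p≥ = ^-cancel-< pmin p' (≤-<-trans (≤-trans (m≤m+n (pmin ^ 4) _) q2) (proj₂ (proj₂ rt)))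
      p≥1 : 1 ≤ p'
      p≥1 = ≤-trans (≤-trans (≤-trans hg1 (m≤n*m g 256)) (m≤n+m (256 * g) (448 * ct P))) p≥
      lg = log-small d (≤-trans (m≤n+m (suc (2 ^ Dmin)) (pmin ^ 4)) q2)
      D = proj₁ lg
      k₀ = k₀-of D
      module B = Base n d P τ P≥1 hd (≤-trans (*-monoʳ-≤ (sparsity P) hd₁) r1) r2 τ₁ (proj₁ (proj₂ (proj₂ tt))) (proj₁ (proj₂ (proj₂ (proj₂ tt))))
      exX exL labs : Gr n → Bool
      exX = Exchangeable.bad n d 1 1 X.PE 16 X.eX
      exL = Exchangeable.bad n d (d ^ 1) g PE p' 1
      LB : ℕ → Gr n → Bool
      LB m = Labelled.bad n d (d ^ jj D m) (suc (d ^ suc (jj D m))) 32 (2 ^ (5 + m)) k₀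
      labs G = any (λ i → true ∧ LB (toℕ {k} i) G) (fins k)
      Z = proj₁ (divide n 2 (s≤s z≤n))
      n≤4Z : ∀ Z → n < suc Z * 2 → n ≤ 2 * (2 * Z)
      n≤4Z zero h = ⊥-elim (<⇒≱ h (≤-trans (*-mono-≤ {2} {6} (m≤m+n 2 4) hk) (≤-trans (≤-reflexive refl) r7)))
      n≤4Z (suc Z) h = ≤-trans (<⇒≤ h) (lin (2 * Z) z≤n (l Z))
        where
        l : ∀ Z → suc (suc Z) * 2 + 0 + 2 * Z ≡ 0 + 2 * (2 * suc Z)
        l = solve-∀
      fr = proj₂ fc n d Z r0 hd hd₁ (n≤4Z Z (proj₂ (proj₂ (divide n 2 (s≤s z≤n)))))
      bad : Gr n → Bool
      bad G = (B.bad G ∨ exX G) ∨ ((exL G ∨ labs G) ∨ proj₁ fr G)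
      rare : ∀ Bt → (16 + (8 * k + 2 ^ Rm * 4)) * Bt ≤ n → Rare d Bt bad
      rare Bt hB = rare-∨ (λ G → B.bad G ∨ exX G) (λ G → (exL G ∨ labs G) ∨ proj₁ fr G)
          (rare-∨ B.bad exX (B.bad-rare (2 * (2 * Bt)) (≤-trans (≤-reflexive (l₁ Bt)) b16))
              (X.rare n d r4 (2 * (2 * Bt)) (≤-trans (≤-trans (≤-reflexive (sym (*-assoc 2 2 Bt))) (*-monoˡ-≤ Bt (m≤m+n 4 12))) b16)))
          (rare-∨ (λ G → exL G ∨ labs G) (proj₁ fr)
            (rare-∨ exL labs (Exchangeable.bad-rare n d (d ^ 1) g PE p' 1 8 p≥1 d1PE hg p8 (2 * (2 * (2 * Bt)))
                (≤-trans (≤-trans (≤-reflexive (l₂ Bt)) (*-monoˡ-≤ Bt (m≤m+n 8 8))) b16))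
              (rare-any (fins k) (λ _ → true) (λ i → LB (toℕ i)) k (≤-reflexive (#-true k)) λ i _ →
                Labelled.bad-rare n d (d ^ jj D (toℕ i)) (suc (d ^ suc (jj D (toℕ i)))) 32 (2 ^ (5 + toℕ i)) k₀ hd B.4d (proj₂ (proj₂ (proj₂ lg)))
                    (label-cost d D (toℕ i) (proj₁ (proj₂ (proj₂ lg)))) (hL (toℕ i) (<⇒≤ (Finₚ.toℕ<n i)))
                  (k * (2 * (2 * (2 * Bt)))) (≤-trans (≤-reflexive (l₃ k Bt)) (≤-trans
                      (*-monoˡ-≤ Bt (≤-trans (m≤m+n (8 * k) (2 ^ Rm * 4)) (m≤n+m (8 * k + 2 ^ Rm * 4) 16))) hB))))
            (proj₁ (proj₂ fr) (2 * (2 * Bt)) (≤-trans (≤-reflexive (l₄ (2 ^ Rm) Bt))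
                (≤-trans (*-monoˡ-≤ Bt (≤-trans (m≤n+m (2 ^ Rm * 4) (8 * k)) (m≤n+m (8 * k + 2 ^ Rm * 4) 16))) hB))))
        where
        b16 : 16 * Bt ≤ n
        b16 = ≤-trans (*-monoˡ-≤ Bt (m≤m+n 16 (8 * k + 2 ^ Rm * 4))) hB
        l₁ : ∀ b → 4 * (2 * (2 * b)) ≡ 16 * b
        l₁ = solve-∀
        l₂ : ∀ b → 2 * (2 * (2 * b)) ≡ 8 * b
        l₂ = solve-∀
        l₃ : ∀ k b → k * (2 * (2 * (2 * b))) ≡ 8 * k * b
        l₃ = solve-∀
        l₄ : ∀ x b → x * (2 * (2 * b)) ≡ x * 4 * b
        l₄ = solve-∀
        d1PE : 2 * (d ^ 1 * PE) ≤ n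
        d1PE = ≤-trans (*-monoʳ-≤ 2 (*-monoˡ-≤ PE (≤-trans (≤-reflexive (*-identityʳ d)) hd₁))) r5
        p8 : 8 * (g * suc (d ^ 1)) ≤ p' ^ 8
        p8 = begin
            8 * (g * suc (d * 1)) ≡⟨ cong (λ y → 8 * (g * suc y)) (*-identityʳ d) ⟩
            8 * (g * suc d) ≤⟨ *-monoʳ-≤ 8 (*-monoʳ-≤ g (≤-trans (proj₂ (proj₂ rt))
                (≤-trans (^-monoˡ-≤ 4 (+-monoˡ-≤ p' p≥1)) (≤-reflexive (trans (cong (_^ 4) (cong (p' +_) (sym (+-identityʳ p')))) (*-^ 2 p' 4)))))) ⟩
            8 * (g * (16 * p' ^ 4)) ≡⟨ l g (p' ^ 4) ⟩
            128 * g * p' ^ 4 ≤⟨ *-monoˡ-≤ (p' ^ 4) (≤-trans (*-monoˡ-≤ g (m≤m+n 128 128))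
                (≤-trans (m≤n+m (256 * g) (448 * ct P)) (≤-trans p≥ (≤-trans (≤-reflexive (sym (*-identityʳ p')))
                (^-monoʳ-≤ p' {{>-nonZero p≥1}} {1} {4} (s≤s z≤n)))))) ⟩
            p' ^ 4 * p' ^ 4 ≡⟨ sym (^-distribˡ-+-* p' 4 4) ⟩
            p' ^ 8 ∎
          where
          open ≤-Reasoning
          l : ∀ g x → 8 * (g * (16 * x)) ≡ 128 * g * x
          l = solve-∀
        hL : ∀ m → m ≤ k → suc (d ^ suc (jj D m)) * suc (d ^ jj D m) ≤ n
        hL m h = ≤-trans (*-mono-≤ (s≤s (pw (s≤s J≤))) (s≤s (pw J≤))) r6
          where
          J≤ : jj D m ≤ Jm
          J≤ = +-mono-≤ (+-monoˡ-≤ 3 (+-monoʳ-≤ 5 h)) (≤-trans (proj₁ (proj₂ lg)) hd₁)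
          pw : ∀ {i j} → i ≤ j → d ^ i ≤ suc d₁ ^ j
          pw {i} {j} h = ≤-trans (^-monoˡ-≤ i (≤-trans hd₁ (n≤1+n d₁))) (^-monoʳ-≤ (suc d₁) h)
      good : ∀ M → IsReg d (adj M) → bad (adj M) ≡ false → Good k M
      good M r e p hu hv = tf , bound , good-at M p tf σ k hk hσ (part-arith k σ n (proj₁ (proj₂ dv)) r7)
        where
        eBX : B.bad (adj M) ∨ exX (adj M) ≡ false
        eBX = ∨-f₁ e
        eB : B.bad (adj M) ≡ false
        eB = ∨-f₁ eBX
        eR = ∨-f₂ {B.bad (adj M) ∨ exX (adj M)} e
        eLL : exL (adj M) ∨ labs (adj M) ≡ false
        eLL = ∨-f₁ eR
        F = sameColour-refinement M p
        side = smaller-side M p hu hv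
        module Q = BFS M p r cc (B.e₁ {adj M} eB) cc≥ 16c B.4d
        module T = Q.FromSide (proj₁ side) (proj₁ (proj₂ side)) (proj₁ (proj₂ (proj₂ side))) (proj₂ (proj₂ (proj₂ side)))
        bal = T.balanced-at B.w rr (120 * rr) (B.e₂ {adj M} eB) B.w-64 B.w≥1 B.w-hi B.d≤n
        sz : ℕ → Fin n → ℕ
        sz t x = # (λ z → sameColour M p t z x)
        shrunk : ∀ x → PX * sz (suc (suc T.s)) x < n
        shrunk = Shrink.shrink-balanced {d = d} F (ct P) τ (12 * τ) P (B.e₃ {adj M} eB) (B.e₄ {adj M} eB) PX (120 * rr) 16 X.eX
          (∨-f₂ {B.bad (adj M)} eBX) (proj₂ (proj₂ (proj₂ (proj₂ tt)))) hP₁ hP₂ r3 PX≥1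
          (suc T.s) (proj₁ bal) (proj₁ (proj₂ bal)) (proj₁ (proj₂ (proj₂ bal))) (proj₂ (proj₂ (proj₂ bal)))
        so = σ-of PX n PX≥1
        t₀ = suc (suc (suc (suc T.s)))
        Lq≤ : Exchangeable.Lq n d (d ^ 1) g PE p' 1 + (2 * τ + 2 * τ * 2) ≤ 12 * τ
        Lq≤ = ≤-trans (+-monoˡ-≤ (2 * τ + 2 * τ * 2) (≤-trans Lq' (m≤n*m τ 6))) (≤-reflexive (l τ))
          where
          open ≤-Reasoning
          l : ∀ τ → 6 * τ + (2 * τ + 2 * τ * 2) ≡ 12 * τ
          l = solve-∀
          l₁ : ∀ p → 7 * ((4 * (p * 1) + 4 * (p * 1)) * (4 * (p * 1) + 4 * (p * 1))) ≡ 448 * (p * p)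
          l₁ = solve-∀
          Lq' : Exchangeable.Lq n d (d ^ 1) g PE p' 1 ≤ τ
          Lq' = *-cancelˡ-≤ (ct P) {{>-nonZero (*-mono-≤ {1} {192} {1} (s≤s z≤n) (*-mono-≤ {1} {P} {1} P≥1 P≥1))}} (begin
            ct P * (7 * ((4 * (p' * 1) + 4 * (p' * 1)) * (4 * (p' * 1) + 4 * (p' * 1)))) ≡⟨ cong (ct P *_) (l₁ p') ⟩
            ct P * (448 * (p' * p')) ≡⟨ l₂ (ct P) (p' * p') ⟩
            448 * ct P * (p' * p') ≤⟨ *-monoˡ-≤ (p' * p') (≤-trans (m≤m+n (448 * ct P) (256 * g)) p≥) ⟩
            p' * (p' * p') ≤⟨ m≤n*m _ p' {{>-nonZero p≥1}} ⟩
            p' * (p' * (p' * p')) ≡⟨ l₃ p' ⟩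
            p' ^ 4 ≤⟨ proj₁ (proj₂ rt) ⟩
            d ≤⟨ τ₁ ⟩
            ct P * τ ∎)
            where
            l₂ : ∀ c x → c * (448 * x) ≡ 448 * c * x
            l₂ = solve-∀
            l₃ : ∀ p → p * (p * (p * p)) ≡ p * (p * (p * (p * 1)))
            l₃ = solve-∀
        fine : ∀ x → K * (d * sz t₀ x) ≤ n
        fine x = ≮⇒≥ λ q → (Shrink.shrink-fine {d = d} F (ct P) τ (12 * τ) P (B.e₃ {adj M} eB) (B.e₄ {adj M} eB) r cc (B.e₁ {adj M} eB) cc≥ 16c B.4d K g p' 1
            (≤-trans (m≤m+n 4 124) hK) hg1 (∨-f₁ eLL) Lq≤ hP₃ hP₄ (suc (suc T.s)) (proj₁ so) (λ y → proj₂ (proj₂ so) _ (shrunk y))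
            (part-arith kk (proj₁ so) n (≤-trans (≤-reflexive (cong (proj₁ so *_) (sym hPX))) (proj₁ (proj₂ so)))
                (≤-trans (≤-reflexive (sym hPX)) (≤-trans (m≤n*m PX 6) r3))) x (<⇒≤ q))
        -- Each stage halves the bound: a larger class would spread over a linear part of the graph
        -- along walks of length `jj D m`, which `spread` excludes with q = 2^(5 + m). As k < 2^k, k
        -- halvings suffice.
        lev : ∀ m → m ≤ k → ∀ x → d * (4 * 2 ^ (5 + m)) * sz (time D t₀ m) x ≤ n
        lev zero _ x = ≤-trans (≤-reflexive (l d (sz t₀ x))) (≤-trans (*-monoˡ-≤ (d * sz t₀ x) hK) (fine x)) where
          l : ∀ d s → d * (4 * 2 ^ 5) * s ≡ 4 * 2 ^ 5 * (d * s)
          l d s = trans (cong (_* s) (*-comm d (4 * 2 ^ 5))) (*-assoc (4 * 2 ^ 5) d s)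
        lev (suc m) hm x = ≤-trans (*-monoˡ-≤ _ scale) (≮⇒≥ λ q → Walks.Spread.spread r cc (B.e₁ {adj M} eB) cc≥ 16c B.4d F (time D t₀ m) (proj₁ dv')
            (jj D m) (2 ^ (5 + m)) k₀ lb hσ' hq x (<⇒≤ q))
          where
          DD = d * (4 * 2 ^ (5 + m))
          DD≥1 : 1 ≤ DD
          DD≥1 = *-mono-≤ {1} {d} {1} hd (*-mono-≤ {1} {4} {1} (s≤s z≤n) (m^n>0 2 (5 + m)))
          dv' = divide n DD DD≥1
          hσ' : ∀ y → sz (time D t₀ m) y ≤ proj₁ dv'
          hσ' y = ≤-pred (*-cancelʳ-< DD _ _ (≤-<-trans (≤-trans (≤-reflexive (*-comm _ DD)) (lev m (≤-trans (n≤1+n m) hm) y)) (proj₂ (proj₂ dv'))))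
          hq : d * proj₁ dv' * (4 * 2 ^ (5 + m)) ≤ n
          hq = ≤-trans (≤-reflexive (l d (proj₁ dv') (4 * 2 ^ (5 + m)))) (proj₁ (proj₂ dv')) where
            l : ∀ d s x → d * s * x ≡ s * (d * x)
            l = solve-∀
          lb : LB m (adj M) ≡ false
          lb = subst (λ y → LB y (adj M) ≡ false) (Finₚ.toℕ-fromℕ< hm) (any-f (enumFin k) {λ i → true ∧ LB (toℕ i) (adj M)} (∨-f₂ {exL (adj M)} eLL) (fromℕ< hm))
          scale : d * (4 * 2 ^ (5 + suc m)) ≤ 2 ^ jj D m
          scale = ≤-trans (*-monoˡ-≤ (4 * 2 ^ (5 + suc m)) (proj₁ (proj₂ (proj₂ lg))))
              (≤-reflexive (trans (cong (2 ^ D *_) (sym (^-distribˡ-+-* 2 2 (5 + suc m))))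
              (trans (sym (^-distribˡ-+-* 2 D (2 + (5 + suc m)))) (cong (2 ^_) (l D m)))))
            where
            l : ∀ D m → D + (2 + (5 + suc m)) ≡ 5 + m + 3 + D
            l = solve-∀
        tf = time D t₀ k
        dv = divide n (6 * k) (≤-trans hk (m≤n*m k 6))
        σ = proj₁ dv
        hσ : ∀ x → sz tf x ≤ σ
        hσ x = ≤-pred (*-cancelʳ-< (6 * k) _ _ (≤-<-trans (≤-trans (≤-trans (≤-reflexive (*-comm _ (6 * k))) (*-monoˡ-≤ (sz tf x) 6k≤))
            (lev k ≤-refl x)) (proj₂ (proj₂ dv))))
          where
          6k≤ : 6 * k ≤ d * (4 * 2 ^ (5 + k))
          6k≤ = ≤-trans (≤-trans (*-mono-≤ {6} {4 * 32} (m≤m+n 6 122) (<⇒≤ (n<2^n k)))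
              (≤-reflexive (trans (*-assoc 4 32 (2 ^ k)) (cong (4 *_) (sym (^-distribˡ-+-* 2 5 k)))))) (m≤n*m (4 * 2 ^ (5 + k)) d {{>-nonZero hd}})
        tf≤ : tf ≤ T.s + Rm
        tf≤ = ≤-trans (time-≤ D t₀ k k ≤-refl) (≤-trans (≤-reflexive (l T.s (k * (k + 9 + D))))
            (+-monoʳ-≤ T.s (+-monoʳ-≤ 4 (*-monoʳ-≤ k (+-monoʳ-≤ (k + 9) (≤-trans (proj₁ (proj₂ lg)) hd₁))))))
          where
          l : ∀ s x → suc (suc (suc (suc s))) + x ≡ s + (4 + x)
          l = solve-∀
        s' = pred T.s
        s'≤ : T.s ≤ suc s'
        s'≤ = n≤1+pred T.s
        v = T.v₀
        sub : ∀ x → single v x ≡ true → proj₁ side x ≡ true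
        sub x q = subst (λ y → proj₁ side y ≡ true) (sym (eqF-t q)) T.v₀∈
        out : Z ≤ outside (adj M) (single v) (suc s')
        out = *-cancelʳ-≤ Z _ 2 (≤-trans (proj₁ (proj₂ (divide n 2 (s≤s z≤n)))) (≤-trans (T.ball-half (single v) (eqF-r v) sub (#-eq v))
            (≤-reflexive (*-comm 2 (outside (adj M) (single v) (suc s'))))))
        -- Otherwise the ball of radius `s'` + 1 + `Rm` around v would be everything; but radius
        -- `s'` + 1 misses half of the vertices, and `far-chain` keeps one outside for `Rm` further
        -- steps.
        bound : ∀ D' → DiamLe M D' → tf ≤ D' + 2
        bound D' h = ≮⇒≥ λ q → 1+n≰n (≤-trans (proj₂ (proj₂ fr) (adj M) (∨-f₂ {exL (adj M) ∨ labs (adj M)} eR) v s'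
            (≤-trans (+-mono-≤ (≤-trans (pred[n]≤n) T.s≤n) r8) (≤-reflexive (cong (n +_) (sym (+-identityʳ n))))) out)
            (≤-reflexive (trans (#-cong {g = λ _ → false} λ x → cong not (grow-≤ (adj M) (single v) (D'≤ q) x (everywhere x))) (S-0 (fins n)))))
          where
          D'≤ : D' + 2 < tf → D' ≤ suc (s' + Rm)
          D'≤ q = ≤-trans (m≤m+n D' 2) (≤-trans (<⇒≤ q) (≤-trans tf≤ (+-monoˡ-≤ Rm s'≤)))
          everywhere : ∀ x → grow (adj M) (single v) D' x ≡ true
          everywhere x = subst (λ j → grow (adj M) (single v) j x ≡ true) (+-identityʳ D') (reach-grow M (single v) r D' 0 v x (eqF-r v) (h v x))

-- From rare events to the theorem.

unique-count : (E : Enum 𝔸) (L : List 𝔸) → Unique L → (f : 𝔸 → Bool) → All (λ x → f x ≡ true) L → length L ≤ S (els E) (λ x → ⟦ f x ⟧)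
unique-count E [] u f h = z≤n
unique-count E (a ∷ L) (a≢ ∷ u) f (fa ∷ h) = begin
    suc (length L) ≤⟨ s≤s (unique-count E L u f' (All.zipWith (λ (p , q) → ∧-i q (not-f (¬t→f λ e → p (sym (eq-t E e))))) (a≢ , h))) ⟩
    suc (S (els E) (λ x → ⟦ f' x ⟧)) ≡⟨ cong (λ b → ⟦ b ⟧ + S (els E) (λ x → ⟦ f' x ⟧)) (sym fa) ⟩
    ⟦ f a ⟧ + S (els E) (λ x → ⟦ f' x ⟧) ≡⟨ cong (_+ S (els E) (λ x → ⟦ f' x ⟧)) (sym (δ E a (λ x → ⟦ f x ⟧))) ⟩
    S (els E) (λ x → ⟦ eq E x a ⟧ * ⟦ f x ⟧) + S (els E) (λ x → ⟦ f' x ⟧) ≡⟨ sym (S-+ (els E) _ _) ⟩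
    S (els E) (λ x → ⟦ eq E x a ⟧ * ⟦ f x ⟧ + ⟦ f' x ⟧) ≤⟨ S-mono (els E) (λ x → split (f x) (eq E x a)) ⟩
    S (els E) (λ x → ⟦ f x ⟧) ∎
  where
  open ≤-Reasoning
  f' = λ x → f x ∧ not (eq E x a)
  split : ∀ p q → ⟦ q ⟧ * ⟦ p ⟧ + ⟦ p ∧ not q ⟧ ≤ ⟦ p ⟧
  split true true = ≤-refl
  split true false = ≤-refl
  split false true = ≤-refl
  split false false = ≤-refl

-- `Good` comes without a decision procedure, so its failures are counted through lists without
-- repetition. Each failure lies in the decidable event `Ev`, whose count is bounded.
rare⇒few : (Ev : Gr n → Bool) (b : ℕ) → Rare d b Ev → ∀ {k} → (∀ M → IsReg d (adj M) → Ev (adj M) ≡ false → Good k M) →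
  (bad : List (Matrix n)) → Unique bad → All (λ M → isRegular d M ≡ true × ¬ Good k M) bad → b * length bad ≤ numRegular n d
rare⇒few {n} {d} Ev b r good bad u h = begin
    b * length bad ≤⟨ *-monoʳ-≤ b (≤-trans (unique-count (Ms n) bad u _ (All.map ev h)) (≤-reflexive (sym (cnt-def Ev)))) ⟩
    b * cnt d Ev ≡⟨ *-comm b (cnt d Ev) ⟩
    cnt d Ev * b ≤⟨ r ⟩
    tot n d ≡⟨ sym (numRegular-cnt n d) ⟩
    numRegular n d ∎
  where
  open ≤-Reasoning
  ev : ∀ {M} → isRegular d M ≡ true × ¬ Good _ M → isRegular d M ∧ Ev (adj M) ≡ true
  ev {M} (p , q) with Ev (adj M) in e
  ... | true = ∧-i p refl
  ... | false = ⊥-elim (q (good M (isRegular-t {M = M} p) e))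

opaque
  -- Chosen in this order: `K₀` starts the stages of `lev`, `g₀` lets the coincidences of a pair pay
  -- for d labels (e = 1, `c₀` = 8), and `P₀` dominates all density requirements.
  K₀ g₀ P₀ : ℕ
  K₀ = 4 * 2 ^ 5
  g₀ = 4 * (2 * (2 * (8 * (cc * K₀))) * 8)
  P₀ = 4 * (1 * (4 * (6 * (2 * (g₀ * 2))))) + (120 * rr + (4 * (g₀ * (2 * (8 * (cc * K₀)))) + 3 * (2 * (g₀ * 2))))
  K₀≥ : 4 * 2 ^ 5 ≤ K₀
  K₀≥ = ≤-refl
  K₀≥1 : 1 ≤ K₀
  K₀≥1 = s≤s z≤n
  g₀≥ : 4 * (2 * (2 * (8 * (cc * K₀))) * 8) ≤ 1 * g₀
  g₀≥ = ≤-reflexive (sym (*-identityˡ g₀))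
  P₀≥₁ : 4 * (1 * (4 * (6 * (2 * (g₀ * 2))))) ≤ P₀
  P₀≥₁ = m≤m+n _ _
  P₀≥₂ : 120 * rr ≤ P₀
  P₀≥₂ = ≤-trans (m≤m+n (120 * rr) _) (m≤n+m _ (4 * (1 * (4 * (6 * (2 * (g₀ * 2)))))))
  P₀≥₃ : 4 * (g₀ * (2 * (8 * (cc * K₀)))) ≤ P₀
  P₀≥₃ = ≤-trans (≤-trans (m≤m+n _ (3 * (2 * (g₀ * 2)))) (m≤n+m _ (120 * rr))) (m≤n+m _ (4 * (1 * (4 * (6 * (2 * (g₀ * 2)))))))
  P₀≥₄ : 3 * (2 * (g₀ * 2)) ≤ P₀
  P₀≥₄ = ≤-trans (≤-trans (m≤n+m _ (4 * (g₀ * (2 * (8 * (cc * K₀)))))) (m≤n+m _ (120 * rr))) (m≤n+m _ (4 * (1 * (4 * (6 * (2 * (g₀ * 2)))))))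

g₀≥1 : 1 ≤ g₀
g₀≥1 = ≤-trans (*-mono-≤ {1} {4} {1} (s≤s z≤n) (*-mono-≤ {1} {_} {1} {8} (*-mono-≤ {1} {2} {1} (s≤s z≤n)
    (*-mono-≤ {1} {2} {1} (s≤s z≤n) (*-mono-≤ {1} {8} {1} (s≤s z≤n) (*-mono-≤ {1} {cc} {1} (≤-trans (s≤s z≤n) cc≥) K₀≥1)))) (s≤s z≤n)))
  (≤-trans g₀≥ (≤-reflexive (*-identityˡ g₀)))

sparsity≥1 : ∀ P → 1 ≤ sparsity P
sparsity≥1 P = ≤-trans (≤-trans (s≤s z≤n) (m≤n+m 32 (8 * P + 12))) (m≤m+n (8 * P + 12 + 32) _)

module Small = SmallDegree K₀ g₀ (6 * (2 * (g₀ * 2))) P₀ K₀≥ g₀≥ g₀≥1 refl P₀≥₁ P₀≥₂ P₀≥₃ P₀≥₄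

theorem9 : ∃ λ (d₀ : ℕ) → (d : ℕ → ℕ) → ((n : ℕ) → d₀ ≤ d n)
    → ((b : ℕ) → 1 ≤ b → ∃ λ N → (n : ℕ) → N ≤ n → b * d n ≤ n)
    → (k : ℕ) → 1 ≤ k
    → (b : ℕ) → 1 ≤ b → ∃ λ N → (n : ℕ) → N ≤ n → (d n * n) % 2 ≡ 0
    → (bad : List (Matrix n)) → Unique bad
    → All (λ M → isRegular (d n) M ≡ true × ¬ Good k M) bad
    → b * length bad ≤ numRegular n (d n)
theorem9 = Small.d₀ , λ d d≥ sparse k hk b hb →
  -- `d₁` depends on k, and the degree may lie on different sides of it for different n; so the case
  -- distinction is made for each n, with N beyond the thresholds of both cases.
  let (d₁ , N₁ , large) = large-degree k hk
      (B , N₂ , small) = Small.small-degree k hk d₁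
      C = sparsity (P-large k)
      (N₃ , sparse-C) = sparse C (sparsity≥1 (P-large k))
      N = N₁ + (N₂ + (N₃ + (8 * b + B * b)))
  in N , λ n hN _ →
  let s₁ = ≤-trans (m≤n+m (N₂ + (N₃ + (8 * b + B * b))) N₁) hN
      s₂ = ≤-trans (m≤n+m (N₃ + (8 * b + B * b)) N₂) s₁
      s₃ = ≤-trans (m≤n+m (8 * b + B * b) N₃) s₂
      conclude : ∀ {B′} → B′ * b ≤ n → Outcome n (d n) k B′ → _
      conclude = λ { h (ev , rare , good) → rare⇒few ev b (rare b h) good }
  in case d₁ ≤? d n of λ where
    (yes h) → conclude {8} (≤-trans (m≤m+n (8 * b) (B * b)) s₃) (large n (d n) h (sparse-C n (≤-trans (m≤m+n N₃ _) s₂)) (≤-trans (m≤m+n N₁ _) hN))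
    (no h) → conclude {B} (≤-trans (m≤n+m (B * b) (8 * b)) s₃) (small n (d n) (d≥ n) (<⇒≤ (≰⇒> h)) (≤-trans (m≤m+n N₂ _) s₁))
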